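{- Let $(W,S)$ be an irreducible, nontrivially $\mathbf{a}(2)$-finite Coxeter system of type $X$, with generators labeled as in the context, and let $\mathcal{S}(W)$ be the set of left stubs of $\mathbf{a}$-value $2$ in $W$. For $n\ge 2$ put $\beta_n=\binom{n}{2}$. Below, a string of generators denotes their product in $W$. \begin{enumerate} \item If $X=A_n$ ($n\ge 3$), then $\mathcal{S}(W)=\mathcal{S}_1\sqcup\mathcal{S}_2$ with $\mathcal{S}_1=\{ij: 1\le i,j\le n,\ j>i+1\}$ and $\mathcal{S}_2=\{i(i-1)(i+1): 1<i<n\}$. \item If $X=B_n$ ($n\ge 3$), then $\mathcal{S}(W)=\mathcal{S}_1\sqcup\mathcal{S}_2\sqcup\mathcal{S}_3$, where $\mathcal{S}_1,\mathcal{S}_2$ consist of the elements given by the same words as in (1) and $\mathcal{S}_3=\{1213\}$. \item If $X=\tilde C_{n-1}$ ($n\ge 5$), then $\mathcal{S}(W)=\mathcal{S}_1\sqcup\mathcal{S}_2\sqcup\mathcal{S}_3\sqcup\mathcal{S}_4$, where $\mathcal{S}_1,\mathcal{S}_2,\mathcal{S}_3$ are given by the same words as in (2) and $\mathcal{S}_4=\{n(n-1)(n-2)n\}$. \item If $X=E_{q,r}$ ($r\ge q\ge 1$), then $\mathcal{S}(W)=\mathcal{S}_1\sqcup\mathcal{S}_2\sqcup\mathcal{T}_2\sqcup\mathcal{S}_3$ with $\mathcal{S}_1=\{st: s,t\in S,\ m(s,t)=2\}$, $\mathcal{S}_2=\{i(i-1)(i+1): -q<i<r\}$, $\mathcal{T}_2=\{0(-1)v,\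 01v\}$, and $\mathcal{S}_3=\{z_s: s\in S,\ s\ne 0\}$, where $z_s=s(s-1)\cdots 1\,0\,(-1)v$ if $1\le s\le r$, $z_s=s(s+1)\cdots(-1)\,0\,1v$ if $-q\le s\le -1$, and $z_v=v0(-1)1$. \item If $X=F_n$ ($n\ge 4$), then $\mathcal{S}(W)=\mathcal{S}_1\sqcup\mathcal{S}_2\sqcup\mathcal{S}_3$, where $\mathcal{S}_1,\mathcal{S}_2$ are given by the same words as in (1) and $\mathcal{S}_3=\{12324,\ 2324\}\sqcup\{i(i-1)\cdots 3\,2\,1\,3: 3\le i\le n\}$. \item If $X=H_n$ ($n\ge 3$), then $\mathcal{S}(W)=\mathcal{S}_1\sqcup\mathcal{S}_2\sqcup\mathcal{S}_3\sqcup\mathcal{S}_4$, where $\mathcal{S}_1,\mathcal{S}_2,\mathcal{S}_3$ are given by the same words as in (2) and $\mathcal{S}_4=\{i(i-1)\cdots 2\,1\,2\,1\,3: 2\le i\le n\}$. \item In each of (1)–(6) the listed elements are pairwise distinct, and $|\mathcal{S}(W)|=\beta_n-1$ for $A_n$; $\beta_n$ for $B_n$; $\beta_n+1$ for $\tilde C_{n-1}$; $\beta_{n+1}-1$ for $E_{q,r}$ where $n=q+r+2=|S|$; $\beta_{n+1}-1$ for $F_n$; and $\beta_{n+1}-1$ for $H_n$. \end{enumerate}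
   Context: $(W,S)$ is a Coxeter system with finite $S$ and Coxeter matrix $m(s,t)$; its Coxeter diagram has vertex set $S$ and an edge $\{s,t\}$ iff $m(s,t)\ge 3$; the system is irreducible if this diagram is connected. $\mathbf{a}:W\to\mathbb{Z}_{\ge0}$ is Lusztig's $\mathbf{a}$-function, defined via the Kazhdan–Lusztig basis $\{C_w\}$ of the Hecke algebra over $\mathbb{Z}[v,v^{ -1}]$: writing $C_xC_y=\sum_z h_{x,y,z}C_z$, $\mathbf{a}(z)$ is the least integer such that $h_{x,y,z}\in v^{\mathbf{a}(z)}\mathbb{Z}[v^{ -1}]$ for all $x,y$. Lusztig's boundedness conjecture is assumed throughout. $W_2=\{w:\mathbf{a}(w)=2\}$; $(W,S)$ is nontrivially $\mathbf{a}(2)$-finite if $W_2$ is finite and nonempty. It is known that the irreducible nontrivially $\mathbf{a}(2)$-finite systems are exactly the following types, with generators labeled as follows (diagram edges listed; unlisted weights of edges are $3$; non-adjacent generators commute): $A_n$: path $1-2-\cdots-n$; $B_n$: same path with $m(1,2)=4$; $\tilde C_{n-1}$: path $1-\cdots-n$ with $m(1,2)=m(n-1,n)=4$; $E_{q,r}$ ($r\ge q\ge1$): vertices $-q,\dots,-1,0,1,\dots,r,v$, path $-q-\cdots-0-\cdots-r$ plus the edge $0-v$; $F_n$: path $1-\cdots-n$ with $m(2,3)=4$; $H_n$: path $1-\cdots-n$ with $m(1,2)=5$. Star operations: for $I=\{s,t\}\subseteq S$ with $m=m(s,t)\ge3$, each $w\in W$ has a unique factorization $w=w^I w_I$ with $l(w)=l(w^I)+l(w_I)$,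 $w_I\in\langle s,t\rangle$ and no right descent of $w^I$ in $I$. If $w_I$ is an alternating product of $s,t$ of length $i$ with $1\le i\le m-1$, the right upper star operation w.r.t. $I$ is defined iff $i\le m-2$ and replaces $w_I$ by the alternating product of length $i+1$ with the same first letter; the right lower star operation is defined iff $i\ge 2$ and replaces $w_I$ by the alternating product of length $i-1$ with the same first letter. Left star operations are defined symmetrically using $w=w_I\,{}^I w$ (alternating products with fixed last letter, letters added/removed on the left). A left stub is an element admitting no right lower star operation w.r.t. any pair $I$ with $m\ge3$. -}

module Defs where

open import Data.Nat as ℕ using (ℕ; zero; suc; _∸_; _≡ᵇ_; _<?_)
open import Data.Nat.Combinatorics using (_C_)
open import Data.Bool using (Bool; true; false; if_then_else_; _∧_; _∨_)
open import Data.Fin using (Fin; toℕ; fromℕ<)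
import Data.Fin as Fin
open import Data.Integer as ℤ using (ℤ; +_; -_)
open import Data.List using (List; []; _∷_; _++_; map; concatMap; length; foldr; reverse; applyUpTo; filter)
import Data.List.Properties as LP
open import Data.List.Relation.Unary.All using (All)
open import Data.List.Relation.Unary.Any using (Any)
open import Data.List.Relation.Unary.AllPairs using (AllPairs)
open import Data.Product using (Σ; ∃; _×_; _,_)
open import Relation.Nullary using (¬_; yes; no)
open import Relation.Binary.PropositionalEquality using (_≡_)

-- Laurent polynomials in v over ℤ: formal sums of monomials c·v^e,
-- given as lists of (coefficient c , exponent e).

Laurent : Set
Laurent = List (ℤ × ℤ)

coeffL : Laurent → ℤ → ℤ
coeffL [] k = + 0
coeffL ((c , e) ∷ p) k with e ℤ.≟ k
... | yes _ = c ℤ.+ coeffL p k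
... | no  _ = coeffL p k

oneL : Laurent
oneL = (+ 1 , + 0) ∷ []

negL : Laurent → Laurent
negL = map (λ { (c , e) → (ℤ.- c , e) })

mulL : Laurent → Laurent → Laurent
mulL p q = concatMap (λ { (c , e) → map (λ { (d , f) → (c ℤ.* d , e ℤ.+ f) }) q }) p

barL : Laurent → Laurent
barL = map (λ { (c , e) → (c , ℤ.- e) })

InVPow : ℤ → Laurent → Set
InVPow a p = ∀ k → a ℤ.< k → coeffL p k ≡ + 0

module Coxeter {n : ℕ} (M : ℕ → ℕ → ℕ) where

  Word : Set
  Word = List (Fin n)

  m : Fin n → Fin n → ℕ
  m s t = M (toℕ s) (toℕ t)

  alt : Fin n → Fin n → ℕ → Word
  alt s t zero = []
  alt s t (suc i) = s ∷ alt t s i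

  -- the congruence on words defining W = ⟨S | s² = 1, (st)^{m(s,t)} = 1⟩
  infix 4 _∼_
  data _∼_ : Word → Word → Set where
    ∼refl  : ∀ {u} → u ∼ u
    ∼sym   : ∀ {u w} → u ∼ w → w ∼ u
    ∼trans : ∀ {u w x} → u ∼ w → w ∼ x → u ∼ x
    ∼cancel : ∀ a b s → (a ++ s ∷ s ∷ b) ∼ (a ++ b)
    ∼braid  : ∀ a b s t → (a ++ alt s t (m s t) ++ b) ∼ (a ++ alt t s (m s t) ++ b)

  Reduced : Word → Set
  Reduced u = ∀ u' → u' ∼ u → length u ℕ.≤ length u'

  -- Hecke algebra: free ℤ[v,v⁻¹]-algebra on the T_s (elements are formal
  -- linear combinations of words) modulo the two-sided ideal generated by
  -- (T_s - v)(T_s + v⁻¹) and the braid relations.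

  FA : Set
  FA = List (Laurent × Word)

  coeffFA : FA → Word → ℤ → ℤ
  coeffFA [] w k = + 0
  coeffFA ((c , u) ∷ x) w k with LP.≡-dec Fin._≟_ u w
  ... | yes _ = coeffL c k ℤ.+ coeffFA x w k
  ... | no  _ = coeffFA x w k

  scaleFA : Laurent → FA → FA
  scaleFA c = map (λ { (d , u) → (mulL c d , u) })

  negFA : FA → FA
  negFA = map (λ { (c , u) → (negL c , u) })

  mulFA : FA → FA → FA
  mulFA x y = concatMap (λ { (c , u) → map (λ { (d , w) → (mulL c d , u ++ w) }) y }) x

  T : Word → FA
  T u = (oneL , u) ∷ []

  data Rel : Set where
    quad  : Fin n → Rel
    braid : Fin n → Fin n → Rel

  relator : Rel → FA
  relator (quad s) =
    (oneL , s ∷ s ∷ []) ∷ (((ℤ.- + 1) , + 0) ∷ [] , []) ∷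
    (((ℤ.- + 1) , + 1) ∷ (+ 1 , ℤ.- + 1) ∷ [] , s ∷ []) ∷ []
  relator (braid s t) = (oneL , alt s t (m s t)) ∷ (((ℤ.- + 1) , + 0) ∷ [] , alt t s (m s t)) ∷ []

  idealSum : List (Laurent × Word × Rel × Word) → FA
  idealSum = concatMap (λ { (c , a , r , b) → scaleFA c (mulFA (mulFA (T a) (relator r)) (T b)) })

  infix 4 _≈H_
  _≈H_ : FA → FA → Set
  x ≈H y = ∃ λ (L : List (Laurent × Word × Rel × Word)) →
           ∀ w k → coeffFA (x ++ negFA y) w k ≡ coeffFA (idealSum L) w k

  -- bar involution: v ↦ v⁻¹, T_s ↦ T_s⁻¹ = T_s - (v - v⁻¹)
  invT : Fin n → FA
  invT s = (oneL , s ∷ []) ∷ (((ℤ.- + 1) , + 1) ∷ (+ 1 , ℤ.- + 1) ∷ [] , []) ∷ []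

  prodInv : Word → FA
  prodInv [] = T []
  prodInv (s ∷ u) = mulFA (invT s) (prodInv u)

  barFA : FA → FA
  barFA = concatMap (λ { (c , u) → scaleFA (barL c) (prodInv u) })

  -- C is the Kazhdan–Lusztig basis element C_w, for u a reduced word of w:
  -- bar-invariant and C ∈ T_w + Σ_y v⁻¹ℤ[v⁻¹] T_y
  IsKL : Word → FA → Set
  IsKL u C = Reduced u × (barFA C ≈H C) ×
    ∃ λ (L : List (Laurent × Word)) →
      All (λ { (p , y) → Reduced y × InVPow (ℤ.- + 1) p }) L × (C ≈H ((oneL , u) ∷ L))

  IsExpansion : FA → List (Laurent × Word × FA) → Set
  IsExpansion P E =
    All (λ { (h , z , C) → IsKL z C }) E ×
    AllPairs (λ { (_ , z , _) (_ , z' , _) → ¬ (z ∼ z') }) E ×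
    (P ≈H concatMap (λ { (h , z , C) → scaleFA h C }) E)

  CoeffBound : ℕ → Word → Set
  CoeffBound a z = ∀ x y Cx Cy → IsKL x Cx → IsKL y Cy →
    ∀ E → IsExpansion (mulFA Cx Cy) E →
    All (λ { (h , z' , _) → z' ∼ z → InVPow (+ a) h }) E

  AValue2 : Word → Set
  AValue2 z = CoeffBound 2 z × ¬ CoeffBound 1 z

  -- Lusztig's boundedness conjecture
  Boundedness : Set
  Boundedness = ∃ λ N → ∀ z → CoeffBound N z

  -- right lower star operation w.r.t. I = {s,t} is defined on w
  RightLowerStar : Fin n → Fin n → Word → Set
  RightLowerStar s t w = ∃ λ (a : Word) → ∃ λ i →
    (2 ℕ.≤ i) × (i ℕ.≤ m s t ∸ 1) ×
    Reduced (a ++ alt s t i) × ((a ++ alt s t i) ∼ w) ×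
    Reduced (a ++ s ∷ []) × Reduced (a ++ t ∷ [])

  LeftStub : Word → Set
  LeftStub w = ∀ s t → 3 ℕ.≤ m s t → ¬ RightLowerStar s t w

  StubList : List Word → Set
  StubList L =
    (∀ w → ((LeftStub w × AValue2 w) → Any (λ u → u ∼ w) L) ×
           (Any (λ u → u ∼ w) L → (LeftStub w × AValue2 w))) ×
    AllPairs (λ u u' → ¬ (u ∼ u')) L

-- Coxeter matrices (on 0-based indices)

pathM : ℕ → ℕ → ℕ
pathM i j = if i ≡ᵇ j then 1 else (if (suc i ≡ᵇ j) ∨ (suc j ≡ᵇ i) then 3 else 2)

isEdge : ℕ → ℕ → ℕ → ℕ → Bool
isEdge a b i j = ((i ≡ᵇ a) ∧ (j ≡ᵇ b)) ∨ ((i ≡ᵇ b) ∧ (j ≡ᵇ a))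

-- A_n : path; B_n : m(1,2)=4; C̃_{n-1} : m(1,2)=m(n-1,n)=4; F_n : m(2,3)=4; H_n : m(1,2)=5
mA : ℕ → ℕ → ℕ
mA = pathM

mB : ℕ → ℕ → ℕ
mB i j = if isEdge 0 1 i j then 4 else pathM i j

mC : ℕ → ℕ → ℕ → ℕ
mC n i j = if isEdge 0 1 i j ∨ isEdge (n ∸ 2) (n ∸ 1) i j then 4 else pathM i j

mF : ℕ → ℕ → ℕ
mF i j = if isEdge 1 2 i j then 4 else pathM i j

mH : ℕ → ℕ → ℕ
mH i j = if isEdge 0 1 i j then 5 else pathM i j

-- E_{q,r}: label k ∈ {-q,…,r} has index k+q; v has index q+r+1
mE : ℕ → ℕ → ℕ → ℕ → ℕ
mE q r i j =
  if i ≡ᵇ j then 1 else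
  (if (i ≡ᵇ N) ∨ (j ≡ᵇ N) then (if isEdge q N i j then 3 else 2) else pathM i j)
  where N = q ℕ.+ r ℕ.+ 1

range : ℕ → ℕ → List ℕ
range a b = applyUpTo (a ℕ.+_) (suc b ∸ a)

toFin : ∀ {n} → ℕ → List (Fin n)
toFin {n} k with k <? n
... | yes p = fromℕ< p ∷ []
... | no _ = []

-- words over 1-based paper labels
embed1 : ∀ {n} → List ℕ → List (Fin n)
embed1 = concatMap (λ k → toFin (k ∸ 1))

embed0 : ∀ {n} → List ℕ → List (Fin n)
embed0 = concatMap toFin

S1 : ℕ → List (List ℕ)
S1 n = concatMap (λ i → map (λ j → i ∷ j ∷ []) (range (suc (suc i)) n)) (range 1 n)

S2 : ℕ → List (List ℕ)
S2 n = map (λ i → i ∷ (i ∸ 1) ∷ suc i ∷ []) (range 2 (n ∸ 1))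

listA : ℕ → List (List ℕ)
listA n = S1 n ++ S2 n

listB : ℕ → List (List ℕ)
listB n = listA n ++ (1 ∷ 2 ∷ 1 ∷ 3 ∷ []) ∷ []

listC : ℕ → List (List ℕ)
listC n = listB n ++ (n ∷ (n ∸ 1) ∷ (n ∸ 2) ∷ n ∷ []) ∷ []

listF : ℕ → List (List ℕ)
listF n = listA n ++ (1 ∷ 2 ∷ 3 ∷ 2 ∷ 4 ∷ []) ∷ (2 ∷ 3 ∷ 2 ∷ 4 ∷ []) ∷
          map (λ i → reverse (range 1 i) ++ 3 ∷ []) (range 3 n)

listH : ℕ → List (List ℕ)
listH n = listB n ++ map (λ i → reverse (range 2 i) ++ 1 ∷ 2 ∷ 1 ∷ 3 ∷ []) (range 2 n)

-- E_{q,r} words, in 0-based indices (label k ↦ k+q, v ↦ N = q+r+1)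
listE : ℕ → ℕ → List (List ℕ)
listE q r = ES1 ++ ES2 ++ ET2 ++ ES3
  where
  N = q ℕ.+ r ℕ.+ 1
  -- {st : m(s,t) = 2}, one word per unordered pair
  ES1 = concatMap (λ i → map (λ j → i ∷ j ∷ [])
          (filter (λ j → mE q r i j ℕ.≟ 2) (range (suc i) N))) (range 0 N)
  ES2 = map (λ j → j ∷ (j ∸ 1) ∷ suc j ∷ []) (range 1 (q ℕ.+ r ∸ 1))
  ET2 = (q ∷ (q ∸ 1) ∷ N ∷ []) ∷ (q ∷ suc q ∷ N ∷ []) ∷ []
  ES3 = map (λ j → reverse (range (q ∸ 1) j) ++ N ∷ []) (range (suc q) (q ℕ.+ r)) ++
        map (λ j → range j (suc q) ++ N ∷ []) (range 0 (q ∸ 1)) ++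
        (N ∷ q ∷ (q ∸ 1) ∷ suc q ∷ []) ∷ []

{-# OPTIONS --safe #-}

-- A reduced word is good if no reduced word a y of the same element has a factor y whose left
-- descents contain two non-commuting letters or three letters. Products C_x C_y have degree at
-- most 2 at good elements: the bad basis elements span an ideal, and modulo it x is shortened by
-- star operations until it is a commuting pair. Conversely a bad right descent set I of w gives
-- degree 3 through C_w C_{w_I}, and two right descents exclude degree 1. So the stubs of a-value 2
-- are words on which no star operation acts from the right, and, whatever the type, the only ones
-- are chains prolonging a commuting pair s t to the left, each in at most one way.
module Submission where

open import Defs
open import Data.Bool using (Bool; true; false; if_then_else_; _∧_; _∨_; not)
open import Data.Bool.Properties using (∧-zeroʳ)
open import Data.Empty using (⊥; ⊥-elim)
open import Data.Fin using (Fin; toℕ)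
import Data.Fin as Fin
import Data.Fin.Properties as FP
open import Data.Integer as ℤ using (ℤ; +_; -[1+_]; -<+; -<-)
import Data.Integer.Properties as ℤP
open import Data.Integer.Tactic.RingSolver using (solve-∀)
open import Data.List using (List; []; _∷_; _++_; map; length; reverse; _∷ʳ_; initLast; _∷ʳ′_; concatMap; allFin)
open import Data.List.Membership.Propositional using (_∈_)
import Data.List.Membership.Propositional.Properties as ∈P
import Data.List.Properties as LP
open import Data.List.Relation.Unary.All as All using (All; []; _∷_)
import Data.List.Relation.Unary.All.Properties as AllP
open import Data.List.Relation.Unary.AllPairs as AllPairs using (AllPairs; []; _∷_)
import Data.List.Relation.Unary.AllPairs.Properties as AllPairsP
open import Data.List.Relation.Unary.Any as Any using (here; there)
import Data.List.Relation.Unary.Any.Properties as AnyP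
open import Data.Maybe using (Maybe; just; nothing)
open import Data.Nat as ℕ using (ℕ; zero; suc; z≤n; s≤s; _+_; _∸_; _≤_; _<_; _≡ᵇ_)
open import Data.Nat.Properties using (*-zeroʳ; +-assoc; +-cancelʳ-≡; +-cancelʳ-≤; +-cancelˡ-≤; +-comm; +-identityʳ; +-monoʳ-<; +-monoʳ-≤; +-monoˡ-≤; +-suc; +-∸-assoc; 0≢1+n; 1+n≢n; <-asym; <-cmp; <-irrefl; <-trans; <-≤-trans; <⇒≢; <⇒≤; <⇒≱; m+[n∸m]≡n; m+n∸m≡n; m<n⇒m<1+n; m∸n+n≡m; m∸n≤m; m≤m+n; m≤n+m; m≤n⇒m<n∨m≡n; m≤n⇒m∸n≡0; m≤n⇒m≤1+n; m≤n⇒m≤o+n; m≤n⇒∃[o]m+o≡n; n<1+n; n≤1+n; suc-injective; ∸-monoˡ-<; ∸-monoˡ-≤; ≤-antisym; ≤-pred; ≤-refl; ≤-reflexive; ≤-trans; ≤∧≢⇒<; ≮⇒≥; ≰⇒>)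
import Data.Nat.Tactic.RingSolver as ℕSolver
open import Data.Product using (Σ; ∃; _×_; _,_; proj₁; proj₂)
open import Data.Sum using (_⊎_; inj₁; inj₂)
open import Data.Unit using (⊤; tt)
open import Relation.Binary.Definitions using (Tri; tri<; tri≈; tri>)
open import Relation.Binary.PropositionalEquality
open import Relation.Nullary using (¬_; yes; no; Dec)
open import Relation.Nullary.Decidable using (map′; _×-dec_; _⊎-dec_; ¬?)

-- The Hecke algebra is given by generators and relations, so at the start neither the word problem
-- of the group nor the linear independence of the T_w is at hand; both are drawn from concrete
-- models. The numbers game, i.e. the dual geometric representation, has signs that read off
-- descents. It is played over ℤ[φ]: for m ≤ 5 the two weights of an edge only have to have product
-- 4cos²(π/m), which is 0, 1, 2 or φ². In the algebra, elements are compared through linear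
-- functionals that vanish on the ideal, and enough of these come from functions on the group, on
-- which the generators act from both sides. Degrees are controlled by two facts. Each right ideal
-- C_p H is spanned by the C_z with left descent p, so lying in several of them forces several
-- descents. And C_t C_y = (v + v⁻¹) C_y for a left descent t of y, so that a factor v + v⁻¹ caused
-- by one letter can be rewritten as caused by another. The argument is run twice: allowing one left
-- descent it bounds the identity and the generators by degree 1, allowing two commuting ones it
-- gives the bound 2.

-- ℤ[φ] with φ² = φ + 1
record R : Set where
  no-eta-equality
  pattern
  constructor _⸴_
  field
    re im : ℤ
open R
infix 4 _⸴_

infixl 6 _⊕_
infixl 7 _⊗_
_⊕_ _⊗_ : R → R → R
(a ⸴ b) ⊕ (c ⸴ d) = (a ℤ.+ c ⸴ b ℤ.+ d)
(a ⸴ b) ⊗ (c ⸴ d) = (a ℤ.* c ℤ.+ b ℤ.* d ⸴ a ℤ.* d ℤ.+ b ℤ.* c ℤ.+ b ℤ.* d)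
⊝_ : R → R
⊝ (a ⸴ b) = (ℤ.- a ⸴ ℤ.- b)

0R 1R 2R φR : R
0R = (+ 0 ⸴ + 0)
1R = (+ 1 ⸴ + 0)
2R = (+ 2 ⸴ + 0)
φR = (+ 0 ⸴ + 1)

-- The cone ℕ + ℕφ without 0 stands in for the order of the reals: it is closed under products
-- because φ² = φ + 1, and membership is visible in two integers. That every value of the game lies
-- in the cone or in its negative is part of `dich`.
Pos Neg : R → Set
Pos x = ∃ λ a → ∃ λ b → x ≡ (+ a ⸴ + b) × 1 ≤ a ℕ.+ b
Neg x = Pos (⊝ x)

neg² : ∀ x → ⊝ (⊝ x) ≡ x
neg² (a ⸴ b) = cong₂ _⸴_ (ℤP.neg-involutive a) (ℤP.neg-involutive b)

pos-neg : ∀ {x} → Pos x → Neg x → ⊥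
pos-neg (zero , suc b , refl , q) (c , d , e , _) with cong im e
... | ()
pos-neg (suc a , b , refl , q) (c , d , e , _) with cong re e
... | ()

-- (A , B) stands for the linear form A p + B q
LF : Set
LF = R × R

_⊞_ : LF → LF → LF
(A , B) ⊞ (C , D) = (A ⊕ C , B ⊕ D)
_⊠_ : R → LF → LF
w ⊠ (A , B) = (w ⊗ A , w ⊗ B)
⊟_ : LF → LF
⊟ (A , B) = (⊝ A , ⊝ B)

eval : R → R → LF → R
eval p q (A , B) = (A ⊗ p) ⊕ (B ⊗ q)

private
  add₁ : ∀ a b c d p q r s k l m n → (a ℤ.+ c) ℤ.* p ℤ.+ (b ℤ.+ d) ℤ.* q ℤ.+ ((k ℤ.+ m) ℤ.* r ℤ.+ (l ℤ.+ n) ℤ.* s)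
         ≡ (a ℤ.* p ℤ.+ b ℤ.* q ℤ.+ (k ℤ.* r ℤ.+ l ℤ.* s)) ℤ.+ (c ℤ.* p ℤ.+ d ℤ.* q ℤ.+ (m ℤ.* r ℤ.+ n ℤ.* s))
  add₁ = solve-∀
  add₂ : ∀ a b c d p q r s k l m n →
     ((a ℤ.+ c) ℤ.* q ℤ.+ (b ℤ.+ d) ℤ.* p ℤ.+ (b ℤ.+ d) ℤ.* q) ℤ.+ ((k ℤ.+ m) ℤ.* s ℤ.+ (l ℤ.+ n) ℤ.* r ℤ.+ (l ℤ.+ n) ℤ.* s)
     ≡ ((a ℤ.* q ℤ.+ b ℤ.* p ℤ.+ b ℤ.* q) ℤ.+ (k ℤ.* s ℤ.+ l ℤ.* r ℤ.+ l ℤ.* s)) ℤ.+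
       ((c ℤ.* q ℤ.+ d ℤ.* p ℤ.+ d ℤ.* q) ℤ.+ (m ℤ.* s ℤ.+ n ℤ.* r ℤ.+ n ℤ.* s))
  add₂ = solve-∀
  sc₁ : ∀ w x a b p q r s k l →
     (w ℤ.* a ℤ.+ x ℤ.* b) ℤ.* p ℤ.+ (w ℤ.* b ℤ.+ x ℤ.* a ℤ.+ x ℤ.* b) ℤ.* q ℤ.+
     ((w ℤ.* k ℤ.+ x ℤ.* l) ℤ.* r ℤ.+ (w ℤ.* l ℤ.+ x ℤ.* k ℤ.+ x ℤ.* l) ℤ.* s)
     ≡ w ℤ.* ((a ℤ.* p ℤ.+ b ℤ.* q) ℤ.+ (k ℤ.* r ℤ.+ l ℤ.* s)) ℤ.+
       x ℤ.* ((a ℤ.* q ℤ.+ b ℤ.* p ℤ.+ b ℤ.* q) ℤ.+ (k ℤ.* s ℤ.+ l ℤ.* r ℤ.+ l ℤ.* s))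
  sc₁ = solve-∀
  sc₂ : ∀ w x a b p q r s k l →
     ((w ℤ.* a ℤ.+ x ℤ.* b) ℤ.* q ℤ.+ (w ℤ.* b ℤ.+ x ℤ.* a ℤ.+ x ℤ.* b) ℤ.* p ℤ.+ (w ℤ.* b ℤ.+ x ℤ.* a ℤ.+ x ℤ.* b) ℤ.* q) ℤ.+
     ((w ℤ.* k ℤ.+ x ℤ.* l) ℤ.* s ℤ.+ (w ℤ.* l ℤ.+ x ℤ.* k ℤ.+ x ℤ.* l) ℤ.* r ℤ.+ (w ℤ.* l ℤ.+ x ℤ.* k ℤ.+ x ℤ.* l) ℤ.* s)
     ≡ w ℤ.* ((a ℤ.* q ℤ.+ b ℤ.* p ℤ.+ b ℤ.* q) ℤ.+ (k ℤ.* s ℤ.+ l ℤ.* r ℤ.+ l ℤ.* s)) ℤ.+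
       x ℤ.* ((a ℤ.* p ℤ.+ b ℤ.* q) ℤ.+ (k ℤ.* r ℤ.+ l ℤ.* s)) ℤ.+
       x ℤ.* ((a ℤ.* q ℤ.+ b ℤ.* p ℤ.+ b ℤ.* q) ℤ.+ (k ℤ.* s ℤ.+ l ℤ.* r ℤ.+ l ℤ.* s))
  sc₂ = solve-∀
  ng₁ : ∀ a b p q r s k l → (ℤ.- a) ℤ.* p ℤ.+ (ℤ.- b) ℤ.* q ℤ.+ ((ℤ.- k) ℤ.* r ℤ.+ (ℤ.- l) ℤ.* s)
        ≡ ℤ.- (a ℤ.* p ℤ.+ b ℤ.* q ℤ.+ (k ℤ.* r ℤ.+ l ℤ.* s))
  ng₁ = solve-∀
  ng₂ : ∀ a b p q r s k l → ((ℤ.- a) ℤ.* q ℤ.+ (ℤ.- b) ℤ.* p ℤ.+ (ℤ.- b) ℤ.* q) ℤ.+ ((ℤ.- k) ℤ.* s ℤ.+ (ℤ.- l) ℤ.* r ℤ.+ (ℤ.- l) ℤ.* s)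
        ≡ ℤ.- ((a ℤ.* q ℤ.+ b ℤ.* p ℤ.+ b ℤ.* q) ℤ.+ (k ℤ.* s ℤ.+ l ℤ.* r ℤ.+ l ℤ.* s))
  ng₂ = solve-∀
  ac : ∀ a b c d → (a ℤ.+ b) ℤ.+ c ℤ.+ d ≡ a ℤ.+ (b ℤ.+ d) ℤ.+ c
  ac = solve-∀

eval-⊞ : ∀ p q K L → eval p q (K ⊞ L) ≡ eval p q K ⊕ eval p q L
eval-⊞ (p ⸴ q) (r ⸴ s) ((a ⸴ b) , (k ⸴ l)) ((c ⸴ d) , (m ⸴ n)) =
  cong₂ _⸴_ (add₁ a b c d p q r s k l m n) (add₂ a b c d p q r s k l m n)
eval-⊠ : ∀ p q w L → eval p q (w ⊠ L) ≡ w ⊗ eval p q L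
eval-⊠ (p ⸴ q) (r ⸴ s) (w ⸴ x) ((a ⸴ b) , (k ⸴ l)) =
  cong₂ _⸴_ (sc₁ w x a b p q r s k l) (sc₂ w x a b p q r s k l)
eval-⊟ : ∀ p q L → eval p q (⊟ L) ≡ ⊝ eval p q L
eval-⊟ (p ⸴ q) (r ⸴ s) ((a ⸴ b) , (k ⸴ l)) = cong₂ _⸴_ (ng₁ a b p q r s k l) (ng₂ a b p q r s k l)

⊗-distribˡ : ∀ w x y → w ⊗ (x ⊕ y) ≡ w ⊗ x ⊕ w ⊗ y
⊗-distribˡ (w ⸴ v) (a ⸴ b) (c ⸴ d) = cong₂ _⸴_ (l₁ w v a b c d) (l₂ w v a b c d)
  where
  l₁ : ∀ w v a b c d → w ℤ.* (a ℤ.+ c) ℤ.+ v ℤ.* (b ℤ.+ d) ≡ (w ℤ.* a ℤ.+ v ℤ.* b) ℤ.+ (w ℤ.* c ℤ.+ v ℤ.* d)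
  l₁ = solve-∀
  l₂ : ∀ w v a b c d → w ℤ.* (b ℤ.+ d) ℤ.+ v ℤ.* (a ℤ.+ c) ℤ.+ v ℤ.* (b ℤ.+ d)
       ≡ (w ℤ.* b ℤ.+ v ℤ.* a ℤ.+ v ℤ.* b) ℤ.+ (w ℤ.* d ℤ.+ v ℤ.* c ℤ.+ v ℤ.* d)
  l₂ = solve-∀

⊗-zeroʳ : ∀ w → w ⊗ 0R ≡ 0R
⊗-zeroʳ (w ⸴ v) = cong₂ _⸴_ (l₁ w v) (l₂ w v)
  where
  l₁ : ∀ w v → w ℤ.* + 0 ℤ.+ v ℤ.* + 0 ≡ + 0
  l₁ = solve-∀
  l₂ : ∀ w v → w ℤ.* + 0 ℤ.+ v ℤ.* + 0 ℤ.+ v ℤ.* + 0 ≡ + 0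
  l₂ = solve-∀

⊗-neg : ∀ w x → w ⊗ (⊝ x) ≡ ⊝ (w ⊗ x)
⊗-neg (w ⸴ v) (a ⸴ b) = cong₂ _⸴_ (l₁ w v a b) (l₂ w v a b)
  where
  l₁ : ∀ w v a b → w ℤ.* (ℤ.- a) ℤ.+ v ℤ.* (ℤ.- b) ≡ ℤ.- (w ℤ.* a ℤ.+ v ℤ.* b)
  l₁ = solve-∀
  l₂ : ∀ w v a b → w ℤ.* (ℤ.- b) ℤ.+ v ℤ.* (ℤ.- a) ℤ.+ v ℤ.* (ℤ.- b) ≡ ℤ.- (w ℤ.* b ℤ.+ v ℤ.* a ℤ.+ v ℤ.* b)
  l₂ = solve-∀

⊕-identityʳ : ∀ x → x ⊕ 0R ≡ x
⊕-identityʳ (a ⸴ b) = cong₂ _⸴_ (ℤP.+-identityʳ a) (ℤP.+-identityʳ b)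

⊕-inverseʳ : ∀ x → x ⊕ (⊝ x) ≡ 0R
⊕-inverseʳ (a ⸴ b) = cong₂ _⸴_ (ℤP.+-inverseʳ a) (ℤP.+-inverseʳ b)

⊕-assoc : ∀ x y z → (x ⊕ y) ⊕ z ≡ x ⊕ (y ⊕ z)
⊕-assoc (a ⸴ b) (c ⸴ d) (e ⸴ f) = cong₂ _⸴_ (ℤP.+-assoc a c e) (ℤP.+-assoc b d f)

⊕-shuffle : ∀ a b c d → (a ⊕ b ⊕ c) ⊕ d ≡ a ⊕ (b ⊕ d) ⊕ c
⊕-shuffle (a ⸴ a') (b ⸴ b') (c ⸴ c') (d ⸴ d') = cong₂ _⸴_ (ac a b c d) (ac a' b' c' d')

-- A sufficient condition only: coefficients in the closed cone, not all zero, make the form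
-- positive on all positive pairs. It turns the sign statements of rank two into closed
-- computations.
posLF : LF → Bool
posLF ((+ a ⸴ + b) , (+ c ⸴ + d)) with a ℕ.+ b ℕ.+ (c ℕ.+ d)
... | zero = false
... | suc _ = true
posLF _ = false

private
  pos⊗ : ∀ a b c d → (+ a ⸴ + b) ⊗ (+ c ⸴ + d) ≡ (+ (a ℕ.* c ℕ.+ b ℕ.* d) ⸴ + (a ℕ.* d ℕ.+ b ℕ.* c ℕ.+ b ℕ.* d))
  pos⊗ a b c d = sym (cong₂ _⸴_ (cong₂ ℤ._+_ (ℤP.pos-* a c) (ℤP.pos-* b d))
    (cong₂ ℤ._+_ (cong₂ ℤ._+_ (ℤP.pos-* a d) (ℤP.pos-* b c)) (ℤP.pos-* b d)))

  ne : ∀ a b c d → 1 ≤ a ℕ.+ b → 1 ≤ c ℕ.+ d →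
       1 ≤ (a ℕ.* c ℕ.+ b ℕ.* d) ℕ.+ (a ℕ.* d ℕ.+ b ℕ.* c ℕ.+ b ℕ.* d)
  ne (suc a) b (suc c) d _ _ = s≤s z≤n
  ne (suc a) b zero (suc d) _ _ rewrite *-zeroʳ a =
    ≤-trans (s≤s z≤n) (≤-trans (m≤m+n (suc (d ℕ.+ a ℕ.* suc d)) (b ℕ.* 0 ℕ.+ b ℕ.* suc d))
     (≤-trans (≤-reflexive (sym (+-assoc (suc (d ℕ.+ a ℕ.* suc d)) _ _))) (m≤n+m _ (b ℕ.* suc d))))
  ne zero (suc b) c (suc d) _ _ = s≤s z≤n
  ne zero (suc b) (suc c) zero _ _ = ≤-trans (s≤s z≤n) (≤-trans (m≤m+n (suc (c ℕ.+ b ℕ.* suc c)) _) (m≤n+m _ (b ℕ.* 0)))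

posLF-sound : ∀ L p q → posLF L ≡ true → Pos p → Pos q → Pos (eval p q L)
posLF-sound ((+ a ⸴ + b) , (+ c ⸴ + d)) p q ok (e , f , refl , h) (g , i , refl , k)
  = _ , _ , cong₂ _⊕_ (pos⊗ a b e f) (pos⊗ c d g i) , go a b c d ok
  where
  go : ∀ a b c d → posLF ((+ a ⸴ + b) , (+ c ⸴ + d)) ≡ true →
       1 ≤ ((a ℕ.* e ℕ.+ b ℕ.* f) ℕ.+ (c ℕ.* g ℕ.+ d ℕ.* i)) ℕ.+
       ((a ℕ.* f ℕ.+ b ℕ.* e ℕ.+ b ℕ.* f) ℕ.+ (c ℕ.* i ℕ.+ d ℕ.* g ℕ.+ d ℕ.* i))
  go a b c d ok = ≤-trans (aux a b c d ok) (≤-reflexive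
      (swap (a ℕ.* e ℕ.+ b ℕ.* f) (c ℕ.* g ℕ.+ d ℕ.* i) (a ℕ.* f ℕ.+ b ℕ.* e ℕ.+ b ℕ.* f) (c ℕ.* i ℕ.+ d ℕ.* g ℕ.+ d ℕ.* i)))
    where
    open import Data.Nat.Tactic.RingSolver using () renaming (solve-∀ to nsolve)
    swap : ∀ x y z w → (x ℕ.+ z) ℕ.+ (y ℕ.+ w) ≡ (x ℕ.+ y) ℕ.+ (z ℕ.+ w)
    swap = nsolve
    aux : ∀ a b c d → posLF ((+ a ⸴ + b) , (+ c ⸴ + d)) ≡ true →
       1 ≤ ((a ℕ.* e ℕ.+ b ℕ.* f) ℕ.+ (a ℕ.* f ℕ.+ b ℕ.* e ℕ.+ b ℕ.* f)) ℕ.+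
             ((c ℕ.* g ℕ.+ d ℕ.* i) ℕ.+ (c ℕ.* i ℕ.+ d ℕ.* g ℕ.+ d ℕ.* i))
    aux (suc a) b c d ok = ≤-trans (ne (suc a) b e f (s≤s z≤n) h) (m≤m+n _ _)
    aux zero (suc b) c d ok = ≤-trans (ne zero (suc b) e f (s≤s z≤n) h) (m≤m+n _ _)
    aux zero zero (suc c) d ok = ne (suc c) d g i (s≤s z≤n) k
    aux zero zero zero (suc d) ok = ne zero (suc d) g i (s≤s z≤n) k

-- The numbers game in rank two, with symbolic starting values.

-- values at s and t, and total values fired at s and at t
State : Set
State = LF × LF × LF × LF

-- A node outside {s , t} receives only multiples of what s and t have fired, so the two accumulated
-- totals determine its value whatever its own weights are.
step : R → R → Bool → State → State
step α β false (P , Q , S , U) = (⊟ P , Q ⊞ (α ⊠ P) , S ⊞ P , U)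
step α β true  (P , Q , S , U) = (P ⊞ (β ⊠ Q) , ⊟ Q , S , U ⊞ Q)

sym-run : R → R → State → List Bool → State
sym-run α β σ [] = σ
sym-run α β σ (b ∷ d) = sym-run α β (step α β b σ) d

σ₀ : State
σ₀ = (1R , 0R) , (0R , 1R) , (0R , 0R) , (0R , 0R)

comp : Bool → State → LF
comp false (P , _) = P
comp true (_ , Q , _) = Q

-- Booleans name the letters, false for s and true for t. Braid words are compared from their first
-- letter, whereas descents are governed by the last letter; hence the second version, indexed from
-- the right end.
altF altB : Bool → ℕ → List Bool
altF x zero = []
altF x (suc j) = x ∷ altF (not x) j
altB x zero = []
altB x (suc j) = altB (not x) j ∷ʳ x

-- The two weights of an edge have product 4cos²(π/m). For m = 4 they are 1 and 2 in either order,
-- which keeps √2 out of the ring; for m = 5 both are φ.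
data Combo : ℕ → R → R → Set where
  c2  : Combo 2 0R 0R
  c3  : Combo 3 1R 1R
  c4  : Combo 4 1R 2R
  c4' : Combo 4 2R 1R
  c5  : Combo 5 φR φR

-- The complete symbolic states coincide, totals included; this is what makes the braid relation
-- hold at every other node of the diagram too.
braid-ok : ∀ {m α β} → Combo m α β → sym-run α β σ₀ (altF false m) ≡ sym-run α β σ₀ (altF true m)
braid-ok c2 = refl
braid-ok c3 = refl
braid-ok c4 = refl
braid-ok c4' = refl
braid-ok c5 = refl

all< : ℕ → (ℕ → Bool) → Bool
all< zero f = true
all< (suc k) f = f k ∧ all< k f

all<-sound : ∀ k f → all< k f ≡ true → ∀ {j} → j < k → f j ≡ true
all<-sound (suc k) f ok {j} (s≤s j≤k) with f k in eq
... | true with j ℕ.≟ k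
...   | yes refl = eq
...   | no j≢k = all<-sound k f ok (≤∧≢⇒< j≤k j≢k)

private
  sgnAt : R → R → Bool → ℕ → Bool → LF
  sgnAt α β x j y = comp y (sym-run α β σ₀ (altB x j))

  -- The sign pattern of the roots of a dihedral group: only at length m do both letters become
  -- descents. Every instance is a closed computation.
  chk : ∀ {m α β} → Combo m α β → (x : Bool) →
    (all< m (λ j → posLF (sgnAt α β x j (not x))) ≡ true) ×
    (all< m (λ j → posLF (⊟ sgnAt α β x (suc j) x)) ≡ true) ×
    (posLF (⊟ sgnAt α β x m (not x)) ≡ true)
  chk c2 false = refl , refl , refl
  chk c2 true = refl , refl , refl
  chk c3 false = refl , refl , refl
  chk c3 true = refl , refl , refl
  chk c4 false = refl , refl , refl
  chk c4 true = refl , refl , refl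
  chk c4' false = refl , refl , refl
  chk c4' true = refl , refl , refl
  chk c5 false = refl , refl , refl
  chk c5 true = refl , refl , refl

sgn-other : ∀ {m α β} → Combo m α β → ∀ x {j} → j < m →
  posLF (comp (not x) (sym-run α β σ₀ (altB x j))) ≡ true
sgn-other {m} c x = all<-sound m _ (proj₁ (chk c x))
sgn-last : ∀ {m α β} → Combo m α β → ∀ x {j} → j < m →
  posLF (⊟ comp x (sym-run α β σ₀ (altB x (suc j)))) ≡ true
sgn-last {m} c x = all<-sound m _ (proj₁ (proj₂ (chk c x)))
sgn-top : ∀ {m α β} → Combo m α β → ∀ x → posLF (⊟ comp (not x) (sym-run α β σ₀ (altB x m))) ≡ true
sgn-top c x = proj₂ (proj₂ (chk c x))

record Geo (n : ℕ) (M : ℕ → ℕ → ℕ) : Set where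
  field
    wt    : Fin n → Fin n → R
    mdiag : ∀ (s : Fin n) → M (toℕ s) (toℕ s) ≡ 1
    msym  : ∀ (s t : Fin n) → M (toℕ s) (toℕ t) ≡ M (toℕ t) (toℕ s)
    combo : ∀ (s t : Fin n) → s ≢ t → Combo (M (toℕ s) (toℕ t)) (wt s t) (wt t s)

negB : R → Bool
negB (+ 0 ⸴ + 0) = false
negB (+ 0 ⸴ -[1+ _ ]) = true
negB (-[1+ _ ] ⸴ + 0) = true
negB (-[1+ _ ] ⸴ -[1+ _ ]) = true
negB _ = false

negB-sound : ∀ x → negB x ≡ true → Neg x
negB-sound (+ 0 ⸴ + zero) ()
negB-sound (+ 0 ⸴ + suc _) ()
negB-sound (+ suc _ ⸴ _) ()
negB-sound (-[1+ a ] ⸴ + suc _) ()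
negB-sound (+ 0 ⸴ -[1+ b ]) _ = 0 , suc b , refl , s≤s z≤n
negB-sound (-[1+ a ] ⸴ + 0) _ = suc a , 0 , refl , s≤s z≤n
negB-sound (-[1+ a ] ⸴ -[1+ b ]) _ = suc a , suc b , refl , s≤s z≤n

negB-complete : ∀ x → Neg x → negB x ≡ true
negB-complete (+ 0 ⸴ + 0) (zero , zero , refl , ())
negB-complete (+ 0 ⸴ + suc b) (_ , _ , e , _) with cong im e
... | ()
negB-complete (+ 0 ⸴ -[1+ b ]) _ = refl
negB-complete (+ suc a ⸴ b) (_ , _ , e , _) with cong re e
... | ()
negB-complete (-[1+ a ] ⸴ + 0) _ = refl
negB-complete (-[1+ a ] ⸴ + suc b) (_ , _ , e , _) with cong im e
... | ()
negB-complete (-[1+ a ] ⸴ -[1+ b ]) _ = refl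

-- Laurent polynomials and formal sums, tested by additive functions.

i0 i1 -1ᶻ : ℤ
i0 = + 0
i1 = + 1
-1ᶻ = -[1+ 0 ]

private
  rearr : ∀ a b c d → (a ℤ.+ b) ℤ.+ (c ℤ.+ d) ≡ (a ℤ.+ c) ℤ.+ (b ℤ.+ d)
  rearr = solve-∀

-- A list of monomials may repeat exponents. Instead of collecting terms, the list is tested against
-- every function of the exponent; `coeffL` is the case of a delta function.
evL : (ℤ → ℤ) → Laurent → ℤ
evL g [] = i0
evL g ((c , e) ∷ p) = c ℤ.* g e ℤ.+ evL g p

evL-cong : ∀ {g h} p → (∀ e → g e ≡ h e) → evL g p ≡ evL h p
evL-cong [] q = refl
evL-cong ((c , e) ∷ p) q = cong₂ (λ a b → c ℤ.* a ℤ.+ b) (q e) (evL-cong p q)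

evL-+ : ∀ g h p → evL (λ e → g e ℤ.+ h e) p ≡ evL g p ℤ.+ evL h p
evL-+ g h [] = refl
evL-+ g h ((c , e) ∷ p) = trans (cong₂ ℤ._+_ (ℤP.*-distribˡ-+ c (g e) (h e)) (evL-+ g h p)) (rearr (c ℤ.* g e) (c ℤ.* h e) _ _)

evL-* : ∀ a g p → evL (λ e → a ℤ.* g e) p ≡ a ℤ.* evL g p
evL-* a g [] = sym (ℤP.*-zeroʳ a)
evL-* a g ((c , e) ∷ p) = trans (cong (ℤ._+_ (c ℤ.* (a ℤ.* g e))) (evL-* a g p)) (l c a (g e) (evL g p))
  where l : ∀ c a x y → c ℤ.* (a ℤ.* x) ℤ.+ a ℤ.* y ≡ a ℤ.* (c ℤ.* x ℤ.+ y)
        l = solve-∀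

evL-0 : ∀ p → evL (λ _ → i0) p ≡ i0
evL-0 [] = refl
evL-0 ((c , e) ∷ p) = trans (cong₂ ℤ._+_ (ℤP.*-zeroʳ c) (evL-0 p)) refl

evL-++ : ∀ g p q → evL g (p ++ q) ≡ evL g p ℤ.+ evL g q
evL-++ g [] q = sym (ℤP.+-identityˡ _)
evL-++ g ((c , e) ∷ p) q = trans (cong (ℤ._+_ (c ℤ.* g e)) (evL-++ g p q)) (sym (ℤP.+-assoc (c ℤ.* g e) _ _))

evL-neg : ∀ g p → evL g (negL p) ≡ ℤ.- evL g p
evL-neg g [] = refl
evL-neg g ((c , e) ∷ p) = trans (cong (ℤ._+_ (ℤ.- c ℤ.* g e)) (evL-neg g p)) (l c (g e) (evL g p))
  where l : ∀ c x y → ℤ.- c ℤ.* x ℤ.+ ℤ.- y ≡ ℤ.- (c ℤ.* x ℤ.+ y)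
        l = solve-∀

evL-bar : ∀ g p → evL g (barL p) ≡ evL (λ e → g (ℤ.- e)) p
evL-bar g [] = refl
evL-bar g ((c , e) ∷ p) = cong (ℤ._+_ (c ℤ.* g (ℤ.- e))) (evL-bar g p)

mulL-∷ : ∀ c e p q → mulL ((c , e) ∷ p) q ≡ mulL ((c , e) ∷ []) q ++ mulL p q
mulL-∷ c e p q = cong (_++ mulL p q) (sym (LP.++-identityʳ _))

evL-mulL : ∀ g p q → evL g (mulL p q) ≡ evL (λ e → evL (λ f → g (e ℤ.+ f)) q) p
evL-mulL g [] q = refl
evL-mulL g ((c , e) ∷ p) q = trans (cong (evL g) (mulL-∷ c e p q))
  (trans (evL-++ g (mulL ((c , e) ∷ []) q) (mulL p q)) (cong₂ ℤ._+_ (one q) (evL-mulL g p q)))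
  where
  l : ∀ c d x y → (c ℤ.* d) ℤ.* x ℤ.+ c ℤ.* y ≡ c ℤ.* (d ℤ.* x ℤ.+ y)
  l = solve-∀
  one : ∀ q → evL g (mulL ((c , e) ∷ []) q) ≡ c ℤ.* evL (λ f → g (e ℤ.+ f)) q
  one [] = sym (ℤP.*-zeroʳ c)
  one ((d , f) ∷ q) = trans (cong (ℤ._+_ ((c ℤ.* d) ℤ.* g (e ℤ.+ f))) (one q)) (l c d (g (e ℤ.+ f)) _)

δℤ : ℤ → ℤ → ℤ
δℤ k e with e ℤ.≟ k
... | yes _ = i1
... | no _ = i0

coeffL-ev : ∀ p k → coeffL p k ≡ evL (δℤ k) p
coeffL-ev [] k = refl
coeffL-ev ((c , e) ∷ p) k with e ℤ.≟ k
... | yes _ = cong₂ ℤ._+_ (sym (ℤP.*-identityʳ c)) (coeffL-ev p k)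
... | no _ = trans (coeffL-ev p k) (trans (sym (ℤP.+-identityˡ _)) (cong (ℤ._+ evL (δℤ k) p) (sym (ℤP.*-zeroʳ c))))

-- A finite sum Σ aᵢ ψ(kᵢ) vanishes as soon as the coefficients collected at each key vanish.
module Keys {K : Set} (_≟_ : (x y : K) → Dec (x ≡ y)) where
  sum : (K → ℤ) → List (ℤ × K) → ℤ
  sum ψ [] = i0
  sum ψ ((a , k) ∷ l) = a ℤ.* ψ k ℤ.+ sum ψ l

  δ : K → K → ℤ
  δ k x with x ≟ k
  ... | yes _ = i1
  ... | no _ = i0

  δ-refl : ∀ k → δ k k ≡ i1
  δ-refl k with k ≟ k
  ... | yes _ = refl
  ... | no q = ⊥-elim (q refl)
  δ-ne : ∀ {k x} → x ≢ k → δ k x ≡ i0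
  δ-ne {k} {x} q with x ≟ k
  ... | yes p = ⊥-elim (q p)
  ... | no _ = refl

  drop : K → List (ℤ × K) → List (ℤ × K)
  drop k [] = []
  drop k ((a , x) ∷ l) with x ≟ k
  ... | yes _ = drop k l
  ... | no _ = (a , x) ∷ drop k l

  drop-len : ∀ k l → length (drop k l) ≤ length l
  drop-len k [] = z≤n
  drop-len k ((a , x) ∷ l) with x ≟ k
  ... | yes _ = ≤-trans (drop-len k l) (n≤1+n _)
  ... | no _ = s≤s (drop-len k l)

  drop-sum : ∀ ψ k l → sum ψ l ≡ sum (δ k) l ℤ.* ψ k ℤ.+ sum ψ (drop k l)
  drop-sum ψ k [] = refl
  drop-sum ψ k ((a , x) ∷ l) with x ≟ k
  ... | yes refl = trans (cong (ℤ._+_ (a ℤ.* ψ x)) (drop-sum ψ x l)) (f a (ψ x) (sum (δ x) l) _)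
    where f : ∀ a p s d → a ℤ.* p ℤ.+ (s ℤ.* p ℤ.+ d) ≡ (a ℤ.* i1 ℤ.+ s) ℤ.* p ℤ.+ d
          f = solve-∀
  ... | no _ = trans (cong (ℤ._+_ (a ℤ.* ψ x)) (drop-sum ψ k l)) (f a (ψ x) (ψ k) (sum (δ k) l) _)
    where f : ∀ a p r s d → a ℤ.* p ℤ.+ (s ℤ.* r ℤ.+ d) ≡ (a ℤ.* i0 ℤ.+ s) ℤ.* r ℤ.+ (a ℤ.* p ℤ.+ d)
          f = solve-∀

  drop-δ : ∀ k j l → k ≢ j → sum (δ j) (drop k l) ≡ sum (δ j) l
  drop-δ k j l k≢j = sym (trans (drop-sum (δ j) k l) (trans (cong (λ z → sum (δ k) l ℤ.* z ℤ.+ sum (δ j) (drop k l)) (δ-ne k≢j))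
    (trans (cong (ℤ._+ sum (δ j) (drop k l)) (ℤP.*-zeroʳ (sum (δ k) l))) (ℤP.+-identityˡ _))))

  drop-δ-self : ∀ k l → sum (δ k) (drop k l) ≡ i0
  drop-δ-self k [] = refl
  drop-δ-self k ((a , x) ∷ l) with x ≟ k
  ... | yes _ = drop-δ-self k l
  ... | no q = trans (cong₂ (λ u v → a ℤ.* u ℤ.+ v) (δ-ne q) (drop-δ-self k l)) (cong (ℤ._+ i0) (ℤP.*-zeroʳ a))

  -- Deleting every occurrence of the first key removes its collected coefficient times ψ, hence 0;
  -- the list gets shorter and the coefficients of the other keys stay.
  sum-zero : ∀ l → (∀ k → sum (δ k) l ≡ i0) → ∀ ψ → sum ψ l ≡ i0
  sum-zero l h ψ = go (length l) l ≤-refl h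
    where
    go : ∀ n l → length l ≤ n → (∀ k → sum (δ k) l ≡ i0) → sum ψ l ≡ i0
    go n [] le h = refl
    go (suc n) ((a , k) ∷ l) (s≤s le) h = trans (drop-sum ψ k ((a , k) ∷ l)) (trans (cong₂ (λ u v → u ℤ.* ψ k ℤ.+ v) (h k)
       (go n (drop k ((a , k) ∷ l)) (≤-trans len le) h')) (trans (ℤP.+-identityʳ _) refl))
      where
      len : length (drop k ((a , k) ∷ l)) ≤ length l
      len with k ≟ k
      ... | yes _ = drop-len k l
      ... | no q = ⊥-elim (q refl)
      h' : ∀ j → sum (δ j) (drop k ((a , k) ∷ l)) ≡ i0
      h' j with k ≟ j
      ... | yes refl = drop-δ-self k ((a , k) ∷ l)
      ... | no q = trans (drop-δ k j ((a , k) ∷ l) q) (h j)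

-- The list is what follows the letter c before which p is put. If p repeated the next letter, p c p
-- would fall under the braid relation of p and c. Above a commuting pair either of its letters can
-- come next, so both are excluded. The repetitions that do give stubs have constructors of their
-- own in `Ch`.
Fresh : {A : Set} → A → List A → Set
Fresh p [] = ⊤
Fresh p (d ∷ []) = ⊤
Fresh p (d ∷ e ∷ []) = p ≢ d × p ≢ e
Fresh p (d ∷ e ∷ f ∷ x) = p ≢ d

-- The stubs of a-value 2, uniformly in the type: a commuting pair s t, preceded by a
-- chain of successively non-commuting letters.
data Ch {A : Set} (m : A → A → ℕ) (_<_ : A → A → Set) : List A → Set where
  pairᶜ  : ∀ {s t} → s < t → m s t ≡ 2 → Ch m _<_ (s ∷ t ∷ [])
  forkᶜ  : ∀ {u s t} → Ch m _<_ (s ∷ t ∷ []) → 3 ≤ m u s → 3 ≤ m u t → Ch m _<_ (u ∷ s ∷ t ∷ [])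
  dblˡ  : ∀ {u s t} → Ch m _<_ (u ∷ s ∷ t ∷ []) → 4 ≤ m u s → Ch m _<_ (s ∷ u ∷ s ∷ t ∷ [])
  dblʳ  : ∀ {u s t} → Ch m _<_ (u ∷ s ∷ t ∷ []) → 4 ≤ m u t → Ch m _<_ (t ∷ u ∷ s ∷ t ∷ [])
  quint : ∀ {u s t} → Ch m _<_ (u ∷ s ∷ t ∷ []) → 5 ≤ m u s → Ch m _<_ (u ∷ s ∷ u ∷ s ∷ t ∷ [])
  tailᶜ  : ∀ {p c d e x} → Ch m _<_ (c ∷ d ∷ e ∷ x) → Fresh p (d ∷ e ∷ x) → m p c ≡ 3 → Ch m _<_ (p ∷ c ∷ d ∷ e ∷ x)

Ch-tail : ∀ {A : Set} {m : A → A → ℕ} {_<_ p c d x} → Ch m _<_ (p ∷ c ∷ d ∷ x) → Ch m _<_ (c ∷ d ∷ x)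
Ch-tail (forkᶜ h _ _) = h
Ch-tail (dblˡ h _) = h
Ch-tail (dblʳ h _) = h
Ch-tail (quint h l) = dblˡ h (<⇒≤ l)
Ch-tail (tailᶜ h _ _) = h

altB-altF : ∀ z j → 2 ≤ j → j ≤ 4 → ∃ λ z' → altB z j ≡ altF z' j
altB-altF z 1 (s≤s ()) _
altB-altF false 2 _ _ = true , refl
altB-altF true 2 _ _ = false , refl
altB-altF false 3 _ _ = false , refl
altB-altF true 3 _ _ = true , refl
altB-altF false 4 _ _ = true , refl
altB-altF true 4 _ _ = false , refl
altB-altF z (suc (suc (suc (suc (suc _))))) _ (s≤s (s≤s (s≤s (s≤s ()))))

-- Words modulo the group relations, and the numbers game on the whole diagram.

module Theory {n : ℕ} (M : ℕ → ℕ → ℕ) (geo : Geo n M) where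

  open Coxeter {n} M public
  open Geo geo public

  ≡⇒∼ : ∀ {u w} → u ≡ w → u ∼ w
  ≡⇒∼ refl = ∼refl

  ∼-++ˡ : ∀ c {u w} → u ∼ w → c ++ u ∼ c ++ w
  ∼-++ˡ c ∼refl = ∼refl
  ∼-++ˡ c (∼sym p) = ∼sym (∼-++ˡ c p)
  ∼-++ˡ c (∼trans p q) = ∼trans (∼-++ˡ c p) (∼-++ˡ c q)
  ∼-++ˡ c (∼cancel a b s) = subst₂ _∼_ (LP.++-assoc c a _) (LP.++-assoc c a b) (∼cancel (c ++ a) b s)
  ∼-++ˡ c (∼braid a b s t) = subst₂ _∼_ (LP.++-assoc c a _) (LP.++-assoc c a _) (∼braid (c ++ a) b s t)

  ∼-++ʳ : ∀ c {u w} → u ∼ w → u ++ c ∼ w ++ c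
  ∼-++ʳ c ∼refl = ∼refl
  ∼-++ʳ c (∼sym p) = ∼sym (∼-++ʳ c p)
  ∼-++ʳ c (∼trans p q) = ∼trans (∼-++ʳ c p) (∼-++ʳ c q)
  ∼-++ʳ c (∼cancel a b s) = subst₂ _∼_ (sym (LP.++-assoc a _ c)) (sym (LP.++-assoc a b c)) (∼cancel a (b ++ c) s)
  ∼-++ʳ c (∼braid a b s t) = subst₂ _∼_ (e s t) (e t s ) (∼braid' a (b ++ c) s t)
    where
    ∼braid' : ∀ a b s t → (a ++ alt s t (m s t) ++ b) ∼ (a ++ alt t s (m s t) ++ b)
    ∼braid' = ∼braid
    e : ∀ x y → a ++ alt x y (m s t) ++ b ++ c ≡ (a ++ alt x y (m s t) ++ b) ++ c
    e x y = trans (cong (a ++_) (sym (LP.++-assoc (alt x y (m s t)) b c))) (sym (LP.++-assoc a _ c))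

  ∼-snoc² : ∀ a s → (a ∷ʳ s) ∷ʳ s ∼ a
  ∼-snoc² a s = ∼trans (≡⇒∼ (LP.++-assoc a _ _)) (∼trans (∼cancel a [] s) (≡⇒∼ (LP.++-identityʳ a)))

  ∼-snoc-cancel : ∀ {a b s} → a ∷ʳ s ∼ b ∷ʳ s → a ∼ b
  ∼-snoc-cancel {a} {b} {s} p = ∼trans (∼sym (∼-snoc² a s)) (∼trans (∼-++ʳ (s ∷ []) p) (∼-snoc² b s))

  ∼-snoc-move : ∀ {a b s} → a ∷ʳ s ∼ b → a ∼ b ∷ʳ s
  ∼-snoc-move {a} {b} {s} p = ∼trans (∼sym (∼-snoc² a s)) (∼-++ʳ (s ∷ []) p)

  length-snoc : ∀ (a : Word) s → length (a ∷ʳ s) ≡ suc (length a)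
  length-snoc a s = trans (LP.length-++ a) (+-comm _ 1)

  -- The numbers game: position u = u⁻¹ρ in coordinates dual to the simple roots.
  V : Set
  V = Fin n → R

  fire : Fin n → V → V
  fire s x t with t Fin.≟ s
  ... | yes _ = ⊝ x s
  ... | no _ = x t ⊕ (wt s t ⊗ x s)

  fire-eq : ∀ s x → fire s x s ≡ ⊝ x s
  fire-eq s x with s Fin.≟ s
  ... | yes _ = refl
  ... | no q = ⊥-elim (q refl)

  fire-ne : ∀ s x {t} → t ≢ s → fire s x t ≡ x t ⊕ (wt s t ⊗ x s)
  fire-ne s x {t} q with t Fin.≟ s
  ... | yes p = ⊥-elim (q p)
  ... | no _ = refl

  fire-cong : ∀ s {x y} → x ≗ y → fire s x ≗ fire s y
  fire-cong s e t with t Fin.≟ s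
  ... | yes _ = cong ⊝_ (e s)
  ... | no _ = cong₂ (λ a b → a ⊕ (wt s t ⊗ b)) (e t) (e s)

  fire² : ∀ s x → fire s (fire s x) ≗ x
  fire² s x t with t Fin.≟ s
  ... | yes refl = trans (cong ⊝_ (fire-eq s x)) (neg² (x s))
  ... | no q = begin
      fire s x t ⊕ (wt s t ⊗ fire s x s)           ≡⟨ cong₂ (λ a b → a ⊕ (wt s t ⊗ b)) (fire-ne s x q) (fire-eq s x) ⟩
      (x t ⊕ wt s t ⊗ x s) ⊕ (wt s t ⊗ (⊝ x s))   ≡⟨ ⊕-assoc _ _ _ ⟩
      x t ⊕ (wt s t ⊗ x s ⊕ wt s t ⊗ (⊝ x s))     ≡⟨ cong (λ z → x t ⊕ (wt s t ⊗ x s ⊕ z)) (⊗-neg (wt s t) (x s)) ⟩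
      x t ⊕ (wt s t ⊗ x s ⊕ ⊝ (wt s t ⊗ x s))     ≡⟨ cong (x t ⊕_) (⊕-inverseʳ _) ⟩
      x t ⊕ 0R                                      ≡⟨ ⊕-identityʳ _ ⟩
      x t ∎
    where open ≡-Reasoning

  run : V → Word → V
  run x [] = x
  run x (s ∷ u) = run (fire s x) u

  run-++ : ∀ x u w → run x (u ++ w) ≡ run (run x u) w
  run-++ x [] w = refl
  run-++ x (s ∷ u) w = run-++ (fire s x) u w

  run-cong : ∀ u {x y} → x ≗ y → run x u ≗ run y u
  run-cong [] e = e
  run-cong (s ∷ u) e = run-cong u (fire-cong s e)

  module Dih (s t : Fin n) (s≢t : s ≢ t) where
    ι : Bool → Fin n
    ι false = s
    ι true = t

    private
      α β : R
      α = wt s t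
      β = wt t s

    alt-s : ∀ j → alt s t j ≡ map ι (altF false j)
    alt-t : ∀ j → alt t s j ≡ map ι (altF true j)
    alt-s zero = refl
    alt-s (suc j) = cong (s ∷_) (alt-t j)
    alt-t zero = refl
    alt-t (suc j) = cong (t ∷_) (alt-s j)

    Sim : V → State → V → Set
    Sim x (P , Q , S , U) y =
      (y s ≡ eval (x s) (x t) P) × (y t ≡ eval (x s) (x t) Q) ×
      (∀ r → r ≢ s → r ≢ t → y r ≡ x r ⊕ wt s r ⊗ eval (x s) (x t) S ⊕ wt t r ⊗ eval (x s) (x t) U)

    sim-step : ∀ x σ y b → Sim x σ y → Sim x (step α β b σ) (fire (ι b) y)
    sim-step x (P , Q , S , U) y false (ep , eq , er) =
      trans (fire-eq s y) (trans (cong ⊝_ ep) (sym (eval-⊟ p q P))) ,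
      trans (fire-ne s y (λ e → s≢t (sym e))) (trans (cong₂ (λ a b → a ⊕ (α ⊗ b)) eq ep)
        (trans (cong (eval p q Q ⊕_) (sym (eval-⊠ p q α P))) (sym (eval-⊞ p q Q (α ⊠ P))))) ,
      λ r r≢s r≢t → trans (fire-ne s y r≢s) (trans (cong₂ (λ a b → a ⊕ (wt s r ⊗ b)) (er r r≢s r≢t) ep)
        (trans (⊕-shuffle (x r) _ _ _) (cong (λ z → x r ⊕ z ⊕ wt t r ⊗ eval p q U)
           (trans (sym (⊗-distribˡ (wt s r) (eval p q S) (eval p q P))) (cong (wt s r ⊗_) (sym (eval-⊞ p q S P)))))))
      where p = x s
            q = x t
    sim-step x (P , Q , S , U) y true (ep , eq , er) =
      trans (fire-ne t y s≢t) (trans (cong₂ (λ a b → a ⊕ (β ⊗ b)) ep eq)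
        (trans (cong (eval p q P ⊕_) (sym (eval-⊠ p q β Q))) (sym (eval-⊞ p q P (β ⊠ Q))))) ,
      trans (fire-eq t y) (trans (cong ⊝_ eq) (sym (eval-⊟ p q Q))) ,
      λ r r≢s r≢t → trans (fire-ne t y r≢t) (trans (cong₂ (λ a b → a ⊕ (wt t r ⊗ b)) (er r r≢s r≢t) eq)
        (trans (⊕-assoc _ _ _) (cong (x r ⊕ wt s r ⊗ eval p q S ⊕_)
           (trans (sym (⊗-distribˡ (wt t r) (eval p q U) (eval p q Q))) (cong (wt t r ⊗_) (sym (eval-⊞ p q U Q)))))))
      where p = x s
            q = x t

    sim-run : ∀ d x σ y → Sim x σ y → Sim x (sym-run α β σ d) (run y (map ι d))
    sim-run [] x σ y h = h
    sim-run (b ∷ d) x σ y h = sim-run d x (step α β b σ) (fire (ι b) y) (sim-step x σ y b h)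

    1⊗ : ∀ p → 1R ⊗ p ≡ p
    1⊗ (a ⸴ b) = cong₂ _⸴_ (l a b) (k a b)
      where
      open import Data.Integer.Tactic.RingSolver using (solve-∀)
      l : ∀ a b → + 1 ℤ.* a ℤ.+ + 0 ℤ.* b ≡ a
      l = solve-∀
      k : ∀ a b → + 1 ℤ.* b ℤ.+ + 0 ℤ.* a ℤ.+ + 0 ℤ.* b ≡ b
      k = solve-∀
    0⊗ : ∀ p → 0R ⊗ p ≡ 0R
    0⊗ (a ⸴ b) = refl
    0⊕ : ∀ p → 0R ⊕ p ≡ p
    0⊕ (a ⸴ b) = cong₂ _⸴_ (Data.Integer.Properties.+-identityˡ a) (Data.Integer.Properties.+-identityˡ b)
      where import Data.Integer.Properties

    sim₀ : ∀ x → Sim x σ₀ x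
    sim₀ x = sym (trans (cong₂ _⊕_ (1⊗ (x s)) (0⊗ (x t))) (⊕-identityʳ _)) ,
             sym (trans (cong₂ _⊕_ (0⊗ (x s)) (1⊗ (x t))) (0⊕ _)) ,
             λ r _ _ → sym (trans (cong₂ (λ a b → x r ⊕ wt s r ⊗ a ⊕ wt t r ⊗ b) z z)
               (trans (cong₂ (λ a b → x r ⊕ a ⊕ b) (⊗-zeroʳ (wt s r)) (⊗-zeroʳ (wt t r)))
                 (trans (⊕-identityʳ _) (⊕-identityʳ _))))
      where z : eval (x s) (x t) (0R , 0R) ≡ 0R
            z = trans (cong₂ _⊕_ (0⊗ (x s)) (0⊗ (x t))) refl

    sim : ∀ x d → Sim x (sym-run α β σ₀ d) (run x (map ι d))
    sim x d = sim-run d x σ₀ x (sim₀ x)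

    sim-det : ∀ {x σ y z} → Sim x σ y → Sim x σ z → y ≗ z
    sim-det (a , b , c) (a' , b' , c') r with r Fin.≟ s | r Fin.≟ t
    ... | yes refl | _ = trans a (sym a')
    ... | no _ | yes refl = trans b (sym b')
    ... | no p | no q = trans (c r p q) (sym (c' r p q))

    cmb : Combo (m s t) α β
    cmb = combo s t s≢t

    -- Both words lead to the same symbolic state by `braid-ok`, and a symbolic state determines the
    -- position at every node by `sim-det`.
    run-braid : ∀ x → run x (alt s t (m s t)) ≗ run x (alt t s (m s t))
    run-braid x rewrite alt-s (m s t) | alt-t (m s t) =
      sim-det {x} {sym-run α β σ₀ (altF false (m s t))} (sim x (altF false (m s t)))
        (subst (λ σ → Sim x σ (run x (map ι (altF true (m s t))))) (sym (braid-ok cmb)) (sim x (altF true (m s t))))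

    m>0 : ∃ λ k → m s t ≡ suc k
    m>0 = go cmb
      where go : ∀ {k a b} → Combo k a b → ∃ λ j → k ≡ suc j
            go c2 = _ , refl
            go c3 = _ , refl
            go c4 = _ , refl
            go c4' = _ , refl
            go c5 = _ , refl

    braidB : ∀ x → map ι (altB x (m s t)) ∼ map ι (altB (not x) (m s t))
    braidB x = go x (par cmb)
      where
      k = m s t
      par : ∀ {k a b} → Combo k a b → (altB false k ≡ altF false k × altB true k ≡ altF true k) ⊎ (altB false k ≡ altF true k × altB true k ≡ altF false k)
      par c2 = inj₂ (refl , refl)
      par c3 = inj₁ (refl , refl)
      par c4 = inj₂ (refl , refl)
      par c4' = inj₂ (refl , refl)
      par c5 = inj₁ (refl , refl)
      br : map ι (altF false k) ∼ map ι (altF true k)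
      br = subst₂ _∼_ (trans (LP.++-identityʳ _) (alt-s k)) (trans (LP.++-identityʳ _) (alt-t k)) (∼braid [] [] s t)
      go : ∀ x → _ → map ι (altB x k) ∼ map ι (altB (not x) k)
      go false (inj₁ (p , q)) rewrite p | q = br
      go true (inj₁ (p , q)) rewrite p | q = ∼sym br
      go false (inj₂ (p , q)) rewrite p | q = ∼sym br
      go true (inj₂ (p , q)) rewrite p | q = br

    map-snoc : ∀ d b → map ι (d ∷ʳ b) ≡ map ι d ∷ʳ ι b
    map-snoc d b = LP.map-++ ι d (b ∷ [])

    NF : ℕ → List Bool → Set
    NF l d = ∃ λ x → ∃ λ j → j ≤ m s t × j ≤ l × map ι d ∼ map ι (altB x j)

    -- The new letter prolongs the alternating word or cancels its last letter; at full length m the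
    -- braid relation first makes the new letter the last one, so that it cancels as well.
    nf-snoc : ∀ x j b → j ≤ m s t → NF (suc j) (altB x j ∷ʳ b)
    nf-snoc x zero b h with m>0
    ... | k , e rewrite e = b , 1 , s≤s z≤n , s≤s z≤n , ∼refl
    nf-snoc x (suc j) b h = go x b (suc j ℕ.≟ m s t)
      where
      same : ∀ x → NF (suc (suc j)) (altB x (suc j) ∷ʳ x)
      same x = not x , j , ≤-trans (n≤1+n j) h , ≤-trans (n≤1+n j) (n≤1+n _) ,
        ∼trans (≡⇒∼ (trans (map-snoc (altB x (suc j)) x) (cong (_∷ʳ ι x) (map-snoc (altB (not x) j) x))))
               (∼-snoc² (map ι (altB (not x) j)) (ι x))
      other : ∀ x → not (not x) ≡ x → Dec (suc j ≡ m s t) → NF (suc (suc j)) (altB x (suc j) ∷ʳ not x)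
      other x nn (no q) = not x , suc (suc j) , ≤∧≢⇒< h q , ≤-refl ,
        ≡⇒∼ (cong (λ z → map ι (altB z (suc j) ∷ʳ not x)) (sym nn))
      other x nn (yes q) = x , j , ≤-trans (n≤1+n j) h , ≤-trans (n≤1+n j) (n≤1+n _) ,
        ∼trans (≡⇒∼ (map-snoc (altB x (suc j)) (not x)))
        (∼trans (∼-++ʳ (ι (not x) ∷ []) (subst (λ k → map ι (altB x k) ∼ map ι (altB (not x) k)) (sym q) (braidB x)))
        (∼trans (≡⇒∼ (cong (_∷ʳ ι (not x)) (map-snoc (altB (not (not x)) j) (not x))))
        (∼trans (∼-snoc² _ (ι (not x))) (≡⇒∼ (cong (λ z → map ι (altB z j)) nn)))))
      go : ∀ x b → Dec (suc j ≡ m s t) → NF (suc (suc j)) (altB x (suc j) ∷ʳ b)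
      go false false _ = same false
      go true true _ = same true
      go false true d = other false refl d
      go true false d = other true refl d

    nf-acc : ∀ d x j → j ≤ m s t → NF (j ℕ.+ length d) (altB x j ++ d)
    nf-acc [] x j h = x , j , h , m≤m+n j 0 , ≡⇒∼ (cong (map ι) (LP.++-identityʳ _))
    nf-acc (b ∷ d) x j h with nf-snoc x j b h
    ... | x₁ , j₁ , h₁ , l₁ , e₁ with nf-acc d x₁ j₁ h₁
    ...   | x₂ , j₂ , h₂ , l₂ , e₂ = x₂ , j₂ , h₂ ,
      ≤-trans l₂ (≤-trans (+-monoˡ-≤ (length d) l₁) (≤-reflexive (sym (+-suc j (length d))))) ,
      ∼trans (≡⇒∼ (trans (cong (map ι) (sym (LP.++-assoc (altB x j) (b ∷ []) d))) (LP.map-++ ι (altB x j ∷ʳ b) d)))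
        (∼trans (∼-++ʳ (map ι d) e₁) (∼trans (≡⇒∼ (sym (LP.map-++ ι (altB x₁ j₁) d))) e₂))

    nf2 : ∀ d → NF (length d) d
    nf2 d = nf-acc d false 0 z≤n

    module Signs (x : V) (ps : Pos (x s)) (pt : Pos (x t)) where
      private
        at : ∀ d b → run x (map ι d) (ι b) ≡ eval (x s) (x t) (comp b (sym-run α β σ₀ d))
        at d false = proj₁ (sim x d)
        at d true = proj₁ (proj₂ (sim x d))
        posI : ∀ d b → posLF (comp b (sym-run α β σ₀ d)) ≡ true → Pos (run x (map ι d) (ι b))
        posI d b ok = subst Pos (sym (at d b)) (posLF-sound (comp b (sym-run α β σ₀ d)) _ _ ok ps pt)
        negI : ∀ d b → posLF (⊟ comp b (sym-run α β σ₀ d)) ≡ true → Neg (run x (map ι d) (ι b))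
        negI d b ok = subst Pos (trans (eval-⊟ _ _ (comp b (sym-run α β σ₀ d))) (cong ⊝_ (sym (at d b)))) (posLF-sound (⊟ comp b (sym-run α β σ₀ d)) _ _ ok ps pt)
      pos-other : ∀ y {j} → j < m s t → Pos (run x (map ι (altB y j)) (ι (not y)))
      pos-other y {j} h = posI (altB y j) (not y) (sgn-other cmb y {j} h)
      neg-last : ∀ y {j} → j < m s t → Neg (run x (map ι (altB y (suc j))) (ι y))
      neg-last y {j} h = negI (altB y (suc j)) y (sgn-last cmb y {j} h)
      neg-top : ∀ y → Neg (run x (map ι (altB y (m s t))) (ι (not y)))
      neg-top y = negI (altB y (m s t)) (not y) (sgn-top cmb y)

  run-resp : ∀ {u w} → u ∼ w → ∀ x → run x u ≗ run x w
  run-resp ∼refl x r = refl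
  run-resp (∼sym p) x r = sym (run-resp p x r)
  run-resp (∼trans p q) x r = trans (run-resp p x r) (run-resp q x r)
  run-resp (∼cancel a b s) x r rewrite run-++ x a (s ∷ s ∷ b) | run-++ x a b = run-cong b (fire² s (run x a)) r
  run-resp (∼braid a b s t) x r
    rewrite run-++ x a (alt s t (m s t) ++ b) | run-++ x a (alt t s (m s t) ++ b)
          | run-++ (run x a) (alt s t (m s t)) b | run-++ (run x a) (alt t s (m s t)) b = run-cong b (h (run x a)) r
    where
    h : ∀ y → run y (alt s t (m s t)) ≗ run y (alt t s (m s t))
    h y with s Fin.≟ t
    ... | yes refl = λ _ → refl
    ... | no q = Dih.run-braid s t q y

  ρ : V
  ρ _ = 1R

  X : Word → V
  X = run ρ

  X-resp : ∀ {u w} → u ∼ w → X u ≗ X w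
  X-resp p = run-resp p ρ

  X-snoc : ∀ u s → X (u ∷ʳ s) ≡ fire s (X u)
  X-snoc u s = run-++ ρ u (s ∷ [])

  -- In group terms `Up u s` means us > u and `Dn u s` means us < u; the lemmas on reduced words
  -- below justify this reading. As records they keep u and s visible where `X u s` would unfold.
  record Up (u : Word) (s : Fin n) : Set where
    constructor mk⁺
    field un⁺ : Pos (X u s)
  record Dn (u : Word) (s : Fin n) : Set where
    constructor mk⁻
    field un⁻ : Neg (X u s)
  open Up public
  open Dn public

  Up-resp : ∀ {u w s} → u ∼ w → Up u s → Up w s
  Up-resp {s = s} p (mk⁺ q) = mk⁺ (subst Pos (X-resp p s) q)
  Dn-resp : ∀ {u w s} → u ∼ w → Dn u s → Dn w s
  Dn-resp {s = s} p (mk⁻ q) = mk⁻ (subst Neg (X-resp p s) q)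

  up-dn : ∀ {u s} → Up u s → Dn u s → ⊥
  up-dn (mk⁺ p) (mk⁻ q) = pos-neg p q

  Up⇒Dn : ∀ {u s} → Up u s → Dn (u ∷ʳ s) s
  Up⇒Dn {u} {s} (mk⁺ p) = mk⁻ (subst Pos (sym (trans (cong (λ f → ⊝ f s) (X-snoc u s)) (trans (cong ⊝_ (fire-eq s (X u))) (neg² _)))) p)
  Dn⇒Up : ∀ {u s} → Dn u s → Up (u ∷ʳ s) s
  Dn⇒Up {u} {s} (mk⁻ p) = mk⁺ (subst Pos (sym (trans (cong (λ f → f s) (X-snoc u s)) (fire-eq s (X u)))) p)

  Strip : Word → Fin n → Set
  Strip u s = ∃ λ a → suc (length a) ≤ length u × a ∷ʳ s ∼ u

  -- The basic dichotomy of the numbers game: no value is zero or of mixed sign, and a negative one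
  -- comes with a word of the same element, no longer than u, that ends in s.
  Dich : Word → Fin n → Set
  Dich u s = Up u s ⊎ (Dn u s × Strip u s)

  module _ (s t : Fin n) (s≢t : s ≢ t) where
    open Dih s t s≢t

    X-app : ∀ a d → X (a ++ map ι d) ≡ run (X a) (map ι d)
    X-app a d = run-++ ρ a (map ι d)

    -- As both letters are positive at a, the rank-two signs apply to what follows a. A word ending
    -- in s exhibits its own stripping; one ending in t has s negative only at full length, where
    -- the braid relation brings s to the end.
    fromNF : ∀ {u} a x j → Up a s → Up a t → u ∼ a ++ map ι (altB x j) → j ≤ m s t →
             length a ℕ.+ j ≤ length u → Dich u s
    fromNF {u} a x j ps pt e j≤m le = go x j e j≤m le
      where
      open Signs (X a) (un⁺ ps) (un⁺ pt)
      U : ∀ x j → Pos (run (X a) (map ι (altB x j)) s) → u ∼ a ++ map ι (altB x j) → Up u s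
      U x j p e = Up-resp (∼sym e) (mk⁺ (subst (λ f → Pos (f s)) (sym (X-app a (altB x j))) p))
      D : ∀ x j → Neg (run (X a) (map ι (altB x j)) s) → u ∼ a ++ map ι (altB x j) → Dn u s
      D x j p e = Dn-resp (∼sym e) (mk⁻ (subst (λ f → Neg (f s)) (sym (X-app a (altB x j))) p))
      st : ∀ j → u ∼ a ++ map ι (altB false (suc j)) → length a ℕ.+ suc j ≤ length u → Strip u s
      st j e le = a ++ map ι (altB true j) ,
        ≤-trans (≤-reflexive (trans (cong suc (trans (LP.length-++ a) (cong (length a ℕ.+_) (trans (LP.length-map ι (altB true j)) (lenB true j))))) (sym (+-suc (length a) j)))) le ,
        ∼trans (≡⇒∼ (trans (LP.++-assoc a _ _) (cong (a ++_) (sym (map-snoc (altB true j) false))))) (∼sym e)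
        where
        lenB : ∀ x j → length (altB x j) ≡ j
        lenB x zero = refl
        lenB x (suc j) = trans (LP.length-++ (altB (not x) j)) (trans (+-comm _ 1) (cong suc (lenB (not x) j)))
      go : ∀ x j → u ∼ a ++ map ι (altB x j) → j ≤ m s t → length a ℕ.+ j ≤ length u → Dich u s
      go x zero e h le = inj₁ (U false 0 (un⁺ ps) e)
      go false (suc j) e h le = inj₂ (D false (suc j) (neg-last false h) e , st j e le)
      go true (suc j) e h le with suc j ℕ.≟ m s t
      ... | no q = inj₁ (U true (suc j) (pos-other true (≤∧≢⇒< h q)) e)
      ... | yes q = inj₂ (D true (suc j) (subst (λ k → Neg (run (X a) (map ι (altB true k)) s)) (sym q) (neg-top true)) e ,
              st j (∼trans e (∼-++ˡ a (subst (λ k → map ι (altB true k) ∼ map ι (altB false k)) (sym q) (braidB true)))) le)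

    module _ (k : ℕ) (IH : ∀ u → length u ≤ k → ∀ s → Dich u s) where
      Strip2 : Word → Set
      Strip2 u = ∃ λ a → ∃ λ d → a ++ map ι d ∼ u × length a ℕ.+ length d ≤ length u × Up a s × Up a t

      -- Letters of {s , t} are taken off the right end as long as one of them is negative, which
      -- ends at the minimal representative of the coset. The induction hypothesis licenses each
      -- removal, and j bounds their number.
      strip2 : ∀ j u → length u ≤ j → length u ≤ k → Strip2 u
      strip2 j u le lk with IH u lk s | IH u lk t
      ... | inj₁ p | inj₁ q = u , [] , ≡⇒∼ (LP.++-identityʳ u) , ≤-reflexive (+-identityʳ _) , p , q
      ... | inj₂ (_ , a , l , e) | _ = peel j false a l e le
        where
        peel : ∀ j b a → suc (length a) ≤ length u → a ∷ʳ ι b ∼ u → length u ≤ j → Strip2 u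
        peel zero b a l e le = ⊥-elim (<⇒≱ l (≤-trans le z≤n))
        peel (suc j) b a l e le with strip2 j a (≤-pred (≤-trans l le)) (≤-trans (≤-trans (n≤1+n _) l) lk)
        ... | a' , d , e' , l' , p , q = a' , d ∷ʳ b ,
           ∼trans (≡⇒∼ (trans (cong (a' ++_) (map-snoc d b)) (sym (LP.++-assoc a' _ _)))) (∼trans (∼-++ʳ _ e') e) ,
           ≤-trans (≤-reflexive (trans (cong (length a' ℕ.+_) (trans (LP.length-++ d) (+-comm _ 1))) (+-suc _ _))) (≤-trans (s≤s l') l) , p , q
      ... | inj₁ _ | inj₂ (_ , a , l , e) = peel j true a l e le
        where
        peel : ∀ j b a → suc (length a) ≤ length u → a ∷ʳ ι b ∼ u → length u ≤ j → Strip2 u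
        peel zero b a l e le = ⊥-elim (<⇒≱ l (≤-trans le z≤n))
        peel (suc j) b a l e le with strip2 j a (≤-pred (≤-trans l le)) (≤-trans (≤-trans (n≤1+n _) l) lk)
        ... | a' , d , e' , l' , p , q = a' , d ∷ʳ b ,
           ∼trans (≡⇒∼ (trans (cong (a' ++_) (map-snoc d b)) (sym (LP.++-assoc a' _ _)))) (∼trans (∼-++ʳ _ e') e) ,
           ≤-trans (≤-reflexive (trans (cong (length a' ℕ.+_) (trans (LP.length-++ d) (+-comm _ 1))) (+-suc _ _))) (≤-trans (s≤s l') l) , p , q

  -- Induction on the length of u = bt. For s = t the sign at s just flips. Otherwise b is brought
  -- to the form a d with a positive at s and t and d a word in these letters; d followed by t
  -- becomes alternating, and the rank-two signs decide.
  dich≤ : ∀ k u → length u ≤ k → ∀ s → Dich u s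
  dich≤ k u le s with initLast u
  dich≤ k .[] le s | [] = inj₁ (mk⁺ (1 , 0 , refl , s≤s z≤n))
  dich≤ zero .(b ∷ʳ t) le s | b ∷ʳ′ t = ⊥-elim (<⇒≱ (≤-reflexive (sym (length-snoc b t))) (≤-trans le z≤n))
  dich≤ (suc k) .(b ∷ʳ t) le s | b ∷ʳ′ t with ≤-pred (subst (_≤ suc k) (length-snoc b t) le) | s Fin.≟ t
  ... | lb | yes refl = h (dich≤ k b lb s)
    where
    h : Dich b s → Dich (b ∷ʳ s) s
    h (inj₁ p) = inj₂ (Up⇒Dn {b} p , b , ≤-reflexive (sym (length-snoc b s)) , ∼refl)
    h (inj₂ (p , _)) = inj₁ (Dn⇒Up {b} p)
  ... | lb | no s≢t with strip2 s t s≢t k (dich≤ k) k b lb lb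
  ...   | a , d , e , l , p , q with Dih.nf2 s t s≢t (d ∷ʳ true)
  ...     | x , j , jm , jl , e' = fromNF s t s≢t a x j p q
       (∼trans (∼-++ʳ (t ∷ []) (∼sym e)) (∼trans (≡⇒∼ (trans (LP.++-assoc a _ _) (cong (a ++_) (sym (map-snoc d true))))) (∼-++ˡ a e'))) jm
       (≤-trans (+-monoʳ-≤ (length a) jl) (≤-trans (≤-reflexive (trans (cong (length a ℕ.+_) (trans (LP.length-++ d) (+-comm _ 1))) (+-suc _ _)))
         (≤-trans (s≤s l) (≤-reflexive (sym (length-snoc b t))))))
    where open Dih s t s≢t

  abstract
    dich : ∀ u s → Dich u s
    dich u = dich≤ (length u) u ≤-refl

    up? : ∀ u s → Up u s ⊎ Dn u s
    up? u s with dich u s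
    ... | inj₁ p = inj₁ p
    ... | inj₂ (p , _) = inj₂ p

  -- Reduced words, descents and a computable normal form.

  Red-resp : ∀ {u w} → u ∼ w → length u ≡ length w → Reduced u → Reduced w
  Red-resp e l h w' e' = subst (_≤ length w') l (h w' (∼trans e' (∼sym e)))

  Red-prefix : ∀ a b → Reduced (a ++ b) → Reduced a
  Red-prefix a b h a' e = +-cancelʳ-≤ (length b) _ _
    (subst₂ _≤_ (LP.length-++ a) (LP.length-++ a') (h (a' ++ b) (∼-++ʳ b e)))
  Red-suffix : ∀ a b → Reduced (a ++ b) → Reduced b
  Red-suffix a b h b' e = +-cancelˡ-≤ (length a) _ _
    (subst₂ _≤_ (LP.length-++ a) (LP.length-++ a) (h (a ++ b') (∼-++ˡ a e)))

  Red-[] : Reduced []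
  Red-[] _ _ = z≤n

  -- s is negative at us, so any other word for us can be rewritten to end in s without growing;
  -- dropping this s leaves a word for u, which has at least the length of u.
  Red-up : ∀ {u s} → Reduced u → Up u s → Reduced (u ∷ʳ s)
  Red-up {u} {s} h p u' e with dich u' s
  ... | inj₁ q = ⊥-elim (up-dn {u'} q (Dn-resp (∼sym e) (Up⇒Dn {u} p)))
  ... | inj₂ (_ , a , l , e') = ≤-trans (≤-reflexive (length-snoc u s))
          (≤-trans (s≤s (h a (∼-snoc-cancel (∼trans e' e)))) l)

  Red-snoc⇒Up : ∀ {u s} → Reduced (u ∷ʳ s) → Up u s
  Red-snoc⇒Up {u} {s} h with dich u s
  ... | inj₁ p = p
  ... | inj₂ (_ , a , l , e) = ⊥-elim (<⇒≱ (≤-trans (s≤s (≤-trans (n≤1+n _) l)) (≤-reflexive (sym (length-snoc u s))))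
         (h a (∼-snoc-move e)))

  Red-dn : ∀ {u s} → Reduced u → Dn u s → ∃ λ a → Reduced (a ∷ʳ s) × a ∷ʳ s ∼ u × length (a ∷ʳ s) ≡ length u
  Red-dn {u} {s} h p with dich u s
  ... | inj₁ q = ⊥-elim (up-dn {u} q p)
  ... | inj₂ (_ , a , l , e) = a , Red-resp (∼sym e) (sym eq) h , e , eq
    where eq = ≤-antisym (≤-trans (≤-reflexive (length-snoc a s)) l) (h _ e)

  abstract
    reduce : ∀ u → ∃ λ u' → Reduced u' × u' ∼ u × length u' ≤ length u
    reduce u = go (length u) u ≤-refl
      where
      go : ∀ k u → length u ≤ k → ∃ λ u' → Reduced u' × u' ∼ u × length u' ≤ length u
      go k u le with initLast u
      go k .[] le | [] = [] , Red-[] , ∼refl , z≤n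
      go zero .(b ∷ʳ s) le | b ∷ʳ′ s = ⊥-elim (<⇒≱ (≤-reflexive (sym (length-snoc b s))) (≤-trans le z≤n))
      go (suc k) .(b ∷ʳ s) le | b ∷ʳ′ s with go k b (≤-pred (subst (_≤ suc k) (length-snoc b s) le))
      ... | b' , h , e , l with up? b' s
      ...   | inj₁ p = b' ∷ʳ s , Red-up h p , ∼-++ʳ _ e , subst₂ _≤_ (sym (length-snoc b' s)) (sym (length-snoc b s)) (s≤s l)
      ...   | inj₂ p with Red-dn h p
      ...     | a , ha , ea , la = a , Red-prefix a (s ∷ []) ha , ∼-snoc-move (∼trans ea e) ,
                   ≤-trans (≤-trans (n≤1+n _) (≤-trans (≤-reflexive (trans (sym (length-snoc a s)) la)) l))
                     (≤-trans (n≤1+n _) (≤-reflexive (sym (length-snoc b s))))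

  Red-length : ∀ {u w} → Reduced u → Reduced w → u ∼ w → length u ≡ length w
  Red-length hu hw e = ≤-antisym (hu _ (∼sym e)) (hw _ e)

  first : List (Fin n) → V → Maybe (Fin n)
  first [] x = nothing
  first (s ∷ ss) x with negB (x s)
  ... | true = just s
  ... | false = first ss x

  first-cong : ∀ ss {x y} → x ≗ y → first ss x ≡ first ss y
  first-cong [] e = refl
  first-cong (s ∷ ss) {x} {y} e rewrite e s with negB (y s)
  ... | true = refl
  ... | false = first-cong ss e

  first-just : ∀ ss x {s} → first ss x ≡ just s → Neg (x s)
  first-just (r ∷ ss) x e with negB (x r) in eq
  first-just (r ∷ ss) x refl | true = negB-sound _ eq
  ... | false = first-just ss x e

  first-nothing : ∀ ss x {s} → s ∈ ss → first ss x ≡ nothing → Neg (x s) → ⊥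
  first-nothing (r ∷ ss) x p e ng with negB (x r) in eq
  first-nothing (r ∷ ss) x (here refl) e ng | false with trans (sym eq) (negB-complete _ ng)
  ... | ()
  first-nothing (r ∷ ss) x (there p) e ng | false = first-nothing ss x p e ng

  -- The word is rebuilt from its position: the last letter is the first negative node, which is
  -- then fired. Only the position and the length enter, both invariants of the element, so
  -- congruent words get literally equal normal forms and the word problem is decided.
  nfF : ℕ → V → Word
  nfS : ℕ → V → Maybe (Fin n) → Word
  nfF zero x = []
  nfF (suc k) x = nfS k x (first (allFin n) x)
  nfS k x nothing = []
  nfS k x (just s) = nfF k (fire s x) ∷ʳ s

  nfF-cong : ∀ k {x y} → x ≗ y → nfF k x ≡ nfF k y
  nfS-cong : ∀ k f {x y} → x ≗ y → nfS k x f ≡ nfS k y f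
  nfF-cong zero e = refl
  nfF-cong (suc k) {x} {y} e = trans (nfS-cong k (first (allFin n) x) e) (cong (nfS k y) (first-cong (allFin n) e))
  nfS-cong k nothing e = refl
  nfS-cong k (just s) e = cong (_∷ʳ s) (nfF-cong k (fire-cong s e))

  nfF-ok : ∀ k u → Reduced u → length u ≡ k → nfF k (X u) ∼ u
  nfF-ok zero [] h e = ∼refl
  nfF-ok (suc k) u h e with first (allFin n) (X u) in eq
  nfF-ok (suc k) u h e | nothing with initLast u
  nfF-ok (suc k) .[] h () | nothing | []
  ... | b ∷ʳ′ s = ⊥-elim (first-nothing (allFin n) (X (b ∷ʳ s)) (∈P.∈-allFin s) eq (un⁻ (Up⇒Dn {b} (Red-snoc⇒Up {b} h))))
  nfF-ok (suc k) u h e | just s with Red-dn {s = s} h (mk⁻ (first-just (allFin n) (X u) eq))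
  ... | a , ha , ea , la = ∼trans (∼-++ʳ (s ∷ []) (∼trans (≡⇒∼ (nfF-cong k ae))
           (nfF-ok k a (Red-prefix a _ ha) (suc-injective (trans (sym (length-snoc a s)) (trans la e)))))) ea
    where
    ae : fire s (X u) ≗ X a
    ae r = trans (cong (λ f → f r) (sym (X-snoc u s))) (sym (X-resp (∼-snoc-move ea) r))

  red : Word → Word
  red u = proj₁ (reduce u)
  red-Red : ∀ u → Reduced (red u)
  red-Red u = proj₁ (proj₂ (reduce u))
  red-∼ : ∀ u → red u ∼ u
  red-∼ u = proj₁ (proj₂ (proj₂ (reduce u)))

  ℓ : Word → ℕ
  ℓ u = length (red u)
  ℓ-resp : ∀ {u w} → u ∼ w → ℓ u ≡ ℓ w
  ℓ-resp {u} {w} e = Red-length (red-Red u) (red-Red w) (∼trans (red-∼ u) (∼trans e (∼sym (red-∼ w))))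

  nf : Word → Word
  nf u = nfF (ℓ u) (X u)

  nf-resp : ∀ {u w} → u ∼ w → nf u ≡ nf w
  nf-resp {u} {w} e = trans (cong (λ k → nfF k (X u)) (ℓ-resp e)) (nfF-cong (ℓ w) (X-resp e))

  nf-∼ : ∀ u → nf u ∼ u
  nf-∼ u = ∼trans (≡⇒∼ (nfF-cong (ℓ u) (X-resp (∼sym (red-∼ u))))) (∼trans (nfF-ok (ℓ u) (red u) (red-Red u) refl) (red-∼ u))

  nfF-len : ∀ k x → length (nfF k x) ≤ k
  nfF-len zero x = z≤n
  nfF-len (suc k) x with first (allFin n) x
  ... | nothing = z≤n
  ... | just s = ≤-trans (≤-reflexive (length-snoc (nfF k (fire s x)) s)) (s≤s (nfF-len k _))

  nf-Red : ∀ u → Reduced (nf u)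
  nf-Red u = Red-resp (∼trans (red-∼ u) (∼sym (nf-∼ u))) len (red-Red u)
    where len = ≤-antisym (red-Red u _ (∼trans (nf-∼ u) (∼sym (red-∼ u)))) (nfF-len (ℓ u) (X u))

  _∼?_ : ∀ u w → Dec (u ∼ w)
  u ∼? w = map′ (λ e → ∼trans (∼sym (nf-∼ u)) (∼trans (≡⇒∼ e) (nf-∼ w))) nf-resp (LP.≡-dec Fin._≟_ (nf u) (nf w))

  nf-idem : ∀ u → nf (nf u) ≡ nf u
  nf-idem u = nf-resp (nf-∼ u)

  -- Reversal is inversion; it exchanges left and right descents.
  rev-snoc : ∀ (u : Word) s → reverse (u ∷ʳ s) ≡ s ∷ reverse u
  rev-snoc u s = LP.reverse-++ u (s ∷ [])
  rev-cons : ∀ (u : Word) s → reverse (s ∷ u) ≡ reverse u ∷ʳ s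
  rev-cons u s = LP.unfold-reverse s u
  rev² : ∀ (u : Word) → reverse (reverse u) ≡ u
  rev² = LP.reverse-involutive

  lastL : Fin n → Fin n → ℕ → Fin n
  lastL s t zero = s
  lastL s t (suc k) = lastL t s k

  alt-snoc : ∀ s t k → alt s t (suc k) ≡ alt s t k ∷ʳ lastL s t k
  alt-snoc s t zero = refl
  alt-snoc s t (suc k) = cong (s ∷_) (alt-snoc t s k)

  rev-alt : ∀ k → (∀ s t → reverse (alt s t k) ≡ alt s t k × lastL s t k ≡ t) ⊎ (∀ s t → reverse (alt s t k) ≡ alt t s k × lastL s t k ≡ s)
  rev-alt zero = inj₂ λ s t → refl , refl
  rev-alt (suc k) with rev-alt k
  ... | inj₁ f = inj₂ λ s t → trans (rev-cons (alt t s k) s) (trans (cong (_∷ʳ s) (proj₁ (f t s)))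
                   (trans (cong (alt t s k ∷ʳ_) (sym (proj₂ (f t s)))) (sym (alt-snoc t s k)))) , proj₂ (f t s)
  ... | inj₂ f = inj₁ λ s t → trans (rev-cons (alt t s k) s) (trans (cong (_∷ʳ s) (proj₁ (f t s)))
                   (trans (cong (alt s t k ∷ʳ_) (sym (proj₂ (f s t)))) (sym (alt-snoc s t k)))) , proj₂ (f t s)

  ∼-rev : ∀ {u w} → u ∼ w → reverse u ∼ reverse w
  ∼-rev ∼refl = ∼refl
  ∼-rev (∼sym p) = ∼sym (∼-rev p)
  ∼-rev (∼trans p q) = ∼trans (∼-rev p) (∼-rev q)
  ∼-rev (∼cancel a b s) = subst₂ _∼_ (sym e) (sym (LP.reverse-++ a b)) (∼cancel (reverse b) (reverse a) s)
    where
    e : reverse (a ++ s ∷ s ∷ b) ≡ reverse b ++ s ∷ s ∷ reverse a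
    e = trans (LP.reverse-++ a (s ∷ s ∷ b)) (trans (cong (_++ reverse a) (trans (rev-cons (s ∷ b) s) (cong (_∷ʳ s) (rev-cons b s))))
          (trans (LP.++-assoc (reverse b ∷ʳ s) (s ∷ []) _) (LP.++-assoc (reverse b) (s ∷ []) _)))
  ∼-rev (∼braid a b s t) = subst₂ _∼_ (sym (e (alt s t (m s t)))) (sym (e (alt t s (m s t))))
        (∼-++ˡ (reverse b) (∼-++ʳ (reverse a) (core (rev-alt (m s t)))))
    where
    e : ∀ c → reverse (a ++ c ++ b) ≡ reverse b ++ reverse c ++ reverse a
    e c = trans (LP.reverse-++ a (c ++ b)) (trans (cong (_++ reverse a) (LP.reverse-++ c b)) (LP.++-assoc (reverse b) _ _))
    br : alt s t (m s t) ∼ alt t s (m s t)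
    br = subst₂ _∼_ (LP.++-identityʳ _) (LP.++-identityʳ _) (∼braid [] [] s t)
    core : _ → reverse (alt s t (m s t)) ∼ reverse (alt t s (m s t))
    core (inj₁ f) rewrite proj₁ (f s t) | proj₁ (f t s) = br
    core (inj₂ f) rewrite proj₁ (f s t) | proj₁ (f t s) = ∼sym br

  rev-∼ : ∀ {u w} → reverse u ∼ w → u ∼ reverse w
  rev-∼ {u} e = ∼trans (≡⇒∼ (sym (rev² u))) (∼-rev e)

  Red-rev : ∀ {u} → Reduced u → Reduced (reverse u)
  Red-rev {u} h w e = subst₂ _≤_ (sym (LP.length-reverse u)) (LP.length-reverse w)
    (h (reverse w) (∼sym (rev-∼ (∼sym e))))

  DnL UpL : Word → Fin n → Set
  DnL u s = Dn (reverse u) s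
  UpL u s = Up (reverse u) s

  DnL-resp : ∀ {u w s} → u ∼ w → DnL u s → DnL w s
  DnL-resp e = Dn-resp (∼-rev e)
  UpL-resp : ∀ {u w s} → u ∼ w → UpL u s → UpL w s
  UpL-resp e = Up-resp (∼-rev e)
  upL-dnL : ∀ {u s} → UpL u s → DnL u s → ⊥
  upL-dnL {u} = up-dn {reverse u}
  upL? : ∀ u s → UpL u s ⊎ DnL u s
  upL? u = up? (reverse u)

  Red-upL : ∀ {u s} → Reduced u → UpL u s → Reduced (s ∷ u)
  Red-upL {u} {s} h p = subst Reduced (trans (rev-snoc (reverse u) s) (cong (s ∷_) (rev² u))) (Red-rev (Red-up (Red-rev h) p))
  Red-cons⇒UpL : ∀ {u s} → Reduced (s ∷ u) → UpL u s
  Red-cons⇒UpL {u} {s} h = Red-snoc⇒Up {reverse u} (subst Reduced (rev-cons u s) (Red-rev h))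
  UpL⇒DnL : ∀ {u s} → UpL u s → DnL (s ∷ u) s
  UpL⇒DnL {u} {s} p = subst (λ z → Dn z s) (sym (rev-cons u s)) (Up⇒Dn {reverse u} p)
  DnL⇒UpL : ∀ {u s} → DnL u s → UpL (s ∷ u) s
  DnL⇒UpL {u} {s} p = subst (λ z → Up z s) (sym (rev-cons u s)) (Dn⇒Up {reverse u} p)

  Red-dnL : ∀ {u s} → Reduced u → DnL u s → ∃ λ a → Reduced (s ∷ a) × s ∷ a ∼ u × suc (length a) ≡ length u
  Red-dnL {u} {s} h p with Red-dn (Red-rev h) p
  ... | a , ha , ea , la = reverse a , subst Reduced (rev-snoc a s) (Red-rev ha) ,
     ∼trans (≡⇒∼ (sym (rev-snoc a s))) (∼sym (rev-∼ (∼sym ea))) ,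
     trans (cong suc (LP.length-reverse a)) (trans (sym (length-snoc a s)) (trans la (LP.length-reverse u)))

  ∼-cons² : ∀ s a → s ∷ s ∷ a ∼ a
  ∼-cons² s a = ∼cancel [] a s
  ∼-cons-move : ∀ {s a b} → s ∷ a ∼ b → a ∼ s ∷ b
  ∼-cons-move {s} {a} e = ∼trans (∼sym (∼-cons² s a)) (∼-++ˡ (s ∷ []) e)
  ∼-cons-cancel : ∀ {s a b} → s ∷ a ∼ s ∷ b → a ∼ b
  ∼-cons-cancel {s} {a} {b} e = ∼trans (∼-cons-move e) (∼-cons² s b)

  snoc-Dn : ∀ {b s} → Reduced (b ∷ʳ s) → Dn (b ∷ʳ s) s
  snoc-Dn {b} h = Up⇒Dn {b} (Red-snoc⇒Up {b} h)
  cons-DnL : ∀ {b s} → Reduced (s ∷ b) → DnL (s ∷ b) s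
  cons-DnL {b} h = UpL⇒DnL {b} (Red-cons⇒UpL h)

  -- Cosets of dihedral subgroups, Matsumoto's theorem and the exchange property.

  lenB : ∀ x j → length (altB x j) ≡ j
  lenB x zero = refl
  lenB x (suc j) = trans (LP.length-++ (altB (not x) j)) (trans (+-comm _ 1) (cong suc (lenB (not x) j)))

  notnot : ∀ x → not (not x) ≡ x
  notnot false = refl
  notnot true = refl

  -- the coset decomposition w = a·w_I with respect to I = {s , t}
  module Coset (s t : Fin n) (s≢t : s ≢ t) where
    open Dih s t s≢t public

    word : Word → Bool → ℕ → Word
    word a x j = a ++ map ι (altB x j)

    word-snoc : ∀ a x j → word a x (suc j) ≡ word a (not x) j ∷ʳ ι x
    word-snoc a x j = trans (cong (a ++_) (map-snoc (altB (not x) j) x)) (sym (LP.++-assoc a _ _))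

    word-len : ∀ a x j → length (word a x j) ≡ length a ℕ.+ j
    word-len a x j = trans (LP.length-++ a) (cong (length a ℕ.+_) (trans (LP.length-map ι (altB x j)) (lenB x j)))

    module _ {a : Word} (us : Up a s) (ut : Up a t) where
      private module S = Signs (X a) (un⁺ us) (un⁺ ut)
      word-X : ∀ x j → X (word a x j) ≡ run (X a) (map ι (altB x j))
      word-X x j = run-++ ρ a _
      word-other : ∀ x {j} → j < m s t → Up (word a x j) (ι (not x))
      word-other x {j} h = mk⁺ (subst (λ f → Pos (f (ι (not x)))) (sym (word-X x j)) (S.pos-other x h))
      word-last : ∀ x {j} → j < m s t → Dn (word a x (suc j)) (ι x)
      word-last x {j} h = mk⁻ (subst (λ f → Neg (f (ι x))) (sym (word-X x (suc j))) (S.neg-last x h))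
      word-top : ∀ x → Dn (word a x (m s t)) (ι (not x))
      word-top x = mk⁻ (subst (λ f → Neg (f (ι (not x)))) (sym (word-X x (m s t))) (S.neg-top x))

      word-Red : Reduced a → ∀ x j → j ≤ m s t → Reduced (word a x j)
      word-Red h x zero le = subst Reduced (sym (LP.++-identityʳ a)) h
      word-Red h x (suc j) le = subst Reduced (sym (word-snoc a x j))
        (Red-up (word-Red h (not x) j (<⇒≤ le)) (subst (λ y → Up (word a (not x) j) (ι y)) (notnot x) (word-other (not x) le)))

    Decomp : Word → Set
    Decomp u = ∃ λ a → ∃ λ x → ∃ λ j → j ≤ m s t × word a x j ∼ u × length a ℕ.+ j ≡ length u × Up a s × Up a t × Reduced a

    decomp-def : ∀ u → Reduced u → Decomp u
    decomp-def u h with strip2 s t s≢t (length u) (λ w _ → dich w) (length u) u ≤-refl ≤-refl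
    ... | a , d , e , l , p , q with nf2 d
    ...   | x , j , jm , jl , e' = a , x , j , jm , ee , len , p , q , Red-prefix a _ (Red-resp (∼sym ee) (trans (sym len) (sym (word-len a x j))) h)
      where
      ee = ∼trans (∼-++ˡ a (∼sym e')) e
      len = ≤-antisym (≤-trans (+-monoʳ-≤ (length a) jl) l) (≤-trans (h _ ee) (≤-reflexive (word-len a x j)))
    abstract
      decomp : ∀ u → Reduced u → Decomp u
      decomp = decomp-def

    -- if both s and t are right descents, w_I is the longest element
    both-def : ∀ u → Reduced u → Dn u s → Dn u t → ∃ λ a → (∀ x → word a x (m s t) ∼ u) × length a ℕ.+ m s t ≡ length u × Reduced a × Up a s × Up a t
    both-def u h ds dt with decomp u h
    ... | a , x , j , jm , e , l , p , q , ra with m≤n⇒m<n∨m≡n jm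
    ...   | inj₁ lt = ⊥-elim (bad x (word-other p q x lt) e)
      where
      bad : ∀ x → Up (word a x j) (ι (not x)) → word a x j ∼ u → ⊥
      bad false up e = up-dn {u} (Up-resp e up) dt
      bad true up e = up-dn {u} (Up-resp e up) ds
    ...   | inj₂ refl = a , two x e , l , ra , p , q
      where
      two : ∀ x → word a x j ∼ u → ∀ y → word a y j ∼ u
      two false e false = e
      two false e true = ∼trans (∼-++ˡ a (∼sym (braidB false))) e
      two true e true = e
      two true e false = ∼trans (∼-++ˡ a (∼sym (braidB true))) e
    abstract
      both : ∀ u → Reduced u → Dn u s → Dn u t → ∃ λ a → (∀ x → word a x (m s t) ∼ u) × length a ℕ.+ m s t ≡ length u × Reduced a × Up a s × Up a t
      both = both-def

  infix 4 _≈b_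
  -- A symmetry constructor would be redundant: exchanging s and t in `bbraid` gives the reverse
  -- move, because m is symmetric.
  data _≈b_ : Word → Word → Set where
    brefl  : ∀ {u} → u ≈b u
    btrans : ∀ {u w x} → u ≈b w → w ≈b x → u ≈b x
    bbraid : ∀ a b s t → (a ++ alt s t (m s t) ++ b) ≈b (a ++ alt t s (m s t) ++ b)

  b-++ʳ : ∀ c {u w} → u ≈b w → u ++ c ≈b w ++ c
  b-++ʳ c brefl = brefl
  b-++ʳ c (btrans p q) = btrans (b-++ʳ c p) (b-++ʳ c q)
  b-++ʳ c (bbraid a b s t) = subst₂ _≈b_ (e (alt s t (m s t))) (e (alt t s (m s t))) (bbraid a (b ++ c) s t)
    where
    e : ∀ y → a ++ y ++ b ++ c ≡ (a ++ y ++ b) ++ c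
    e y = trans (cong (a ++_) (sym (LP.++-assoc y b c))) (sym (LP.++-assoc a _ c))

  b-braidB : ∀ s t (s≢t : s ≢ t) a x → Coset.word s t s≢t a x (m s t) ≈b Coset.word s t s≢t a (not x) (m s t)
  b-braidB s t s≢t a x = go x (par cmb)
    where
    open Coset s t s≢t
    k = m s t
    par : ∀ {k a b} → Combo k a b → (altB false k ≡ altF false k × altB true k ≡ altF true k) ⊎ (altB false k ≡ altF true k × altB true k ≡ altF false k)
    par c2 = inj₂ (refl , refl)
    par c3 = inj₁ (refl , refl)
    par c4 = inj₂ (refl , refl)
    par c4' = inj₂ (refl , refl)
    par c5 = inj₁ (refl , refl)
    ft : a ++ map ι (altF false k) ≈b a ++ map ι (altF true k)
    ft = subst₂ _≈b_ (cong (a ++_) (trans (LP.++-identityʳ _) (alt-s k))) (cong (a ++_) (trans (LP.++-identityʳ _) (alt-t k))) (bbraid a [] s t)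
    tf : a ++ map ι (altF true k) ≈b a ++ map ι (altF false k)
    tf = subst₂ _≈b_ (cong (a ++_) (trans (cong (λ z → alt t s z ++ []) (msym t s)) (trans (LP.++-identityʳ _) (alt-t k))))
                     (cong (a ++_) (trans (cong (λ z → alt s t z ++ []) (msym t s)) (trans (LP.++-identityʳ _) (alt-s k)))) (bbraid a [] t s)
    go : ∀ x → _ → word a x k ≈b word a (not x) k
    go false (inj₁ (p , q)) rewrite p | q = ft
    go true (inj₁ (p , q)) rewrite p | q = tf
    go false (inj₂ (p , q)) rewrite p | q = tf
    go true (inj₂ (p , q)) rewrite p | q = ft

  -- If the last letters s and t differ, both are right descents, so the element is a times the
  -- longest element of ⟨s , t⟩; the two words are joined through its two alternating forms, with
  -- the induction hypothesis on either side. Braid moves alone are wanted because cancelling s s is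
  -- not an equality in the Hecke algebra.
  matsumoto-def : ∀ {u w} → Reduced u → Reduced w → u ∼ w → u ≈b w
  matsumoto-def {u} {w} hu hw e = go (length u) u w refl hu hw e
    where
    go : ∀ k u w → length u ≡ k → Reduced u → Reduced w → u ∼ w → u ≈b w
    go k u w l hu hw e with initLast u | initLast w
    go k .[] .[] l hu hw e | [] | [] = brefl
    go k .[] .(w' ∷ʳ t) l hu hw e | [] | w' ∷ʳ′ t = ⊥-elim (<⇒≱ (≤-reflexive (sym (length-snoc w' t))) (≤-trans (hw [] e) z≤n))
    go k .(u' ∷ʳ s) .[] l hu hw e | u' ∷ʳ′ s | [] = ⊥-elim (<⇒≱ (≤-reflexive (sym (length-snoc u' s))) (≤-trans (hu [] (∼sym e)) z≤n))
    go zero .(u' ∷ʳ s) .(w' ∷ʳ t) l hu hw e | u' ∷ʳ′ s | w' ∷ʳ′ t = ⊥-elim (0≢1+n (trans (sym l) (length-snoc u' s)))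
    go (suc k) .(u' ∷ʳ s) .(w' ∷ʳ t) l hu hw e | u' ∷ʳ′ s | w' ∷ʳ′ t with s Fin.≟ t
    ... | yes refl = b-++ʳ _ (go k u' w' (suc-injective (trans (sym (length-snoc u' s)) l)) (Red-prefix u' _ hu) (Red-prefix w' _ hw) (∼-snoc-cancel e))
    ... | no s≢t with Coset.both s t s≢t (u' ∷ʳ s) hu (snoc-Dn {u'} hu) (Dn-resp (∼sym e) (snoc-Dn {w'} hw)) | Coset.m>0 s t s≢t
    ...   | a , f , la , ra , us , ut | j , mj = btrans left (btrans (b-braidB s t s≢t a false) right)
      where
      open Coset s t s≢t
      lu : length u' ≡ k
      lu = suc-injective (trans (sym (length-snoc u' s)) l)
      side : ∀ b c → Reduced (c ∷ʳ ι b) → word a b (m s t) ∼ c ∷ʳ ι b → word a (not b) j ∼ c × Reduced (word a (not b) j)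
      side b c hc ee = ∼-snoc-cancel (∼trans (≡⇒∼ (trans (sym (word-snoc a b j)) (cong (word a b) (sym mj)))) ee) ,
                       word-Red us ut ra (not b) j (≤-trans (n≤1+n j) (≤-reflexive (sym mj)))
      sl = side false u' hu (f false)
      sr = side true w' hw (∼trans (f true) e)
      left : u' ∷ʳ s ≈b word a false (m s t)
      left = subst (u' ∷ʳ s ≈b_) (trans (sym (word-snoc a false j)) (cong (word a false) (sym mj)))
               (b-++ʳ (s ∷ []) (go k u' (word a true j) lu (Red-prefix u' _ hu) (proj₂ sl) (∼sym (proj₁ sl))))
      right : word a true (m s t) ≈b w' ∷ʳ t
      right = subst (_≈b w' ∷ʳ t) (trans (sym (word-snoc a true j)) (cong (word a true) (sym mj)))
               (b-++ʳ (t ∷ []) (go k (word a false j) w' (trans (Red-length (proj₂ sr) (Red-prefix w' _ hw) (proj₁ sr))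
                  (suc-injective (trans (sym (length-snoc w' t)) (trans (sym (Red-length hu hw e)) l)))) (proj₂ sr) (Red-prefix w' _ hw) (proj₁ sr)))
  abstract
    matsumoto : ∀ {u w} → Reduced u → Reduced w → u ∼ w → u ≈b w
    matsumoto {u} {w} = matsumoto-def {u} {w}

  -- Let r be the last letter of w and write w = a w_I with I = {r , t}. If neither letter is a
  -- descent of sa, then sa is again minimal in its coset and t stays an ascent of sw, against the
  -- assumption. Otherwise induction gives sa = ax with x in I, so sw lies in the coset of a, one
  -- step longer than w, and its descent t forces sw = wt.
  exchange-def : ∀ w s t → Reduced w → UpL w s → Up w t → Dn (s ∷ w) t → s ∷ w ∼ w ∷ʳ t
  exchange-def w s t hw us ut d = go (length w) w ≤-refl t hw us ut d
    where
    m>1 : ∀ s t → s ≢ t → 1 < m s t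
    m>1 s t s≢t = h (Dih.cmb s t s≢t)
      where
      h : ∀ {k a b} → Combo k a b → 1 < k
      h c2 = s≤s (s≤s z≤n)
      h c3 = s≤s (s≤s z≤n)
      h c4 = s≤s (s≤s z≤n)
      h c4' = s≤s (s≤s z≤n)
      h c5 = s≤s (s≤s z≤n)
    ρ-up : ∀ s → Up [] s
    ρ-up s = mk⁺ (1 , 0 , refl , s≤s z≤n)
    go : ∀ k w → length w ≤ k → ∀ t → Reduced w → UpL w s → Up w t → Dn (s ∷ w) t → s ∷ w ∼ w ∷ʳ t
    go k w l t hw us ut d with initLast w
    go k .[] l t hw us ut d | [] with s Fin.≟ t
    ... | yes refl = ∼refl
    ... | no s≢t = ⊥-elim (up-dn {s ∷ []} (Coset.word-other s t s≢t {[]} (ρ-up s) (ρ-up t) false {1} (m>1 s t s≢t)) d)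
    go zero .(w' ∷ʳ r) l t hw us ut d | w' ∷ʳ′ r = ⊥-elim (<⇒≱ (≤-reflexive (sym (length-snoc w' r))) (≤-trans l z≤n))
    go (suc k) .(w' ∷ʳ r) l t hw us ut d | w' ∷ʳ′ r = main
      where
      w₀ = w' ∷ʳ r
      r≢t : r ≢ t
      r≢t refl = up-dn {w₀} ut (snoc-Dn {w'} hw)
      open Coset r t r≢t
      sw-Red : Reduced (s ∷ w₀)
      sw-Red = Red-upL hw us
      main : s ∷ w₀ ∼ w₀ ∷ʳ t
      main with decomp w₀ hw
      ... | a , x , zero , jm , e , la , p , q , ra = ⊥-elim (up-dn {w₀} (Up-resp (∼trans (≡⇒∼ (sym (LP.++-identityʳ a))) e) p) (snoc-Dn {w'} hw))
      ... | a , true , suc j , jm , e , la , p , q , ra = ⊥-elim (up-dn {w₀} ut (Dn-resp e (word-last p q true jm)))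
      ... | a , false , suc j , jm , e , la , p , q , ra = result
        where
        j<m : suc j < m r t
        j<m = ≤∧≢⇒< jm λ eq → up-dn {w₀} ut (Dn-resp e (subst (λ z → Dn (word a false z) t) (sym eq) (word-top p q false)))
        sa-Red : Reduced (s ∷ a)
        sa-Red = Red-prefix (s ∷ a) (map ι (altB false (suc j)))
          (Red-resp (∼-++ˡ (s ∷ []) (∼sym e)) (cong suc (sym (trans (word-len a false (suc j)) la))) sw-Red)
        ka : length a ≤ k
        ka = ≤-trans (m≤m+n (length a) j) (≤-pred (≤-trans (≤-reflexive (trans (sym (+-suc (length a) j)) la)) l))
        -- if sa ∼ ax with x ∈ I then sw lies in the coset aW_I as well
        shift : ∀ b → s ∷ a ∼ a ∷ʳ ι b → s ∷ w₀ ∼ w₀ ∷ʳ t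
        shift b ee with nf2 (b ∷ altB false (suc j))
        ... | y , i , im , il , e' = fin y i ei e'' im
          where
          e'' : s ∷ w₀ ∼ word a y i
          e'' = ∼trans (∼-++ˡ (s ∷ []) (∼sym e)) (∼trans (∼-++ʳ (map ι (altB false (suc j))) ee)
                  (∼trans (≡⇒∼ (LP.++-assoc a (ι b ∷ []) _)) (∼-++ˡ a e')))
          ei : i ≡ suc (suc j)
          ei = ≤-antisym (≤-trans il (≤-reflexive (cong suc (lenB false (suc j)))))
            (+-cancelˡ-≤ (length a) _ _ (≤-trans (≤-reflexive (trans (+-suc _ _) (cong suc la)))
              (≤-trans (sw-Red _ (∼sym e'')) (≤-reflexive (word-len a y i)))))
          viaT : s ∷ w₀ ∼ word a true (suc (suc j)) → s ∷ w₀ ∼ w₀ ∷ʳ t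
          viaT f = ∼trans f (∼trans (≡⇒∼ (word-snoc a true (suc j))) (∼-++ʳ (t ∷ []) e))
          fin : ∀ y i → i ≡ suc (suc j) → s ∷ w₀ ∼ word a y i → i ≤ m r t → s ∷ w₀ ∼ w₀ ∷ʳ t
          fin true .(suc (suc j)) refl f _ = viaT f
          fin false .(suc (suc j)) refl f im with m≤n⇒m<n∨m≡n im
          ... | inj₁ lt = ⊥-elim (up-dn {s ∷ w₀} (Up-resp (∼sym f) (word-other p q false lt)) d)
          ... | inj₂ eq = viaT (∼trans f (subst (λ z → word a false z ∼ word a true z) (sym eq) (∼-++ˡ a (braidB false))))
        result : s ∷ w₀ ∼ w₀ ∷ʳ t
        result with up? (s ∷ a) r | up? (s ∷ a) t
        ... | inj₁ ur | inj₁ ut' = ⊥-elim (up-dn {s ∷ w₀} (Up-resp (∼-++ˡ (s ∷ []) e) (word-other ur ut' false j<m)) d)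
        ... | inj₂ dr | _ = shift false (go k a ka r ra (Red-cons⇒UpL sa-Red) p dr)
        ... | inj₁ _ | inj₂ dt = shift true (go k a ka t ra (Red-cons⇒UpL sa-Red) q dt)
  abstract
    exchange : ∀ w s t → Reduced w → UpL w s → Up w t → Dn (s ∷ w) t → s ∷ w ∼ w ∷ʳ t
    exchange = exchange-def

  -- The free algebra and its Hecke quotient, seen through linear functionals.

  Fun : Set
  Fun = Word → ℤ → ℤ

  -- A functional is given by its values on the monomials vᵉu. Two lists have the same coefficients
  -- exactly when every `ev φ` agrees on them, so an identity between elements becomes an identity
  -- between integers.
  ev : Fun → FA → ℤ
  ev φ [] = i0
  ev φ ((c , u) ∷ x) = evL (φ u) c ℤ.+ ev φ x

  ev-cong : ∀ {φ ψ} x → (∀ u e → φ u e ≡ ψ u e) → ev φ x ≡ ev ψ x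
  ev-cong [] q = refl
  ev-cong ((c , u) ∷ x) q = cong₂ ℤ._+_ (evL-cong c (q u)) (ev-cong x q)

  ev-+ : ∀ φ ψ x → ev (λ u e → φ u e ℤ.+ ψ u e) x ≡ ev φ x ℤ.+ ev ψ x
  ev-+ φ ψ [] = refl
  ev-+ φ ψ ((c , u) ∷ x) = trans (cong₂ ℤ._+_ (evL-+ (φ u) (ψ u) c) (ev-+ φ ψ x)) (rearr (evL (φ u) c) _ _ _)

  ev-* : ∀ a φ x → ev (λ u e → a ℤ.* φ u e) x ≡ a ℤ.* ev φ x
  ev-* a φ [] = sym (ℤP.*-zeroʳ a)
  ev-* a φ ((c , u) ∷ x) = trans (cong₂ ℤ._+_ (evL-* a (φ u) c) (ev-* a φ x)) (sym (ℤP.*-distribˡ-+ a _ _))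

  ev-0 : ∀ x → ev (λ _ _ → i0) x ≡ i0
  ev-0 [] = refl
  ev-0 ((c , u) ∷ x) = trans (cong₂ ℤ._+_ (evL-0 c) (ev-0 x)) refl

  ev-++ : ∀ φ x y → ev φ (x ++ y) ≡ ev φ x ℤ.+ ev φ y
  ev-++ φ [] y = sym (ℤP.+-identityˡ _)
  ev-++ φ ((c , u) ∷ x) y = trans (cong (ℤ._+_ (evL (φ u) c)) (ev-++ φ x y)) (sym (ℤP.+-assoc (evL (φ u) c) _ _))

  ev-neg : ∀ φ x → ev φ (negFA x) ≡ ℤ.- ev φ x
  ev-neg φ [] = refl
  ev-neg φ ((c , u) ∷ x) = trans (cong₂ ℤ._+_ (evL-neg (φ u) c) (ev-neg φ x)) (sym (ℤP.neg-distrib-+ (evL (φ u) c) _))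

  shift : ℤ → Fun → Fun
  shift e φ u f = φ u (e ℤ.+ f)

  ev-evL : ∀ (Φ : ℤ → Fun) c x → ev (λ u f → evL (λ e → Φ e u f) c) x ≡ evL (λ e → ev (Φ e) x) c
  ev-evL Φ [] x = ev-0 x
  ev-evL Φ ((a , e) ∷ c) x = trans (ev-+ _ _ x) (cong₂ ℤ._+_ (ev-* a (Φ e) x) (ev-evL Φ c x))

  evL-comm : ∀ (g : ℤ → ℤ → ℤ) c d → evL (λ e → evL (g e) d) c ≡ evL (λ f → evL (λ e → g e f) c) d
  evL-comm g [] d = sym (evL-0 d)
  evL-comm g ((a , e) ∷ c) d = trans (cong₂ ℤ._+_ (sym (evL-* a (g e) d)) (evL-comm g c d)) (sym (evL-+ (λ f → a ℤ.* g e f) _ d))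

  ev-scale : ∀ φ c x → ev φ (scaleFA c x) ≡ evL (λ e → ev (shift e φ) x) c
  ev-scale φ c [] = sym (evL-0 c)
  ev-scale φ c ((d , u) ∷ x) = trans (cong₂ ℤ._+_ (evL-mulL (φ u) c d) (ev-scale φ c x)) (sym (evL-+ _ _ c))

  mulFA-∷ : ∀ c u x y → mulFA ((c , u) ∷ x) y ≡ mulFA ((c , u) ∷ []) y ++ mulFA x y
  mulFA-∷ c u x y = cong (_++ mulFA x y) (sym (LP.++-identityʳ _))

  ev-mul : ∀ φ x y → ev φ (mulFA x y) ≡ ev (λ u e → ev (λ w f → φ (u ++ w) (e ℤ.+ f)) y) x
  ev-mul φ [] y = refl
  ev-mul φ ((c , u) ∷ x) y = trans (cong (ev φ) (mulFA-∷ c u x y))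
    (trans (ev-++ φ (mulFA ((c , u) ∷ []) y) (mulFA x y)) (cong₂ ℤ._+_ (one y) (ev-mul φ x y)))
    where
    one : ∀ y → ev φ (mulFA ((c , u) ∷ []) y) ≡ evL (λ e → ev (λ w f → φ (u ++ w) (e ℤ.+ f)) y) c
    one [] = sym (evL-0 c)
    one ((d , w) ∷ y) = trans (cong₂ ℤ._+_ (evL-mulL (φ (u ++ w)) c d) (one y)) (sym (evL-+ _ _ c))

  ev-bar : ∀ φ x → ev φ (barFA x) ≡ ev (λ u e → ev (shift (ℤ.- e) φ) (prodInv u)) x
  ev-bar φ [] = refl
  ev-bar φ ((c , u) ∷ x) = trans (ev-++ φ (scaleFA (barL c) (prodInv u)) (barFA x))
    (cong₂ ℤ._+_ (trans (ev-scale φ (barL c) (prodInv u)) (evL-bar _ c)) (ev-bar φ x))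

  ev-T : ∀ φ u → ev φ (T u) ≡ φ u i0
  ev-T φ u = trans (ℤP.+-identityʳ _) (trans (ℤP.+-identityʳ _) (ℤP.*-identityˡ _))

  private
    Ky : Set
    Ky = Word × ℤ
    _≟K_ : (x y : Ky) → Dec (x ≡ y)
    (u , e) ≟K (w , k) with LP.≡-dec Fin._≟_ u w | e ℤ.≟ k
    ... | yes refl | yes refl = yes refl
    ... | no q | _ = no λ { refl → q refl }
    ... | yes _ | no q = no λ { refl → q refl }
    module KS = Keys _≟K_

    flatL : Laurent → Word → List (ℤ × Ky)
    flatL [] u = []
    flatL ((a , e) ∷ c) u = (a , u , e) ∷ flatL c u
    flat : FA → List (ℤ × Ky)
    flat [] = []
    flat ((c , u) ∷ x) = flatL c u ++ flat x

    sum-++ : ∀ ψ k l → KS.sum ψ (k ++ l) ≡ KS.sum ψ k ℤ.+ KS.sum ψ l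
    sum-++ ψ [] l = sym (ℤP.+-identityˡ _)
    sum-++ ψ ((a , x) ∷ k) l = trans (cong (ℤ._+_ (a ℤ.* ψ x)) (sum-++ ψ k l)) (sym (ℤP.+-assoc (a ℤ.* ψ x) _ _))
    flatL-ev : ∀ (φ : Fun) c u → KS.sum (λ { (u , e) → φ u e }) (flatL c u) ≡ evL (φ u) c
    flatL-ev φ [] u = refl
    flatL-ev φ ((a , e) ∷ c) u = cong (ℤ._+_ (a ℤ.* φ u e)) (flatL-ev φ c u)
    flat-ev : ∀ (φ : Fun) x → KS.sum (λ { (u , e) → φ u e }) (flat x) ≡ ev φ x
    flat-ev φ [] = refl
    flat-ev φ ((c , u) ∷ x) = trans (sum-++ _ (flatL c u) (flat x)) (cong₂ ℤ._+_ (flatL-ev φ c u) (flat-ev φ x))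
    sum-cong : ∀ {ψ χ} l → (∀ k → ψ k ≡ χ k) → KS.sum ψ l ≡ KS.sum χ l
    sum-cong [] h = refl
    sum-cong ((a , k) ∷ l) h = cong₂ (λ x y → a ℤ.* x ℤ.+ y) (h k) (sum-cong l h)

  δW : Word → ℤ → Fun
  δW w k u e with LP.≡-dec Fin._≟_ u w
  ... | yes _ = δℤ k e
  ... | no _ = i0

  coeff-ev : ∀ x w k → coeffFA x w k ≡ ev (δW w k) x
  coeff-ev [] w k = refl
  coeff-ev ((c , u) ∷ x) w k with LP.≡-dec Fin._≟_ u w
  ... | yes _ = cong₂ ℤ._+_ (coeffL-ev c k) (coeff-ev x w k)
  ... | no _ = trans (coeff-ev x w k) (trans (sym (ℤP.+-identityˡ _)) (cong (ℤ._+ ev (δW w k) x) (sym (evL-0 c))))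

  private
    δ-agree : ∀ w k u e → δW w k u e ≡ KS.δ (w , k) (u , e)
    δ-agree w k u e with LP.≡-dec Fin._≟_ u w
    ... | no _ = refl
    ... | yes refl with e ℤ.≟ k
    ...   | yes refl = refl
    ...   | no _ = refl

  ev-zero : ∀ x → (∀ w k → coeffFA x w k ≡ i0) → ∀ φ → ev φ x ≡ i0
  ev-zero x h φ = trans (sym (flat-ev φ x)) (KS.sum-zero (flat x)
    (λ { (w , k) → trans (sum-cong (flat x) λ { (u , e) → sym (δ-agree w k u e) }) (trans (flat-ev (δW w k) x) (trans (sym (coeff-ev x w k)) (h w k))) }) _)

  m-m : ∀ {a b : ℤ} → a ≡ b → a ℤ.+ ℤ.- b ≡ i0
  m-m {a} refl = ℤP.+-inverseʳ a
  m≡ : ∀ {a b : ℤ} → a ℤ.+ ℤ.- b ≡ i0 → a ≡ b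
  m≡ {a} {b} e = trans (sym (l a b)) (trans (cong (ℤ._+ b) e) (ℤP.+-identityˡ b))
    where l : ∀ a b → a ℤ.+ ℤ.- b ℤ.+ b ≡ a
          l = solve-∀

  ev-coeff : ∀ x y → (∀ w k → coeffFA x w k ≡ coeffFA y w k) → ∀ φ → ev φ x ≡ ev φ y
  ev-coeff x y h φ = m≡ (trans (sym (trans (ev-++ φ x (negFA y)) (cong (ℤ._+_ (ev φ x)) (ev-neg φ y))))
     (ev-zero (x ++ negFA y) (λ w k → trans (coeff-ev (x ++ negFA y) w k) (trans (ev-++ _ x (negFA y))
        (trans (cong (ℤ._+_ (ev (δW w k) x)) (ev-neg _ y)) (m-m (trans (sym (coeff-ev x w k)) (trans (h w k) (coeff-ev y w k))))))) φ))

  coeff-of-ev : ∀ x y → (∀ φ → ev φ x ≡ ev φ y) → ∀ w k → coeffFA x w k ≡ coeffFA y w k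
  coeff-of-ev x y h w k = trans (coeff-ev x w k) (trans (h _) (sym (coeff-ev y w k)))

  -- linear functionals on the free algebra that vanish on the Hecke ideal
  record HF (φ : Fun) : Set where
    field
      quadF  : ∀ a b s e → φ (a ++ s ∷ s ∷ b) e ≡ φ (a ++ b) e ℤ.+ (φ (a ++ s ∷ b) (e ℤ.+ i1) ℤ.+ ℤ.- φ (a ++ s ∷ b) (e ℤ.+ -1ᶻ))
      braidF : ∀ a b s t e → φ (a ++ alt s t (m s t) ++ b) e ≡ φ (a ++ alt t s (m s t) ++ b) e
  open HF public

  infix 4 _≃_
  -- Equality in the quotient, tested by the functionals that kill the ideal. It follows directly
  -- from `_≈H_`; the converse `≃⇒≈H` rests on the normal form. Compatibility with an operation
  -- reduces to showing that the transposed operation preserves `HF`.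
  record _≃_ (x y : FA) : Set where
    constructor mk≃
    field at : ∀ φ → HF φ → ev φ x ≡ ev φ y
  open _≃_ public

  HF-shift : ∀ {φ} k → HF φ → HF (shift k φ)
  HF-shift {φ} k h .quadF a b s e = trans (quadF h a b s (k ℤ.+ e)) (cong₂ (λ p q → φ (a ++ b) (k ℤ.+ e) ℤ.+ (φ (a ++ s ∷ b) p ℤ.+ ℤ.- φ (a ++ s ∷ b) q)) (ℤP.+-assoc k e i1) (ℤP.+-assoc k e -1ᶻ))
  HF-shift k h .braidF a b s t e = braidF h a b s t (k ℤ.+ e)

  gen : Word → Rel → Word → FA
  gen a r b = mulFA (mulFA (T a) (relator r)) (T b)

  ev-gen-quad : ∀ φ a s b → ev φ (gen a (quad s) b) ≡
     φ (a ++ s ∷ s ∷ b) i0 ℤ.+ (ℤ.- φ (a ++ b) i0 ℤ.+ (ℤ.- φ (a ++ s ∷ b) i1 ℤ.+ φ (a ++ s ∷ b) -1ᶻ))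
  ev-gen-quad φ a s b rewrite LP.++-assoc a (s ∷ s ∷ []) b | LP.++-assoc a [] b | LP.++-assoc a (s ∷ []) b =
    l (φ (a ++ s ∷ s ∷ b) i0) (φ (a ++ b) i0) (φ (a ++ s ∷ b) i1) (φ (a ++ s ∷ b) -1ᶻ)
    where
    l : ∀ p q r t → (i1 ℤ.* p ℤ.+ i0) ℤ.+ ((-1ᶻ ℤ.* q ℤ.+ i0) ℤ.+ ((-1ᶻ ℤ.* r ℤ.+ (i1 ℤ.* t ℤ.+ i0)) ℤ.+ i0)) ≡ p ℤ.+ (ℤ.- q ℤ.+ (ℤ.- r ℤ.+ t))
    l = solve-∀

  ev-gen-braid : ∀ φ a s t b → ev φ (gen a (braid s t) b) ≡ φ (a ++ alt s t (m s t) ++ b) i0 ℤ.+ ℤ.- φ (a ++ alt t s (m s t) ++ b) i0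
  ev-gen-braid φ a s t b rewrite LP.++-assoc a (alt s t (m s t)) b | LP.++-assoc a (alt t s (m s t)) b =
    l (φ (a ++ alt s t (m s t) ++ b) i0) (φ (a ++ alt t s (m s t) ++ b) i0)
    where
    l : ∀ p q → (i1 ℤ.* p ℤ.+ i0) ℤ.+ ((-1ᶻ ℤ.* q ℤ.+ i0) ℤ.+ i0) ≡ p ℤ.+ ℤ.- q
    l = solve-∀

  ideal-vanish : ∀ φ → HF φ → ∀ L → ev φ (idealSum L) ≡ i0
  ideal-vanish φ h [] = refl
  ideal-vanish φ h ((c , a , r , b) ∷ L) = trans (ev-++ φ (scaleFA c (gen a r b)) (idealSum L))
    (trans (cong₂ ℤ._+_ (trans (ev-scale φ c (gen a r b)) (trans (evL-cong c (λ e → zero-gen r (shift e φ) (HF-shift e h))) (evL-0 c))) (ideal-vanish φ h L)) refl)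
    where
    l : ∀ q r t → (q ℤ.+ (r ℤ.+ ℤ.- t)) ℤ.+ (ℤ.- q ℤ.+ (ℤ.- r ℤ.+ t)) ≡ i0
    l = solve-∀
    zero-gen : ∀ r ψ → HF ψ → ev ψ (gen a r b) ≡ i0
    zero-gen (quad s) ψ h = trans (ev-gen-quad ψ a s b) (trans (cong (ℤ._+ (ℤ.- ψ (a ++ b) i0 ℤ.+ (ℤ.- ψ (a ++ s ∷ b) i1 ℤ.+ ψ (a ++ s ∷ b) -1ᶻ))) (quadF h a b s i0)) (l (ψ (a ++ b) i0) (ψ (a ++ s ∷ b) i1) _))
    zero-gen (braid s t) ψ h = trans (ev-gen-braid ψ a s t b) (m-m (braidF h a b s t i0))

  ≈H⇒≃ : ∀ {x y} → x ≈H y → x ≃ y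
  ≈H⇒≃ {x} {y} (L , h) .at φ hf = m≡ (trans (sym (trans (ev-++ φ x (negFA y)) (cong (ℤ._+_ (ev φ x)) (ev-neg φ y))))
    (trans (ev-coeff (x ++ negFA y) (idealSum L) h φ) (ideal-vanish φ hf L)))

  -- equality modulo the ideal, with an explicit element of the ideal
  infix 4 _≋_
  record _≋_ (x y : FA) : Set where
    constructor _by_
    field
      combination : List (Laurent × Word × Rel × Word)
      equal : ∀ φ → ev φ x ≡ ev φ y ℤ.+ ev φ (idealSum combination)
  infix 3 _by_

  ev-ideal-++ : ∀ φ K L → ev φ (idealSum (K ++ L)) ≡ ev φ (idealSum K) ℤ.+ ev φ (idealSum L)
  ev-ideal-++ φ [] L = sym (ℤP.+-identityˡ _)
  ev-ideal-++ φ ((c , a , r , b) ∷ K) L = trans (ev-++ φ (scaleFA c (gen a r b)) _)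
    (trans (cong (ℤ._+_ (ev φ (scaleFA c (gen a r b)))) (ev-ideal-++ φ K L))
      (trans (sym (ℤP.+-assoc (ev φ (scaleFA c (gen a r b))) _ _)) (cong (ℤ._+ ev φ (idealSum L)) (sym (ev-++ φ (scaleFA c (gen a r b)) (idealSum K))))))

  ≋-refl : ∀ {x y} → (∀ φ → ev φ x ≡ ev φ y) → x ≋ y
  ≋-refl h = [] by λ φ → trans (h φ) (sym (ℤP.+-identityʳ _))

  ≋-trans : ∀ {x y z} → x ≋ y → y ≋ z → x ≋ z
  ≋-trans {z = z} (K by h) (L by k) = L ++ K by λ φ → trans (h φ) (trans (cong (ℤ._+ ev φ (idealSum K)) (k φ))
    (trans (ℤP.+-assoc (ev φ z) _ _) (cong (ℤ._+_ (ev φ z)) (sym (ev-ideal-++ φ L K)))))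

  ≋-++ : ∀ {x y x' y'} → x ≋ y → x' ≋ y' → x ++ x' ≋ y ++ y'
  ≋-++ {x} {y} {x'} {y'} (K by h) (L by k) = K ++ L by λ φ → trans (ev-++ φ x x') (trans (cong₂ ℤ._+_ (h φ) (k φ))
    (trans (rearr (ev φ y) _ _ _) (sym (cong₂ ℤ._+_ (ev-++ φ y y') (ev-ideal-++ φ K L)))))

  ev-single : ∀ φ c u → ev φ ((c , u) ∷ []) ≡ evL (φ u) c
  ev-single φ c u = ℤP.+-identityʳ _

  ev-ideal1 : ∀ φ c a r b → ev φ (idealSum ((c , a , r , b) ∷ [])) ≡ evL (λ e → ev (shift e φ) (gen a r b)) c
  ev-ideal1 φ c a r b = trans (ev-++ φ (scaleFA c (gen a r b)) []) (trans (ℤP.+-identityʳ _) (ev-scale φ c (gen a r b)))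

  ≋-braid : ∀ c a b s t → (c , a ++ alt s t (m s t) ++ b) ∷ [] ≋ (c , a ++ alt t s (m s t) ++ b) ∷ []
  ≋-braid c a b s t = (c , a , braid s t , b) ∷ [] by λ φ → let A = a ++ alt s t (m s t) ++ b ; B = a ++ alt t s (m s t) ++ b in
    trans (ev-single φ c A) (sym (trans (cong₂ ℤ._+_ (ev-single φ c B) (ev-ideal1 φ c a (braid s t) b))
      (trans (sym (evL-+ (φ B) _ c)) (evL-cong c λ e →
        trans (cong (ℤ._+_ (φ B e)) (ev-gen-braid (shift e φ) a s t b)) (trans (cong (λ z → φ B e ℤ.+ (φ A z ℤ.+ ℤ.- φ B z)) (ℤP.+-identityʳ e)) (l (φ A e) (φ B e)))))))
    where l : ∀ a b → b ℤ.+ (a ℤ.+ ℤ.- b) ≡ a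
          l = solve-∀

  v-v⁻¹ : Laurent
  v-v⁻¹ = (i1 , i1) ∷ (-1ᶻ , -1ᶻ) ∷ []

  ≋-quad : ∀ c a b s → (c , a ++ s ∷ s ∷ b) ∷ [] ≋ (c , a ++ b) ∷ (mulL c v-v⁻¹ , a ++ s ∷ b) ∷ []
  ≋-quad c a b s = (c , a , quad s , b) ∷ [] by λ φ → let A = a ++ s ∷ s ∷ b ; B = a ++ b ; D = a ++ s ∷ b in
    trans (ev-single φ c A) (sym (trans (cong₂ ℤ._+_ (cong (ℤ._+_ (evL (φ B) c)) (trans (ev-single φ (mulL c v-v⁻¹) D) (evL-mulL (φ D) c v-v⁻¹))) (ev-ideal1 φ c a (quad s) b))
     (trans (cong (ℤ._+ evL (λ e → ev (shift e φ) (gen a (quad s) b)) c) (sym (evL-+ (φ B) _ c)))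
      (trans (sym (evL-+ _ _ c)) (evL-cong c λ e → trans (cong (ℤ._+_ ((φ B e ℤ.+ evL (λ f → φ D (e ℤ.+ f)) v-v⁻¹))) (ev-gen-quad (shift e φ) a s b))
        (trans (cong (λ z → (φ B e ℤ.+ evL (λ f → φ D (e ℤ.+ f)) v-v⁻¹) ℤ.+ (φ A z ℤ.+ (ℤ.- φ B z ℤ.+ (ℤ.- φ D (e ℤ.+ i1) ℤ.+ φ D (e ℤ.+ -1ᶻ))))) (ℤP.+-identityʳ e))
          (l (φ A e) (φ B e) (φ D (e ℤ.+ i1)) (φ D (e ℤ.+ -1ᶻ)))))))))
    where l : ∀ a b p q → (b ℤ.+ (i1 ℤ.* p ℤ.+ (-1ᶻ ℤ.* q ℤ.+ i0))) ℤ.+ (a ℤ.+ (ℤ.- b ℤ.+ (ℤ.- p ℤ.+ q))) ≡ a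
          l = solve-∀

  ≋-[] : ∀ {x} → x ≋ x
  ≋-[] {x} = ≋-refl {x} {x} λ _ → refl

  ≋⇒≃ : ∀ {x y} → x ≋ y → x ≃ y
  ≋⇒≃ {y = y} (L by h) .at φ hf = trans (h φ) (trans (cong (ℤ._+_ (ev φ y)) (ideal-vanish φ hf L)) (ℤP.+-identityʳ _))

  -- f(e+1) − f(e−1): the action of v − v⁻¹
  ∂ : (ℤ → ℤ) → ℤ → ℤ
  ∂ f e = f (e ℤ.+ i1) ℤ.+ ℤ.- f (e ℤ.+ -1ᶻ)

  ∂-cong : ∀ {f g} → (∀ e → f e ≡ g e) → ∀ e → ∂ f e ≡ ∂ g e
  ∂-cong h e = cong₂ (λ a b → a ℤ.+ ℤ.- b) (h _) (h _)

  -- The regular representation, from both sides, on functions on the group.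

  abstract
    dl dr : Fin n → Word → ℤ
    dl s w with upL? w s
    ... | inj₁ _ = i0
    ... | inj₂ _ = i1
    dr t w with up? w t
    ... | inj₁ _ = i0
    ... | inj₂ _ = i1

    dl-up : ∀ {s w} → UpL w s → dl s w ≡ i0
    dl-up {s} {w} p with upL? w s
    ... | inj₁ _ = refl
    ... | inj₂ q = ⊥-elim (up-dn p q)
    dl-dn : ∀ {s w} → DnL w s → dl s w ≡ i1
    dl-dn {s} {w} p with upL? w s
    ... | inj₁ q = ⊥-elim (up-dn q p)
    ... | inj₂ q = refl
    dr-up : ∀ {s w} → Up w s → dr s w ≡ i0
    dr-up {s} {w} p with up? w s
    ... | inj₁ _ = refl
    ... | inj₂ q = ⊥-elim (up-dn p q)
    dr-dn : ∀ {s w} → Dn w s → dr s w ≡ i1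
    dr-dn {s} {w} p with up? w s
    ... | inj₁ q = ⊥-elim (up-dn q p)
    ... | inj₂ q = refl
    dl-resp : ∀ s {u w} → u ∼ w → dl s u ≡ dl s w
    dl-resp s {u} {w} e with upL? u s
    ... | inj₁ p = sym (dl-up (UpL-resp e p))
    ... | inj₂ p = sym (dl-dn (DnL-resp e p))
    dr-resp : ∀ s {u w} → u ∼ w → dr s u ≡ dr s w
    dr-resp s {u} {w} e with up? u s
    ... | inj₁ p = sym (dr-up (Up-resp e p))
    ... | inj₂ p = sym (dr-dn (Dn-resp e p))

    rev-dl : ∀ s u → dl s u ≡ dr s (reverse u)
    rev-dl s u with upL? u s
    ... | inj₁ a = refl
    ... | inj₂ a = refl
    up-dr : ∀ {t u} → dr t u ≡ i0 → Up u t
    up-dr {t} {u} k with up? u t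
    ... | inj₁ b = b
    dn-dr : ∀ {t u} → dr t u ≡ i1 → Dn u t
    dn-dr {t} {u} k with up? u t
    ... | inj₂ b = b

  infixl 6 _◁_ _▷_ _◁◁_
  -- Transposes of left and right multiplication by a generator: T_s T_w is T_sw, plus (v - v⁻¹) T_w
  -- when s is a left descent of w, and symmetrically on the right.
  _◁_ _▷_ : Fun → Fin n → Fun
  (g ◁ s) w e = g (s ∷ w) e ℤ.+ dl s w ℤ.* ∂ (g w) e
  (g ▷ t) w e = g (w ∷ʳ t) e ℤ.+ dr t w ℤ.* ∂ (g w) e

  _◁◁_ : Fun → Word → Fun
  g ◁◁ [] = g
  g ◁◁ (s ∷ u) = (g ◁ s) ◁◁ u

  infix 4 _≐_
  _≐_ : Fun → Fun → Set
  g ≐ h = ∀ w e → g w e ≡ h w e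

  Inv : Fun → Set
  Inv g = ∀ {u w} → u ∼ w → ∀ e → g u e ≡ g w e

  ◁-Inv : ∀ {g} s → Inv g → Inv (g ◁ s)
  ◁-Inv {g} s h p e = cong₂ ℤ._+_ (h (∼-++ˡ (s ∷ []) p) e) (cong₂ ℤ._*_ (dl-resp s p) (∂-cong (h p) e))
  ▷-Inv : ∀ {g} s → Inv g → Inv (g ▷ s)
  ▷-Inv {g} s h p e = cong₂ ℤ._+_ (h (∼-++ʳ (s ∷ []) p) e) (cong₂ ℤ._*_ (dr-resp s p) (∂-cong (h p) e))

  ◁-cong : ∀ {g h} s → g ≐ h → g ◁ s ≐ h ◁ s
  ◁-cong s q w e = cong₂ ℤ._+_ (q _ e) (cong (ℤ._*_ (dl s w)) (∂-cong (q w) e))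
  ◁◁-cong : ∀ {g h} u → g ≐ h → g ◁◁ u ≐ h ◁◁ u
  ◁◁-cong [] q = q
  ◁◁-cong (s ∷ u) q = ◁◁-cong u (◁-cong s q)
  ◁◁-++ : ∀ g u w → g ◁◁ (u ++ w) ≡ (g ◁◁ u) ◁◁ w
  ◁◁-++ g [] w = refl
  ◁◁-++ g (s ∷ u) w = ◁◁-++ (g ◁ s) u w
  ◁◁-Inv : ∀ {g} u → Inv g → Inv (g ◁◁ u)
  ◁◁-Inv [] h = h
  ◁◁-Inv (s ∷ u) h = ◁◁-Inv u (◁-Inv s h)

  -- g = g₁ + c (v − v⁻¹) g₂ is preserved by the operators
  ◁-lin : ∀ {g g₁ g₂} c s → (∀ w e → g w e ≡ g₁ w e ℤ.+ c ℤ.* ∂ (g₂ w) e) →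
          ∀ w e → (g ◁ s) w e ≡ (g₁ ◁ s) w e ℤ.+ c ℤ.* ∂ ((g₂ ◁ s) w) e
  ◁-lin {g} {g₁} {g₂} c s q w e = trans (cong₂ (λ a b → a ℤ.+ dl s w ℤ.* b) (q (s ∷ w) e) (cong₂ (λ a b → a ℤ.+ ℤ.- b) (q w _) (q w _)))
    (l (g₁ (s ∷ w) e) c (g₂ (s ∷ w) (e ℤ.+ i1)) (g₂ (s ∷ w) (e ℤ.+ -1ᶻ)) (dl s w) (g₁ w (e ℤ.+ i1)) (g₁ w (e ℤ.+ -1ᶻ))
       (g₂ w (e ℤ.+ i1 ℤ.+ i1)) (g₂ w (e ℤ.+ i1 ℤ.+ -1ᶻ)) (g₂ w (e ℤ.+ -1ᶻ ℤ.+ i1)) (g₂ w (e ℤ.+ -1ᶻ ℤ.+ -1ᶻ)))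
    where
    l : ∀ a c p q d x y m n o r →
      (a ℤ.+ c ℤ.* (p ℤ.+ ℤ.- q)) ℤ.+ d ℤ.* ((x ℤ.+ c ℤ.* (m ℤ.+ ℤ.- n)) ℤ.+ ℤ.- (y ℤ.+ c ℤ.* (o ℤ.+ ℤ.- r)))
      ≡ (a ℤ.+ d ℤ.* (x ℤ.+ ℤ.- y)) ℤ.+ c ℤ.* ((p ℤ.+ d ℤ.* (m ℤ.+ ℤ.- n)) ℤ.+ ℤ.- (q ℤ.+ d ℤ.* (o ℤ.+ ℤ.- r)))
    l = solve-∀
  ◁◁-lin : ∀ {g g₁ g₂} c u → (∀ w e → g w e ≡ g₁ w e ℤ.+ c ℤ.* ∂ (g₂ w) e) →
          ∀ w e → (g ◁◁ u) w e ≡ (g₁ ◁◁ u) w e ℤ.+ c ℤ.* ∂ ((g₂ ◁◁ u) w) e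
  ◁◁-lin c [] q = q
  ◁◁-lin {g} {g₁} {g₂} c (s ∷ u) q = ◁◁-lin c u (◁-lin {g} {g₁} {g₂} c s q)

  private
    q₀ : ∀ d d' G W A B x y → d ≡ i0 → d' ≡ i1 → G ≡ W →
      (G ℤ.+ d' ℤ.* (A ℤ.+ ℤ.- B)) ℤ.+ d ℤ.* ((A ℤ.+ d ℤ.* x) ℤ.+ ℤ.- (B ℤ.+ d ℤ.* y)) ≡ W ℤ.+ i1 ℤ.* ((A ℤ.+ d ℤ.* x) ℤ.+ ℤ.- (B ℤ.+ d ℤ.* y))
    q₀ d d' G W A B x y refl refl refl = l G A B x y
      where
      l : ∀ a p q x y → (a ℤ.+ i1 ℤ.* (p ℤ.+ ℤ.- q)) ℤ.+ i0 ℤ.* ((p ℤ.+ i0 ℤ.* x) ℤ.+ ℤ.- (q ℤ.+ i0 ℤ.* y)) ≡ a ℤ.+ i1 ℤ.* ((p ℤ.+ i0 ℤ.* x) ℤ.+ ℤ.- (q ℤ.+ i0 ℤ.* y))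
      l = solve-∀
    q₁ : ∀ d d' G W X Y → d ≡ i1 → d' ≡ i0 → G ≡ W → (G ℤ.+ d' ℤ.* X) ℤ.+ d ℤ.* Y ≡ W ℤ.+ i1 ℤ.* Y
    q₁ d d' G W X Y refl refl refl = l G X Y
      where
      l : ∀ a x y → (a ℤ.+ i0 ℤ.* x) ℤ.+ i1 ℤ.* y ≡ a ℤ.+ i1 ℤ.* y
      l = solve-∀
    q₂ : ∀ A d d' r r' X₁ X₂ Y₁ Y₂ Z₁ Z₂ → d' ≡ i1 ℤ.+ ℤ.- d → r' ≡ i1 ℤ.+ ℤ.- r → d ≡ r → X₁ ≡ Y₁ → X₂ ≡ Y₂ →
      (A ℤ.+ d' ℤ.* (X₁ ℤ.+ ℤ.- X₂)) ℤ.+ r ℤ.* ((Y₁ ℤ.+ d ℤ.* Z₁) ℤ.+ ℤ.- (Y₂ ℤ.+ d ℤ.* Z₂)) ≡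
      (A ℤ.+ r' ℤ.* (Y₁ ℤ.+ ℤ.- Y₂)) ℤ.+ d ℤ.* ((X₁ ℤ.+ r ℤ.* Z₁) ℤ.+ ℤ.- (X₂ ℤ.+ r ℤ.* Z₂))
    q₂ A d d' r r' X₁ X₂ Y₁ Y₂ Z₁ Z₂ refl refl refl refl refl = refl

    q₃ : ∀ A d d' r r' X₁ X₂ Y₁ Y₂ Z₁ Z₂ → d' ≡ d → r' ≡ r →
      (A ℤ.+ d' ℤ.* (X₁ ℤ.+ ℤ.- X₂)) ℤ.+ r ℤ.* ((Y₁ ℤ.+ d ℤ.* Z₁) ℤ.+ ℤ.- (Y₂ ℤ.+ d ℤ.* Z₂)) ≡
      (A ℤ.+ r' ℤ.* (Y₁ ℤ.+ ℤ.- Y₂)) ℤ.+ d ℤ.* ((X₁ ℤ.+ r ℤ.* Z₁) ℤ.+ ℤ.- (X₂ ℤ.+ r ℤ.* Z₂))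
    q₃ A d d' r r' X₁ X₂ Y₁ Y₂ Z₁ Z₂ refl refl = l A X₁ X₂ Y₁ Y₂ Z₁ Z₂ d r
      where
      l : ∀ A x₁ x₂ y₁ y₂ z₁ z₂ d r →
        (A ℤ.+ d ℤ.* (x₁ ℤ.+ ℤ.- x₂)) ℤ.+ r ℤ.* ((y₁ ℤ.+ d ℤ.* z₁) ℤ.+ ℤ.- (y₂ ℤ.+ d ℤ.* z₂)) ≡
        (A ℤ.+ r ℤ.* (y₁ ℤ.+ ℤ.- y₂)) ℤ.+ d ℤ.* ((x₁ ℤ.+ r ℤ.* z₁) ℤ.+ ℤ.- (x₂ ℤ.+ r ℤ.* z₂))
      l = solve-∀

  ◁-quad : ∀ {g} → Inv g → ∀ s w e → (g ◁ s ◁ s) w e ≡ g w e ℤ.+ i1 ℤ.* ∂ ((g ◁ s) w) e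
  ◁-quad {g} h s w e = go (upL? w s)
    where
    go : UpL w s ⊎ DnL w s → (g ◁ s ◁ s) w e ≡ g w e ℤ.+ i1 ℤ.* ∂ ((g ◁ s) w) e
    go (inj₁ p) = q₀ (dl s w) (dl s (s ∷ w)) (g (s ∷ s ∷ w) e) (g w e) (g (s ∷ w) (e ℤ.+ i1)) (g (s ∷ w) (e ℤ.+ -1ᶻ)) (∂ (g w) (e ℤ.+ i1)) (∂ (g w) (e ℤ.+ -1ᶻ))
      (dl-up p) (dl-dn (UpL⇒DnL {w} p)) (h (∼-cons² s w) e)
    go (inj₂ p) = q₁ (dl s w) (dl s (s ∷ w)) (g (s ∷ s ∷ w) e) (g w e) (∂ (g (s ∷ w)) e) (∂ ((g ◁ s) w) e)
      (dl-dn p) (dl-up (DnL⇒UpL {w} p)) (h (∼-cons² s w) e)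

  -- Left and right multiplication commute; the only nontrivial case is sw = wt.
  flip-case : ∀ w s t → dr t (s ∷ w) ≢ dr t w → s ∷ w ∼ w ∷ʳ t
  flip-case w s t ne = case (reduce w)
    where
    case : (∃ λ w' → Reduced w' × w' ∼ w × length w' ≤ length w) → s ∷ w ∼ w ∷ʳ t
    case (w' , h , e , _) = ∼trans (∼-++ˡ (s ∷ []) (∼sym e)) (∼trans (go (upL? w' s) (up? w' t) (up? (s ∷ w') t)) (∼-++ʳ (t ∷ []) e))
      where
      ne' : dr t (s ∷ w') ≢ dr t w'
      ne' q = ne (trans (dr-resp t (∼-++ˡ (s ∷ []) (∼sym e))) (trans q (dr-resp t e)))
      go : UpL w' s ⊎ DnL w' s → Up w' t ⊎ Dn w' t → Up (s ∷ w') t ⊎ Dn (s ∷ w') t → s ∷ w' ∼ w' ∷ʳ t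
      go _ (inj₁ p) (inj₁ q) = ⊥-elim (ne' (trans (dr-up q) (sym (dr-up p))))
      go _ (inj₂ p) (inj₂ q) = ⊥-elim (ne' (trans (dr-dn q) (sym (dr-dn p))))
      go (inj₁ a) (inj₁ p) (inj₂ q) = exchange w' s t h a p q
      go (inj₁ a) (inj₂ p) (inj₁ q) with Red-dn h p
      ... | b , hb , eb , lb = ⊥-elim (up-dn q (Dn-resp (∼-++ˡ (s ∷ []) eb)
               (snoc-Dn {s ∷ b} (Red-resp (∼-++ˡ (s ∷ []) (∼sym eb)) (cong suc (sym lb)) (Red-upL h a)))))
      go (inj₂ a) pt qt with Red-dnL h a
      ... | y , hy , ey , ly = lower pt qt
        where
        yR : Reduced y
        yR = Red-suffix (s ∷ []) y hy
        sy : s ∷ w' ∼ y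
        sy = ∼sym (∼-cons-move ey)
        lower : Up w' t ⊎ Dn w' t → Up (s ∷ w') t ⊎ Dn (s ∷ w') t → s ∷ w' ∼ w' ∷ʳ t
        lower (inj₁ p) (inj₁ q) = ⊥-elim (ne' (trans (dr-up q) (sym (dr-up p))))
        lower (inj₂ p) (inj₂ q) = ⊥-elim (ne' (trans (dr-dn q) (sym (dr-dn p))))
        lower (inj₂ p) (inj₁ q) = ∼trans sy (∼trans (∼sym (∼-snoc² y t)) (∼-++ʳ (t ∷ [])
              (∼trans (∼sym (exchange y s t yR (Red-cons⇒UpL hy) (Up-resp sy q) (Dn-resp (∼sym ey) p))) ey)))
        lower (inj₁ p) (inj₂ q) with Red-dn yR (Dn-resp sy q)
        ... | b , hb , eb , lb = ⊥-elim (up-dn p (Dn-resp (∼trans (∼-++ˡ (s ∷ []) eb) ey)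
               (snoc-Dn {s ∷ b} (Red-resp (∼-++ˡ (s ∷ []) (∼sym eb)) (cong suc (sym lb)) hy))))

  -- If multiplying by one letter leaves the descent status of the other unchanged, the terms match
  -- one by one. If not, then sw = wt, the two statuses are equal and both get reversed, and the
  -- terms match by invariance of g. The braid relation for the left operators is deduced from this
  -- commutation.
  ◁▷-comm : ∀ {g} → Inv g → ∀ s t → (g ◁ s) ▷ t ≐ (g ▷ t) ◁ s
  ◁▷-comm {g} h s t w e with dr t (s ∷ w) ℤ.≟ dr t w | dl s (w ∷ʳ t) ℤ.≟ dl s w
  ... | yes p | yes q = q₃ (g (s ∷ w ∷ʳ t) e) (dl s w) (dl s (w ∷ʳ t)) (dr t w) (dr t (s ∷ w)) (g (w ∷ʳ t) (e ℤ.+ i1)) (g (w ∷ʳ t) (e ℤ.+ -1ᶻ))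
         (g (s ∷ w) (e ℤ.+ i1)) (g (s ∷ w) (e ℤ.+ -1ᶻ)) (∂ (g w) (e ℤ.+ i1)) (∂ (g w) (e ℤ.+ -1ᶻ)) q p
  ... | no p | _ = coincide (flip-case w s t p)
    where
    coincide : s ∷ w ∼ w ∷ʳ t → ((g ◁ s) ▷ t) w e ≡ ((g ▷ t) ◁ s) w e
    coincide q = core dl' dr' same
      where
      core : dl s (w ∷ʳ t) ≡ i1 ℤ.+ ℤ.- dl s w → dr t (s ∷ w) ≡ i1 ℤ.+ ℤ.- dr t w → dl s w ≡ dr t w → ((g ◁ s) ▷ t) w e ≡ ((g ▷ t) ◁ s) w e
      core a b c = q₂ (g (s ∷ w ∷ʳ t) e) (dl s w) (dl s (w ∷ʳ t)) (dr t w) (dr t (s ∷ w)) (g (w ∷ʳ t) (e ℤ.+ i1)) (g (w ∷ʳ t) (e ℤ.+ -1ᶻ))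
         (g (s ∷ w) (e ℤ.+ i1)) (g (s ∷ w) (e ℤ.+ -1ᶻ)) (∂ (g w) (e ℤ.+ i1)) (∂ (g w) (e ℤ.+ -1ᶻ)) a b c (h (∼sym q) _) (h (∼sym q) _)
      comp-l : dl s (s ∷ w) ≡ i1 ℤ.+ ℤ.- dl s w
      comp-l = go (upL? w s)
        where
        go : UpL w s ⊎ DnL w s → dl s (s ∷ w) ≡ i1 ℤ.+ ℤ.- dl s w
        go (inj₁ p) = trans (dl-dn (UpL⇒DnL {w} p)) (sym (cong (λ z → i1 ℤ.+ ℤ.- z) (dl-up p)))
        go (inj₂ p) = trans (dl-up (DnL⇒UpL {w} p)) (sym (cong (λ z → i1 ℤ.+ ℤ.- z) (dl-dn p)))
      comp-r : dr t (w ∷ʳ t) ≡ i1 ℤ.+ ℤ.- dr t w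
      comp-r = go (up? w t)
        where
        go : Up w t ⊎ Dn w t → dr t (w ∷ʳ t) ≡ i1 ℤ.+ ℤ.- dr t w
        go (inj₁ p) = trans (dr-dn (Up⇒Dn {w} p)) (sym (cong (λ z → i1 ℤ.+ ℤ.- z) (dr-up p)))
        go (inj₂ p) = trans (dr-up (Dn⇒Up {w} p)) (sym (cong (λ z → i1 ℤ.+ ℤ.- z) (dr-dn p)))
      dl' : dl s (w ∷ʳ t) ≡ i1 ℤ.+ ℤ.- dl s w
      dl' = trans (sym (dl-resp s q)) comp-l
      same : dl s w ≡ dr t w
      same = lengths (upL? w s) (up? w t)
        where
        -- sw = wt has the same length on both sides
        r = reduce w
        w' = proj₁ r
        hR = proj₁ (proj₂ r)
        eR = proj₁ (proj₂ (proj₂ r))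
        q' : s ∷ w' ∼ w' ∷ʳ t
        q' = ∼trans (∼-++ˡ (s ∷ []) eR) (∼trans q (∼-++ʳ (t ∷ []) (∼sym eR)))
        lengths : _ → _ → dl s w ≡ dr t w
        lengths (inj₁ a) (inj₁ b) = trans (dl-up a) (sym (dr-up b))
        lengths (inj₂ a) (inj₂ b) = trans (dl-dn a) (sym (dr-dn b))
        lengths (inj₁ a) (inj₂ b) with Red-dn hR (Dn-resp (∼sym eR) b)
        ... | c , hc , ec , lc = ⊥-elim (<⇒≱ (s≤s (≤-trans (n≤1+n _) (≤-reflexive (trans (sym (length-snoc c t)) lc))))
               (Red-upL hR (UpL-resp (∼sym eR) a) c (∼trans (∼-snoc-move ec) (∼sym q'))))
        lengths (inj₂ a) (inj₁ b) with Red-dnL hR (DnL-resp (∼sym eR) a)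
        ... | c , hc , ec , lc = ⊥-elim (<⇒≱ (≤-trans (s≤s (≤-trans (n≤1+n _) (≤-reflexive lc))) (≤-reflexive (sym (length-snoc w' t))))
               (Red-up hR (Up-resp (∼sym eR) b) c (∼trans (∼-cons-move ec) q')))
      dr' : dr t (s ∷ w) ≡ i1 ℤ.+ ℤ.- dr t w
      dr' = trans (dr-resp t q) comp-r
  ... | yes p | no q = ⊥-elim (q (sym-flip p))
    where
    sym-flip : dr t (s ∷ w) ≡ dr t w → dl s (w ∷ʳ t) ≡ dl s w
    sym-flip p with dl s (w ∷ʳ t) ℤ.≟ dl s w
    ... | yes z = z
    ... | no z = ⊥-elim (z' (flipL z))
      where
      flipL : dl s (w ∷ʳ t) ≢ dl s w → s ∷ w ∼ w ∷ʳ t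
      flipL z = subst₂ _∼_ (trans (rev-snoc (reverse w) s) (cong (s ∷_) (rev² w))) (trans (rev-cons (reverse w) t) (cong (_∷ʳ t) (rev² w)))
         (∼-rev (∼sym (flip-case (reverse w) t s λ y → z (trans (rev-dl s (w ∷ʳ t)) (trans (cong (dr s) (rev-snoc w t)) (trans y (sym (rev-dl s w))))))))
      z' : s ∷ w ∼ w ∷ʳ t → ⊥
      z' y = go (up? w t)
        where
        go : Up w t ⊎ Dn w t → ⊥
        go (inj₁ a) = up-dn (up-dr (trans p (dr-up a))) (Dn-resp (∼sym y) (Up⇒Dn a))
        go (inj₂ a) = up-dn (Up-resp (∼sym y) (Dn⇒Up a)) (dn-dr (trans p (dr-dn a)))

  -- The value of g at the product of the generators T along u: they act on g one after the other,
  -- and the result is evaluated at the identity.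
  ext : Fun → Fun
  ext g u e = (g ◁◁ u) [] e

  ◁◁▷-comm : ∀ {h} → Inv h → ∀ A t → (h ◁◁ A) ▷ t ≐ (h ▷ t) ◁◁ A
  ◁◁▷-comm i [] t w e = refl
  ◁◁▷-comm {h} i (s ∷ A) t w e = trans (◁◁▷-comm (◁-Inv {h} s i) A t w e) (◁◁-cong A (◁▷-comm i s t) w e)

  ▷-up : ∀ h {t b} → Up b t → ∀ e → (h ▷ t) b e ≡ h (b ∷ʳ t) e
  ▷-up h {t} {b} u e = trans (cong (λ z → h (b ∷ʳ t) e ℤ.+ z ℤ.* ∂ (h b) e) (dr-up u)) (ℤP.+-identityʳ _)
  ◁-up : ∀ h {s b} → UpL b s → ∀ e → (h ◁ s) b e ≡ h (s ∷ b) e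
  ◁-up h {s} {b} u e = trans (cong (λ z → h (s ∷ b) e ℤ.+ z ℤ.* ∂ (h b) e) (dl-up u)) (ℤP.+-identityʳ _)

  ext-red : ∀ u → Reduced u → ∀ g e → ext g u e ≡ g u e
  ext-red [] h g e = refl
  ext-red (s ∷ u) h g e = trans (ext-red u (Red-suffix (s ∷ []) u h) (g ◁ s) e) (◁-up g (Red-cons⇒UpL h) e)

  -- A value at w = bt is a value at b of the function changed by the right operator for t. Right
  -- operators commute with all left ones, so descending along a reduced word of w reaches the
  -- identity.
  agree-at-[] : ∀ A A' → (∀ h → Inv h → ∀ e → (h ◁◁ A) [] e ≡ (h ◁◁ A') [] e) → ∀ h → Inv h → h ◁◁ A ≐ h ◁◁ A'
  agree-at-[] A A' q h i w e = trans (◁◁-Inv A i (∼sym (red-∼ w)) e) (trans (go (length (red w)) (red w) ≤-refl (red-Red w) h i) (◁◁-Inv A' i (red-∼ w) e))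
    where
    go : ∀ k w → length w ≤ k → Reduced w → ∀ h → Inv h → (h ◁◁ A) w e ≡ (h ◁◁ A') w e
    go k w le hw h i with initLast w
    ... | [] = q h i e
    go zero .(b ∷ʳ t) le hw h i | b ∷ʳ′ t = ⊥-elim (<⇒≱ (≤-reflexive (sym (length-snoc b t))) (≤-trans le z≤n))
    go (suc k) .(b ∷ʳ t) le hw h i | b ∷ʳ′ t =
      trans (sym (▷-up (h ◁◁ A) (Red-snoc⇒Up {b} hw) e)) (trans (◁◁▷-comm i A t b e)
        (trans (go k b (≤-pred (subst (_≤ suc k) (length-snoc b t) le)) (Red-prefix b _ hw) (h ▷ t) (▷-Inv {h} t i))
          (trans (sym (◁◁▷-comm i A' t b e)) (▷-up (h ◁◁ A') (Red-snoc⇒Up {b} hw) e))))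

  len-alt : ∀ s t k → length (alt s t k) ≡ k
  len-alt s t zero = refl
  len-alt s t (suc k) = cong suc (len-alt t s k)

  ρ-up : ∀ s → Up [] s
  ρ-up s = mk⁺ (1 , 0 , refl , s≤s z≤n)

  alt-∼ : ∀ s t → alt s t (m s t) ∼ alt t s (m s t)
  alt-∼ s t = subst₂ _∼_ (LP.++-identityʳ _) (LP.++-identityʳ _) (∼braid [] [] s t)

  Red-alt : ∀ s t → s ≢ t → ∀ j → j ≤ m s t → Reduced (alt s t j)
  Red-alt s t s≢t j le = pre (m s t) j le top
    where
    open Coset s t s≢t
    wR : ∀ x → Reduced (map ι (altB x (m s t)))
    wR x = word-Red (ρ-up s) (ρ-up t) Red-[] x (m s t) ≤-refl
    par : ∀ {k a b} → Combo k a b → (altF false k ≡ altB false k) ⊎ (altF false k ≡ altB true k)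
    par c2 = inj₂ refl
    par c3 = inj₁ refl
    par c4 = inj₂ refl
    par c4' = inj₂ refl
    par c5 = inj₁ refl
    top : Reduced (alt s t (m s t))
    top with par cmb
    ... | inj₁ q = subst Reduced (sym (trans (alt-s (m s t)) (cong (map ι) q))) (wR false)
    ... | inj₂ q = subst Reduced (sym (trans (alt-s (m s t)) (cong (map ι) q))) (wR true)
    alt-split : ∀ s t j k → ∃ λ b → alt s t (j ℕ.+ k) ≡ alt s t j ++ b
    alt-split s t zero k = _ , refl
    alt-split s t (suc j) k with alt-split t s j k
    ... | b , e = b , cong (s ∷_) e
    pre : ∀ k j → j ≤ k → Reduced (alt s t k) → Reduced (alt s t j)
    pre k j le h with alt-split s t j (k ℕ.∸ j)
    ... | b , e = Red-prefix (alt s t j) b (subst Reduced (trans (cong (alt s t) (sym (m+[n∸m]≡n le))) e) h)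

  -- For the braid relation both alternating words are reduced, so at the identity the operators
  -- merely evaluate g at two congruent words; `agree-at-[]` carries the equality to all elements.
  HF-ext : ∀ {g} → Inv g → HF (ext g)
  HF-ext {g} i .quadF a b s e = trans (cong (λ f → f [] e) (◁◁-++ g a (s ∷ s ∷ b)))
    (trans (◁◁-lin {(g ◁◁ a) ◁ s ◁ s} {g ◁◁ a} {(g ◁◁ a) ◁ s} i1 b (◁-quad (◁◁-Inv a i) s) [] e)
      (cong₂ ℤ._+_ (cong (λ f → f [] e) (sym (◁◁-++ g a b))) (trans (ℤP.*-identityˡ _)
        (cong (λ f → ∂ (f []) e) (sym (◁◁-++ g a (s ∷ b)))))))
  HF-ext {g} i .braidF a b s t e = trans (cong (λ f → f [] e) (split (alt s t (m s t))))
    (trans (◁◁-cong b (swap (s Fin.≟ t)) [] e) (cong (λ f → f [] e) (sym (split (alt t s (m s t))))))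
    where
    split : ∀ c → g ◁◁ (a ++ c ++ b) ≡ ((g ◁◁ a) ◁◁ c) ◁◁ b
    split c = trans (◁◁-++ g a (c ++ b)) (◁◁-++ (g ◁◁ a) c b)
    swap : Dec (s ≡ t) → (g ◁◁ a) ◁◁ alt s t (m s t) ≐ (g ◁◁ a) ◁◁ alt t s (m s t)
    swap (yes refl) w e = refl
    swap (no q) = agree-at-[] (alt s t (m s t)) (alt t s (m s t)) (λ h i e → trans (ext-red (alt s t (m s t)) (Red-alt s t q _ ≤-refl) h e)
      (trans (i (alt-∼ s t) e) (sym (ext-red (alt t s (m s t)) (Red-alt t s (λ z → q (sym z)) (m s t) (≤-reflexive (msym s t))) h e)))) (g ◁◁ a) (◁◁-Inv a i)

  -- Rewriting to normal form; the basis of the T_w.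

  Can : FA → Set
  Can x = All (λ p → nf (proj₂ p) ≡ proj₂ p) x
  Len≤ : ℕ → FA → Set
  Len≤ k x = All (λ p → length (proj₂ p) ≤ k) x

  b⇒≋ : ∀ {u w} → u ≈b w → ∀ c b → (c , u ++ b) ∷ [] ≋ (c , w ++ b) ∷ []
  b⇒≋ brefl c b = ≋-[]
  b⇒≋ (btrans p q) c b = ≋-trans (b⇒≋ p c b) (b⇒≋ q c b)
  b⇒≋ (bbraid a b' s t) c b = subst₂ (λ y z → (c , y) ∷ [] ≋ (c , z) ∷ []) (e (alt s t (m s t))) (e (alt t s (m s t))) (≋-braid c a (b' ++ b) s t)
    where
    e : ∀ y → a ++ y ++ b' ++ b ≡ (a ++ y ++ b') ++ b
    e y = trans (cong (a ++_) (sym (LP.++-assoc y b' b))) (sym (LP.++-assoc a _ b))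

  find : ∀ p b → Reduced p → Reduced (p ++ b) ⊎ ∃ λ p' → ∃ λ s → ∃ λ b' → Reduced p' × Dn p' s × p ++ b ≡ p' ++ s ∷ b'
  find p [] h = inj₁ (subst Reduced (sym (LP.++-identityʳ p)) h)
  find p (s ∷ b) h with up? p s
  ... | inj₂ d = inj₂ (p , s , b , h , d , refl)
  ... | inj₁ u with find (p ∷ʳ s) b (Red-up h u)
  ...   | inj₁ r = inj₁ (subst Reduced (LP.++-assoc p _ b) r)
  ...   | inj₂ (p' , s' , b' , h' , d' , e) = inj₂ (p' , s' , b' , h' , d' , trans (sym (LP.++-assoc p _ b)) e)

  Len-mono : ∀ {j k x} → j ≤ k → Len≤ j x → Len≤ k x
  Len-mono le = All.map (λ q → ≤-trans q le)

  -- A reduced word reaches its normal form by braid moves. Otherwise the first letter s that breaks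
  -- reducedness is a descent of the reduced prefix before it; rewriting that prefix to end in s
  -- creates s s, and the quadratic relation leaves two shorter words.
  norm1 : ∀ k u c → length u ≤ k → ∃ λ x' → Can x' × Len≤ (length u) x' × ((c , u) ∷ []) ≋ x'
  norm1 k u c le with find [] u Red-[]
  norm1 k u c le | inj₁ h = (c , nf u) ∷ [] , nf-idem u ∷ [] , ≤-reflexive (Red-length (nf-Red u) h (nf-∼ u)) ∷ [] ,
    subst₂ (λ y z → (c , y) ∷ [] ≋ (c , z) ∷ []) (LP.++-identityʳ u) (LP.++-identityʳ _) (b⇒≋ (matsumoto h (nf-Red u) (∼sym (nf-∼ u))) c [])
  norm1 zero [] c le | inj₂ ([] , s , b , h , d , ())
  norm1 zero [] c le | inj₂ (x ∷ p , s , b , h , d , ())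
  norm1 (suc k) u c le | inj₂ (p , s , b , h , d , e) with Red-dn h d
  ... | a , ha , ea , la = x₁ ++ x₂ , AllP.++⁺ c₁ c₂ , AllP.++⁺ (Len-mono {x = x₁} lt₁ l₁) (Len-mono {x = x₂} lt₂ l₂) ,
      ≋-trans (subst (λ z → (c , z) ∷ [] ≋ (c , (a ∷ʳ s) ++ s ∷ b) ∷ []) (sym e) (b⇒≋ (matsumoto h ha (∼sym ea)) c (s ∷ b)))
      (≋-trans (subst (λ z → (c , z) ∷ [] ≋ (c , a ++ b) ∷ (mulL c v-v⁻¹ , a ++ s ∷ b) ∷ []) (sym (LP.++-assoc a (s ∷ []) (s ∷ b))) (≋-quad c a b s)) (≋-++ {(c , a ++ b) ∷ []} e₁ e₂))
    where
    lu : length u ≡ suc (suc (length (a ++ b)))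
    lu = trans (cong length e) (trans (LP.length-++ p) (trans (cong (ℕ._+ suc (length b)) (trans (sym la) (length-snoc a s)))
         (cong suc (trans (+-suc (length a) (length b)) (cong suc (sym (LP.length-++ a)))))))
    lu' : length u ≡ suc (length (a ++ s ∷ b))
    lu' = trans lu (cong suc (trans (cong suc (LP.length-++ a)) (trans (sym (+-suc (length a) (length b))) (sym (LP.length-++ a)))))
    lt₁ : length (a ++ b) ≤ length u
    lt₁ = ≤-trans (≤-trans (n≤1+n _) (n≤1+n _)) (≤-reflexive (sym lu))
    lt₂ : length (a ++ s ∷ b) ≤ length u
    lt₂ = ≤-trans (n≤1+n _) (≤-reflexive (sym lu'))
    r₁ = norm1 k (a ++ b) c (≤-trans (n≤1+n _) (≤-pred (≤-trans (≤-reflexive (sym lu)) le)))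
    r₂ = norm1 k (a ++ s ∷ b) (mulL c v-v⁻¹) (≤-pred (≤-trans (≤-reflexive (sym lu')) le))
    x₁ = proj₁ r₁
    c₁ = proj₁ (proj₂ r₁)
    l₁ = proj₁ (proj₂ (proj₂ r₁))
    e₁ = proj₂ (proj₂ (proj₂ r₁))
    x₂ = proj₁ r₂
    c₂ = proj₁ (proj₂ r₂)
    l₂ = proj₁ (proj₂ (proj₂ r₂))
    e₂ = proj₂ (proj₂ (proj₂ r₂))

  norm : ∀ x → ∃ λ x' → Can x' × (∀ k → Len≤ k x → Len≤ k x') × x ≋ x'
  norm [] = [] , [] , (λ k _ → []) , ≋-[]
  norm ((c , u) ∷ x) with norm1 (length u) u c ≤-refl | norm x
  ... | y , cy , ly , ey | z , cz , lz , ez = y ++ z , AllP.++⁺ cy cz , (λ { k (p ∷ q) → AllP.++⁺ (Len-mono p ly) (lz k q) }) , ≋-++ {(c , u) ∷ []} ey ez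

  ev-cong-All : ∀ {φ ψ : Fun} x → All (λ p → ∀ e → φ (proj₂ p) e ≡ ψ (proj₂ p) e) x → ev φ x ≡ ev ψ x
  ev-cong-All [] [] = refl
  ev-cong-All ((c , u) ∷ x) (p ∷ q) = cong₂ ℤ._+_ (evL-cong c p) (ev-cong-All x q)

  ev-mono : ∀ φ u e → ev φ ((((i1 , e) ∷ []) , u) ∷ []) ≡ φ u e
  ev-mono φ u e = trans (ℤP.+-identityʳ _) (trans (ℤP.+-identityʳ _) (ℤP.*-identityˡ _))

  -- A functional on the Hecke algebra is determined by its values on reduced words.
  HF-det : ∀ {φ ψ} → HF φ → HF ψ → (∀ u → Reduced u → ∀ e → φ u e ≡ ψ u e) → φ ≐ ψ
  HF-det {φ} {ψ} hφ hψ q u e with norm1 (length u) u ((i1 , e) ∷ []) ≤-refl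
  ... | x , cx , _ , ex = trans (sym (ev-mono φ u e)) (trans (at (≋⇒≃ ex) φ hφ) (trans (ev-cong-All x (All.map (λ {p} c e → q (proj₂ p) (subst Reduced c (nf-Red (proj₂ p))) e) cx))
      (trans (sym (at (≋⇒≃ ex) ψ hψ)) (ev-mono ψ u e))))

  δC : Word → ℤ → Fun
  δC w k u e = δW (nf w) k (nf u) e

  δC-Inv : ∀ w k → Inv (δC w k)
  δC-Inv w k p e = cong (λ z → δW (nf w) k z e) (nf-resp p)

  nf-eq : ∀ {u w} → nf u ≡ nf w → u ∼ w
  nf-eq {u} {w} e = ∼trans (∼sym (nf-∼ u)) (∼trans (≡⇒∼ e) (nf-∼ w))

  δC-yes : ∀ {w k u e} → u ∼ w → δC w k u e ≡ δℤ k e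
  δC-yes {w} {k} {u} {e} p with LP.≡-dec Fin._≟_ (nf u) (nf w)
  ... | yes _ = refl
  ... | no q = ⊥-elim (q (nf-resp p))
  δC-no : ∀ {w k u e} → ¬ (u ∼ w) → δC w k u e ≡ i0
  δC-no {w} {k} {u} {e} p with LP.≡-dec Fin._≟_ (nf u) (nf w)
  ... | yes q = ⊥-elim (p (nf-eq q))
  ... | no _ = refl

  -- the coefficient of vᵏ T_w
  τ : Word → ℤ → Fun
  τ w k = ext (δC w k)

  HF-τ : ∀ w k → HF (τ w k)
  HF-τ w k = HF-ext (δC-Inv w k)

  τ-red : ∀ w k u → Reduced u → ∀ e → τ w k u e ≡ δC w k u e
  τ-red w k u h e = ext-red u h (δC w k) e

  co : Word → ℤ → FA → ℤ
  co w k = ev (τ w k)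

  -- On an element in normal form the functionals τ return the coefficients of the list, so they
  -- suffice to detect 0. With `τ-red` this says that the T_w form a basis.
  faithful : ∀ x → (∀ w k → co w k x ≡ i0) → ∀ φ → HF φ → ev φ x ≡ i0
  faithful x h φ hφ = trans (at (≋⇒≃ ex) φ hφ) (ev-zero x' van φ)
    where
    nx = norm x
    x' = proj₁ nx
    cx = proj₁ (proj₂ nx)
    ex : x ≋ x'
    ex = proj₂ (proj₂ (proj₂ nx))
    van : ∀ w k → coeffFA x' w k ≡ i0
    van w k with LP.≡-dec Fin._≟_ (nf w) w
    ... | yes q = trans (coeff-ev x' w k) (trans (ev-cong-All x' (All.map (λ {p} c e → trans (cong₂ (λ a b → δW a k b e) (sym q) (sym c)) (sym (τ-red w k (proj₂ p) (subst Reduced c (nf-Red (proj₂ p))) e))) cx))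
                  (trans (sym (at (≋⇒≃ ex) _ (HF-τ w k))) (h w k)))
    ... | no q = trans (coeff-ev x' w k) (trans (ev-cong-All {ψ = λ _ _ → i0} x' (All.map (λ {p} c e → dif (proj₂ p) c e) cx)) (ev-0 x'))
      where
      dif : ∀ u → nf u ≡ u → ∀ e → δW w k u e ≡ i0
      dif u c e with LP.≡-dec Fin._≟_ u w
      ... | yes refl = ⊥-elim (q c)
      ... | no _ = refl

  ev-minus : ∀ φ x y → ev φ (x ++ negFA y) ≡ ev φ x ℤ.+ ℤ.- ev φ y
  ev-minus φ x y = trans (ev-++ φ x (negFA y)) (cong (ℤ._+_ (ev φ x)) (ev-neg φ y))

  co-≃ : ∀ {x y} → (∀ w k → co w k x ≡ co w k y) → x ≃ y
  co-≃ {x} {y} h .at φ hφ = m≡ (trans (sym (ev-minus φ x y)) (faithful (x ++ negFA y) (λ w k → trans (ev-minus (τ w k) x y) (m-m (h w k))) φ hφ))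

  -- The difference is rewritten to normal form while the elements of the ideal used on the way are
  -- recorded. The normal form has all coefficients 0, so the recorded combination equals the
  -- difference.
  ≃⇒≈H : ∀ {x y} → x ≃ y → x ≈H y
  ≃⇒≈H {x} {y} h with norm (x ++ negFA y)
  ... | z , cz , _ , (L by ez) = L , coeff-of-ev (x ++ negFA y) (idealSum L) λ φ → trans (ez φ) (trans (cong (λ a → a ℤ.+ ev φ (idealSum L)) (ev-zero z van φ)) (ℤP.+-identityˡ _))
    where
    van : ∀ w k → coeffFA z w k ≡ i0
    van w k with LP.≡-dec Fin._≟_ (nf w) w
    ... | yes q = trans (coeff-ev z w k) (trans (ev-cong-All z (All.map (λ {p} c e → trans (cong₂ (λ a b → δW a k b e) (sym q) (sym c)) (sym (τ-red w k (proj₂ p) (subst Reduced c (nf-Red (proj₂ p))) e))) cz))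
                  (trans (sym (at (≋⇒≃ {x ++ negFA y} {z} (L by ez)) _ (HF-τ w k))) (trans (ev-minus (τ w k) x y) (m-m (at h _ (HF-τ w k))))))
    ... | no q = trans (coeff-ev z w k) (trans (ev-cong-All {ψ = λ _ _ → i0} z (All.map (λ {p} c e → dif (proj₂ p) c e) cz)) (ev-0 z))
      where
      dif : ∀ u → nf u ≡ u → ∀ e → δW w k u e ≡ i0
      dif u c e with LP.≡-dec Fin._≟_ u w
      ... | yes refl = ⊥-elim (q c)
      ... | no _ = refl

  HF-cong : ∀ {φ ψ} → φ ≐ ψ → HF φ → HF ψ
  HF-cong q h .quadF a b s e = trans (sym (q _ e)) (trans (quadF h a b s e) (cong₂ (λ x y → x ℤ.+ y) (q _ e) (∂-cong (q _) e)))
  HF-cong q h .braidF a b s t e = trans (sym (q _ e)) (trans (braidF h a b s t e) (q _ e))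

  HF-0 : HF (λ _ _ → i0)
  HF-0 .quadF a b s e = refl
  HF-0 .braidF a b s t e = refl

  HF-+ : ∀ {φ ψ} → HF φ → HF ψ → HF (λ u e → φ u e ℤ.+ ψ u e)
  HF-+ {φ} {ψ} h k .quadF a b s e = trans (cong₂ ℤ._+_ (quadF h a b s e) (quadF k a b s e)) (l (φ (a ++ b) e) (φ (a ++ s ∷ b) (e ℤ.+ i1)) (φ (a ++ s ∷ b) (e ℤ.+ -1ᶻ)) (ψ (a ++ b) e) (ψ (a ++ s ∷ b) (e ℤ.+ i1)) (ψ (a ++ s ∷ b) (e ℤ.+ -1ᶻ)))
    where l : ∀ a b c x y z → (a ℤ.+ (b ℤ.+ ℤ.- c)) ℤ.+ (x ℤ.+ (y ℤ.+ ℤ.- z)) ≡ (a ℤ.+ x) ℤ.+ ((b ℤ.+ y) ℤ.+ ℤ.- (c ℤ.+ z))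
          l = solve-∀
  HF-+ h k .braidF a b s t e = cong₂ ℤ._+_ (braidF h a b s t e) (braidF k a b s t e)

  HF-* : ∀ {φ} c → HF φ → HF (λ u e → c ℤ.* φ u e)
  HF-* {φ} c h .quadF a b s e = trans (cong (ℤ._*_ c) (quadF h a b s e)) (l c (φ (a ++ b) e) _ _)
    where l : ∀ k a b c → k ℤ.* (a ℤ.+ (b ℤ.+ ℤ.- c)) ≡ k ℤ.* a ℤ.+ (k ℤ.* b ℤ.+ ℤ.- (k ℤ.* c))
          l = solve-∀
  HF-* c h .braidF a b s t e = cong (ℤ._*_ c) (braidF h a b s t e)

  HF-pre : ∀ {φ} c → HF φ → HF (λ u e → φ (c ++ u) e)
  HF-pre {φ} c h .quadF a b s e = trans (cong (λ z → φ z e) (sym (LP.++-assoc c a _))) (trans (quadF h (c ++ a) b s e)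
     (cong₂ (λ x y → φ x e ℤ.+ (φ y (e ℤ.+ i1) ℤ.+ ℤ.- φ y (e ℤ.+ -1ᶻ))) (LP.++-assoc c a b) (LP.++-assoc c a _)))
  HF-pre {φ} c h .braidF a b s t e = trans (cong (λ z → φ z e) (sym (LP.++-assoc c a _))) (trans (braidF h (c ++ a) b s t e) (cong (λ z → φ z e) (LP.++-assoc c a _)))

  HF-post : ∀ {φ} c → HF φ → HF (λ u e → φ (u ++ c) e)
  HF-post {φ} c h .quadF a b s e = trans (cong (λ z → φ z e) (LP.++-assoc a _ c)) (trans (quadF h a (b ++ c) s e)
     (cong₂ (λ x y → φ x e ℤ.+ (φ y (e ℤ.+ i1) ℤ.+ ℤ.- φ y (e ℤ.+ -1ᶻ))) (sym (LP.++-assoc a b c)) (sym (LP.++-assoc a _ c))))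
  HF-post {φ} c h .braidF a b s t e = trans (cong (λ z → φ z e) (ass (alt s t (m s t)))) (trans (braidF h a (b ++ c) s t e) (cong (λ z → φ z e) (sym (ass (alt t s (m s t))))))
    where
    ass : ∀ y → (a ++ y ++ b) ++ c ≡ a ++ y ++ b ++ c
    ass y = trans (LP.++-assoc a _ c) (cong (a ++_) (LP.++-assoc y b c))

  HF-evL : ∀ (Φ : ℤ → Fun) c → (∀ f → HF (Φ f)) → HF (λ u e → evL (λ f → Φ f u e) c)
  HF-evL Φ [] h = HF-0
  HF-evL Φ ((a , f) ∷ c) h = HF-+ (HF-* a (h f)) (HF-evL Φ c h)

  HF-ev : ∀ (Φ : Word → ℤ → Fun) y → (∀ w f → HF (Φ w f)) → HF (λ u e → ev (λ w f → Φ w f u e) y)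
  HF-ev Φ [] h = HF-0
  HF-ev Φ ((c , w) ∷ y) h = HF-+ (HF-evL (Φ w) c (h w)) (HF-ev Φ y h)

  HF-shift' : ∀ {φ} f → HF φ → HF (λ u e → φ u (e ℤ.+ f))
  HF-shift' {φ} f h = HF-cong (λ u e → cong (φ u) (ℤP.+-comm f e)) (HF-shift f h)

  ≃-refl : ∀ {x} → x ≃ x
  ≃-refl .at φ h = refl
  ≃-sym : ∀ {x y} → x ≃ y → y ≃ x
  ≃-sym p .at φ h = sym (at p φ h)
  ≃-trans : ∀ {x y z} → x ≃ y → y ≃ z → x ≃ z
  ≃-trans p q .at φ h = trans (at p φ h) (at q φ h)
  ≃-++ : ∀ {x y x' y'} → x ≃ x' → y ≃ y' → x ++ y ≃ x' ++ y'
  ≃-++ {x} {y} {x'} {y'} p q .at φ h = trans (ev-++ φ x y) (trans (cong₂ ℤ._+_ (at p φ h) (at q φ h)) (sym (ev-++ φ x' y')))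

  ≃-mul : ∀ {x x' y y'} → x ≃ x' → y ≃ y' → mulFA x y ≃ mulFA x' y'
  ≃-mul {x} {x'} {y} {y'} p q .at φ h = trans (ev-mul φ x y)
    (trans (at p _ (HF-ev (λ w f u e → φ (u ++ w) (e ℤ.+ f)) y (λ w f → HF-shift' {λ u e → φ (u ++ w) e} f (HF-post w h))))
    (trans (ev-cong x' (λ u e → at q _ (HF-shift e (HF-pre u h)))) (sym (ev-mul φ x' y'))))

  ≃-scale : ∀ c {x y} → x ≃ y → scaleFA c x ≃ scaleFA c y
  ≃-scale c {x} {y} p .at φ h = trans (ev-scale φ c x) (trans (evL-cong c (λ e → at p _ (HF-shift e h))) (sym (ev-scale φ c y)))

  mul-assoc : ∀ x y z → mulFA (mulFA x y) z ≃ mulFA x (mulFA y z)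
  mul-assoc x y z .at φ h = trans (ev-mul φ (mulFA x y) z) (trans (ev-mul _ x y) (trans
     (ev-cong x (λ u e → trans (ev-cong y (λ w f → ev-cong z (λ t g → cong₂ φ (LP.++-assoc u w t) (ℤP.+-assoc e f g)))) (sym (ev-mul (λ w f → φ (u ++ w) (e ℤ.+ f)) y z))))
     (sym (ev-mul φ x (mulFA y z)))))

  Vs : ℤ → FA → FA
  Vs e = scaleFA ((i1 , e) ∷ [])
  sc : ℤ → FA → FA
  sc a = scaleFA ((a , i0) ∷ [])

  ev-V : ∀ φ e x → ev φ (Vs e x) ≡ ev (shift e φ) x
  ev-V φ e x = trans (ev-scale φ ((i1 , e) ∷ []) x) (trans (ℤP.+-identityʳ _) (ℤP.*-identityˡ _))
  ev-sc : ∀ φ a x → ev φ (sc a x) ≡ a ℤ.* ev φ x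
  ev-sc φ a x = trans (ev-scale φ ((a , i0) ∷ []) x) (trans (ℤP.+-identityʳ _) (cong (ℤ._*_ a) (ev-cong x λ u e → cong (φ u) (ℤP.+-identityˡ e))))

  Vs-cong : ∀ e {x y} → x ≃ y → Vs e x ≃ Vs e y
  Vs-cong e = ≃-scale ((i1 , e) ∷ [])

  ≃-neg : ∀ {x y} → x ≃ y → negFA x ≃ negFA y
  ≃-neg {x} {y} p .at φ h = trans (ev-neg φ x) (trans (cong ℤ.-_ (at p φ h)) (sym (ev-neg φ y)))

  -- The elements C_s and the bar involution.

  Cg : Fin n → FA
  Cg s = (((i1 , i0) ∷ []) , s ∷ []) ∷ (((i1 , -1ᶻ) ∷ []) , []) ∷ []

  C· : Fin n → FA → FA
  C· s x = mulFA (Cg s) x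

  cl : Fin n → Fun → Fun
  cl s φ w f = φ (s ∷ w) f ℤ.+ φ w (-1ᶻ ℤ.+ f)

  ev-C : ∀ φ s x → ev φ (C· s x) ≡ ev (cl s φ) x
  ev-C φ s x = trans (ev-mul φ (Cg s) x) (trans (l (ev (λ w f → φ (s ∷ w) (i0 ℤ.+ f)) x) B) (trans (cong (ℤ._+ B) (ev-cong x λ w f → cong (φ (s ∷ w)) (ℤP.+-identityˡ f))) (sym (ev-+ (λ w f → φ (s ∷ w) f) (λ w f → φ w (-1ᶻ ℤ.+ f)) x))))
    where B = ev (λ w f → φ w (-1ᶻ ℤ.+ f)) x
          l : ∀ a b → (i1 ℤ.* a ℤ.+ i0) ℤ.+ ((i1 ℤ.* b ℤ.+ i0) ℤ.+ i0) ≡ a ℤ.+ b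
          l = solve-∀

  HF-cl : ∀ {φ} s → HF φ → HF (cl s φ)
  HF-cl s h = HF-+ (HF-pre (s ∷ []) h) (HF-shift -1ᶻ h)

  C-cong : ∀ s {x y} → x ≃ y → C· s x ≃ C· s y
  C-cong s {x} {y} p .at φ h = trans (ev-C φ s x) (trans (at p _ (HF-cl s h)) (sym (ev-C φ s y)))

  -- Left division by T_s on functionals; it computes the bar involution.
  Dv : Fin n → Fun → Fun
  Dv s φ w f = φ (s ∷ w) f ℤ.+ (ℤ.- φ w (i1 ℤ.+ f) ℤ.+ φ w (-1ᶻ ℤ.+ f))

  Pv : Fun → Word → ℤ
  Pv φ u = ev φ (prodInv u)

  Pv-cong : ∀ {φ ψ} u → φ ≐ ψ → Pv φ u ≡ Pv ψ u
  Pv-cong u q = ev-cong (prodInv u) q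

  Pv-cons : ∀ φ s u → Pv φ (s ∷ u) ≡ Pv (Dv s φ) u
  Pv-cons φ s u = trans (ev-mul φ (invT s) y) (trans (l (ev (λ w f → φ (s ∷ w) (i0 ℤ.+ f)) y) (ev (shift i1 φ) y) (ev (shift -1ᶻ φ) y))
     (trans (cong₂ ℤ._+_ (ev-cong y λ w f → cong (φ (s ∷ w)) (ℤP.+-identityˡ f)) (trans (cong (ℤ._+ ev (shift -1ᶻ φ) y) neg-ev)
        (sym (ev-+ (λ w f → ℤ.- φ w (i1 ℤ.+ f)) (shift -1ᶻ φ) y)))) (sym (ev-+ (λ w f → φ (s ∷ w) f) (λ w f → ℤ.- φ w (i1 ℤ.+ f) ℤ.+ φ w (-1ᶻ ℤ.+ f)) y))))
    where
    y = prodInv u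
    l : ∀ a b c → (i1 ℤ.* a ℤ.+ i0) ℤ.+ ((-1ᶻ ℤ.* b ℤ.+ (i1 ℤ.* c ℤ.+ i0)) ℤ.+ i0) ≡ a ℤ.+ (ℤ.- b ℤ.+ c)
    l = solve-∀
    m1 : ∀ a → -1ᶻ ℤ.* a ≡ ℤ.- a
    m1 = solve-∀
    neg-ev : ℤ.- ev (λ w f → φ w (i1 ℤ.+ f)) y ≡ ev (λ w f → ℤ.- φ w (i1 ℤ.+ f)) y
    neg-ev = trans (sym (m1 (ev (shift i1 φ) y))) (trans (sym (ev-* -1ᶻ (shift i1 φ) y)) (ev-cong y λ w f → m1 (φ w (i1 ℤ.+ f))))

  HF-neg : ∀ {φ} → HF φ → HF (λ u e → ℤ.- φ u e)
  HF-neg {φ} h = HF-cong (λ u e → l (φ u e)) (HF-* -1ᶻ h)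
    where l : ∀ a → -1ᶻ ℤ.* a ≡ ℤ.- a
          l = solve-∀

  HF-Dv : ∀ {φ} s → HF φ → HF (Dv s φ)
  HF-Dv s h = HF-+ (HF-pre (s ∷ []) h) (HF-+ (HF-neg (HF-shift i1 h)) (HF-shift -1ᶻ h))

  Dv-inv : ∀ {φ} → HF φ → ∀ s w f → Dv s φ (s ∷ w) f ≡ φ w f
  Dv-inv {φ} h s w f = trans (cong₂ ℤ._+_ (quadF h [] w s f) (cong₂ (λ a b → ℤ.- φ (s ∷ w) a ℤ.+ φ (s ∷ w) b) (ℤP.+-comm i1 f) (ℤP.+-comm -1ᶻ f)))
    (l (φ w f) (φ (s ∷ w) (f ℤ.+ i1)) (φ (s ∷ w) (f ℤ.+ -1ᶻ)))
    where l : ∀ a b c → (a ℤ.+ (b ℤ.+ ℤ.- c)) ℤ.+ (ℤ.- b ℤ.+ c) ≡ a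
          l = solve-∀

  Dv-cong : ∀ s {φ ψ} → φ ≐ ψ → Dv s φ ≐ Dv s ψ
  Dv-cong s q w f = cong₂ ℤ._+_ (q _ _) (cong₂ (λ a b → ℤ.- a ℤ.+ b) (q _ _) (q _ _))

  -- Each T_s is invertible modulo the ideal, by `Dv-inv`, so a functional in `HF` is determined by
  -- its values on words with a fixed prefix.
  cancel-pre : ∀ d {φ ψ} → HF φ → HF ψ → (∀ w f → φ (d ++ w) f ≡ ψ (d ++ w) f) → φ ≐ ψ
  cancel-pre [] h k q = q
  cancel-pre (s ∷ d) {φ} {ψ} h k q w f = trans (sym (Dv-inv h s w f)) (trans (Dv-cong s inner w f) (Dv-inv k s w f))
    where
    inner' : (λ u e → φ (s ∷ u) e) ≐ (λ u e → ψ (s ∷ u) e)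
    inner' = cancel-pre d (HF-pre (s ∷ []) h) (HF-pre (s ∷ []) k) q
    inner : (λ u e → φ (s ∷ u) e) ≐ (λ u e → ψ (s ∷ u) e)
    inner = inner'

  DDv : Word → Fun → Fun
  DDv [] φ = φ
  DDv (s ∷ c) φ = DDv c (Dv s φ)

  HF-DDv : ∀ c {φ} → HF φ → HF (DDv c φ)
  HF-DDv [] h = h
  HF-DDv (s ∷ c) h = HF-DDv c (HF-Dv s h)

  Pv-++ : ∀ c φ b → Pv φ (c ++ b) ≡ Pv (DDv c φ) b
  Pv-++ [] φ b = refl
  Pv-++ (s ∷ c) φ b = trans (Pv-cons φ s (c ++ b)) (Pv-++ c (Dv s φ) b)

  DDv-inv : ∀ c {φ} → HF φ → ∀ w f → DDv c φ (reverse c ++ w) f ≡ φ w f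
  DDv-inv [] h w f = refl
  DDv-inv (s ∷ c) {φ} h w f = trans (cong (λ z → DDv c (Dv s φ) z f) (trans (cong (_++ w) (rev-cons c s)) (LP.++-assoc (reverse c) _ w)))
    (trans (DDv-inv c (HF-Dv s h) (s ∷ w) f) (Dv-inv h s w f))

  -- `DDv c` divides by the letters of c in turn, and the prefix `reverse c` undoes it. The reverse
  -- of an alternating word is one of the two alternating words of that length, so the braid
  -- relation of the functional itself identifies both divisions behind such a prefix, which is then
  -- cancelled.
  DDv-braid : ∀ s t {φ} → HF φ → DDv (alt s t (m s t)) φ ≐ DDv (alt t s (m s t)) φ
  DDv-braid s t {φ} h = cancel-pre (reverse c) (HF-DDv c h) (HF-DDv c' h) λ w f →
      trans (DDv-inv c h w f) (trans (sym (DDv-inv c' h w f)) (swap (rev-alt (m s t)) w f))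
    where
    c = alt s t (m s t)
    c' = alt t s (m s t)
    swap : _ → ∀ w f → DDv c' φ (reverse c' ++ w) f ≡ DDv c' φ (reverse c ++ w) f
    swap (inj₁ g) w f rewrite proj₁ (g s t) | proj₁ (g t s) = sym (braidF (HF-DDv c' h) [] w s t f)
    swap (inj₂ g) w f rewrite proj₁ (g s t) | proj₁ (g t s) = braidF (HF-DDv c' h) [] w s t f

  DDv-++ : ∀ a b φ → DDv (a ++ b) φ ≡ DDv b (DDv a φ)
  DDv-++ [] b φ = refl
  DDv-++ (s ∷ a) b φ = DDv-++ a b (Dv s φ)

  Pv-quad : ∀ a b s {φ} → HF φ → Pv φ (a ++ s ∷ s ∷ b) ≡ Pv φ (a ++ b) ℤ.+ (Pv (shift -1ᶻ φ) (a ++ s ∷ b) ℤ.+ ℤ.- Pv (shift i1 φ) (a ++ s ∷ b))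
  Pv-quad [] b s {φ} h = trans (Pv-cons φ s (s ∷ b)) (trans (ev-+ (λ w f → φ (s ∷ w) f) (λ w f → ℤ.- φ w (i1 ℤ.+ f) ℤ.+ φ w (-1ᶻ ℤ.+ f)) y)
      (trans (cong₂ ℤ._+_ one (ev-+ (λ w f → ℤ.- φ w (i1 ℤ.+ f)) (shift -1ᶻ φ) y))
      (trans (cong (λ z → Pv φ b ℤ.+ (z ℤ.+ Pv (shift -1ᶻ φ) (s ∷ b))) (ng y)) (cong (ℤ._+_ (Pv φ b)) (ℤP.+-comm (ℤ.- ev (shift i1 φ) y) (Pv (shift -1ᶻ φ) (s ∷ b)))))))
    where
    y = prodInv (s ∷ b)
    one : Pv (λ w f → φ (s ∷ w) f) (s ∷ b) ≡ Pv φ b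
    one = trans (Pv-cons (λ w f → φ (s ∷ w) f) s b) (Pv-cong b λ w f → Dv-inv h s w f)
    m1 : ∀ a → -1ᶻ ℤ.* a ≡ ℤ.- a
    m1 = solve-∀
    ng : ∀ y → ev (λ w f → ℤ.- φ w (i1 ℤ.+ f)) y ≡ ℤ.- ev (shift i1 φ) y
    ng y = trans (ev-cong y λ w f → sym (m1 (φ w (i1 ℤ.+ f)))) (trans (ev-* -1ᶻ (shift i1 φ) y) (m1 (ev (shift i1 φ) y)))
  Pv-quad (r ∷ a) b s {φ} h = trans (Pv-cons φ r (a ++ s ∷ s ∷ b)) (trans (Pv-quad a b s (HF-Dv r h))
     (cong₂ ℤ._+_ (sym (Pv-cons φ r (a ++ b))) (cong₂ (λ x y → x ℤ.+ ℤ.- y)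
        (trans (Pv-cong (a ++ s ∷ b) (comm -1ᶻ)) (sym (Pv-cons (shift -1ᶻ φ) r (a ++ s ∷ b))))
        (trans (Pv-cong (a ++ s ∷ b) (comm i1)) (sym (Pv-cons (shift i1 φ) r (a ++ s ∷ b)))))))
    where
    cm : ∀ a b c → a ℤ.+ (b ℤ.+ c) ≡ b ℤ.+ (a ℤ.+ c)
    cm = solve-∀
    comm : ∀ k → shift k (Dv r φ) ≐ Dv r (shift k φ)
    comm k w f = cong (ℤ._+_ (φ (r ∷ w) (k ℤ.+ f))) (cong₂ (λ x y → ℤ.- φ w x ℤ.+ φ w y) (cm i1 k f) (cm -1ᶻ k f))

  -- The transpose of the bar involution; `HF-bar` then says that the involution is well defined on
  -- the quotient.
  barF : Fun → Fun
  barF φ u e = Pv (shift (ℤ.- e) φ) u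

  HF-bar : ∀ {φ} → HF φ → HF (barF φ)
  HF-bar {φ} h .quadF a b s e = trans (Pv-quad a b s (HF-shift (ℤ.- e) h))
    (cong (ℤ._+_ (Pv (shift (ℤ.- e) φ) (a ++ b))) (cong₂ (λ x y → x ℤ.+ ℤ.- y) (Pv-cong (a ++ s ∷ b) λ w f → cong (φ w) (l₁ e f)) (Pv-cong (a ++ s ∷ b) λ w f → cong (φ w) (l₂ e f))))
    where
    l₁ : ∀ e f → ℤ.- e ℤ.+ (-1ᶻ ℤ.+ f) ≡ ℤ.- (e ℤ.+ i1) ℤ.+ f
    l₁ = solve-∀
    l₂ : ∀ e f → ℤ.- e ℤ.+ (i1 ℤ.+ f) ≡ ℤ.- (e ℤ.+ -1ᶻ) ℤ.+ f
    l₂ = solve-∀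
  HF-bar {φ} h .braidF a b s t e = trans (go (alt s t (m s t))) (trans (Pv-cong b (≐DD b)) (sym (go (alt t s (m s t)))))
    where
    χ = shift (ℤ.- e) φ
    go : ∀ c → Pv χ (a ++ c ++ b) ≡ Pv (DDv c (DDv a χ)) b
    go c = trans (Pv-++ a χ (c ++ b)) (Pv-++ c (DDv a χ) b)
    ≐DD : ∀ b → DDv (alt s t (m s t)) (DDv a χ) ≐ DDv (alt t s (m s t)) (DDv a χ)
    ≐DD _ = DDv-braid s t (HF-DDv a (HF-shift (ℤ.- e) h))

  ev-barF : ∀ φ x → ev φ (barFA x) ≡ ev (barF φ) x
  ev-barF φ x = ev-bar φ x

  bar-cong : ∀ {x y} → x ≃ y → barFA x ≃ barFA y
  bar-cong {x} {y} p .at φ h = trans (ev-barF φ x) (trans (at p _ (HF-bar h)) (sym (ev-barF φ y)))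

  bar-++ : ∀ x y → barFA (x ++ y) ≃ barFA x ++ barFA y
  bar-++ x y .at φ h = trans (ev-barF φ (x ++ y)) (trans (ev-++ _ x y) (trans (sym (cong₂ ℤ._+_ (ev-barF φ x) (ev-barF φ y))) (sym (ev-++ φ (barFA x) (barFA y)))))

  bar-sc : ∀ a x → barFA (sc a x) ≃ sc a (barFA x)
  bar-sc a x .at φ h = trans (ev-barF φ (sc a x)) (trans (ev-sc _ a x) (trans (cong (ℤ._*_ a) (sym (ev-barF φ x))) (sym (ev-sc φ a (barFA x)))))

  bar-C : ∀ s x → barFA (C· s x) ≃ C· s (barFA x)
  bar-C s x .at φ h = trans (ev-barF φ (C· s x)) (trans (ev-C _ s x) (trans (ev-cong x pt) (trans (sym (ev-barF (cl s φ) x)) (sym (ev-C φ s (barFA x))))))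
    where
    pt : cl s (barF φ) ≐ barF (cl s φ)
    pt u e = trans (cong (ℤ._+ barF φ u (-1ᶻ ℤ.+ e)) (Pv-cons χ s u)) (trans (sym (ev-+ _ _ (prodInv u)))
       (Pv-cong u λ w f → trans (cong (λ z → (χ (s ∷ w) f ℤ.+ (ℤ.- χ w (i1 ℤ.+ f) ℤ.+ χ w (-1ᶻ ℤ.+ f))) ℤ.+ φ w z) (k e f))
          (trans (l (χ (s ∷ w) f) (χ w (i1 ℤ.+ f)) (χ w (-1ᶻ ℤ.+ f))) (cong (λ z → χ (s ∷ w) f ℤ.+ φ w z) (j e f)))))
      where
      χ = shift (ℤ.- e) φ
      k : ∀ e f → ℤ.- (-1ᶻ ℤ.+ e) ℤ.+ f ≡ ℤ.- e ℤ.+ (i1 ℤ.+ f)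
      k = solve-∀
      j : ∀ e f → ℤ.- e ℤ.+ (-1ᶻ ℤ.+ f) ≡ -1ᶻ ℤ.+ (ℤ.- e ℤ.+ f)
      j = solve-∀
      l : ∀ a b c → (a ℤ.+ (ℤ.- b ℤ.+ c)) ℤ.+ b ≡ a ℤ.+ c
      l = solve-∀

  δℤ-refl : ∀ k → δℤ k k ≡ i1
  δℤ-refl k with k ℤ.≟ k
  ... | yes _ = refl
  ... | no q = ⊥-elim (q refl)
  δℤ-ne : ∀ {k e} → e ≢ k → δℤ k e ≡ i0
  δℤ-ne {k} {e} q with e ℤ.≟ k
  ... | yes p = ⊥-elim (q p)
  ... | no _ = refl
  δℤ-bij : ∀ {k e k' e'} → (e ≡ k → e' ≡ k') → (e' ≡ k' → e ≡ k) → δℤ k e ≡ δℤ k' e'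
  δℤ-bij {k} {e} f g with e ℤ.≟ k
  ... | yes p = sym (trans (cong (λ z → δℤ _ z) (f p)) (δℤ-refl _))
  ... | no q = sym (δℤ-ne λ p → q (g p))

  δℤ-shift : ∀ k e d → δℤ k (d ℤ.+ e) ≡ δℤ (k ℤ.+ ℤ.- d) e
  δℤ-shift k e d = δℤ-bij (λ p → trans (l₁ d e) (cong (λ z → z ℤ.+ ℤ.- d) p)) (λ p → trans (cong (ℤ._+_ d) p) (l₂ d k))
    where
    l₁ : ∀ d e → e ≡ d ℤ.+ e ℤ.+ ℤ.- d
    l₁ = solve-∀
    l₂ : ∀ d k → d ℤ.+ (k ℤ.+ ℤ.- d) ≡ k
    l₂ = solve-∀

  δC-shift : ∀ w k u e d → δC w k u (d ℤ.+ e) ≡ δC w (k ℤ.+ ℤ.- d) u e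
  δC-shift w k u e d with u ∼? w
  ... | yes p = trans (δC-yes p) (trans (δℤ-shift k e d) (sym (δC-yes p)))
  ... | no q = trans (δC-no q) (sym (δC-no q))

  δC-move : ∀ s w k u e → δC w k (s ∷ u) e ≡ δC (s ∷ w) k u e
  δC-move s w k u e with u ∼? (s ∷ w)
  ... | yes p = trans (δC-yes (∼trans (∼-++ˡ (s ∷ []) p) (∼-cons² s w))) (sym (δC-yes p))
  ... | no q = trans (δC-no λ p → q (∼-cons-move p)) (sym (δC-no q))

  τ-shift : ∀ w k d u e → τ w k u (d ℤ.+ e) ≡ τ w (k ℤ.+ ℤ.- d) u e
  τ-shift w k d = HF-det (HF-shift d (HF-τ w k)) (HF-τ w (k ℤ.+ ℤ.- d)) λ u h e →
     trans (τ-red w k u h (d ℤ.+ e)) (trans (δC-shift w k u e d) (sym (τ-red w (k ℤ.+ ℤ.- d) u h e)))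

  τ-resp : ∀ {w w'} k → w ∼ w' → τ w k ≐ τ w' k
  τ-resp k p u e = cong (λ z → ext (λ u e → δW z k (nf u) e) u e) (nf-resp p)

  co-resp : ∀ {w w'} k x → w ∼ w' → co w k x ≡ co w' k x
  co-resp k x p = ev-cong x (τ-resp k p)

  cl-τ : ∀ s w k → cl s (τ w k) ≐ (λ u e → (τ (s ∷ w) k u e ℤ.+ dl s w ℤ.* (τ w (k ℤ.+ -1ᶻ) u e ℤ.+ ℤ.- τ w (k ℤ.+ i1) u e)) ℤ.+ τ w (k ℤ.+ i1) u e)
  cl-τ s w k = HF-det (HF-cl s (HF-τ w k)) (HF-+ (HF-+ (HF-τ (s ∷ w) k) (HF-* (dl s w) (HF-+ (HF-τ w (k ℤ.+ -1ᶻ)) (HF-neg (HF-τ w (k ℤ.+ i1)))))) (HF-τ w (k ℤ.+ i1)))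
    λ u h e → cong₂ ℤ._+_ (trans (ext-red u h (δC w k ◁ s) e) (cong₂ ℤ._+_ (trans (δC-move s w k u e) (sym (τ-red (s ∷ w) k u h e)))
         (trans (dlδ u e) (sym (cong₂ (λ a b → dl s w ℤ.* (a ℤ.+ ℤ.- b)) (τ-red w _ u h e) (τ-red w _ u h e))))))
       (τ-shift w k -1ᶻ u e)
    where
    dlδ : ∀ u e → dl s u ℤ.* ∂ (δC w k u) e ≡ dl s w ℤ.* (δC w (k ℤ.+ -1ᶻ) u e ℤ.+ ℤ.- δC w (k ℤ.+ i1) u e)
    dlδ u e = trans (cong (ℤ._*_ (dl s u)) (cong₂ (λ a b → a ℤ.+ ℤ.- b) (trans (cong (δC w k u) (ℤP.+-comm e i1)) (δC-shift w k u e i1)) (trans (cong (δC w k u) (ℤP.+-comm e -1ᶻ)) (δC-shift w k u e -1ᶻ)))) (go (u ∼? w))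
      where
      go : Dec (u ∼ w) → dl s u ℤ.* (δC w (k ℤ.+ -1ᶻ) u e ℤ.+ ℤ.- δC w (k ℤ.+ i1) u e) ≡ dl s w ℤ.* (δC w (k ℤ.+ -1ᶻ) u e ℤ.+ ℤ.- δC w (k ℤ.+ i1) u e)
      go (yes p) = cong (λ z → z ℤ.* (δC w (k ℤ.+ -1ᶻ) u e ℤ.+ ℤ.- δC w (k ℤ.+ i1) u e)) (dl-resp s p)
      go (no q) = trans (cong (ℤ._*_ (dl s u)) (cong₂ (λ a b → a ℤ.+ ℤ.- b) (δC-no q) (δC-no q))) (trans (ℤP.*-zeroʳ (dl s u)) (sym
         (trans (cong (ℤ._*_ (dl s w)) (cong₂ (λ a b → a ℤ.+ ℤ.- b) (δC-no q) (δC-no q))) (ℤP.*-zeroʳ (dl s w)))))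

  -- With p_w the coefficient of T_w in x, the coefficient in C_s x is p_sw + v⁻¹p_w if sw > w and
  -- p_sw + v p_w if sw < w; a factor v⁻¹ is read off one exponent higher.
  co-C : ∀ s w k x → co w k (C· s x) ≡ (co (s ∷ w) k x ℤ.+ dl s w ℤ.* (co w (k ℤ.+ -1ᶻ) x ℤ.+ ℤ.- co w (k ℤ.+ i1) x)) ℤ.+ co w (k ℤ.+ i1) x
  co-C s w k x = trans (ev-C (τ w k) s x) (trans (ev-cong x (cl-τ s w k)) (trans (ev-+ (λ u e → τ (s ∷ w) k u e ℤ.+ dl s w ℤ.* δ u e) (τ w (k ℤ.+ i1)) x) (cong (ℤ._+ co w (k ℤ.+ i1) x) (trans (ev-+ (τ (s ∷ w) k) (λ u e → dl s w ℤ.* δ u e) x) (cong (ℤ._+_ (co (s ∷ w) k x))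
     (trans (ev-* (dl s w) δ x) (cong (ℤ._*_ (dl s w)) (trans (ev-+ (τ w (k ℤ.+ -1ᶻ)) (λ u e → ℤ.- τ w (k ℤ.+ i1) u e) x) (cong (ℤ._+_ (co w (k ℤ.+ -1ᶻ) x)) ng)))))))))
    where
    δ : Fun
    δ u e = τ w (k ℤ.+ -1ᶻ) u e ℤ.+ ℤ.- τ w (k ℤ.+ i1) u e
    m1 : ∀ a → -1ᶻ ℤ.* a ≡ ℤ.- a
    m1 = solve-∀
    ng : ev (λ u e → ℤ.- τ w (k ℤ.+ i1) u e) x ≡ ℤ.- co w (k ℤ.+ i1) x
    ng = trans (ev-cong x λ u e → sym (m1 (τ w (k ℤ.+ i1) u e))) (trans (ev-* -1ᶻ (τ w (k ℤ.+ i1)) x) (m1 (co w (k ℤ.+ i1) x)))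

  co-C-up : ∀ {s w} → UpL w s → ∀ k x → co w k (C· s x) ≡ co (s ∷ w) k x ℤ.+ co w (k ℤ.+ i1) x
  co-C-up {s} {w} u k x = trans (co-C s w k x) (l (co (s ∷ w) k x) (dl s w) (co w (k ℤ.+ -1ᶻ) x ℤ.+ ℤ.- co w (k ℤ.+ i1) x) (co w (k ℤ.+ i1) x) (dl-up u))
    where l : ∀ a d b c → d ≡ i0 → (a ℤ.+ d ℤ.* b) ℤ.+ c ≡ a ℤ.+ c
          l a d b c refl = cong (ℤ._+ c) (ℤP.+-identityʳ a)
  co-C-dn : ∀ {s w} → DnL w s → ∀ k x → co w k (C· s x) ≡ co (s ∷ w) k x ℤ.+ co w (k ℤ.+ -1ᶻ) x
  co-C-dn {s} {w} u k x = trans (co-C s w k x) (l (co (s ∷ w) k x) (dl s w) (co w (k ℤ.+ -1ᶻ) x) (co w (k ℤ.+ i1) x) (dl-dn u))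
    where l' : ∀ a b c → (a ℤ.+ i1 ℤ.* (b ℤ.+ ℤ.- c)) ℤ.+ c ≡ a ℤ.+ b
          l' = solve-∀
          l : ∀ a d b c → d ≡ i1 → (a ℤ.+ d ℤ.* (b ℤ.+ ℤ.- c)) ℤ.+ c ≡ a ℤ.+ b
          l a d b c refl = l' a b c

  -- an element of C_s H satisfies p_{w} = v⁻¹ p_{sw} whenever sw > w
  Fac : Fin n → FA → Set
  Fac s x = ∃ λ z → x ≃ C· s z

  k+1-1 : ∀ k → k ℤ.+ i1 ℤ.+ -1ᶻ ≡ k
  k+1-1 = solve-∀

  co-Fac : ∀ {s x w} → Fac s x → UpL w s → ∀ k → co w k x ≡ co (s ∷ w) (k ℤ.+ i1) x
  co-Fac {s} {x} {w} (z , p) u k = trans (at p (τ w k) (HF-τ w k)) (trans (co-C-up {s} {w} u k z) (trans (ℤP.+-comm (co (s ∷ w) k z) (co w (k ℤ.+ i1) z))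
    (trans (cong₂ ℤ._+_ (sym (co-resp (k ℤ.+ i1) z (∼-cons² s w))) (cong (λ j → co (s ∷ w) j z) (sym (k+1-1 k))))
      (trans (sym (co-C-dn {s} {s ∷ w} (UpL⇒DnL {w} u) (k ℤ.+ i1) z)) (sym (at p (τ (s ∷ w) (k ℤ.+ i1)) (HF-τ (s ∷ w) (k ℤ.+ i1))))))))

  Fac-resp : ∀ {s x y} → x ≃ y → Fac s x → Fac s y
  Fac-resp p (z , q) = z , ≃-trans (≃-sym p) q
  Fac-++ : ∀ {s x y} → Fac s x → Fac s y → Fac s (x ++ y)
  Fac-++ {s} {x} {y} (a , p) (b , q) = a ++ b , ≃-trans (≃-++ p q) (mk≃ λ φ h → trans (ev-++ φ (C· s a) (C· s b)) (trans (cong₂ ℤ._+_ (ev-C φ s a) (ev-C φ s b)) (trans (sym (ev-++ _ a b)) (sym (ev-C φ s (a ++ b))))))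
  Fac-neg : ∀ {s x} → Fac s x → Fac s (negFA x)
  Fac-neg {s} (a , p) = negFA a , ≃-trans (≃-neg p) (mk≃ λ φ h → trans (ev-neg φ (C· s a)) (trans (cong ℤ.-_ (ev-C φ s a)) (trans (sym (ev-neg _ a)) (sym (ev-C φ s (negFA a))))))
  Fac-V : ∀ {s x} e → Fac s x → Fac s (Vs e x)
  Fac-V {s} e (a , p) = Vs e a , ≃-trans (Vs-cong e p) (mk≃ λ φ h → trans (ev-V φ e (C· s a)) (trans (ev-C _ s a)
      (trans (ev-cong a λ w f → cong (ℤ._+_ (φ (s ∷ w) (e ℤ.+ f))) (cong (φ w) (l e f))) (trans (sym (ev-V _ e a)) (sym (ev-C φ s (Vs e a)))))))
    where l : ∀ e f → e ℤ.+ (-1ᶻ ℤ.+ f) ≡ -1ᶻ ℤ.+ (e ℤ.+ f)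
          l = solve-∀
  Fac-[] : ∀ {s} → Fac s []
  Fac-[] {s} = [] , mk≃ λ φ h → sym (ev-C φ s [])

  Pv-top : ∀ u φ → (∀ w → length w < length u → ∀ f → φ w f ≡ i0) → Pv φ u ≡ φ u i0
  Pv-top [] φ h = ev-T φ []
  Pv-top (s ∷ u) φ h = trans (Pv-cons φ s u) (trans (Pv-top u (Dv s φ) λ w lt f →
       trans (cong₂ (λ a b → a ℤ.+ b) (h (s ∷ w) (s≤s lt) f) (cong₂ (λ a b → ℤ.- a ℤ.+ b) (h w (m<n⇒m<1+n lt) _) (h w (m<n⇒m<1+n lt) _))) refl)
     (trans (cong (ℤ._+_ (φ (s ∷ u) i0)) (cong₂ (λ a b → ℤ.- a ℤ.+ b) (h u ≤-refl _) (h u ≤-refl _))) (ℤP.+-identityʳ _)))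

  ext-vanish : ∀ k g → (∀ w → length w < k → ∀ e → g w e ≡ i0) → ∀ u → length u < k → ∀ e → ext g u e ≡ i0
  ext-vanish k g h [] lt e = h [] lt e
  ext-vanish (suc k) g h (s ∷ u) (s≤s lt) e = ext-vanish k (g ◁ s) (λ w l e → trans (cong₂ ℤ._+_ (h (s ∷ w) (s≤s l) e)
      (trans (cong (ℤ._*_ (dl s w)) (cong₂ (λ a b → a ℤ.+ ℤ.- b) (h w (m<n⇒m<1+n l) _) (h w (m<n⇒m<1+n l) _))) (ℤP.*-zeroʳ (dl s w)))) refl) u lt e

  τ-vanish : ∀ {y} → Reduced y → ∀ k u → length u < length y → ∀ e → τ y k u e ≡ i0
  τ-vanish {y} hy k u lt e = ext-vanish (length y) (δC y k) (λ w l e → δC-no λ p → <⇒≱ l (hy w p)) u lt e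

  -- Kazhdan-Lusztig elements: uniqueness, existence, expansions.

  Low : ℕ → FA → Set
  Low k x = ∃ λ x' → Can x' × All (λ p → length (proj₂ p) < k) x' × x ≃ x'

  low : ∀ x → ∃ λ k → Low k x
  low x with norm x
  ... | x' , c , _ , e = bound x' , x' , c , ok x' , ≋⇒≃ e
    where
    bound : FA → ℕ
    bound [] = 0
    bound ((c , u) ∷ x) = suc (length u) ℕ.+ bound x
    ok : ∀ x → All (λ p → length (proj₂ p) < bound x) x
    ok [] = []
    ok ((c , u) ∷ x) = m≤m+n _ _ ∷ All.map (λ q → ≤-trans q (m≤n+m _ (suc (length u)))) (ok x)

  can-red : ∀ {u} → nf u ≡ u → Reduced u
  can-red {u} c = subst Reduced c (nf-Red u)

  δC-neg : ∀ w k u e → δC w k u (ℤ.- e) ≡ δC w (ℤ.- k) u e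
  δC-neg w k u e with u ∼? w
  ... | yes p = trans (δC-yes p) (trans (δℤ-bij (λ q → trans (sym (ℤP.neg-involutive e)) (cong ℤ.-_ q)) (λ q → trans (cong ℤ.-_ q) (ℤP.neg-involutive k))) (sym (δC-yes p)))
  ... | no q = trans (δC-no q) (sym (δC-no q))

  -- In maximal length the bar involution only inverts v.
  co-bar-top : ∀ {z} → Reduced z → ∀ x → Can x → All (λ p → length (proj₂ p) ≤ length z) x → ∀ e → co z e (barFA x) ≡ co z (ℤ.- e) x
  co-bar-top {z} hz x c l e = trans (ev-barF (τ z e) x) (ev-cong-All x (All.zipWith (λ {p} (cp , lp) f → pt (proj₂ p) (can-red cp) lp f) (c , l)))
    where
    pt : ∀ u → Reduced u → length u ≤ length z → ∀ f → barF (τ z e) u f ≡ τ z (ℤ.- e) u f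
    pt u hu lu f = trans (Pv-top u (shift (ℤ.- f) (τ z e)) (λ w lt g → τ-vanish hz e w (<-≤-trans lt lu) _))
      (trans (cong (τ z e u) (ℤP.+-identityʳ _)) (trans (τ-red z e u hu _) (trans (δC-neg z e u f) (sym (τ-red z (ℤ.- e) u hu f)))))

  keep : ℕ → FA → FA
  keep k [] = []
  keep k ((c , u) ∷ x) with length u ℕ.≟ k
  ... | yes _ = keep k x
  ... | no _ = (c , u) ∷ keep k x

  keep-Can : ∀ k x → Can x → All (λ p → length (proj₂ p) < suc k) x → Can (keep k x) × All (λ p → length (proj₂ p) < k) (keep k x)
  keep-Can k [] c l = [] , []
  keep-Can k ((_ , u) ∷ x) (c ∷ cs) (l ∷ ls) with length u ℕ.≟ k | keep-Can k x cs ls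
  ... | yes _ | r = r
  ... | no q | (a , b) = c ∷ a , ≤∧≢⇒< (≤-pred l) q ∷ b

  keep-co : ∀ k x z e → Reduced z → length z ≢ k → Can x → co z e (keep k x) ≡ co z e x
  keep-co k [] z e hz q c = refl
  keep-co k ((a , u) ∷ x) z e hz q (c ∷ cs) with length u ℕ.≟ k
  ... | no _ = cong (ℤ._+_ (evL (τ z e u) a)) (keep-co k x z e hz q cs)
  ... | yes p = trans (keep-co k x z e hz q cs) (trans (sym (ℤP.+-identityˡ _)) (cong (ℤ._+ co z e x)
      (sym (trans (evL-cong a λ f → trans (τ-red z e u (can-red c) f) (δC-no λ r → q (trans (sym (Red-length (can-red c) hz r)) p))) (evL-0 a)))))

  co-short : ∀ z e x → Reduced z → Can x → All (λ p → length (proj₂ p) < length z) x → co z e x ≡ i0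
  co-short z e x hz c l = trans (ev-cong-All {ψ = λ _ _ → i0} x (All.map (λ {p} q f → τ-vanish hz e (proj₂ p) q f) l)) (ev-0 x)

  -- In the largest length that occurs, a coefficient is invariant under v ↦ v⁻¹ by `co-bar-top` and
  -- has negative exponents only, so it is 0; the words of that length are dropped and the bound
  -- decreases.
  uniq : ∀ k x → Low k x → barFA x ≃ x → (∀ y j → co y (+ j) x ≡ i0) → x ≃ []
  uniq zero x ([] , _ , _ , e) b h = e
  uniq zero x ((_ ∷ _) , _ , (() ∷ _) , e) b h
  uniq (suc k) x (x' , c , l , e) b h = uniq k x (keep k x' , proj₁ kc , proj₂ kc , eq) b h
    where
    kc = keep-Can k x' c l
    top : ∀ z → Reduced z → length z ≡ k → ∀ j → co z j x ≡ i0
    top z hz lz (+ j) = h z j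
    top z hz lz -[1+ j ] = trans (sym (at b (τ z -[1+ j ]) (HF-τ z -[1+ j ]))) (trans (at (bar-cong e) (τ z -[1+ j ]) (HF-τ z -[1+ j ]))
       (trans (co-bar-top hz x' c (All.map (λ q → ≤-trans (≤-pred q) (≤-reflexive (sym lz))) l) -[1+ j ]) (trans (sym (at e (τ z (+ suc j)) (HF-τ z (+ suc j)))) (h z (suc j)))))
    pt : ∀ z → Reduced z → ∀ j → co z j x ≡ co z j (keep k x')
    pt z hz j with length z ℕ.≟ k
    ... | yes p = trans (top z hz p j) (sym (co-short z j (keep k x') hz (proj₁ kc) (All.map (λ q → subst (_ <_) (sym p) q) (proj₂ kc))))
    ... | no q = trans (at e (τ z j) (HF-τ z j)) (sym (keep-co k x' z j hz q c))
    eq : x ≃ keep k x'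
    eq = co-≃ λ w j → trans (co-resp j x (∼sym (red-∼ w))) (trans (pt (red w) (red-Red w) j) (co-resp j (keep k x') (red-∼ w)))

  -- `IsKL` in terms of coefficients: no positive powers of v, and constant terms given by a delta
  -- function. The theory is developed for this form; `IsKL⇒KL` and `KL⇒IsKL` translate.
  record KL (w : Word) (C : FA) : Set where
    field
      isRed : Reduced w
      isBar : barFA C ≃ C
      isNeg : ∀ y k → co y (+ suc k) C ≡ i0
      isTop : ∀ y → co y i0 C ≡ δC w i0 y i0
  open KL public

  -- Integral combinations of the vᵉC_w with `Q w e`. With the exponent inside the predicate, one
  -- notion serves both for conditions on descents and for degree bounds.
  data Span (Q : Word → ℤ → Set) : FA → Set where
    sgen : ∀ {w e C} → KL w C → Q w e → Span Q (Vs e C)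
    s[]  : Span Q []
    s+   : ∀ {x y} → Span Q x → Span Q y → Span Q (x ++ y)
    s-   : ∀ {x} → Span Q x → Span Q (negFA x)
    s≃   : ∀ {x y} → x ≃ y → Span Q x → Span Q y

  Span-map : ∀ {Q Q' : Word → ℤ → Set} → (∀ {w e} → Q w e → Q' w e) → ∀ {x} → Span Q x → Span Q' x
  Span-map f (sgen k q) = sgen k (f q)
  Span-map f s[] = s[]
  Span-map f (s+ a b) = s+ (Span-map f a) (Span-map f b)
  Span-map f (s- a) = s- (Span-map f a)
  Span-map f (s≃ e a) = s≃ e (Span-map f a)

  sc-split : ∀ a b x → sc (a ℤ.+ b) x ≃ sc a x ++ sc b x
  sc-split a b x .at φ h = trans (ev-sc φ (a ℤ.+ b) x) (trans (ℤP.*-distribʳ-+ (ev φ x) a b) (sym (trans (ev-++ φ (sc a x) (sc b x)) (cong₂ ℤ._+_ (ev-sc φ a x) (ev-sc φ b x)))))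

  sc1 : ∀ x → x ≃ sc i1 x
  sc1 x .at φ h = sym (trans (ev-sc φ i1 x) (ℤP.*-identityˡ (ev φ x)))

  Span-sc : ∀ {Q} a {x} → Span Q x → Span Q (sc a x)
  Span-sc (+ zero) {x} p = s≃ (mk≃ λ φ h → sym (trans (ev-sc φ i0 x) (ℤP.*-zeroˡ (ev φ x)))) s[]
  Span-sc (+ suc k) {x} p = s≃ (≃-trans (≃-++ (sc1 x) ≃-refl) (≃-sym (sc-split i1 (+ k) x)))
     (s+ p (Span-sc (+ k) p))
  Span-sc -[1+ k ] {x} p = s≃ (mk≃ λ φ h → trans (ev-neg φ (sc (+ suc k) x)) (trans (cong ℤ.-_ (ev-sc φ (+ suc k) x)) (trans (ℤP.neg-distribˡ-* (+ suc k) (ev φ x)) (sym (ev-sc φ -[1+ k ] x)))))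
     (s- (pos k))
    where
    pos : ∀ k → Span _ (sc (+ suc k) x)
    pos k = s≃ (≃-trans (≃-++ (sc1 x) ≃-refl) (≃-sym (sc-split i1 (+ k) x)))
       (s+ p (rec k))
      where
      rec : ∀ k → Span _ (sc (+ k) x)
      rec zero = s≃ (mk≃ λ φ h → sym (trans (ev-sc φ i0 x) (ℤP.*-zeroˡ (ev φ x)))) s[]
      rec (suc k) = pos k

  V0 : ∀ x → Vs i0 x ≃ x
  V0 x .at φ h = trans (ev-V φ i0 x) (ev-cong x λ u e → cong (φ u) (ℤP.+-identityˡ e))

  -- bar-invariant elements with coefficients in ℤ[v⁻¹]
  record Latt (x : FA) : Set where
    constructor latt
    field
      lBar : barFA x ≃ x
      lNeg : ∀ y k → co y (+ suc k) x ≡ i0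
  open Latt public

  ev-sub : ∀ φ x a y → ev φ (x ++ negFA (sc a y)) ≡ ev φ x ℤ.+ ℤ.- (a ℤ.* ev φ y)
  ev-sub φ x a y = trans (ev-minus φ x (sc a y)) (cong (λ z → ev φ x ℤ.+ ℤ.- z) (ev-sc φ a y))

  bar-neg : ∀ x → barFA (negFA x) ≃ negFA (barFA x)
  bar-neg x .at φ h = trans (ev-barF φ (negFA x)) (trans (ev-neg _ x) (trans (cong ℤ.-_ (sym (ev-barF φ x))) (sym (ev-neg φ (barFA x)))))

  Latt-sub : ∀ {x y} a → Latt x → Latt y → Latt (x ++ negFA (sc a y))
  Latt-sub {x} {y} a (latt b p) (latt b' p') = latt
    (≃-trans (bar-++ x (negFA (sc a y))) (≃-++ b (≃-trans (bar-neg (sc a y)) (≃-neg (≃-trans (bar-sc a y) (≃-scale ((a , i0) ∷ []) b'))))))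
    λ z k → trans (ev-sub (τ z (+ suc k)) x a y) (trans (cong₂ (λ u v → u ℤ.+ ℤ.- (a ℤ.* v)) (p z k) (p' z k)) (cong (λ z → i0 ℤ.+ ℤ.- z) (ℤP.*-zeroʳ a)))

  KL-Latt : ∀ {w C} → KL w C → Latt C
  KL-Latt k = latt (isBar k) (isNeg k)

  δC00 : ∀ {w u} → u ∼ w → δC w i0 u i0 ≡ i1
  δC00 p = δC-yes p

  -- Subtract from x its components along C_u for the listed words u.
  record Sub (us : List Word) (Ex : Word → Set) (x : FA) : Set where
    constructor sub
    field
      rest : FA
      rLatt : Latt rest
      comps : FA
      split : x ≃ rest ++ comps
      cSpan : Span (λ z e → e ≡ i0 × Ex z × (co z i0 x ≢ i0)) comps
      either : ∀ z → (co z i0 rest ≡ i0) ⊎ (co z i0 rest ≡ co z i0 x)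
      killed : ∀ z → All (λ u → ¬ (z ∼ u)) us ⊎ (co z i0 rest ≡ i0)
      other : ∀ z e → (∀ u C → Ex u → KL u C → co z e C ≡ i0) → co z e rest ≡ co z e x

  -- The constant terms of C_u are a delta function at u, so subtracting the right multiple of C_u
  -- clears the constant term at u and leaves all others alone; the order of the words is
  -- immaterial.
  subtract : ∀ (Ex : Word → Set) us x → Latt x → All (λ u → Ex u × ∃ (KL u)) us → Sub us Ex x
  subtract Ex [] x l [] = sub x l [] (mk≃ λ φ h → sym (trans (ev-++ φ x []) (ℤP.+-identityʳ _))) s[] (λ z → inj₂ refl) (λ z → inj₁ []) (λ z e h → refl)
  subtract Ex (u ∷ us) x l ((ex , C , kl) ∷ r) with co u i0 x ℤ.≟ i0
  ... | yes q with subtract Ex us x l r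
  ...   | sub y ly c s cs ei ki ot = sub y ly c s cs ei ki' ot
    where
    ki' : ∀ z → All (λ u → ¬ (z ∼ u)) (u ∷ us) ⊎ (co z i0 y ≡ i0)
    ki' z with ki z | z ∼? u
    ... | inj₂ p | _ = inj₂ p
    ... | inj₁ p | no n = inj₁ (n ∷ p)
    ... | inj₁ p | yes zu with ei z
    ...   | inj₁ t = inj₂ t
    ...   | inj₂ t = inj₂ (trans t (trans (co-resp i0 x zu) q))
  subtract Ex (u ∷ us) x l ((ex , C , kl) ∷ r) | no q with subtract Ex us (x ++ negFA (sc (co u i0 x) C)) (Latt-sub (co u i0 x) l (KL-Latt kl)) r
  ...   | sub y ly c s cs ei ki ot = sub y ly (c ++ sc a (Vs i0 C)) eq
          (s+ (Span-map (λ { {z} (p , p' , ne) → p , p' , λ t → ne (zero-stays z t) }) cs) (Span-sc a (sgen kl (refl , ex , q)))) ei' ki' ot'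
    where
    a = co u i0 x
    x₁ = x ++ negFA (sc a C)
    coef : ∀ z → co z i0 x₁ ≡ co z i0 x ℤ.+ ℤ.- (a ℤ.* δC u i0 z i0)
    coef z = trans (ev-sub (τ z i0) x a C) (cong (λ t → co z i0 x ℤ.+ ℤ.- (a ℤ.* t)) (isTop kl z))
    yesC : ∀ z → z ∼ u → co z i0 x₁ ≡ i0
    yesC z p = trans (coef z) (trans (cong₂ (λ t r → t ℤ.+ ℤ.- (a ℤ.* r)) (co-resp i0 x p) (δC00 p)) (trans (cong (λ t → a ℤ.+ ℤ.- t) (ℤP.*-identityʳ a)) (ℤP.+-inverseʳ a)))
    noC : ∀ z → ¬ (z ∼ u) → co z i0 x₁ ≡ co z i0 x
    noC z p = trans (coef z) (trans (cong (λ t → co z i0 x ℤ.+ ℤ.- (a ℤ.* t)) (δC-no p)) (trans (cong (λ t → co z i0 x ℤ.+ ℤ.- t) (ℤP.*-zeroʳ a)) (ℤP.+-identityʳ _)))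
    zero-stays : ∀ z → co z i0 x ≡ i0 → co z i0 x₁ ≡ i0
    zero-stays z t with z ∼? u
    ... | yes p = yesC z p
    ... | no p = trans (noC z p) t
    eq : x ≃ y ++ (c ++ sc a (Vs i0 C))
    eq .at φ h = trans (l₁ (ev φ x) (a ℤ.* ev φ C)) (trans (cong (ℤ._+ (a ℤ.* ev φ C)) (trans (sym (ev-sub φ x a C)) (trans (at s φ h) (ev-++ φ y c))))
       (trans (ℤP.+-assoc (ev φ y) (ev φ c) _) (trans (cong (λ t → ev φ y ℤ.+ (ev φ c ℤ.+ a ℤ.* t)) (sym (at (V0 C) φ h)))
         (trans (cong (λ t → ev φ y ℤ.+ (ev φ c ℤ.+ t)) (sym (ev-sc φ a (Vs i0 C)))) (trans (cong (ℤ._+_ (ev φ y)) (sym (ev-++ φ c (sc a (Vs i0 C))))) (sym (ev-++ φ y (c ++ sc a (Vs i0 C)))))))))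
      where l₁ : ∀ a b → a ≡ (a ℤ.+ ℤ.- b) ℤ.+ b
            l₁ = solve-∀
    ei' : ∀ z → (co z i0 y ≡ i0) ⊎ (co z i0 y ≡ co z i0 x)
    ei' z with ei z | z ∼? u
    ... | inj₁ t | _ = inj₁ t
    ... | inj₂ t | yes p = inj₁ (trans t (yesC z p))
    ... | inj₂ t | no p = inj₂ (trans t (noC z p))
    ki' : ∀ z → All (λ u → ¬ (z ∼ u)) (u ∷ us) ⊎ (co z i0 y ≡ i0)
    ki' z with ki z | z ∼? u
    ... | inj₂ p | _ = inj₂ p
    ... | inj₁ p | no n = inj₁ (n ∷ p)
    ... | inj₁ p | yes zu with ei z
    ...   | inj₁ t = inj₂ t
    ...   | inj₂ t = inj₂ (trans t (yesC z zu))
    ot' : ∀ z e → (∀ u C → Ex u → KL u C → co z e C ≡ i0) → co z e y ≡ co z e x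
    ot' z e h = trans (ot z e h) (trans (ev-sub (τ z e) x a C) (trans (cong (λ t → co z e x ℤ.+ ℤ.- (a ℤ.* t)) (h u C ex kl)) (trans (cong (λ t → co z e x ℤ.+ ℤ.- t) (ℤP.*-zeroʳ a)) (ℤP.+-identityʳ _))))

  KL-unique : ∀ {w w' C C'} → w ∼ w' → KL w C → KL w' C' → C ≃ C'
  KL-unique {w} {w'} {C} {C'} p k k' = mk≃ λ φ h → m≡ (trans (sym (trans (ev-sub φ C i1 C') (cong (λ t → ev φ C ℤ.+ ℤ.- t) (ℤP.*-identityˡ _)))) (at z φ h))
    where
    lt = Latt-sub i1 (KL-Latt k) (KL-Latt k')
    x = C ++ negFA (sc i1 C')
    coz : ∀ y j → co y (+ j) x ≡ i0
    coz y (suc j) = lNeg lt y j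
    coz y zero = trans (ev-sub (τ y i0) C i1 C') (trans (cong₂ (λ a b → a ℤ.+ ℤ.- (i1 ℤ.* b)) (isTop k y) (isTop k' y))
       (trans (cong (λ t → δC w i0 y i0 ℤ.+ ℤ.- t) (ℤP.*-identityˡ _)) (m-m (cong (λ t → δW t i0 (nf y) i0) (nf-resp p)))))
    z : x ≃ []
    z = uniq (proj₁ (low x)) x (proj₂ (low x)) (lBar lt) coz

  -- the coefficient of T_z in C_s C_y, at v⁰ and above
  C-Latt : ∀ {s y C} → KL y C → UpL y s → Latt (C· s C)
  C-Latt {s} {y} {C} k u = latt (≃-trans (bar-C s C) (C-cong s (isBar k))) pos
    where
    pos : ∀ z j → co z (+ suc j) (C· s C) ≡ i0
    pos z j with upL? z s
    ... | inj₁ p = trans (co-C-up {s} {z} p (+ suc j) C) (trans (cong₂ ℤ._+_ (isNeg k (s ∷ z) j) (isNeg k z (j ℕ.+ 1))) refl)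
    ... | inj₂ p = trans (co-C-dn {s} {z} p (+ suc j) C) (trans (cong₂ ℤ._+_ (isNeg k (s ∷ z) j) (low0 j)) refl)
      where
      low0 : ∀ j → co z (+ suc j ℤ.+ -1ᶻ) C ≡ i0
      low0 (suc j) = isNeg k z j
      low0 zero = trans (isTop k z) (δC-no λ e → upL-dnL {z} {s} (UpL-resp {y} {z} {s} (∼sym e) u) p)

  -- Support and leading coefficient travel with the element: apart from T_w, only shorter words
  -- occur in C_w. Subtracting such C_u with u shorter than sw therefore leaves the long
  -- coefficients of C_s C_w untouched.
  Exists : ℕ → Set
  Exists k = ∀ w → Reduced w → length w ≤ k → ∃ λ C → KL w C × (∀ y e → Reduced y → length w ≤ length y → ¬ (y ∼ w) → co y e C ≡ i0) × (∀ e → co w e C ≡ δC w i0 w e)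

  -- support of C_s C_w, given that of C_w
  C-supp : ∀ {w s C} → Reduced (s ∷ w) → (∀ y e → Reduced y → length w ≤ length y → ¬ (y ∼ w) → co y e C ≡ i0) →
           ∀ z e → Reduced z → length (s ∷ w) ≤ length z → ¬ (z ∼ s ∷ w) → co z e (C· s C) ≡ i0
  C-supp {w} {s} {C'} hw sup' z e hz lz ne with upL? z s
  ... | inj₁ p = trans (co-C-up {s} {z} p e C') (cong₂ ℤ._+_
          (sup' (s ∷ z) e (Red-upL {z} {s} hz p) (≤-trans (n≤1+n (length w)) (≤-trans lz (n≤1+n (length z)))) λ q → ne (∼-cons-move q))
          (sup' z (e ℤ.+ i1) hz (≤-trans (n≤1+n (length w)) lz) λ q → <⇒≱ lz (hz w (∼sym q))))
  ... | inj₂ p with Red-dnL hz p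
  ...   | a , ha , ea , la = trans (co-C-dn {s} {z} p e C') (cong₂ ℤ._+_
          (trans (co-resp e C' (∼sym (∼-cons-move ea))) (sup' a e (Red-suffix (s ∷ []) a ha) (≤-pred (≤-trans lz (≤-reflexive (sym la)))) λ q → ne (∼trans (∼sym ea) (∼-++ˡ (s ∷ []) q))))
          (sup' z (e ℤ.+ -1ᶻ) hz (≤-trans (n≤1+n (length w)) lz) λ q → <⇒≱ lz (hz w (∼sym q))))

  C-lead : ∀ {w s C} → Reduced (s ∷ w) → (∀ y e → Reduced y → length w ≤ length y → ¬ (y ∼ w) → co y e C ≡ i0) →
           (∀ e → co w e C ≡ δC w i0 w e) → ∀ e → co (s ∷ w) e (C· s C) ≡ δC (s ∷ w) i0 (s ∷ w) e
  C-lead {w} {s} {C'} hw sup' ld e = trans (co-C-dn {s} {s ∷ w} (cons-DnL {w} {s} hw) e C') (trans (cong₂ ℤ._+_ (trans (co-resp e C' (∼-cons² s w)) (ld e))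
      (sup' (s ∷ w) (e ℤ.+ -1ᶻ) hw (n≤1+n (length w)) λ q → <⇒≱ (≤-refl {suc (length w)}) (hw w (∼sym q)))) (trans (ℤP.+-identityʳ (δC w i0 w e)) (trans (δC-yes {w} {i0} {w} {e} ∼refl) (sym (δC-yes {s ∷ w} {i0} {s ∷ w} {e} ∼refl)))))

  shorter : ℕ → FA → List Word
  shorter k [] = []
  shorter k ((c , u) ∷ x) with length u ℕ.<? k
  ... | yes _ = u ∷ shorter k x
  ... | no _ = shorter k x

  shorter-len : ∀ k x → All (λ u → length u < k) (shorter k x)
  shorter-len k [] = []
  shorter-len k ((c , u) ∷ x) with length u ℕ.<? k
  ... | yes p = p ∷ shorter-len k x
  ... | no _ = shorter-len k x

  shorter-Can : ∀ k x → Can x → All (λ u → Reduced u) (shorter k x)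
  shorter-Can k [] [] = []
  shorter-Can k ((c , u) ∷ x) (p ∷ q) with length u ℕ.<? k
  ... | yes _ = can-red p ∷ shorter-Can k x q
  ... | no _ = shorter-Can k x q

  co-absent : ∀ k x z e → Can x → Reduced z → length z < k → All (λ u → ¬ (z ∼ u)) (shorter k x) → co z e x ≡ i0
  co-absent k [] z e c hz lz a = refl
  co-absent k ((c , u) ∷ x) z e (p ∷ q) hz lz a with length u ℕ.<? k
  co-absent k ((c , u) ∷ x) z e (p ∷ q) hz lz (n ∷ a) | yes _ = trans (cong₂ ℤ._+_ (trans (evL-cong c λ f → trans (τ-red z e u (can-red p) f) (δC-no λ r → n (∼sym r))) (evL-0 c)) (co-absent k x z e q hz lz a)) refl
  co-absent k ((c , u) ∷ x) z e (p ∷ q) hz lz a | no g = trans (cong₂ ℤ._+_ (trans (evL-cong c λ f → trans (τ-red z e u (can-red p) f) (δC-no λ r → g (subst (_< k) (Red-length hz (can-red p) (∼sym r)) lz))) (evL-0 c)) (co-absent k x z e q hz lz a)) refl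

  -- C_s C_w is bar-invariant, has coefficients in ℤ[v⁻¹], and has the desired constant terms from
  -- length ℓ(sw) on. The finitely many nonzero constant terms in smaller lengths are removed by
  -- subtracting the C_u already constructed.
  exists : ∀ k → Exists k
  exists k [] hw le = T [] , record { isRed = hw ; isBar = mk≃ λ φ h → trans (ev-barF φ (T [])) (trans (ev-T (barF φ) []) (trans (ev-T (shift i0 φ) []) (sym (ev-T φ []))))
      ; isNeg = λ y j → trans (ev-T (τ y (+ suc j)) []) (neg0 y j) ; isTop = λ y → trans (ev-T (τ y i0) []) (symδ y) } ,
      (λ y e hy _ q → trans (ev-T (τ y e) []) (δC-no λ p → q (∼sym p))) ,
      λ e → trans (ev-T (τ [] e) []) (trans (δC-yes {[]} {e} {[]} {i0} ∼refl) (trans (δℤ-bij {e} {i0} {i0} {e} sym sym) (sym (δC-yes {[]} {i0} {[]} {e} ∼refl))))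
    where
    neg0 : ∀ y j → δC y (+ suc j) [] i0 ≡ i0
    neg0 y j with [] ∼? y
    ... | yes p = trans (δC-yes p) refl
    ... | no q = δC-no q
    symδ : ∀ y → δC y i0 [] i0 ≡ δC [] i0 y i0
    symδ y with [] ∼? y
    ... | yes p = trans (δC-yes p) (sym (δC-yes (∼sym p)))
    ... | no q = trans (δC-no q) (sym (δC-no λ p → q (∼sym p)))
  exists (suc k) (s ∷ w) hw (s≤s le) with exists k w (Red-suffix (s ∷ []) w hw) le
  ... | C' , kl' , sup' , ld' = y , record { isRed = hw ; isBar = lBar ly ; isNeg = lNeg ly ; isTop = top } , supp , (λ e → trans (far (s ∷ w) e hw ≤-refl) (C-lead {w} {s} {C'} hw sup' ld' e))
    where
    u' : UpL w s
    u' = Red-cons⇒UpL hw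
    x = C· s C'
    lx = C-Latt kl' u'
    nx = norm x
    x' = proj₁ nx
    cx : Can x'
    cx = proj₁ (proj₂ nx)
    ex : x ≃ x'
    ex = ≋⇒≃ (proj₂ (proj₂ (proj₂ nx)))
    K = length (s ∷ w)
    us = shorter K x'
    Ex : Word → Set
    Ex u = Reduced u × length u < K
    kls : All (λ u → Ex u × ∃ (KL u)) us
    kls = All.zipWith (λ {u} (l , r) → let le' = ≤-trans (≤-pred l) le in (r , l) , proj₁ (exists k u r le') , proj₁ (proj₂ (exists k u r le'))) (shorter-len K x' , shorter-Can K x' cx)
    S : Sub us Ex x
    S = subtract Ex us x lx kls
    open Sub S renaming (rest to y ; rLatt to ly)
    K≤ : ∀ {u} → length u < K → length u ≤ k
    K≤ l = ≤-trans (≤-pred l) le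
    supC : ∀ z e → Reduced z → K ≤ length z → ∀ u C → Ex u → KL u C → co z e C ≡ i0
    supC z e hz lz u C (ru , lt) klu = trans (at (KL-unique ∼refl klu (proj₁ (proj₂ ee))) (τ z e) (HF-τ z e)) (proj₁ (proj₂ (proj₂ ee)) z e hz (≤-trans (<⇒≤ lt) lz) λ p → <⇒≱ lt (≤-trans lz (hz u (∼sym p))))
      where ee = exists k u ru (K≤ {u} lt)
    far : ∀ z e → Reduced z → K ≤ length z → co z e y ≡ co z e x
    far z e hz lz = other z e (λ u C ex klu → supC z e hz lz u C ex klu)
    no-w : ∀ {z} → Reduced z → K ≤ length z → ¬ (z ∼ w)
    no-w hz lz p = <⇒≱ lz (hz w (∼sym p))
    ssz : ∀ {z} → s ∷ z ∼ w → z ∼ s ∷ w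
    ssz p = ∼-cons-move p
    topR : ∀ z → Reduced z → co z i0 y ≡ δC (s ∷ w) i0 z i0
    topR z hz with length z ℕ.<? K
    topR z hz | yes lz = trans zero' (sym (δC-no λ p → <⇒≢ lz (Red-length hz hw p)))
      where
      zero' : co z i0 y ≡ i0
      zero' with killed z | either z
      ... | inj₂ t | _ = t
      ... | inj₁ _ | inj₁ t = t
      ... | inj₁ n | inj₂ t = trans t (trans (at ex (τ z i0) (HF-τ z i0)) (co-absent K x' z i0 cx hz lz n))
    topR z hz | no g with ≮⇒≥ g | upL? z s
    ... | lz | inj₁ p = trans (far z i0 hz lz) (trans (co-C-up {s} {z} p i0 C') (trans (cong₂ ℤ._+_
          (trans (isTop kl' (s ∷ z)) (δC-no λ q → upL-dnL {z} {s} p (DnL-resp {s ∷ w} {z} {s} (∼sym (ssz {z} q)) (cons-DnL {w} hw)))) (isNeg kl' z 0)) (sym (δC-no λ q → upL-dnL {z} {s} p (DnL-resp {s ∷ w} {z} {s} (∼sym q) (cons-DnL {w} hw))))))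
    ... | lz | inj₂ p = trans (far z i0 hz lz) (trans (co-C-dn {s} {z} p i0 C') (trans (cong₂ ℤ._+_
          (trans (isTop kl' (s ∷ z)) (δC-move s w i0 z i0)) (sup' z (i0 ℤ.+ -1ᶻ) hz (≤-trans (n≤1+n _) lz) (no-w {z} hz lz))) (ℤP.+-identityʳ _)))
    top : ∀ z → co z i0 y ≡ δC (s ∷ w) i0 z i0
    top z = trans (co-resp i0 y (∼sym (red-∼ z))) (trans (topR (red z) (red-Red z)) (δC-Inv (s ∷ w) i0 (red-∼ z) i0))
    supp : ∀ z e → Reduced z → K ≤ length z → ¬ (z ∼ s ∷ w) → co z e y ≡ i0
    supp z e hz lz ne = trans (far z e hz lz) (C-supp {w} {s} {C'} hw sup' z e hz lz ne)

  KL-supp : ∀ {w C} → KL w C → ∀ y e → Reduced y → length w ≤ length y → ¬ (y ∼ w) → co y e C ≡ i0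
  KL-supp {w} k y e hy le ne with exists (length w) w (isRed k) ≤-refl
  ... | C , k' , sup , _ = trans (at (KL-unique ∼refl k k') (τ y e) (HF-τ y e)) (sup y e hy le ne)

  KL-lead : ∀ {w C} → KL w C → ∀ e → co w e C ≡ δC w i0 w e
  KL-lead {w} k e with exists (length w) w (isRed k) ≤-refl
  ... | C , k' , _ , ld = trans (at (KL-unique ∼refl k k') (τ w e) (HF-τ w e)) (ld e)

  KC : Word → FA
  KC w = proj₁ (exists (length (nf w)) (nf w) (nf-Red w) ≤-refl)
  KC-KL : ∀ w → KL (nf w) (KC w)
  KC-KL w = proj₁ (proj₂ (exists (length (nf w)) (nf w) (nf-Red w) ≤-refl))

  KL-resp : ∀ {w w' C} → Reduced w' → w ∼ w' → KL w C → KL w' C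
  KL-resp h p k = record { isRed = h ; isBar = isBar k ; isNeg = isNeg k ; isTop = λ y → trans (isTop k y) (cong (λ t → δW t i0 (nf y) i0) (nf-resp p)) }

  KL-of : ∀ w → Reduced w → ∃ (KL w)
  KL-of w h = KC w , KL-resp h (nf-∼ w) (KC-KL w)

  -- Subtracting each C_z with the constant term of x at z as factor leaves a bar-invariant element
  -- with coefficients in v⁻¹ℤ[v⁻¹], which is 0 by `uniq`. Hence only the exponent 0 occurs, and
  -- this is what later keeps degrees from growing.
  expand : ∀ x → Latt x → Span (λ z e → e ≡ i0 × Reduced z × (co z i0 x ≢ i0)) x
  expand x lx with low x
  ... | k , x' , c , l , ex = s≃ (≃-sym (≃-trans split (≃-++ rest0 ≃-refl))) cSpan
    where
    kls : All (λ u → Reduced u × ∃ (KL u)) (shorter k x')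
    kls = All.map (λ {u} r → r , KL-of u r) (shorter-Can k x' c)
    open Sub (subtract Reduced (shorter k x') x lx kls)
    zR : ∀ z → Reduced z → co z i0 rest ≡ i0
    zR z hz with killed z | either z
    ... | inj₂ t | _ = t
    ... | inj₁ _ | inj₁ t = t
    ... | inj₁ a | inj₂ t with length z ℕ.<? k
    ...   | yes lz = trans t (trans (at ex (τ z i0) (HF-τ z i0)) (co-absent k x' z i0 c hz lz a))
    ...   | no g = trans t (trans (at ex (τ z i0) (HF-τ z i0)) (co-short z i0 x' hz c (All.map (λ q → <-≤-trans q (≮⇒≥ g)) l)))
    vanish : ∀ z j → co z (+ j) rest ≡ i0
    vanish z (suc j) = lNeg rLatt z j
    vanish z zero = trans (co-resp i0 rest (∼sym (red-∼ z))) (zR (red z) (red-Red z))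
    rest0 : rest ≃ []
    rest0 = uniq (proj₁ (low rest)) rest (proj₂ (low rest)) (lBar rLatt) vanish

  Span-Fac : ∀ {Q s} → (∀ {w e C} → KL w C → Q w e → Fac s C) → ∀ {x} → Span Q x → Fac s x
  Span-Fac f (sgen {e = e} k q) = Fac-V e (f k q)
  Span-Fac f s[] = Fac-[]
  Span-Fac f (s+ a b) = Fac-++ (Span-Fac f a) (Span-Fac f b)
  Span-Fac f (s- a) = Fac-neg (Span-Fac f a)
  Span-Fac f (s≃ e a) = Fac-resp e (Span-Fac f a)

  Fac-C : ∀ {s x} → Fac s (C· s x)
  Fac-C {s} {x} = x , ≃-refl

  Fac-low : ∀ {s x z} → Fac s x → (∀ y j → co y (+ suc j) x ≡ i0) → UpL z s → co z i0 x ≡ i0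
  Fac-low {s} {x} {z} f h u = trans (co-Fac {s} {x} {z} f u i0) (h (s ∷ z) 0)

  -- For w = sa the difference C_s C_a - C_w is a combination of C_z with z shorter. Each such z has
  -- left descent s, since in C_s H an element without positive powers of v has constant term 0 at
  -- the ascents; so induction applies to every C_z.
  KL-Fac : ∀ {w C s} → KL w C → DnL w s → Fac s C
  KL-Fac {w} {C} {s} = go (length w) ≤-refl
    where
    go : ∀ k {w C} → length w ≤ k → KL w C → DnL w s → Fac s C
    go k {w} {C} le kl d with Red-dnL (isRed kl) d
    go zero {[]} le kl d | a , ha , ea , ()
    go zero {_ ∷ _} () kl d | _
    go (suc k) {w} {C} le kl d | a , ha , ea , la = Fac-resp diff≃ (Fac-++ (Fac-C {s} {C'}) (Fac-neg (Span-Fac (λ { {z} kz (_ , _ , ne) → go k (≤-pred (≤-trans (short {z} (isRed kz) ne) le)) kz (dn {z} ne) }) (expand df ldf))))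
      where
      C' = proj₁ (KL-of a (Red-suffix (s ∷ []) a ha))
      kl' = proj₂ (KL-of a (Red-suffix (s ∷ []) a ha))
      x = C· s C'
      lx = C-Latt {s} {a} kl' (Red-cons⇒UpL ha)
      df = x ++ negFA (sc i1 C)
      ldf = Latt-sub i1 lx (KL-Latt kl)
      coef : ∀ z e → co z e df ≡ co z e x ℤ.+ ℤ.- co z e C
      coef z e = trans (ev-sub (τ z e) x i1 C) (cong (λ t → co z e x ℤ.+ ℤ.- t) (ℤP.*-identityˡ _))
      dn : ∀ {z} → co z i0 df ≢ i0 → DnL z s
      dn {z} ne with upL? z s
      ... | inj₂ p = p
      ... | inj₁ p = ⊥-elim (ne (trans (coef z i0) (trans (cong₂ (λ a b → a ℤ.+ ℤ.- b) (Fac-low {s} {x} {z} (Fac-C {s} {C'}) (lNeg lx) p)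
               (trans (isTop kl z) (δC-no λ q → upL-dnL {z} {s} p (DnL-resp {w} {z} {s} (∼sym q) d)))) refl)))
      short : ∀ {z} → Reduced z → co z i0 df ≢ i0 → length z < length w
      short {z} hz ne with length z ℕ.<? length w | z ∼? w
      ... | yes p | _ = p
      ... | no g | yes q = ⊥-elim (ne (trans (coef z i0) (m-m (trans (co-resp i0 x (∼trans q (∼sym ea)))
               (trans (C-lead {a} {s} {C'} ha (KL-supp kl') (KL-lead kl') i0) (trans (δC-yes {s ∷ a} {i0} {s ∷ a} {i0} ∼refl) (sym (trans (isTop kl z) (δC-yes {w} {i0} {z} {i0} q)))))))))
      ... | no g | no q = ⊥-elim (ne (trans (coef z i0) (cong₂ (λ a b → a ℤ.+ ℤ.- b)
               (C-supp {a} {s} {C'} ha (KL-supp kl') z i0 hz (≤-trans (≤-reflexive la) (≮⇒≥ g)) (λ r → q (∼trans r ea)))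
               (KL-supp kl z i0 hz (≮⇒≥ g) q))))
      diff≃ : x ++ negFA df ≃ C
      diff≃ .at φ h = trans (ev-minus φ x df) (trans (cong (λ t → ev φ x ℤ.+ ℤ.- t) (trans (ev-sub φ x i1 C) (cong (λ t → ev φ x ℤ.+ ℤ.- t) (ℤP.*-identityˡ _)))) (l (ev φ x) (ev φ C)))
        where l : ∀ a b → a ℤ.+ ℤ.- (a ℤ.+ ℤ.- b) ≡ b
              l = solve-∀

  C²-lemma : ∀ {s x} → Fac s x → C· s x ≃ Vs i1 x ++ Vs -1ᶻ x
  C²-lemma {s} {x} (z , p) = ≃-trans (C-cong s p) (≃-trans core (≃-sym (≃-++ (Vs-cong i1 p) (Vs-cong -1ᶻ p))))
    where
    core : C· s (C· s z) ≃ Vs i1 (C· s z) ++ Vs -1ᶻ (C· s z)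
    core .at φ h = trans (ev-C φ s (C· s z)) (trans (ev-C (cl s φ) s z) (trans (ev-cong z pt) (trans (ev-+ (cl s (shift i1 φ)) (cl s (shift -1ᶻ φ)) z)
       (sym (trans (ev-++ φ (Vs i1 (C· s z)) (Vs -1ᶻ (C· s z))) (cong₂ ℤ._+_ (trans (ev-V φ i1 (C· s z)) (ev-C (shift i1 φ) s z)) (trans (ev-V φ -1ᶻ (C· s z)) (ev-C (shift -1ᶻ φ) s z))))))))
      where
      l : ∀ A B C D → (A ℤ.+ (B ℤ.+ ℤ.- C)) ℤ.+ C ℤ.+ (C ℤ.+ D) ≡ (B ℤ.+ A) ℤ.+ (C ℤ.+ D)
      l = solve-∀
      e₁ : ∀ f → i1 ℤ.+ (-1ᶻ ℤ.+ f) ≡ f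
      e₁ = solve-∀
      pt : cl s (cl s φ) ≐ (λ w f → cl s (shift i1 φ) w f ℤ.+ cl s (shift -1ᶻ φ) w f)
      pt w f = trans (cong (λ t → t ℤ.+ φ (s ∷ w) (-1ᶻ ℤ.+ f) ℤ.+ (φ (s ∷ w) (-1ᶻ ℤ.+ f) ℤ.+ φ w (-1ᶻ ℤ.+ (-1ᶻ ℤ.+ f))))
            (trans (quadF h [] w s f) (cong (λ t → φ w f ℤ.+ t) (cong₂ (λ a b → φ (s ∷ w) a ℤ.+ ℤ.- φ (s ∷ w) b) (ℤP.+-comm f i1) (ℤP.+-comm f -1ᶻ)))))
          (trans (l (φ w f) (φ (s ∷ w) (i1 ℤ.+ f)) (φ (s ∷ w) (-1ᶻ ℤ.+ f)) (φ w (-1ᶻ ℤ.+ (-1ᶻ ℤ.+ f))))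
             (cong (λ t → (φ (s ∷ w) (i1 ℤ.+ f) ℤ.+ φ w t) ℤ.+ (φ (s ∷ w) (-1ᶻ ℤ.+ f) ℤ.+ φ w (-1ᶻ ℤ.+ (-1ᶻ ℤ.+ f)))) (sym (e₁ f))))

  -- The terms of C_t C_y outside the descent class of y: only ty and ry can occur.
  C-terms : ∀ {t y C} → KL y C → UpL y t → ∀ {z} → co z i0 (C· t C) ≢ i0 →
            DnL z t × (∀ {r} → DnL y r → UpL z r → z ∼ t ∷ y ⊎ z ∼ r ∷ y)
  C-terms {t} {y} {C} k u {z} ne = dn , nb
    where
    lx = C-Latt {t} {y} k u
    dn : DnL z t
    dn with upL? z t
    ... | inj₂ p = p
    ... | inj₁ p = ⊥-elim (ne (Fac-low {t} {C· t C} {z} (Fac-C {t} {C}) (lNeg lx) p))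
    nb : ∀ {r} → DnL y r → UpL z r → z ∼ t ∷ y ⊎ z ∼ r ∷ y
    nb {r} dy uz with z ∼? (t ∷ y) | z ∼? (r ∷ y)
    ... | yes p | _ = inj₁ p
    ... | no _ | yes q = inj₂ q
    ... | no p | no q = ⊥-elim (ne (trans (co-C-dn {t} {z} dn i0 C) (cong₂ ℤ._+_ (trans (isTop k (t ∷ z)) (δC-no λ e → p (∼-cons-move e)))
          (trans (co-Fac {r} {C} {z} (KL-Fac k dy) uz -1ᶻ) (trans (isTop k (r ∷ z)) (δC-no λ e → q (∼-cons-move e)))))))

  Span-V : ∀ {Q Q' : Word → ℤ → Set} e → (∀ {w f} → Q w f → Q' w (e ℤ.+ f)) → ∀ {x} → Span Q x → Span Q' (Vs e x)
  Span-V e g (sgen {w} {f} {C} k q) = s≃ (mk≃ λ φ h → trans (ev-V φ (e ℤ.+ f) C) (trans (ev-cong C λ u i → cong (φ u) (ℤP.+-assoc e f i)) (sym (trans (ev-V φ e (Vs f C)) (ev-V (shift e φ) f C))))) (sgen k (g q))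
  Span-V e g s[] = s[]
  Span-V e g (s+ {x} {y} a b) = s≃ (mk≃ λ φ h → sym (trans (ev-V φ e (x ++ y)) (trans (ev-++ (shift e φ) x y) (trans (sym (cong₂ ℤ._+_ (ev-V φ e x) (ev-V φ e y))) (sym (ev-++ φ (Vs e x) (Vs e y))))))) (s+ (Span-V e g a) (Span-V e g b))
  Span-V e g (s- {x} a) = s≃ (mk≃ λ φ h → sym (trans (ev-V φ e (negFA x)) (trans (ev-neg (shift e φ) x) (trans (cong ℤ.-_ (sym (ev-V φ e x))) (sym (ev-neg φ (Vs e x))))))) (s- (Span-V e g a))
  Span-V e g (s≃ p a) = s≃ (Vs-cong e p) (Span-V e g a)

  record Lin (F : FA → FA) : Set where
    field
      F-cong : ∀ {x y} → x ≃ y → F x ≃ F y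
      F-++ : ∀ x y → F (x ++ y) ≃ F x ++ F y
      F-neg : ∀ x → F (negFA x) ≃ negFA (F x)
      F-V : ∀ e x → F (Vs e x) ≃ Vs e (F x)
      F-[] : F [] ≃ []
  open Lin public

  Span-Lin : ∀ {F} → Lin F → ∀ {Q Q' : Word → ℤ → Set} → (∀ {w e C} → KL w C → Q w e → Span Q' (Vs e (F C))) → ∀ {x} → Span Q x → Span Q' (F x)
  Span-Lin L f (sgen {w} {e} {C} k q) = s≃ (≃-sym (F-V L e C)) (f k q)
  Span-Lin L f s[] = s≃ (≃-sym (F-[] L)) s[]
  Span-Lin L f (s+ {x} {y} a b) = s≃ (≃-sym (F-++ L x y)) (s+ (Span-Lin L f a) (Span-Lin L f b))
  Span-Lin L f (s- {x} a) = s≃ (≃-sym (F-neg L x)) (s- (Span-Lin L f a))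
  Span-Lin L f (s≃ p a) = s≃ (F-cong L p) (Span-Lin L f a)

  mulˡ-Lin : ∀ a → Lin (mulFA a)
  mulˡ-Lin a = record
    { F-cong = λ p → ≃-mul (≃-refl {a}) p
    ; F-++ = λ x y → mk≃ λ φ h → trans (ev-mul φ a (x ++ y)) (trans (ev-cong a λ u e → ev-++ _ x y) (trans (ev-+ _ _ a) (sym (trans (ev-++ φ (mulFA a x) (mulFA a y)) (cong₂ ℤ._+_ (ev-mul φ a x) (ev-mul φ a y))))))
    ; F-neg = λ x → mk≃ λ φ h → trans (ev-mul φ a (negFA x)) (trans (ev-cong a λ u e → ev-neg _ x) (trans (neg-ev a (λ u e → ev (λ w f → φ (u ++ w) (e ℤ.+ f)) x)) (sym (trans (ev-neg φ (mulFA a x)) (cong ℤ.-_ (ev-mul φ a x))))))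
    ; F-V = λ e x → mk≃ λ φ h → trans (ev-mul φ a (Vs e x)) (trans (ev-cong a λ u f → trans (ev-V _ e x) (ev-cong x λ w g → cong (φ (u ++ w)) (l f e g))) (sym (trans (ev-V φ e (mulFA a x)) (ev-mul (shift e φ) a x))))
    ; F-[] = mk≃ λ φ h → trans (ev-mul φ a []) (ev-0 a) }
    where
    l : ∀ f e g → f ℤ.+ (e ℤ.+ g) ≡ e ℤ.+ (f ℤ.+ g)
    l = solve-∀
    m1 : ∀ a → -1ᶻ ℤ.* a ≡ ℤ.- a
    m1 = solve-∀
    neg-ev : ∀ x (φ : Fun) → ev (λ u e → ℤ.- φ u e) x ≡ ℤ.- ev φ x
    neg-ev x φ = trans (ev-cong x λ u e → sym (m1 (φ u e))) (trans (ev-* -1ᶻ φ x) (m1 (ev φ x)))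

  mulʳ-Lin : ∀ b → Lin (λ x → mulFA x b)
  mulʳ-Lin b = record
    { F-cong = λ p → ≃-mul p (≃-refl {b})
    ; F-++ = λ x y → mk≃ λ φ h → trans (ev-mul φ (x ++ y) b) (trans (ev-++ _ x y) (sym (trans (ev-++ φ (mulFA x b) (mulFA y b)) (cong₂ ℤ._+_ (ev-mul φ x b) (ev-mul φ y b)))))
    ; F-neg = λ x → mk≃ λ φ h → trans (ev-mul φ (negFA x) b) (trans (ev-neg _ x) (sym (trans (ev-neg φ (mulFA x b)) (cong ℤ.-_ (ev-mul φ x b)))))
    ; F-V = λ e x → mk≃ λ φ h → trans (ev-mul φ (Vs e x) b) (trans (ev-V _ e x) (trans (ev-cong x λ u f → ev-cong b λ w g → cong (φ (u ++ w)) (ℤP.+-assoc e f g)) (sym (trans (ev-V φ e (mulFA x b)) (ev-mul (shift e φ) x b)))))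
    ; F-[] = ≃-refl }

  -- Coordinates with respect to the Kazhdan-Lusztig basis.

  All-Q : Word → ℤ → Set
  All-Q _ _ = ⊤

  Span-C : ∀ s {x} → Span All-Q x → Span All-Q (C· s x)
  Span-C s = Span-Lin (mulˡ-Lin (Cg s)) λ {w} {e} {C} k _ → Span-V {Q = All-Q} e (λ _ → tt) (one k (upL? w s))
    where
    one : ∀ {w C} → KL w C → UpL w s ⊎ DnL w s → Span All-Q (C· s C)
    one {w} {C} k (inj₁ p) = Span-map (λ _ → tt) (expand (C· s C) (C-Latt {s} {w} k p))
    one {w} {C} k (inj₂ p) = s≃ (≃-sym (C²-lemma (KL-Fac {w} {C} {s} k p))) (s+ (sgen {w = w} {e = i1} {C = C} k tt) (sgen {w = w} {e = -1ᶻ} {C = C} k tt))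

  Span-T : ∀ u → Span All-Q (T u)
  Span-T [] = s≃ (V0 (T [])) (sgen {w = []} {e = i0} {C = T []} (proj₁ (proj₂ (exists 0 [] Red-[] z≤n))) tt)
  Span-T (s ∷ u) = s≃ (mk≃ {C· s (T u) ++ negFA (Vs -1ᶻ (T u))} {T (s ∷ u)} λ φ h → trans (ev-minus φ (C· s (T u)) (Vs -1ᶻ (T u))) (trans (cong₂ (λ a b → a ℤ.+ ℤ.- b) (trans (ev-C φ s (T u)) (ev-T (cl s φ) u)) (trans (ev-V φ -1ᶻ (T u)) (ev-T (shift -1ᶻ φ) u)))
       (trans (l (φ (s ∷ u) i0) (φ u (-1ᶻ ℤ.+ i0))) (sym (ev-T φ (s ∷ u))))))
     (s+ (Span-C s (Span-T u)) (s- (Span-V {Q = All-Q} -1ᶻ (λ _ → tt) (Span-T u))))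
    where l : ∀ a b → (a ℤ.+ b) ℤ.+ ℤ.- b ≡ a
          l = solve-∀

  Span-all : ∀ x → Span All-Q x
  Span-all [] = s[]
  Span-all ((c , u) ∷ x) = s+ {x = (c , u) ∷ []} (lau c) (Span-all x)
    where
    lau : ∀ c → Span All-Q ((c , u) ∷ [])
    lau [] = s≃ (mk≃ λ φ h → refl) s[]
    lau ((a , e) ∷ c) = s≃ (mk≃ λ φ h → trans (ev-++ φ (sc a (Vs e (T u))) ((c , u) ∷ [])) (trans (cong₂ ℤ._+_ (trans (ev-sc φ a (Vs e (T u))) (cong (ℤ._*_ a) (trans (ev-V φ e (T u)) (trans (ev-T (shift e φ) u) (cong (φ u) (ℤP.+-identityʳ e)))))) (ev-single φ c u))
        (sym (ev-single φ ((a , e) ∷ c) u))))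
      (s+ (Span-sc a (Span-V {Q = All-Q} e (λ _ → tt) (Span-T u))) (lau c))

  vpow-vanish : ∀ y j u p → Reduced u → InVPow -1ᶻ p → evL (τ y (+ j) u) p ≡ i0
  vpow-vanish y j u p hu iv = trans (evL-cong p (τ-red y (+ j) u hu)) (go (u ∼? y))
    where
    go : Dec (u ∼ y) → evL (δC y (+ j) u) p ≡ i0
    go (yes q) = trans (evL-cong p λ e → δC-yes q) (trans (sym (coeffL-ev p (+ j))) (iv (+ j) -<+))
    go (no q) = trans (evL-cong p λ e → δC-no q) (evL-0 p)

  IsKL⇒KL : ∀ {w C} → IsKL w C → KL w C
  IsKL⇒KL {w} {C} (h , b , L , al , eq) = record { isRed = h ; isBar = ≈H⇒≃ {barFA C} {C} b ; isNeg = λ y k → coef y (suc k) (neg0 y k) ; isTop = λ y → trans (coef' y 0) (symδ y) }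
    where
    low0 : ∀ y j L → All (λ { (p , u) → Reduced u × InVPow (ℤ.- + 1) p }) L → co y (+ j) L ≡ i0
    low0 y j [] [] = refl
    low0 y j ((p , u) ∷ L) ((hu , iv) ∷ a) = trans (cong₂ ℤ._+_ (vpow-vanish y j u p hu iv) (low0 y j L a)) refl
    coef' : ∀ y j → co y (+ j) C ≡ δC y (+ j) w i0
    coef' y j = trans (at (≈H⇒≃ {C} {(oneL , w) ∷ L} eq) (τ y (+ j)) (HF-τ y (+ j))) (trans (cong₂ ℤ._+_ (trans (ℤP.+-identityʳ (i1 ℤ.* τ y (+ j) w i0)) (trans (ℤP.*-identityˡ (τ y (+ j) w i0)) (τ-red y (+ j) w h i0))) (low0 y j L al)) (ℤP.+-identityʳ _))
    coef : ∀ y j → δC y (+ j) w i0 ≡ i0 → co y (+ j) C ≡ i0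
    coef y j e = trans (coef' y j) e
    neg0 : ∀ y k → δC y (+ suc k) w i0 ≡ i0
    neg0 y k with w ∼? y
    ... | yes p = trans (δC-yes p) refl
    ... | no q = δC-no q
    symδ : ∀ y → δC y i0 w i0 ≡ δC w i0 y i0
    symδ y with w ∼? y
    ... | yes p = trans (δC-yes p) (sym (δC-yes (∼sym p)))
    ... | no q = trans (δC-no q) (sym (δC-no λ p → q (∼sym p)))

  pick : Word → FA → Laurent
  pick u [] = []
  pick u ((c , u') ∷ x) with LP.≡-dec Fin._≟_ u' u
  ... | yes _ = c ++ pick u x
  ... | no _ = pick u x
  dropW : Word → FA → FA
  dropW u [] = []
  dropW u ((c , u') ∷ x) with LP.≡-dec Fin._≟_ u' u
  ... | yes _ = dropW u x
  ... | no _ = (c , u') ∷ dropW u x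

  pick-coeff : ∀ u x k → coeffL (pick u x) k ≡ coeffFA x u k
  pick-coeff u [] k = refl
  pick-coeff u ((c , u') ∷ x) k with LP.≡-dec Fin._≟_ u' u
  ... | yes _ = trans (coeffL-ev (c ++ pick u x) k) (trans (evL-++ (δℤ k) c (pick u x)) (cong₂ ℤ._+_ (sym (coeffL-ev c k)) (trans (sym (coeffL-ev (pick u x) k)) (pick-coeff u x k))))
  ... | no _ = pick-coeff u x k

  pick-ev : ∀ φ u x → evL (φ u) (pick u x) ℤ.+ ev φ (dropW u x) ≡ ev φ x
  pick-ev φ u [] = refl
  pick-ev φ u ((c , u') ∷ x) with LP.≡-dec Fin._≟_ u' u
  ... | yes refl = trans (cong (ℤ._+ ev φ (dropW u' x)) (evL-++ (φ u') c (pick u' x))) (trans (ℤP.+-assoc (evL (φ u') c) _ _) (cong (ℤ._+_ (evL (φ u') c)) (pick-ev φ u' x)))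
  ... | no _ = trans (l (evL (φ u) (pick u x)) (evL (φ u') c) (ev φ (dropW u x))) (cong (ℤ._+_ (evL (φ u') c)) (pick-ev φ u x))
    where l : ∀ a b c → a ℤ.+ (b ℤ.+ c) ≡ b ℤ.+ (a ℤ.+ c)
          l = solve-∀

  dropW-coeff : ∀ u x k → (∀ w → coeffFA x w k ≡ i0) → ∀ w → coeffFA (dropW u x) w k ≡ i0
  dropW-coeff u x k h w with LP.≡-dec Fin._≟_ w u
  ... | yes refl = self x
    where
    self : ∀ x → coeffFA (dropW w x) w k ≡ i0
    self [] = refl
    self ((c , u') ∷ x) with LP.≡-dec Fin._≟_ u' w
    ... | yes _ = self x
    ... | no q with LP.≡-dec Fin._≟_ u' w
    ...   | yes p = ⊥-elim (q p)
    ...   | no _ = self x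
  ... | no q = trans (oth x) (h w)
    where
    oth : ∀ x → coeffFA (dropW u x) w k ≡ coeffFA x w k
    oth [] = refl
    oth ((c , u') ∷ x) with LP.≡-dec Fin._≟_ u' u
    oth ((c , u') ∷ x) | yes refl with LP.≡-dec Fin._≟_ u' w
    ... | yes p = ⊥-elim (q (sym p))
    ... | no _ = oth x
    oth ((c , u') ∷ x) | no _ with LP.≡-dec Fin._≟_ u' w
    ... | yes _ = cong (ℤ._+_ (coeffL c k)) (oth x)
    ... | no _ = oth x

  -- `IsKL` restricts each listed coefficient separately, so entries with the same word have to be
  -- merged first: terms of degree at least 0 may cancel only between several entries.
  gather : ℕ → FA → FA
  gather zero x = []
  gather (suc f) [] = []
  gather (suc f) ((c , u) ∷ x) = (pick u ((c , u) ∷ x) , u) ∷ gather f (dropW u ((c , u) ∷ x))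

  dropW-len : ∀ u x → length (dropW u x) ≤ length x
  dropW-len u [] = z≤n
  dropW-len u ((c , u') ∷ x) with LP.≡-dec Fin._≟_ u' u
  ... | yes _ = ≤-trans (dropW-len u x) (n≤1+n _)
  ... | no _ = s≤s (dropW-len u x)

  dropW-head : ∀ c u x → length (dropW u ((c , u) ∷ x)) ≤ length x
  dropW-head c u x with LP.≡-dec Fin._≟_ u u
  ... | yes _ = dropW-len u x
  ... | no q = ⊥-elim (q refl)

  dropW-Can : ∀ u x → Can x → Can (dropW u x)
  dropW-Can u [] [] = []
  dropW-Can u ((c , u') ∷ x) (p ∷ q) with LP.≡-dec Fin._≟_ u' u
  ... | yes _ = dropW-Can u x q
  ... | no _ = p ∷ dropW-Can u x q

  gather-ev : ∀ f x → length x ≤ f → ∀ φ → ev φ (gather f x) ≡ ev φ x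
  gather-ev zero [] le φ = refl
  gather-ev (suc f) [] le φ = refl
  gather-ev (suc f) ((c , u) ∷ x) (s≤s le) φ = trans (cong (ℤ._+_ (evL (φ u) (pick u ((c , u) ∷ x)))) (gather-ev f _ (≤-trans (dropW-head c u x) le) φ)) (pick-ev φ u ((c , u) ∷ x))

  gather-ok : ∀ f x → Can x → All (λ { (p , u) → nf u ≡ u × (∀ k → (∀ w → coeffFA x w k ≡ i0) → coeffL p k ≡ i0) }) (gather f x)
  gather-ok zero x c = []
  gather-ok (suc f) [] c = []
  gather-ok (suc f) ((c , u) ∷ x) (q ∷ qs) = (q , λ k h → trans (pick-coeff u ((c , u) ∷ x) k) (h u)) ∷
    All.map (λ { {p , u'} (a , b) → a , λ k h → b k (dropW-coeff u ((c , u) ∷ x) k h) }) (gather-ok f (dropW u ((c , u) ∷ x)) (dropW-Can u ((c , u) ∷ x) (q ∷ qs)))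

  can-zero : ∀ x → Can x → ∀ w k → co w k x ≡ i0 → coeffFA x w k ≡ i0
  can-zero x cx w k h with LP.≡-dec Fin._≟_ (nf w) w
  ... | yes q = trans (coeff-ev x w k) (trans (ev-cong-All x (All.map (λ {p} c e → trans (cong₂ (λ a b → δW a k b e) (sym q) (sym c)) (sym (τ-red w k (proj₂ p) (can-red c) e))) cx)) h)
  ... | no q = trans (coeff-ev x w k) (trans (ev-cong-All {ψ = λ _ _ → i0} x (All.map (λ {p} c e → dif (proj₂ p) c e) cx)) (ev-0 x))
    where
    dif : ∀ u → nf u ≡ u → ∀ e → δW w k u e ≡ i0
    dif u c e with LP.≡-dec Fin._≟_ u w
    ... | yes refl = ⊥-elim (q c)
    ... | no _ = refl

  KL⇒IsKL : ∀ {w C} → KL w C → IsKL w C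
  KL⇒IsKL {w} {C} kl = isRed kl , ≃⇒≈H (isBar kl) , L , All.map (λ { {p , u} (a , b) → can-red a , inv p b }) ok , ≃⇒≈H eq
    where
    x = C ++ negFA (T w)
    nx = norm x
    x' = proj₁ nx
    cx : Can x'
    cx = proj₁ (proj₂ nx)
    ex : x ≃ x'
    ex = ≋⇒≃ (proj₂ (proj₂ (proj₂ nx)))
    L = gather (length x') x'
    ok = gather-ok (length x') x' cx
    coz : ∀ y j → co y (+ j) x ≡ i0
    coz y j = trans (ev-minus (τ y (+ j)) C (T w)) (m-m (trans (lem j) (sym (trans (ev-T (τ y (+ j)) w) (τ-red y (+ j) w (isRed kl) i0)))))
      where
      lem : ∀ j → co y (+ j) C ≡ δC y (+ j) w i0
      lem zero with w ∼? y
      ... | yes p = trans (isTop kl y) (trans (δC-yes (∼sym p)) (sym (δC-yes p)))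
      ... | no q = trans (isTop kl y) (trans (δC-no λ p → q (∼sym p)) (sym (δC-no q)))
      lem (suc j) with w ∼? y
      ... | yes p = trans (isNeg kl y j) (sym (δC-yes p))
      ... | no q = trans (isNeg kl y j) (sym (δC-no q))
    zeroAt : ∀ j u → coeffFA x' u (+ j) ≡ i0
    zeroAt j u = can-zero x' cx u (+ j) (trans (sym (at ex (τ u (+ j)) (HF-τ u (+ j)))) (coz u j))
    inv : ∀ p → (∀ k → (∀ u → coeffFA x' u k ≡ i0) → coeffL p k ≡ i0) → InVPow (ℤ.- + 1) p
    inv p b (+ j) lt = b (+ j) (zeroAt j)
    inv p b -[1+ j ] (-<- ())
    eq : C ≃ (oneL , w) ∷ L
    eq .at φ h = trans (l (ev φ C) (ev φ (T w))) (trans (cong (ℤ._+_ (ev φ (T w))) (trans (sym (ev-minus φ C (T w))) (trans (at ex φ h) (sym (gather-ev (length x') x' ≤-refl φ)))))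
        (cong (ℤ._+ ev φ L) (ev-single φ oneL w)))
      where l : ∀ a b → a ≡ b ℤ.+ (a ℤ.+ ℤ.- b)
            l = solve-∀

  -- the coefficient of vᵏ C_w
  under : ℕ → FA → FA
  under k [] = []
  under k ((c , u) ∷ x) with length u ℕ.<? k
  ... | yes _ = (c , u) ∷ under k x
  ... | no _ = under k x

  under-ok : ∀ k x → Can x → Can (under k x) × All (λ p → length (proj₂ p) < k) (under k x)
  under-ok k [] [] = [] , []
  under-ok k ((c , u) ∷ x) (p ∷ q) with length u ℕ.<? k | under-ok k x q
  ... | yes l | a , b = p ∷ a , l ∷ b
  ... | no _ | r = r

  under-co : ∀ k x → Can x → ∀ z e → Reduced z → length z < k → co z e (under k x) ≡ co z e x
  under-co k [] c z e hz lz = refl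
  under-co k ((a , u) ∷ x) (c ∷ cs) z e hz lz with length u ℕ.<? k
  ... | yes _ = cong (ℤ._+_ (evL (τ z e u) a)) (under-co k x cs z e hz lz)
  ... | no g = trans (under-co k x cs z e hz lz) (trans (sym (ℤP.+-identityˡ _)) (cong (ℤ._+ co z e x)
       (sym (trans (evL-cong a λ f → trans (τ-red z e u (can-red c) f) (δC-no λ r → g (subst (_< k) (Red-length hz (can-red c) (∼sym r)) lz))) (evL-0 a)))))

  low-of : ∀ k x → (∀ z e → Reduced z → k ≤ length z → co z e x ≡ i0) → Low k x
  low-of k x h with norm x
  ... | x' , c , _ , ex = under k x' , proj₁ (under-ok k x' c) , proj₂ (under-ok k x' c) ,
      co-≃ λ w e → trans (co-resp e x (∼sym (red-∼ w))) (trans (pt (red w) e (red-Red w)) (co-resp e (under k x') (red-∼ w)))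
    where
    pt : ∀ z e → Reduced z → co z e x ≡ co z e (under k x')
    pt z e hz with length z ℕ.<? k
    ... | yes l = trans (at (≋⇒≃ ex) (τ z e) (HF-τ z e)) (sym (under-co k x' c z e hz l))
    ... | no g = trans (h z e hz (≮⇒≥ g)) (sym (co-short z e (under k x') hz (proj₁ (under-ok k x' c)) (All.map (λ q → <-≤-trans q (≮⇒≥ g)) (proj₂ (under-ok k x' c)))))

  abstract
    tail-low : ∀ u → Low (length (nf u)) (KC u ++ negFA (T (nf u)))
    tail-low u = low-of (length (nf u)) _ λ z e hz lz → trans (ev-minus (τ z e) (KC u) (T (nf u))) (m-m (go z e hz lz (z ∼? nf u)))
      where
      go : ∀ z e → Reduced z → length (nf u) ≤ length z → Dec (z ∼ nf u) → co z e (KC u) ≡ co z e (T (nf u))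
      go z e hz lz (no q) = trans (KL-supp (KC-KL u) z e hz lz q) (sym (trans (ev-T (τ z e) (nf u)) (trans (τ-red z e (nf u) (nf-Red u) i0) (δC-no λ p → q (∼sym p)))))
      go z e hz lz (yes q) = trans (co-resp e (KC u) q) (trans (KL-lead (KC-KL u) e) (trans (δC-yes {nf u} {i0} {nf u} {e} ∼refl) (sym (trans (ev-T (τ z e) (nf u)) (trans (τ-red z e (nf u) (nf-Red u) i0) (trans (δC-yes (∼sym q)) (δℤ-bij {e} {i0} {i0} {e} sym sym)))))))

  tl : Word → FA
  tl u = proj₁ (tail-low u)
  tl-Can : ∀ u → Can (tl u)
  tl-Can u = proj₁ (proj₂ (tail-low u))
  tl-len : ∀ u → All (λ p → length (proj₂ p) < length (nf u)) (tl u)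
  tl-len u = proj₁ (proj₂ (proj₂ (tail-low u)))
  tl-≃ : ∀ u → KC u ++ negFA (T (nf u)) ≃ tl u
  tl-≃ u = proj₂ (proj₂ (proj₂ (tail-low u)))

  -- The dual basis by triangular inversion. As C_u is T_u plus the shorter words of `tl u`, a
  -- functional with prescribed values on the C_u must send T_u to the prescribed value minus its
  -- value on the tail. The number f is fuel; all amounts above the length of u give the same value.
  module Coord (w : Word) (k : ℤ) where
    G : ℕ → Word → ℤ → ℤ
    G zero u e = i0
    G (suc f) u e = δC w k u e ℤ.+ ℤ.- ev (λ u' e' → G f u' (e ℤ.+ e')) (tl u)

    G-fuel : ∀ f f' u → nf u ≡ u → length u < f → length u < f' → ∀ e → G f u e ≡ G f' u e
    G-fuel (suc f) (suc f') u c (s≤s l) (s≤s l') e = cong (λ t → δC w k u e ℤ.+ ℤ.- t)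
      (ev-cong-All (tl u) (All.zipWith (λ {p} (cp , lp) e' → G-fuel f f' (proj₂ p) cp (<-≤-trans (subst (length (proj₂ p) <_) (cong length c) lp) l) (<-≤-trans (subst (length (proj₂ p) <_) (cong length c) lp) l') (e ℤ.+ e')) (tl-Can u , tl-len u)))

    g : Fun
    g u e = G (suc (length (nf u))) (nf u) e

    g-Inv : Inv g
    g-Inv p e = cong (λ z → G (suc (length z)) z e) (nf-resp p)

  Dk : Word → ℤ → Fun
  Dk w k = ext (Coord.g w k)
  HF-D : ∀ w k → HF (Dk w k)
  HF-D w k = HF-ext (Coord.g-Inv w k)

  D-KC : ∀ w k c e → nf c ≡ c → ev (Dk w k) (Vs e (KC c)) ≡ δC w k c e
  D-KC w k c e cc = trans (ev-V (Dk w k) e (KC c)) (trans (l (ev φ (KC c)) (ev φ (T (nf c)))) (trans (cong₂ ℤ._+_ head (trans (sym (ev-minus φ (KC c) (T (nf c)))) (trans (at (tl-≃ c) φ (HF-shift e (HF-D w k))) tail)))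
      (l' (δC w k c e) _)))
    where
    open Coord w k
    φ = shift e (Dk w k)
    l : ∀ a b → a ≡ b ℤ.+ (a ℤ.+ ℤ.- b)
    l = solve-∀
    l' : ∀ a b → (a ℤ.+ ℤ.- b) ℤ.+ b ≡ a
    l' = solve-∀
    onCan : ∀ u → nf u ≡ u → ∀ j → Dk w k u j ≡ G (suc (length u)) u j
    onCan u cu j = trans (ext-red u (can-red cu) g j) (cong (λ z → G (suc (length z)) z j) cu)
    head : ev φ (T (nf c)) ≡ δC w k c e ℤ.+ ℤ.- ev (λ u' e' → G (length c) u' (e ℤ.+ e')) (tl c)
    head = trans (ev-T φ (nf c)) (trans (cong₂ (Dk w k) cc (ℤP.+-identityʳ e)) (onCan c cc e))
    tail : ev φ (tl c) ≡ ev (λ u' e' → G (length c) u' (e ℤ.+ e')) (tl c)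
    tail = ev-cong-All (tl c) (All.zipWith (λ {p} (cp , lp) j → trans (onCan (proj₂ p) cp (e ℤ.+ j)) (G-fuel _ _ (proj₂ p) cp ≤-refl (subst (length (proj₂ p) <_) (cong length cc) lp) (e ℤ.+ j))) (tl-Can c , tl-len c))

  D-KL : ∀ w k {z C} → KL z C → ∀ e → ev (Dk w k) (Vs e C) ≡ δC w k z e
  D-KL w k {z} {C} kl e = trans (at (Vs-cong e (KL-unique (∼trans (∼sym (nf-∼ z)) (∼sym (nf-∼ (nf z)))) kl (KC-KL (nf z)))) (Dk w k) (HF-D w k))
    (trans (D-KC w k (nf z) e (nf-idem z)) (δC-Inv w k (nf-∼ z) e))

  Supp : (Word → ℤ → Set) → FA → Set
  Supp Q x = ∀ w k → ev (Dk w k) x ≢ i0 → Q w k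

  record Resp (Q : Word → ℤ → Set) : Set where
    constructor mkResp
    field along : ∀ {w w' e} → w ∼ w' → Q w e → Q w' e
  open Resp public

  Span⇒Supp : ∀ {Q x} → Resp Q → Span Q x → Supp Q x
  Span⇒Supp {Q} r (sgen {z} {e} kl q) w k ne with z ∼? w
  ... | no p = ⊥-elim (ne (trans (D-KL w k kl e) (δC-no p)))
  ... | yes p with e ℤ.≟ k
  ...   | yes refl = along r p q
  ...   | no f = ⊥-elim (ne (trans (D-KL w k kl e) (trans (δC-yes p) (δℤ-ne f))))
  Span⇒Supp r s[] w k ne = ⊥-elim (ne refl)
  Span⇒Supp r (s+ {x} {y} a b) w k ne with ev (Dk w k) x ℤ.≟ i0
  ... | no p = Span⇒Supp r a w k p
  ... | yes p = Span⇒Supp r b w k λ q → ne (trans (ev-++ (Dk w k) x y) (cong₂ ℤ._+_ p q))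
  Span⇒Supp r (s- {x} a) w k ne = Span⇒Supp r a w k λ q → ne (trans (ev-neg (Dk w k) x) (cong ℤ.-_ q))
  Span⇒Supp r (s≃ p a) w k ne = Span⇒Supp r a w k λ q → ne (trans (sym (at p (Dk w k) (HF-D w k))) q)

  private

    comb : List (ℤ × Ky) → FA
    comb [] = []
    comb ((a , w , e) ∷ l) = sc a (Vs e (KC w)) ++ comb l

    val : Fun → Ky → ℤ
    val φ (w , e) = ev φ (Vs e (KC w))

    comb-ev : ∀ φ l → ev φ (comb l) ≡ KS.sum (val φ) l
    comb-ev φ [] = refl
    comb-ev φ ((a , w , e) ∷ l) = trans (ev-++ φ (sc a (Vs e (KC w))) (comb l)) (cong₂ ℤ._+_ (ev-sc φ a (Vs e (KC w))) (comb-ev φ l))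

    CanK : List (ℤ × Ky) → Set
    CanK = All (λ { (a , w , e) → nf w ≡ w })

    negK : List (ℤ × Ky) → List (ℤ × Ky)
    negK [] = []
    negK ((a , k) ∷ l) = (ℤ.- a , k) ∷ negK l

    toComb : ∀ {x} → Span All-Q x → ∃ λ l → CanK l × x ≃ comb l
    toComb (sgen {w} {e} {C} kl _) = (i1 , nf w , e) ∷ [] , nf-idem w ∷ [] ,
      mk≃ λ φ h → trans (at (Vs-cong e (KL-unique (∼trans (∼sym (nf-∼ w)) (∼sym (nf-∼ (nf w)))) kl (KC-KL (nf w)))) φ h)
        (sym (trans (ev-++ φ (sc i1 (Vs e (KC (nf w)))) []) (trans (ℤP.+-identityʳ _) (trans (ev-sc φ i1 (Vs e (KC (nf w)))) (ℤP.*-identityˡ _)))))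
    toComb s[] = [] , [] , ≃-refl
    toComb (s+ {x} {y} a b) with toComb a | toComb b
    ... | l , c , p | l' , c' , p' = l ++ l' , AllP.++⁺ c c' , ≃-trans (≃-++ p p') (app l l')
      where
      app : ∀ l l' → comb l ++ comb l' ≃ comb (l ++ l')
      app [] l' = ≃-refl
      app ((a , w , e) ∷ l) l' .at φ h = trans (cong (ev φ) (LP.++-assoc (sc a (Vs e (KC w))) (comb l) (comb l'))) (trans (ev-++ φ (sc a (Vs e (KC w))) (comb l ++ comb l')) (trans (cong (ℤ._+_ (ev φ (sc a (Vs e (KC w))))) (at (app l l') φ h)) (sym (ev-++ φ (sc a (Vs e (KC w))) (comb (l ++ l'))))))
    toComb (s- {x} a) with toComb a
    ... | l , c , p = negK l , can l c , mk≃ λ φ h → trans (ev-neg φ x) (trans (cong ℤ.-_ (trans (at p φ h) (comb-ev φ l))) (trans (ngs φ l) (sym (comb-ev φ (negK l)))))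
      where
      can : ∀ l → CanK l → CanK (negK l)
      can [] [] = []
      can ((a , k) ∷ l) (p ∷ q) = p ∷ can l q
      ngs : ∀ φ l → ℤ.- KS.sum (val φ) l ≡ KS.sum (val φ) (negK l)
      ngs φ [] = refl
      ngs φ ((a , k) ∷ l) = trans (ng a (val φ k) (KS.sum (val φ) l)) (cong (ℤ._+_ (ℤ.- a ℤ.* val φ k)) (ngs φ l))
        where ng : ∀ a b c → ℤ.- (a ℤ.* b ℤ.+ c) ≡ ℤ.- a ℤ.* b ℤ.+ ℤ.- c
              ng = solve-∀
    toComb (s≃ p a) with toComb a
    ... | l , c , q = l , c , ≃-trans (≃-sym p) q

    part : (Ky → Bool) → Bool → List (ℤ × Ky) → List (ℤ × Ky)
    part f b [] = []
    part f b ((a , k) ∷ l) with f k | b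
    ... | true | true = (a , k) ∷ part f b l
    ... | false | false = (a , k) ∷ part f b l
    ... | true | false = part f b l
    ... | false | true = part f b l

    part-sum : ∀ f ψ l → KS.sum ψ l ≡ KS.sum ψ (part f true l) ℤ.+ KS.sum ψ (part f false l)
    part-sum f ψ [] = refl
    part-sum f ψ ((a , k) ∷ l) with f k
    ... | true = trans (cong (ℤ._+_ (a ℤ.* ψ k)) (part-sum f ψ l)) (sym (ℤP.+-assoc (a ℤ.* ψ k) _ _))
    ... | false = trans (cong (ℤ._+_ (a ℤ.* ψ k)) (part-sum f ψ l)) (lm (a ℤ.* ψ k) (KS.sum ψ (part f true l)) _)
      where lm : ∀ a b c → a ℤ.+ (b ℤ.+ c) ≡ b ℤ.+ (a ℤ.+ c)
            lm = solve-∀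

    part-absent : ∀ f j → f j ≡ true → ∀ l → KS.sum (KS.δ j) (part f false l) ≡ i0
    part-absent f j q [] = refl
    part-absent f j q ((a , k) ∷ l) with f k in eq
    ... | true = part-absent f j q l
    ... | false = trans (cong₂ (λ x y → a ℤ.* x ℤ.+ y) (KS.δ-ne λ { refl → absurd (trans (sym eq) q) }) (part-absent f j q l)) (trans (ℤP.+-identityʳ _) (ℤP.*-zeroʳ a))
      where absurd : ∀ {A : Set} → false ≡ true → A
            absurd ()

    part-absent' : ∀ f j → f j ≡ false → ∀ l → KS.sum (KS.δ j) (part f true l) ≡ i0
    part-absent' f j q [] = refl
    part-absent' f j q ((a , k) ∷ l) with f k in eq
    ... | false = part-absent' f j q l
    ... | true = trans (cong₂ (λ x y → a ℤ.* x ℤ.+ y) (KS.δ-ne λ { refl → absurd (trans (sym eq) q) }) (part-absent' f j q l)) (trans (ℤP.+-identityʳ _) (ℤP.*-zeroʳ a))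
      where absurd : ∀ {A : Set} → true ≡ false → A
            absurd ()

    sum-congC : ∀ {ψ χ} l → CanK l → (∀ w e → nf w ≡ w → ψ (w , e) ≡ χ (w , e)) → KS.sum ψ l ≡ KS.sum χ l
    sum-congC [] [] h = refl
    sum-congC ((a , w , e) ∷ l) (p ∷ q) h = cong₂ (λ x y → a ℤ.* x ℤ.+ y) (h w e p) (sum-congC l q h)

    valD : ∀ w k u e → nf w ≡ w → nf u ≡ u → val (Dk w k) (u , e) ≡ KS.δ (w , k) (u , e)
    valD w k u e cw cu = trans (D-KC w k u e cu) (go (LP.≡-dec Fin._≟_ u w) (e ℤ.≟ k))
      where
      go : Dec (u ≡ w) → Dec (e ≡ k) → δC w k u e ≡ KS.δ (w , k) (u , e)
      go (yes refl) (yes refl) = trans (δC-yes {u} {e} {u} {e} ∼refl) (trans (δℤ-refl e) (sym (KS.δ-refl (u , e))))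
      go (yes refl) (no q) = trans (δC-yes {u} {k} {u} {e} ∼refl) (trans (δℤ-ne q) (sym (KS.δ-ne λ { refl → q refl })))
      go (no q) _ = trans (δC-no {w} {k} {u} {e} λ p → q (trans (sym cu) (trans (nf-resp p) cw))) (sym (KS.δ-ne λ { refl → q refl }))

  -- Any x is a combination of vᵉC_w in some way. Split by whether the coordinate of x at the key
  -- vanishes: the terms with vanishing coordinate add up to 0, and `Q` holds at all other keys.
  Supp⇒Span : ∀ {Q x} → Supp Q x → Span Q x
  Supp⇒Span {Q} {x} sp with toComb (Span-all x)
  ... | l , c , p = s≃ (≃-sym (mk≃ λ φ h → trans (at p φ h) (trans (comb-ev φ l) (trans (part-sum f (val φ) l)
         (trans (cong (ℤ._+_ (KS.sum (val φ) l₁)) (KS.sum-zero l₀ zero₀ (val φ))) (trans (ℤP.+-identityʳ _) (sym (comb-ev φ l₁)))))))) (good l₁ (canP true l c) all₁)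
    where
    f : Ky → Bool
    f (w , k) with ev (Dk w k) x ℤ.≟ i0
    ... | yes _ = false
    ... | no _ = true
    f-true : ∀ w k → f (w , k) ≡ true → ev (Dk w k) x ≢ i0
    f-true w k e with ev (Dk w k) x ℤ.≟ i0
    ... | no q = q
    f-false : ∀ w k → f (w , k) ≡ false → ev (Dk w k) x ≡ i0
    f-false w k e with ev (Dk w k) x ℤ.≟ i0
    ... | yes q = q
    l₁ = part f true l
    l₀ = part f false l
    canP : ∀ b l → CanK l → CanK (part f b l)
    canP b [] [] = []
    canP b ((a , k) ∷ l) (p ∷ q) with f k | b
    ... | true | true = p ∷ canP true l q
    ... | false | false = p ∷ canP false l q
    ... | true | false = canP false l q
    ... | false | true = canP true l q
    all₁ : All (λ { (a , w , k) → f (w , k) ≡ true }) l₁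
    all₁ = go l
      where
      go : ∀ l → All (λ { (a , w , k) → f (w , k) ≡ true }) (part f true l)
      go [] = []
      go ((a , w , k) ∷ l) with f (w , k) in eq
      ... | true = eq ∷ go l
      ... | false = go l
    zero₀ : ∀ j → KS.sum (KS.δ j) l₀ ≡ i0
    zero₀ (w , k) with f (w , k) in eq | LP.≡-dec Fin._≟_ (nf w) w
    ... | true | _ = part-absent f (w , k) eq l
    ... | false | yes cw = trans (sym (trans (cong (ℤ._+ KS.sum (KS.δ (w , k)) l₀) (part-absent' f (w , k) eq l)) (ℤP.+-identityˡ _)))
          (trans (sym (part-sum f (KS.δ (w , k)) l)) (trans (sym (sum-congC l c λ u e cu → valD w k u e cw cu)) (trans (sym (comb-ev (Dk w k) l)) (trans (sym (at p (Dk w k) (HF-D w k))) (f-false w k eq)))))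
    ... | false | no nw = trans (sum-congC {χ = λ _ → i0} l₀ (canP false l c) λ u e cu → KS.δ-ne λ { refl → nw cu }) (z l₀)
      where
      z : ∀ l → KS.sum (λ _ → i0) l ≡ i0
      z [] = refl
      z ((a , k) ∷ l) = trans (cong₂ ℤ._+_ (ℤP.*-zeroʳ a) (z l)) refl
    good : ∀ l → CanK l → All (λ { (a , w , k) → f (w , k) ≡ true }) l → Span Q (comb l)
    good [] [] [] = s[]
    good ((a , w , k) ∷ l) (p ∷ q) (t ∷ ts) = s+ (Span-sc a (sgen (KL-resp (can-red p) (nf-∼ w) (KC-KL w)) (sp w k (f-true w k t)))) (good l q ts)

  -- The C_w are a basis, so membership is tested coordinate by coordinate. The use is to collect
  -- descents: an element of both C_p H and C_q H involves only z having p and q as left descents.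
  Span-∩ : ∀ {Q Q' x} → Resp Q → Resp Q' → Span Q x → Span Q' x → Span (λ w e → Q w e × Q' w e) x
  Span-∩ r r' a b = Supp⇒Span λ w k ne → Span⇒Supp r a w k ne , Span⇒Supp r' b w k ne

  -- in an expansion the coefficient of C_z is read off by the functionals D
  expansion-coeff : ∀ {P E} → IsExpansion P E → ∀ z k → All (λ { (h , z' , _) → z' ∼ z → coeffL h k ≡ ev (Dk z k) P }) E
  expansion-coeff {P} {E} (kls , dist , eq) z k = All.map (λ f p → trans (f p) (sym (at (≈H⇒≃ {P} {SE E} eq) (Dk z k) (HF-D z k)))) (go E kls dist)
    where
    SE : List (Laurent × Word × FA) → FA
    SE = concatMap (λ { (h , z , C) → scaleFA h C })
    term : ∀ h z' C → IsKL z' C → ev (Dk z k) (scaleFA h C) ≡ evL (λ e → δC z k z' e) h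
    term h z' C kl = trans (ev-scale (Dk z k) h C) (evL-cong h λ e → trans (sym (ev-V (Dk z k) e C)) (D-KL z k (IsKL⇒KL {z'} {C} kl) e))
    yes' : ∀ h z' C → IsKL z' C → z' ∼ z → ev (Dk z k) (scaleFA h C) ≡ coeffL h k
    yes' h z' C kl p = trans (term h z' C kl) (trans (evL-cong h λ e → δC-yes p) (sym (coeffL-ev h k)))
    no' : ∀ h z' C → IsKL z' C → ¬ (z' ∼ z) → ev (Dk z k) (scaleFA h C) ≡ i0
    no' h z' C kl p = trans (term h z' C kl) (trans (evL-cong h λ e → δC-no p) (evL-0 h))
    rest0 : ∀ E → All (λ { (h , z , C) → IsKL z C }) E → All (λ { (_ , z' , _) → ¬ (z' ∼ z) }) E → ev (Dk z k) (SE E) ≡ i0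
    rest0 [] [] [] = refl
    rest0 ((h , z' , C) ∷ E) (kl ∷ kls) (q ∷ qs) = trans (ev-++ (Dk z k) (scaleFA h C) (SE E)) (cong₂ ℤ._+_ (no' h z' C kl q) (rest0 E kls qs))
    go : ∀ E → All (λ { (h , z , C) → IsKL z C }) E → AllPairs (λ { (_ , z , _) (_ , z' , _) → ¬ (z ∼ z') }) E →
         All (λ { (h , z' , _) → z' ∼ z → coeffL h k ≡ ev (Dk z k) (SE E) }) E
    go [] [] [] = []
    go ((h , z' , C) ∷ E) (kl ∷ kls) (d ∷ ds) =
      (λ p → trans (sym (yes' h z' C kl p)) (trans (sym (ℤP.+-identityʳ _)) (trans (cong (ℤ._+_ (ev (Dk z k) (scaleFA h C))) (sym (rest0 E kls (All.map (λ q r → q (∼trans p (∼sym r))) d)))) (sym (ev-++ (Dk z k) (scaleFA h C) (SE E))))))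
      ∷ All.zipWith (λ { {h₂ , z₂ , C₂} (f , q) p → trans (f p) (sym (trans (ev-++ (Dk z k) (scaleFA h C) (SE E)) (trans (cong (ℤ._+ ev (Dk z k) (SE E)) (no' h z' C kl λ r → q (∼trans r (∼sym p)))) (ℤP.+-identityˡ _)))) }) (go E kls ds , d)

  -- The anti-automorphism induced by reversing words.

  rv : FA → FA
  rv [] = []
  rv ((c , u) ∷ x) = (c , reverse u) ∷ rv x

  revF : Fun → Fun
  revF φ u e = φ (reverse u) e

  ev-rv : ∀ φ x → ev φ (rv x) ≡ ev (revF φ) x
  ev-rv φ [] = refl
  ev-rv φ ((c , u) ∷ x) = cong (ℤ._+_ (evL (φ (reverse u)) c)) (ev-rv φ x)

  rev-mid : ∀ (a c b : Word) → reverse (a ++ c ++ b) ≡ reverse b ++ reverse c ++ reverse a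
  rev-mid a c b = trans (LP.reverse-++ a (c ++ b)) (trans (cong (_++ reverse a) (LP.reverse-++ c b)) (LP.++-assoc (reverse b) _ _))

  HF-rev : ∀ {φ} → HF φ → HF (revF φ)
  HF-rev {φ} h .quadF a b s e = trans (cong (λ z → φ z e) (rev-mid a (s ∷ s ∷ []) b)) (trans (quadF h (reverse b) (reverse a) s e)
     (cong₂ (λ x y → φ x e ℤ.+ (φ y (e ℤ.+ i1) ℤ.+ ℤ.- φ y (e ℤ.+ -1ᶻ))) (sym (rev-mid a [] b)) (sym (rev-mid a (s ∷ []) b))))
  HF-rev {φ} h .braidF a b s t e = trans (cong (λ z → φ z e) (rev-mid a _ b)) (trans (core (rev-alt (m s t))) (cong (λ z → φ z e) (sym (rev-mid a _ b))))
    where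
    core : _ → φ (reverse b ++ reverse (alt s t (m s t)) ++ reverse a) e ≡ φ (reverse b ++ reverse (alt t s (m s t)) ++ reverse a) e
    core (inj₁ f) rewrite proj₁ (f s t) | proj₁ (f t s) = braidF h (reverse b) (reverse a) s t e
    core (inj₂ f) rewrite proj₁ (f s t) | proj₁ (f t s) = sym (braidF h (reverse b) (reverse a) s t e)

  rv-cong : ∀ {x y} → x ≃ y → rv x ≃ rv y
  rv-cong {x} {y} p .at φ h = trans (ev-rv φ x) (trans (at p (revF φ) (HF-rev h)) (sym (ev-rv φ y)))

  rv² : ∀ x → rv (rv x) ≃ x
  rv² x .at φ h = trans (ev-rv φ (rv x)) (trans (ev-rv (revF φ) x) (ev-cong x λ u e → cong (λ z → φ z e) (rev² u)))

  ev-comm : ∀ (Φ : Word → ℤ → Word → ℤ → ℤ) x y → ev (λ u e → ev (Φ u e) y) x ≡ ev (λ w f → ev (λ u e → Φ u e w f) x) y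
  ev-comm Φ [] y = sym (ev-0 y)
  ev-comm Φ ((c , u) ∷ x) y = trans (cong₂ ℤ._+_ (sym (ev-evL (Φ u) c y)) (ev-comm Φ x y)) (sym (ev-+ (λ w f → evL (λ e → Φ u e w f) c) (λ w f → ev (λ u e → Φ u e w f) x) y))

  rv-mul : ∀ x y → rv (mulFA x y) ≃ mulFA (rv y) (rv x)
  rv-mul x y .at φ h = trans (ev-rv φ (mulFA x y)) (trans (ev-mul (revF φ) x y) (trans (ev-comm (λ u e w f → φ (reverse (u ++ w)) (e ℤ.+ f)) x y)
     (trans (ev-cong y λ w f → trans (ev-cong x λ u e → cong₂ φ (LP.reverse-++ u w) (ℤP.+-comm e f)) (sym (ev-rv (λ u e → φ (reverse w ++ u) (f ℤ.+ e)) x)))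
       (trans (sym (ev-rv (λ w f → ev (λ u e → φ (w ++ u) (f ℤ.+ e)) (rv x)) y)) (sym (ev-mul φ (rv y) (rv x)))))))

  prodInv-++ : ∀ u w → mulFA (prodInv u) (prodInv w) ≃ prodInv (u ++ w)
  prodInv-++ [] w .at φ h = trans (ev-mul φ (T []) (prodInv w)) (trans (ev-T (λ u e → ev (λ w f → φ (u ++ w) (e ℤ.+ f)) (prodInv w)) []) (ev-cong (prodInv w) λ v f → cong (φ v) (ℤP.+-identityˡ f)))
  prodInv-++ (s ∷ u) w = ≃-trans (mul-assoc (invT s) (prodInv u) (prodInv w)) (≃-mul (≃-refl {invT s}) (prodInv-++ u w))

  prodInv1 : ∀ s → prodInv (s ∷ []) ≃ invT s
  prodInv1 s .at φ h = refl

  rv-prodInv : ∀ u → rv (prodInv u) ≃ prodInv (reverse u)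
  rv-prodInv [] = ≃-refl
  rv-prodInv (s ∷ u) = ≃-trans (rv-mul (invT s) (prodInv u)) (≃-trans (≃-mul (rv-prodInv u) (≃-sym (prodInv1 s)))
     (subst (λ z → mulFA (prodInv (reverse u)) (prodInv (s ∷ [])) ≃ prodInv z) (sym (rev-cons u s)) (prodInv-++ (reverse u) (s ∷ []))))

  bar-rv : ∀ x → barFA (rv x) ≃ rv (barFA x)
  bar-rv x .at φ h = trans (ev-barF φ (rv x)) (trans (ev-rv (barF φ) x) (trans (ev-cong x λ u e → trans (sym (at (rv-prodInv u) (shift (ℤ.- e) φ) (HF-shift (ℤ.- e) h))) (ev-rv (shift (ℤ.- e) φ) (prodInv u)))
     (trans (sym (ev-barF (revF φ) x)) (sym (ev-rv φ (barFA x))))))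

  δC-rev : ∀ w k u e → δC w k (reverse u) e ≡ δC (reverse w) k u e
  δC-rev w k u e with u ∼? reverse w
  ... | yes p = trans (δC-yes (∼trans (∼-rev p) (≡⇒∼ (rev² w)))) (sym (δC-yes p))
  ... | no q = trans (δC-no {w} {k} {reverse u} {e} λ p → q (rev-∼ {u} {w} p)) (sym (δC-no q))

  co-rv : ∀ w k x → co w k (rv x) ≡ co (reverse w) k x
  co-rv w k x = trans (ev-rv (τ w k) x) (ev-cong x (HF-det (HF-rev (HF-τ w k)) (HF-τ (reverse w) k) λ u h e →
     trans (τ-red w k (reverse u) (Red-rev h) e) (trans (δC-rev w k u e) (sym (τ-red (reverse w) k u h e)))))

  KL-rv : ∀ {w C} → KL w C → KL (reverse w) (rv C)
  KL-rv {w} {C} kl = record { isRed = Red-rev (isRed kl) ; isBar = ≃-trans (bar-rv C) (rv-cong (isBar kl))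
    ; isNeg = λ y k → trans (co-rv y (+ suc k) C) (isNeg kl (reverse y) k)
    ; isTop = λ y → trans (co-rv y i0 C) (trans (isTop kl (reverse y)) (δC-rev w i0 y i0)) }

  Span-rv : ∀ {Q : Word → ℤ → Set} {x} → Span Q x → Span (λ w e → Q (reverse w) e) (rv x)
  Span-rv {Q} (sgen {w} {e} {C} kl q) = s≃ (mk≃ λ φ h → trans (ev-V φ e (rv C)) (trans (ev-rv (shift e φ) C) (sym (trans (ev-rv φ (Vs e C)) (ev-V (revF φ) e C)))))
     (sgen (KL-rv kl) (subst (λ z → Q z e) (sym (rev² w)) q))
  Span-rv s[] = s[]
  Span-rv (s+ {x} {y} a b) = s≃ (mk≃ λ φ h → trans (ev-++ φ (rv x) (rv y)) (trans (cong₂ ℤ._+_ (ev-rv φ x) (ev-rv φ y)) (sym (trans (ev-rv φ (x ++ y)) (ev-++ (revF φ) x y))))) (s+ (Span-rv a) (Span-rv b))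
  Span-rv (s- {x} a) = s≃ (mk≃ λ φ h → trans (ev-neg φ (rv x)) (trans (cong ℤ.-_ (ev-rv φ x)) (sym (trans (ev-rv φ (negFA x)) (ev-neg (revF φ) x))))) (s- (Span-rv a))
  Span-rv (s≃ p a) = s≃ (rv-cong p) (Span-rv a)

  CR : Fin n → FA → FA
  CR s x = mulFA x (Cg s)

  rv-C : ∀ s x → rv (C· s x) ≃ CR s (rv x)
  rv-C s x = rv-mul (Cg s) x

  -- Several descents at once, and good elements.

  -- two descents force the longest element of the dihedral group
  m-cases : ∀ {s t} → s ≢ t → (m s t ≡ 2) ⊎ (3 ≤ m s t)
  m-cases {s} {t} q = go (combo s t q)
    where
    go : ∀ {k a b} → Combo k a b → (k ≡ 2) ⊎ (3 ≤ k)
    go c2 = inj₁ refl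
    go c3 = inj₂ (s≤s (s≤s (s≤s z≤n)))
    go c4 = inj₂ (s≤s (s≤s (s≤s z≤n)))
    go c4' = inj₂ (s≤s (s≤s (s≤s z≤n)))
    go c5 = inj₂ (s≤s (s≤s (s≤s z≤n)))

  m≥3⇒≢ : ∀ {s t} → 3 ≤ m s t → s ≢ t
  m≥3⇒≢ {s} le refl with subst (3 ≤_) (mdiag s) le
  ... | s≤s ()

  bothR-def : ∀ {u s t} → s ≢ t → Reduced u → Dn u s → Dn u t → ∃ λ a → a ++ alt s t (m s t) ∼ u × length (a ++ alt s t (m s t)) ≡ length u
  bothR-def {u} {s} {t} q h ds dt with Coset.both s t q u h ds dt
  ... | a , f , l , _ = a , go (par cmb) , trans (LP.length-++ a) (trans (cong (length a ℕ.+_) (len-alt s t (m s t))) l)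
    where
    open Coset s t q
    par : ∀ {k a b} → Combo k a b → (altF false k ≡ altB false k) ⊎ (altF false k ≡ altB true k)
    par c2 = inj₂ refl
    par c3 = inj₁ refl
    par c4 = inj₂ refl
    par c4' = inj₂ refl
    par c5 = inj₁ refl
    go : _ → a ++ alt s t (m s t) ∼ u
    go (inj₁ e) = ∼trans (≡⇒∼ (cong (a ++_) (trans (alt-s (m s t)) (cong (map ι) e)))) (f false)
    go (inj₂ e) = ∼trans (≡⇒∼ (cong (a ++_) (trans (alt-s (m s t)) (cong (map ι) e)))) (f true)
  abstract
    bothR : ∀ {u s t} → s ≢ t → Reduced u → Dn u s → Dn u t → ∃ λ a → a ++ alt s t (m s t) ∼ u × length (a ++ alt s t (m s t)) ≡ length u
    bothR {u} {s} {t} = bothR-def {u} {s} {t}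

  bothL-def : ∀ {u s t} → s ≢ t → Reduced u → DnL u s → DnL u t → ∃ λ b → alt s t (m s t) ++ b ∼ u × length (alt s t (m s t) ++ b) ≡ length u
  bothL-def {u} {s} {t} q h ds dt with bothR {reverse u} {s} {t} q (Red-rev {u} h) ds dt
  ... | a , e , l = reverse a , ∼trans (∼-++ʳ (reverse a) (core (rev-alt (m s t)))) (∼trans (≡⇒∼ (sym (LP.reverse-++ a (alt s t (m s t))))) (∼trans (∼-rev e) (≡⇒∼ (rev² u)))) ,
     trans (LP.length-++ (alt s t (m s t))) (trans (cong₂ ℕ._+_ refl (LP.length-reverse a)) (trans (+-comm _ (length a)) (trans (sym (LP.length-++ a)) (trans l (LP.length-reverse u)))))
    where
    core : _ → alt s t (m s t) ∼ reverse (alt s t (m s t))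
    core (inj₁ f) = ≡⇒∼ (sym (proj₁ (f s t)))
    core (inj₂ f) = ∼trans (alt-∼ s t) (≡⇒∼ (sym (proj₁ (f s t))))
  abstract
    bothL : ∀ {u s t} → s ≢ t → Reduced u → DnL u s → DnL u t → ∃ λ b → alt s t (m s t) ++ b ∼ u × length (alt s t (m s t) ++ b) ≡ length u
    bothL {u} {s} {t} = bothL-def {u} {s} {t}

  commL-def : ∀ {u s t} → m s t ≡ 2 → s ≢ t → Reduced u → DnL u s → DnL u t → ∃ λ b → s ∷ t ∷ b ∼ u × Reduced (s ∷ t ∷ b)
  commL-def {u} {s} {t} e q h ds dt with bothL {u} {s} {t} q h ds dt
  ... | b , p , l rewrite e = b , p , Red-resp (∼sym p) (sym l) h
  abstract
    commL : ∀ {u s t} → m s t ≡ 2 → s ≢ t → Reduced u → DnL u s → DnL u t → ∃ λ b → s ∷ t ∷ b ∼ u × Reduced (s ∷ t ∷ b)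
    commL {u} {s} {t} = commL-def {u} {s} {t}

  swap₂ : ∀ {s t} → m s t ≡ 2 → ∀ b → s ∷ t ∷ b ∼ t ∷ s ∷ b
  swap₂ {s} {t} e b = subst (λ k → alt s t k ++ b ∼ alt t s k ++ b) e (∼braid [] b s t)

  cons-comm-def : ∀ {p r x} → m p r ≡ 2 → Reduced (p ∷ x) → DnL x r → DnL (p ∷ x) r
  cons-comm-def {p} {r} {x} e h d with Red-dnL {x} {r} (Red-suffix (p ∷ []) x h) d
  ... | x' , hx , ex , lx = DnL-resp {r ∷ p ∷ x'} {p ∷ x} {r} ee (cons-DnL {p ∷ x'} {r} (Red-resp (∼sym ee) (cong suc (sym lx)) h))
    where
    ee : r ∷ p ∷ x' ∼ p ∷ x
    ee = ∼trans (∼sym (swap₂ e x')) (∼-++ˡ (p ∷ []) ex)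
  abstract
    cons-comm : ∀ {p r x} → m p r ≡ 2 → Reduced (p ∷ x) → DnL x r → DnL (p ∷ x) r
    cons-comm {p} {r} {x} = cons-comm-def {p} {r} {x}

  uncons-comm-def : ∀ {p r x} → m p r ≡ 2 → p ≢ r → Reduced (p ∷ x) → DnL (p ∷ x) r → DnL x r
  uncons-comm-def {p} {r} {x} e q h d with commL {p ∷ x} {p} {r} e q h (cons-DnL {x} {p} h) d
  ... | b , eb , hb = DnL-resp {r ∷ b} {x} {r} (∼-cons-cancel eb) (cons-DnL {b} {r} (Red-suffix (p ∷ []) (r ∷ b) hb))
  abstract
    uncons-comm : ∀ {p r x} → m p r ≡ 2 → p ≢ r → Reduced (p ∷ x) → DnL (p ∷ x) r → DnL x r
    uncons-comm {p} {r} {x} = uncons-comm-def {p} {r} {x}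

  -- K = false: a-value 1, K = true: a-value 2.
  Many : Bool → Word → Set
  Many false y = ∃ λ p → ∃ λ q → p ≢ q × DnL y p × DnL y q
  Many true y = ∃ λ p → ∃ λ q → ∃ λ r → (p ≢ q × p ≢ r × q ≢ r) × DnL y p × DnL y q × DnL y r

  Edge : Word → Set
  Edge y = ∃ λ p → ∃ λ q → 3 ≤ m p q × DnL y p × DnL y q

  module Good (K : Bool) where
    BadL : Word → Set
    BadL y = Edge y ⊎ Many K y

    Many-resp : ∀ K {y z} → y ∼ z → Many K y → Many K z
    Many-resp false {y} {z} e (p , q , ne , a , b) = p , q , ne , DnL-resp {y} {z} e a , DnL-resp {y} {z} e b
    Many-resp true {y} {z} e (p , q , r , ne , a , b , c) = p , q , r , ne , DnL-resp {y} {z} e a , DnL-resp {y} {z} e b , DnL-resp {y} {z} e c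

    BadL-resp : ∀ {y z} → y ∼ z → BadL y → BadL z
    BadL-resp {y} {z} e (inj₁ (p , q , l , a , b)) = inj₁ (p , q , l , DnL-resp {y} {z} e a , DnL-resp {y} {z} e b)
    BadL-resp e (inj₂ x) = inj₂ (Many-resp K e x)

    G : Word → Set
    G w = ∀ a y → a ++ y ∼ w → Reduced (a ++ y) → ¬ BadL y

    G-resp : ∀ {w w'} → w ∼ w' → G w → G w'
    G-resp e g a y p = g a y (∼trans p (∼sym e))

    G-suffix : ∀ b {y} → Reduced (b ++ y) → G (b ++ y) → G y
    G-suffix b {y} h g a z e hz bad = g (b ++ a) z ee (Red-resp (∼sym ee) (trans (LP.length-++ b) (trans (cong (length b ℕ.+_) (Red-length (Red-suffix b y h) hz (∼sym e))) (trans (sym (LP.length-++ b)) (cong length (sym (LP.++-assoc b a z)))))) h) bad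
      where
      ee : (b ++ a) ++ z ∼ b ++ y
      ee = ∼trans (≡⇒∼ (LP.++-assoc b a z)) (∼-++ˡ b e)

    G-notBad : ∀ {w} → G w → ¬ BadL w
    G-notBad {w} g b = g [] (nf w) (nf-∼ w) (nf-Red w) (BadL-resp (∼sym (nf-∼ w)) b)

    G-tail : ∀ {p z} → Reduced (p ∷ z) → G (p ∷ z) → G z
    G-tail {p} h g = G-suffix (p ∷ []) h g

    -- p is a left descent too, and two left descents of a good element must commute; a descent
    -- commuting with p passes through it.
    FCL : ∀ {p z r} → Reduced (p ∷ z) → G (p ∷ z) → DnL (p ∷ z) r → p ≢ r → m p r ≡ 2 × DnL z r
    FCL {p} {z} {r} h g d q with m-cases q
    ... | inj₁ e = e , uncons-comm {p} {r} {z} e q h d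
    ... | inj₂ l = ⊥-elim (G-notBad g (inj₁ (p , r , l , cons-DnL {z} {p} h , d)))

    module _ (r t : Fin n) (adj : 3 ≤ m t r) where
      private

        contra : ∀ {a : ℕ} → a ≡ 2 → 3 ≤ a → ⊥
        contra refl (s≤s (s≤s ()))

        module _ {z : Word} (gz : G z) (hz : Reduced z) (dr : DnL z r) (ut : UpL z t) (ur : UpL (t ∷ z) r) where
          htz : Reduced (t ∷ z)
          htz = Red-upL hz ut
          r≢ : ∀ {p} → DnL (t ∷ z) p → r ≢ p
          r≢ d refl = upL-dnL {t ∷ z} {r} ur d

          -- If t and a non-commuting p were both left descents of tz, a word for tz would begin
          -- with t p t, and z with p t. The descent r of z passes through p by `FCL`; what remains
          -- is good, yet has the non-commuting left descents t and r.
          long : ∀ {p} k → 3 ≤ k → ∀ b → alt t p k ++ b ∼ t ∷ z → length (alt t p k ++ b) ≡ length (t ∷ z) → DnL (t ∷ z) p → ⊥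
          long (suc zero) (s≤s ())
          long (suc (suc zero)) (s≤s (s≤s ()))
          long {p} (suc (suc (suc j))) _ b e len d = G-notBad gtb (inj₁ (t , r , adj , cons-DnL {tb} {t} (Red-suffix (p ∷ []) (t ∷ tb) hpt) , drt))
            where
            tb : Word
            tb = alt p t j ++ b
            ez : p ∷ t ∷ tb ∼ z
            ez = ∼-cons-cancel e
            hpt : Reduced (p ∷ t ∷ tb)
            hpt = Red-resp (∼sym ez) (suc-injective (sym len)) hz
            gp : G (p ∷ t ∷ tb)
            gp = G-resp (∼sym ez) gz
            drt : DnL (t ∷ tb) r
            drt = proj₂ (FCL {p} {t ∷ tb} {r} hpt gp (DnL-resp {z} {p ∷ t ∷ tb} {r} (∼sym ez) dr) λ { refl → r≢ d refl })
            gtb : G (t ∷ tb)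
            gtb = G-tail {p} {t ∷ tb} hpt gp

          others : ∀ {p} → DnL (t ∷ z) p → t ≢ p → m t p ≡ 2 × DnL z p
          others {p} d q = case (m-cases q)
            where
            viaLong : 3 ≤ m t p → (∃ λ b → alt t p (m t p) ++ b ∼ t ∷ z × length (alt t p (m t p) ++ b) ≡ length (t ∷ z)) → ⊥
            viaLong l (b , e , len) = long (m t p) l b e len d
            case : m t p ≡ 2 ⊎ 3 ≤ m t p → m t p ≡ 2 × DnL z p
            case (inj₁ e) = e , uncons-comm {t} {p} {z} e q htz d
            case (inj₂ l) = ⊥-elim (viaLong l (bothL {t ∷ z} {t} {p} q htz (cons-DnL {z} {t} htz) d))

          -- Every left descent of tz other than t commutes with t, is a left descent of z and
          -- differs from r. So an edge among the descents cannot involve t and is present in z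
          -- already, and in a set of too many descents t may be replaced by r.
          base : BadL (t ∷ z) → ⊥
          base (inj₁ (p , q , l , dp , dq)) with t Fin.≟ p | t Fin.≟ q
          ... | yes refl | yes refl = m≥3⇒≢ l refl
          ... | yes refl | no b = contra (proj₁ (others dq b)) l
          ... | no a | yes refl = contra (trans (msym p t) (proj₁ (others dp a))) l
          ... | no a | no b = G-notBad gz (inj₁ (p , q , l , proj₂ (others dp a) , proj₂ (others dq b)))
          base (inj₂ b) = many K b λ x → G-notBad gz (inj₂ x)
            where
            many : ∀ K → Many K (t ∷ z) → (Many K z → ⊥) → ⊥
            many false (p , q , ne , dp , dq) k with t Fin.≟ p | t Fin.≟ q
            ... | yes refl | yes refl = ne refl
            ... | yes refl | no b = k (r , q , r≢ dq , dr , proj₂ (others dq b))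
            ... | no a | _ = k (r , p , r≢ dp , dr , proj₂ (others dp a))
            many true (p , q , s , (n₁ , n₂ , n₃) , dp , dq , ds) k with t Fin.≟ p | t Fin.≟ q | t Fin.≟ s
            ... | yes refl | yes refl | _ = n₁ refl
            ... | yes refl | _ | yes refl = n₂ refl
            ... | _ | yes refl | yes refl = n₃ refl
            ... | yes refl | no b | no c = k (r , q , s , (r≢ dq , r≢ ds , n₃) , dr , proj₂ (others dq b) , proj₂ (others ds c))
            ... | no a | yes refl | no c = k (r , p , s , (r≢ dp , r≢ ds , n₂) , dr , proj₂ (others dp a) , proj₂ (others ds c))
            ... | no a | no b | yes refl = k (r , p , q , (r≢ dp , r≢ dq , n₁) , dr , proj₂ (others dp a) , proj₂ (others dq b))
            ... | no a | no b | no c = k (p , q , s , (n₁ , n₂ , n₃) , proj₂ (others dp a) , proj₂ (others dq b) , proj₂ (others ds c))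

      -- G is closed under upper star operations.
      starG : ∀ {z} → G z → Reduced z → DnL z r → UpL z t → UpL (t ∷ z) r → G (t ∷ z)
      starG gz hz dr ut ur [] y e hy bad = base gz hz dr ut ur (BadL-resp e bad)
      -- A first letter p other than t commutes with t and starts a word of z = pb. All assumptions
      -- pass from z to b, and p is cancelled on both sides.
      starG {z} gz hz dr ut ur (p ∷ a) y e hy bad with t Fin.≟ p
      ... | yes refl = gz a y (∼-cons-cancel e) (Red-suffix (p ∷ []) (a ++ y) hy) bad
      ... | no q with others gz hz dr ut ur {p} (DnL-resp {p ∷ a ++ y} {t ∷ z} {p} e (cons-DnL {a ++ y} {p} hy)) q
      ...   | c , dp with commL {t ∷ z} {t} {p} c q (htz gz hz dr ut ur) (cons-DnL {z} {t} (htz gz hz dr ut ur)) (DnL-resp {p ∷ a ++ y} {t ∷ z} {p} e (cons-DnL {a ++ y} {p} hy))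
      ...     | b , eb , hb = starG {b} gb hb' drb utb urb a y (∼-cons-cancel (∼trans e (∼trans (∼sym eb) (swap₂ c b)))) (Red-suffix (p ∷ []) (a ++ y) hy) bad
        where
        dp' : DnL (t ∷ z) p
        dp' = DnL-resp {p ∷ a ++ y} {t ∷ z} {p} e (cons-DnL {a ++ y} {p} hy)
        ez : p ∷ b ∼ z
        ez = ∼-cons-cancel eb
        hpb : Reduced (p ∷ b)
        hpb = Red-suffix (t ∷ []) (p ∷ b) hb
        gpb = G-resp (∼sym ez) gz
        gb = G-tail {p} {b} hpb gpb
        hb' = Red-suffix (p ∷ []) b hpb
        p≢r : p ≢ r
        p≢r refl = upL-dnL {t ∷ z} {r} ur dp'
        fcl = FCL {p} {b} {r} hpb gpb (DnL-resp {z} {p ∷ b} {r} (∼sym ez) dr) p≢r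
        drb = proj₂ fcl
        hptb : Reduced (p ∷ t ∷ b)
        hptb = Red-resp (swap₂ c b) refl hb
        htb = Red-suffix (p ∷ []) (t ∷ b) hptb
        utb : UpL b t
        utb = Red-cons⇒UpL {b} {t} htb
        urb : UpL (t ∷ b) r
        urb with upL? (t ∷ b) r
        ... | inj₁ u = u
        ... | inj₂ d = ⊥-elim (upL-dnL {t ∷ z} {r} ur (DnL-resp {p ∷ t ∷ b} {t ∷ z} {r} (∼trans (∼sym (swap₂ c b)) eb) (cons-comm {p} {r} {t ∷ b} (proj₁ fcl) hptb d)))

    -- a prefix with bad right descents is a suffix with bad left descents after moving the bad factor
    BadR : Word → Set
    BadR y = BadL (reverse y)

    private
      tri-comm : ∀ {y p q r} → Reduced y → p ≢ q → p ≢ r → q ≢ r → m p q ≡ 2 → m p r ≡ 2 → m q r ≡ 2 → DnL y p → DnL y q → DnL y r →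
                 ∃ λ b → p ∷ q ∷ r ∷ b ∼ y × Reduced (p ∷ q ∷ r ∷ b)
      tri-comm {y} {p} {q} {r} h n₁ n₂ n₃ e₁ e₂ e₃ dp dq dr with commL {y} {p} {q} e₁ n₁ h dp dq
      ... | b , eb , hb with Red-dnL {b} {r} (Red-suffix (p ∷ q ∷ []) b hb) (uncons-comm {q} {r} {b} e₃ n₃ (Red-suffix (p ∷ []) (q ∷ b) hb) (uncons-comm {p} {r} {q ∷ b} e₂ n₂ hb (DnL-resp {y} {p ∷ q ∷ b} {r} (∼sym eb) dr)))
      ...   | c , hc , ec , lc = c , ∼trans (∼-++ˡ (p ∷ q ∷ []) ec) eb , Red-resp (∼-++ˡ (p ∷ q ∷ []) (∼sym ec)) (cong (λ k → suc (suc k)) (sym lc)) hb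

      factor : ∀ {w} a c b → (a ++ c) ++ b ∼ w → Reduced ((a ++ c) ++ b) → G w → ¬ BadL (c ++ b)
      factor a c b e h g = g a (c ++ b) (∼trans (≡⇒∼ (sym (LP.++-assoc a c b))) e) (subst Reduced (LP.++-assoc a c b) h)

      alt-bad : ∀ {s t b} → s ≢ t → Reduced (alt s t (m s t) ++ b) → DnL (alt s t (m s t) ++ b) s × DnL (alt s t (m s t) ++ b) t
      alt-bad {s} {t} {b} q h = go s t q refl h , DnL-resp {alt t s (m s t) ++ b} {alt s t (m s t) ++ b} {t} (∼-++ʳ b (∼sym (alt-∼ s t)))
           (go t s (λ e → q (sym e)) (msym s t) (Red-resp (∼-++ʳ b (alt-∼ s t)) (trans (LP.length-++ (alt s t (m s t))) (trans (cong (ℕ._+ length b) (trans (len-alt s t (m s t)) (sym (len-alt t s (m s t))))) (sym (LP.length-++ (alt t s (m s t)))))) h))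
        where
        go : ∀ s t → s ≢ t → ∀ {k} → k ≡ m s t → Reduced (alt s t k ++ b) → DnL (alt s t k ++ b) s
        go s t q {k} e h with Dih.m>0 s t q
        ... | j , ej with trans e ej
        ...   | refl = cons-DnL {alt t s j ++ b} {s} h

      rm : ∀ {y} a c b → a ++ c ∼ y → length (a ++ c) ≡ length y → Reduced (y ++ b) → (a ++ c) ++ b ∼ y ++ b × Reduced ((a ++ c) ++ b)
      rm {y} a c b e l h = ∼-++ʳ b e , Red-resp (∼-++ʳ b (∼sym e)) (trans (LP.length-++ y) (trans (cong (ℕ._+ length b) (sym l)) (sym (LP.length-++ (a ++ c))))) h

    -- If the prefix y has right descents s and t, it is a times the longest element of ⟨s , t⟩, and
    -- that element followed by b is a suffix with left descents s and t. Three commuting right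
    -- descents are brought to the end of y in the same way.
    G-prefix : ∀ {w} → G w → ∀ y b → y ++ b ∼ w → Reduced (y ++ b) → ¬ BadR y
    G-prefix {w} g y b e h bad = go bad
      where
      hy = Red-prefix y b h
      pairBad : ∀ {s t} → s ≢ t → Dn (reverse (reverse y)) s → Dn (reverse (reverse y)) t → ∃ λ z → G z × (DnL z s × DnL z t)
      pairBad {s} {t} q ds dt with bothR {y} {s} {t} q hy (subst (λ z → Dn z s) (rev² y) ds) (subst (λ z → Dn z t) (rev² y) dt)
      ... | a , ea , la = alt s t (m s t) ++ b , gz , alt-bad {s} {t} {b} q hz
        where
        r = rm {y} a (alt s t (m s t)) b ea la h
        hall = subst Reduced (LP.++-assoc a (alt s t (m s t)) b) (proj₂ r)
        hz = Red-suffix a (alt s t (m s t) ++ b) hall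
        gz = G-suffix a hall (G-resp (∼sym (∼trans (≡⇒∼ (sym (LP.++-assoc a (alt s t (m s t)) b))) (∼trans (proj₁ r) e))) g)
      edge : ∀ {s t} → 3 ≤ m s t → Dn (reverse (reverse y)) s → Dn (reverse (reverse y)) t → ⊥
      edge {s} {t} l ds dt with pairBad (m≥3⇒≢ l) ds dt
      ... | z , gz , a , c = G-notBad gz (inj₁ (s , t , l , a , c))
      many : ∀ K' → K' ≡ K → Many K' (reverse y) → ⊥
      many false e' (p , q , ne , dp , dq) with pairBad ne dp dq
      ... | z , gz , a , c = G-notBad gz (inj₂ (subst (λ k → Many k z) e' (p , q , ne , a , c)))
      many true e' (p , q , r , (n₁ , n₂ , n₃) , dp , dq , dr) with m-cases n₁ | m-cases n₂ | m-cases n₃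
      ... | inj₂ l | _ | _ = edge l dp dq
      ... | _ | inj₂ l | _ = edge l dp dr
      ... | _ | _ | inj₂ l = edge l dq dr
      ... | inj₁ e₁ | inj₁ e₂ | inj₁ e₃ with tri-comm {reverse y} (Red-rev hy) n₁ n₂ n₃ e₁ e₂ e₃ dp dq dr
      ...   | c , ec , hc = G-notBad gz (inj₂ (subst (λ k → Many k (r ∷ q ∷ p ∷ b)) e' (p , q , r , (n₁ , n₂ , n₃) , Dp , Dq , cons-DnL {q ∷ p ∷ b} {r} hz)))
        where
        rqp = r ∷ q ∷ p ∷ []
        rev-e : reverse c ++ rqp ∼ y
        rev-e = ∼trans (≡⇒∼ (sym (LP.reverse-++ (p ∷ q ∷ r ∷ []) c))) (∼trans (∼-rev ec) (≡⇒∼ (rev² y)))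
        RM = rm {y} (reverse c) rqp b rev-e (Red-length (subst Reduced (LP.reverse-++ (p ∷ q ∷ r ∷ []) c) (Red-rev hc)) hy rev-e) h
        hall = subst Reduced (LP.++-assoc (reverse c) rqp b) (proj₂ RM)
        hz = Red-suffix (reverse c) (rqp ++ b) hall
        gz = G-suffix (reverse c) hall (G-resp (∼sym (∼trans (≡⇒∼ (sym (LP.++-assoc (reverse c) rqp b))) (∼trans (proj₁ RM) e))) g)
        hqp = Red-suffix (r ∷ []) (q ∷ p ∷ b) hz
        Dq : DnL (r ∷ q ∷ p ∷ b) q
        Dq = cons-comm {r} {q} {q ∷ p ∷ b} (trans (msym r q) e₃) hz (cons-DnL {p ∷ b} {q} hqp)
        Dp : DnL (r ∷ q ∷ p ∷ b) p
        Dp = cons-comm {r} {p} {q ∷ p ∷ b} (trans (msym r p) e₂) hz (cons-comm {q} {p} {p ∷ b} (trans (msym q p) e₁) hqp (cons-DnL {b} {p} (Red-suffix (q ∷ []) (p ∷ b) hqp)))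
      go : BadR y → ⊥
      go (inj₁ (p , q , l , dp , dq)) = edge l dp dq
      go (inj₂ x) = many K refl x

    G-rev : ∀ {w} → G w → G (reverse w)
    G-rev {w} g a y e h bad = G-prefix g (reverse y) (reverse a) (∼trans (≡⇒∼ (sym (LP.reverse-++ a y))) (∼trans (∼-rev e) (≡⇒∼ (rev² w))))
       (subst Reduced (LP.reverse-++ a y) (Red-rev h)) (subst BadL (sym (rev² y)) bad)

  -- Products of basis elements modulo the bad ones.

  module Level (K : Bool) where

    open Good K public

    Spanned : Fin n → FA → Set
    Spanned p = Span (λ z _ → DnL z p)

    dbl : FA → FA
    dbl x = Vs i1 x ++ Vs -1ᶻ x

    Lin-dbl : ∀ {F} → Lin F → ∀ x → F (dbl x) ≃ dbl (F x)
    Lin-dbl L x = ≃-trans (F-++ L (Vs i1 x) (Vs -1ᶻ x)) (≃-++ (F-V L i1 x) (F-V L -1ᶻ x))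

    dbl-cong : ∀ {x y} → x ≃ y → dbl x ≃ dbl y
    dbl-cong p = ≃-++ (Vs-cong i1 p) (Vs-cong -1ᶻ p)

    Span-dbl : ∀ {R : Word → Set} {x} → Span (λ z _ → R z) x → Span (λ z _ → R z) (dbl x)
    Span-dbl {R} s = s+ (Span-V {Q = λ z _ → R z} i1 (λ q → q) s) (Span-V {Q = λ z _ → R z} -1ᶻ (λ q → q) s)

    Span-one : ∀ {Q : Word → ℤ → Set} {w C} → KL w C → Q w i0 → Span Q C
    Span-one {C = C} kl q = s≃ (V0 C) (sgen kl q)

    -- C_p C_w is (v + v⁻¹) C_w if p is a left descent of w, and otherwise a combination of C_z with
    -- left descent p; the C_w span the whole algebra.
    Fac⇒Span : ∀ {p x} → Fac p x → Spanned p x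
    Fac⇒Span {p} {x} (z , e) = s≃ (≃-sym e) (Span-Lin (mulˡ-Lin (Cg p)) (λ {w} {e} {C} kl _ → Span-V {Q = λ z _ → DnL z p} e (λ q → q) (go kl (upL? w p))) (Span-all z))
      where
      go : ∀ {w C} → KL w C → UpL w p ⊎ DnL w p → Spanned p (C· p C)
      go {w} {C} kl (inj₁ u) = Span-map (λ { {z} (_ , _ , ne) → proj₁ (C-terms {p} {w} {C} kl u {z} ne) }) (expand (C· p C) (C-Latt {p} {w} kl u))
      go {w} {C} kl (inj₂ d) = s≃ (≃-sym (C²-lemma (KL-Fac {w} {C} {p} kl d))) (Span-dbl {λ z → DnL z p} (Span-one kl d))

    Resp-Dn : ∀ p → Resp (λ z _ → DnL z p)
    Resp-Dn p = mkResp λ {w} {w'} e d → DnL-resp {w} {w'} {p} e d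

    NG : Word → ℤ → Set
    NG w _ = ¬ G w

    -- A condition imposed at good elements only; this expresses a statement about the quotient by
    -- the bad elements without forming it.
    Bnd : (ℤ → Set) → Word → ℤ → Set
    Bnd P w e = G w → P e

    Resp-Bnd : ∀ P → Resp (Bnd P)
    Resp-Bnd P = mkResp λ e f g → f (G-resp (∼sym e) g)

    NG⇒Bnd : ∀ {P x} → Span NG x → Span (Bnd P) x
    NG⇒Bnd = Span-map λ ng g → ⊥-elim (ng g)

    edge-NG : ∀ {z p q} → 3 ≤ m p q → DnL z p → DnL z q → ¬ G z
    edge-NG {z} {p} {q} l a b g = G-notBad g (inj₁ (p , q , l , a , b))

    Fac-CR : ∀ {p u x} → Fac p x → Fac p (CR u x)
    Fac-CR {p} {u} (z , e) = CR u z , ≃-trans (≃-mul e ≃-refl) (mul-assoc (Cg p) z (Cg u))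

    -- The product stays in C_p H for every left descent p of w, so each of its terms inherits those
    -- descents and is bad for the same reason as w.
    bad-CR : ∀ {w C} → KL w C → BadL w → ∀ u → Span NG (CR u C)
    bad-CR {w} {C} kl bad u = go bad
      where
      sp : ∀ {p} → DnL w p → Spanned p (CR u C)
      sp {p} d = Fac⇒Span (Fac-CR {p} {u} {C} (KL-Fac {w} {C} {p} kl d))
      many : ∀ K' → K' ≡ K → Many K' w → Span NG (CR u C)
      many false e (p , q , ne , a , b) = Span-map (λ { {z} (x , y) g → G-notBad g (inj₂ (subst (λ k → Many k z) e (p , q , ne , x , y))) }) (Span-∩ (Resp-Dn p) (Resp-Dn q) (sp a) (sp b))
      many true e (p , q , r , ne , a , b , c) = Span-map (λ { {z} ((x , y) , t) g → G-notBad g (inj₂ (subst (λ k → Many k z) e (p , q , r , ne , x , y , t))) })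
        (Span-∩ (mkResp λ {w} {w'} e (x , y) → DnL-resp {w} {w'} {p} e x , DnL-resp {w} {w'} {q} e y) (Resp-Dn r) (Span-∩ (Resp-Dn p) (Resp-Dn q) (sp a) (sp b)) (sp c))
      go : BadL w → Span NG (CR u C)
      go (inj₁ (p , q , l , a , b)) = Span-map (λ { {z} (x , y) → edge-NG {z} l x y }) (Span-∩ (Resp-Dn p) (Resp-Dn q) (sp a) (sp b))
      go (inj₂ x) = many K refl x

    sym3 : ∀ {t r} → 3 ≤ m t r → 3 ≤ m r t
    sym3 {t} {r} l = subst (3 ≤_) (msym t r) l

    -- Let w have left descent r. If t is one as well, w is bad. Otherwise C_t C_w expands at v⁰
    -- into C_z with left descent t: z is bad if it also has r, and else z = tw or z = rw. When such
    -- a z is good, so is w, as a tail of tw or as the upper star w = rz; hence the condition at w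
    -- passes to z and no exponent grows.
    stepL : ∀ {P r t x} → 3 ≤ m t r → Span (λ w e → Bnd P w e × DnL w r) x → Span (Bnd P) (C· t x)
    stepL {P} {r} {t} adj = Span-Lin (mulˡ-Lin (Cg t)) λ {w} {e} {C} kl (f , dr) → go kl f dr (upL? w t)
      where
      go : ∀ {w e C} → KL w C → Bnd P w e → DnL w r → UpL w t ⊎ DnL w t → Span (Bnd P) (Vs e (C· t C))
      go {w} {e} {C} kl f dr (inj₂ dt) = NG⇒Bnd (Span-V {Q = NG} e (λ q → q) (s≃ (≃-sym (C²-lemma (KL-Fac {w} {C} {t} kl dt))) (Span-dbl {λ z → ¬ G z} (Span-one {NG} kl (edge-NG {w} adj dt dr)))))
      go {w} {e} {C} kl f dr (inj₁ ut) = Span-V {Q = λ z g → g ≡ i0 × Bnd P z e} e (λ { (refl , q) → subst (Bnd P _) (sym (ℤP.+-identityʳ e)) q })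
          (Span-map (λ { {z} (e0 , hz , ne) → e0 , term {z} hz (C-terms {t} {w} {C} kl ut {z} ne) }) (expand (C· t C) (C-Latt {t} {w} kl ut)))
        where
        term : ∀ {z} → Reduced z → DnL z t × (∀ {r} → DnL w r → UpL z r → z ∼ t ∷ w ⊎ z ∼ r ∷ w) → Bnd P z e
        term {z} hz (dt , nb) g = cases (upL? z r)
          where
          viaT : z ∼ t ∷ w → P e
          viaT p = f (G-tail {t} {w} (Red-upL {w} {t} (isRed kl) ut) (G-resp p g))
          viaR : UpL z r → z ∼ r ∷ w → P e
          viaR uz p = f (G-resp (∼sym (∼-cons-move (∼sym p))) (starG t r (sym3 {t} {r} adj) {z} g hz dt uz (UpL-resp {w} {r ∷ z} {t} (∼-cons-move (∼sym p)) ut)))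
          either' : UpL z r → z ∼ t ∷ w ⊎ z ∼ r ∷ w → P e
          either' uz (inj₁ p) = viaT p
          either' uz (inj₂ p) = viaR uz p
          cases : UpL z r ⊎ DnL z r → P e
          cases (inj₂ dz) = ⊥-elim (edge-NG {z} adj dt dz g)
          cases (inj₁ uz) = either' uz (nb dr uz)

    -- w admits the left lower star operation for {t , r}, which removes its first letter t.
    record LRed (w : Word) : Set where
      constructor lred
      field
        t r : Fin n
        w₁ : Word
        eq : t ∷ w₁ ∼ w
        redt : Reduced (t ∷ w₁)
        dnr : DnL w₁ r
        upr : UpL w r
        adj : 3 ≤ m t r

    DfQ : Fin n → Fin n → Word → Word → ℤ → Set
    DfQ t r w₁ z e = e ≡ i0 × Reduced z × DnL z t × (DnL z r ⊎ (UpL z r × z ∼ r ∷ w₁))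

    -- Every term of C_t C_w₁ has left descent t. Apart from C_w itself and from terms which also
    -- have left descent r, and so are bad, only z = r w₁ can occur, the result of a second lower
    -- star operation.
    star-eq : ∀ {t r w₁ w C₁ C} → t ∷ w₁ ∼ w → Reduced (t ∷ w₁) → DnL w₁ r → KL w₁ C₁ → KL w C →
              ∃ λ d → C ≃ C· t C₁ ++ negFA d × Span (DfQ t r w₁) d
    star-eq {t} {r} {w₁} {w} {C₁} {C} eq ht dr k₁ k = df , diff≃ , Span-map (λ { {z} (e0 , hz , ne) → e0 , hz , term {z} ne }) (expand df ldf)
      where
      ut : UpL w₁ t
      ut = Red-cons⇒UpL {w₁} {t} ht
      x = C· t C₁
      df = x ++ negFA (sc i1 C)
      ldf : Latt df
      ldf = Latt-sub i1 (C-Latt {t} {w₁} k₁ ut) (KL-Latt k)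
      coef : ∀ z e → co z e df ≡ co z e x ℤ.+ ℤ.- co z e C
      coef z e = trans (ev-sub (τ z e) x i1 C) (cong (λ t → co z e x ℤ.+ ℤ.- t) (ℤP.*-identityˡ _))
      notw : ∀ {z} → co z i0 df ≢ i0 → ¬ (z ∼ w)
      notw {z} ne q = ne (trans (coef z i0) (m-m (trans (co-resp i0 x (∼trans q (∼sym eq)))
           (trans (C-lead {w₁} {t} {C₁} ht (KL-supp k₁) (KL-lead k₁) i0) (trans (δC-yes {t ∷ w₁} {i0} {t ∷ w₁} {i0} ∼refl) (sym (trans (isTop k z) (δC-yes {w} {i0} {z} {i0} q))))))))
      nex : ∀ {z} → co z i0 df ≢ i0 → co z i0 x ≢ i0
      nex {z} ne q = ne (trans (coef z i0) (cong₂ (λ a b → a ℤ.+ ℤ.- b) q (trans (isTop k z) (δC-no {w} {i0} {z} {i0} (notw {z} ne)))))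
      term : ∀ {z} → co z i0 df ≢ i0 → DnL z t × (DnL z r ⊎ (UpL z r × z ∼ r ∷ w₁))
      term {z} ne = proj₁ ct , cases (upL? z r)
        where
        ct : DnL z t × (∀ {r} → DnL w₁ r → UpL z r → z ∼ t ∷ w₁ ⊎ z ∼ r ∷ w₁)
        ct = C-terms {t} {w₁} {C₁} k₁ ut {z} (nex {z} ne)
        pickr : UpL z r → z ∼ t ∷ w₁ ⊎ z ∼ r ∷ w₁ → DnL z r ⊎ (UpL z r × z ∼ r ∷ w₁)
        pickr u (inj₁ p) = ⊥-elim (notw {z} ne (∼trans p eq))
        pickr u (inj₂ p) = inj₂ (u , p)
        cases : UpL z r ⊎ DnL z r → DnL z r ⊎ (UpL z r × z ∼ r ∷ w₁)
        cases (inj₂ d) = inj₁ d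
        cases (inj₁ u) = pickr u (proj₂ ct dr u)
      diff≃ : C ≃ x ++ negFA df
      diff≃ .at φ h = sym (trans (ev-minus φ x df) (trans (cong (λ t → ev φ x ℤ.+ ℤ.- t) (trans (ev-sub φ x i1 C) (cong (λ t → ev φ x ℤ.+ ℤ.- t) (ℤP.*-identityˡ _)))) (l (ev φ x) (ev φ C))))
        where l : ∀ a b → a ℤ.+ ℤ.- (a ℤ.+ ℤ.- b) ≡ b
              l = solve-∀

    module Claims (TL : ∀ w → Reduced w → BadL w ⊎ LRed w ⊎ G w) where
      Claim : Word → Set
      Claim w = G w ⊎ (∀ {C} → KL w C → ∀ u → Span NG (CR u C))

      -- Induction on the length. If w is an upper star t w₁ of a good w₁, it is good. Otherwise the
      -- products of C_w₁ are bad, and have left descent r throughout, so `stepL` with the empty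
      -- condition keeps them bad under C_t; the correction terms have an index that is bad or equal
      -- to r w₁.
      claim : ∀ k w → length w ≤ k → Reduced w → Claim w
      claim k w le hw = go (TL w hw) k le
        where
        go : BadL w ⊎ LRed w ⊎ G w → ∀ k → length w ≤ k → Claim w
        go (inj₁ b) k le = inj₂ λ kl → bad-CR kl b
        go (inj₂ (inj₂ g)) k le = inj₁ g
        go (inj₂ (inj₁ (lred t r w₁ eq redt dnr upr adj))) zero le with ≤-trans (≤-reflexive (Red-length redt hw eq)) le
        ... | ()
        go (inj₂ (inj₁ (lred t r w₁ eq redt dnr upr adj))) (suc k) le = main (claim k w₁ l₁ h₁) (Red-dnL {w₁} {r} h₁ dnr)
          where
          h₁ : Reduced w₁
          h₁ = Red-suffix (t ∷ []) w₁ redt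
          l₁ : length w₁ ≤ k
          l₁ = ≤-pred (≤-trans (≤-reflexive (Red-length redt hw eq)) le)
          ut : UpL w₁ t
          ut = Red-cons⇒UpL {w₁} {t} redt
          fromG₁ : G w₁ → G w
          fromG₁ g = G-resp eq (starG r t adj {w₁} g h₁ dnr ut (UpL-resp {w} {t ∷ w₁} {r} (∼sym eq) upr))
          C₁ = proj₁ (KL-of w₁ h₁)
          kl₁ = proj₂ (KL-of w₁ h₁)
          main : Claim w₁ → (∃ λ a → Reduced (r ∷ a) × r ∷ a ∼ w₁ × suc (length a) ≡ length w₁) → Claim w
          main (inj₁ g) _ = inj₁ (fromG₁ g)
          main (inj₂ f₁) (a , ha , ea , la) = second (claim k a (≤-trans (≤-trans (n≤1+n _) (≤-reflexive la)) l₁) hA) (upL? a t)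
            where
            hA : Reduced a
            hA = Red-suffix (r ∷ []) a ha
            finish : (∀ z → Reduced z → DnL z t → z ∼ a → ∀ {C} → KL z C → ∀ u → Span NG (CR u C)) → Claim w
            finish fa = inj₂ λ {C} kl u → let se = star-eq {t} {r} {w₁} {w} {C₁} {C} eq redt dnr kl₁ kl ; d = proj₁ se in
              s≃ (≃-sym (≃-trans (≃-mul (proj₁ (proj₂ se)) ≃-refl) (≃-trans (F-++ (mulʳ-Lin (Cg u)) (C· t C₁) (negFA d)) (≃-++ (mul-assoc (Cg t) C₁ (Cg u)) (F-neg (mulʳ-Lin (Cg u)) d)))))
               (s+ (Span-map (λ f g → f g) (stepL {λ _ → ⊥} {r} {t} adj (Span-∩ (Resp-Bnd (λ _ → ⊥)) (Resp-Dn r) (Span-map (λ ng g → ng g) (f₁ kl₁ u)) (Fac⇒Span (Fac-CR {r} {u} {C₁} (KL-Fac {w₁} {C₁} {r} kl₁ dnr))))))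
                   (s- (Span-Lin (mulʳ-Lin (Cg u)) (λ {z} {e} {Cz} kz q → Span-V {Q = NG} e (λ q → q) (dterm kz u q)) (proj₂ (proj₂ se)))))
              where
              dterm : ∀ {z e Cz} → KL z Cz → ∀ u → DfQ t r w₁ z e → Span NG (CR u Cz)
              dterm {z} kz u (_ , hz , dt , inj₁ dz) = bad-CR kz (inj₁ (t , r , adj , dt , dz)) u
              dterm {z} kz u (_ , hz , dt , inj₂ (uz , p)) = fa z hz dt (∼trans p (∼sym (∼-cons-move ea))) kz u
            second : Claim a → UpL a t ⊎ DnL a t → Claim w
            -- Here a is good with left descent t, so w arises from it by two upper star operations
            -- and is good itself.
            second (inj₁ ga) (inj₂ dt) = inj₁ (fromG₁ (G-resp ea (starG t r (sym3 {t} {r} adj) {a} ga hA dt (Red-cons⇒UpL {a} {r} ha) (UpL-resp {w₁} {r ∷ a} {t} (∼sym ea) ut))))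
            second (inj₁ ga) (inj₁ u) = finish λ z hz dt p → ⊥-elim (upL-dnL {a} {t} u (DnL-resp {z} {a} {t} p dt))
            second (inj₂ fa) _ = finish λ z hz dt p {C} kl u → s≃ (≃-mul (KL-unique (∼sym p) (proj₂ (KL-of a hA)) kl) ≃-refl) (fa (proj₂ (KL-of a hA)) u)

      NG-CR : ∀ {x} → Span NG x → ∀ u → Span NG (CR u x)
      NG-CR s u = Span-Lin (mulʳ-Lin (Cg u)) (λ {w} {e} {C} kl ng → Span-V {Q = NG} e (λ q → q) (use ng kl (claim (length w) w ≤-refl (isRed kl)))) s
        where
        use : ∀ {w C} → ¬ G w → KL w C → Claim w → Span NG (CR u C)
        use ng kl (inj₁ g) = ⊥-elim (ng g)
        use ng kl (inj₂ f) = f kl u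

      NG-T : ∀ u {x} → Span NG x → Span NG (mulFA x (T u))
      NG-T [] {x} s = s≃ (mk≃ λ φ h → sym (trans (ev-mul φ x (T [])) (ev-cong x λ u e → trans (ev-T (λ w f → φ (u ++ w) (e ℤ.+ f)) []) (cong₂ φ (LP.++-identityʳ u) (ℤP.+-identityʳ e))))) s
      NG-T (a ∷ u) {x} s = s≃ (≃-trans (mul-assoc x (Ta a) (T u)) (≃-mul (≃-refl {x}) (Tcons a u))) (NG-T u (s≃ (xT a) (s+ (NG-CR s a) (s- (Span-V {Q = NG} -1ᶻ (λ q → q) s)))))
        where
        Ta : Fin n → FA
        Ta a = T (a ∷ [])
        Tcons : ∀ a u → mulFA (Ta a) (T u) ≃ T (a ∷ u)
        Tcons a u .at φ h = refl
        xT : ∀ a → CR a x ++ negFA (Vs -1ᶻ x) ≃ mulFA x (Ta a)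
        xT a .at φ h = trans (ev-minus φ (CR a x) (Vs -1ᶻ x)) (trans (cong₂ (λ p q → p ℤ.+ ℤ.- q) (trans (ev-mul φ x (Cg a)) (trans (ev-cong x λ u e → l (φ (u ++ a ∷ []) (e ℤ.+ i0)) (φ (u ++ []) (e ℤ.+ -1ᶻ))) (ev-+ (λ u e → φ (u ++ a ∷ []) (e ℤ.+ i0)) (λ u e → φ (u ++ []) (e ℤ.+ -1ᶻ)) x)))
              (trans (ev-V φ -1ᶻ x) (ev-cong x λ u e → cong₂ φ (sym (LP.++-identityʳ u)) (ℤP.+-comm -1ᶻ e))))
            (trans (l' (ev (λ u e → φ (u ++ a ∷ []) (e ℤ.+ i0)) x) (ev (λ u e → φ (u ++ []) (e ℤ.+ -1ᶻ)) x)) (sym (trans (ev-mul φ x (Ta a)) (ev-cong x λ u e → ev-T (λ w f → φ (u ++ w) (e ℤ.+ f)) (a ∷ []))))))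
          where
          l : ∀ p q → (i1 ℤ.* p ℤ.+ i0) ℤ.+ ((i1 ℤ.* q ℤ.+ i0) ℤ.+ i0) ≡ p ℤ.+ q
          l = solve-∀
          l' : ∀ p q → (p ℤ.+ q) ℤ.+ ℤ.- q ≡ p
          l' = solve-∀

      NG-mulʳ : ∀ {x} → Span NG x → ∀ y → Span NG (mulFA x y)
      NG-mulʳ {x} s [] = s≃ (≃-sym (F-[] (mulˡ-Lin x))) s[]
      NG-mulʳ {x} s ((c , u) ∷ y) = s≃ (≃-sym (F-++ (mulˡ-Lin x) ((c , u) ∷ []) y)) (s+ (lau c) (NG-mulʳ s y))
        where
        lau : ∀ c → Span NG (mulFA x ((c , u) ∷ []))
        lau [] = s≃ (mk≃ λ φ h → sym (trans (ev-mul φ x (([] , u) ∷ [])) (ev-0 x))) s[]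
        lau ((a , e) ∷ c) = s≃ (mk≃ λ φ h → trans (ev-++ φ (sc a (Vs e (mulFA x (T u)))) (mulFA x ((c , u) ∷ [])))
             (trans (cong₂ ℤ._+_ (trans (ev-sc φ a (Vs e (mulFA x (T u)))) (trans (cong (ℤ._*_ a) (trans (ev-V φ e (mulFA x (T u))) (trans (ev-mul (shift e φ) x (T u)) (ev-cong x λ w f → trans (ev-T (λ w' f' → φ (w ++ w') (e ℤ.+ (f ℤ.+ f'))) u) (cong (φ (w ++ u)) (l e f)))))) (sym (ev-* a (λ w f → φ (w ++ u) (f ℤ.+ e)) x)))) (ev-mul φ x ((c , u) ∷ [])))
             (trans (sym (ev-+ (λ w f → a ℤ.* φ (w ++ u) (f ℤ.+ e)) (λ w f → ev (λ w' f' → φ (w ++ w') (f ℤ.+ f')) ((c , u) ∷ [])) x))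
               (trans (ev-cong x λ w f → sym (ℤP.+-assoc (a ℤ.* φ (w ++ u) (f ℤ.+ e)) (evL (λ f' → φ (w ++ u) (f ℤ.+ f')) c) i0)) (sym (ev-mul φ x (((a , e) ∷ c , u) ∷ [])))))))
          (s+ (Span-sc a (Span-V {Q = NG} e (λ q → q) (NG-T u s))) (lau c))
          where l : ∀ e f → e ℤ.+ (f ℤ.+ i0) ≡ f ℤ.+ e
                l = solve-∀

      NG-rv : ∀ {x} → Span NG x → Span NG (rv x)
      NG-rv s = Span-map (λ ng g → ng (G-rev g)) (Span-rv {NG} s)

      NG-mulˡ : ∀ {x} → Span NG x → ∀ y → Span NG (mulFA y x)
      NG-mulˡ {x} s y = s≃ (≃-trans (rv-mul (rv x) (rv y)) (≃-mul (rv² y) (rv² x))) (NG-rv (NG-mulʳ (NG-rv s) (rv y)))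

    rv-V : ∀ e x → rv (Vs e x) ≃ Vs e (rv x)
    rv-V e x .at φ h = trans (ev-rv φ (Vs e x)) (trans (ev-V (revF φ) e x) (sym (trans (ev-V φ e (rv x)) (ev-rv (shift e φ) x))))

    rv-++ : ∀ x y → rv (x ++ y) ≃ rv x ++ rv y
    rv-++ x y .at φ h = trans (ev-rv φ (x ++ y)) (trans (ev-++ (revF φ) x y) (sym (trans (ev-++ φ (rv x) (rv y)) (cong₂ ℤ._+_ (ev-rv φ x) (ev-rv φ y)))))

    rv-neg : ∀ x → rv (negFA x) ≃ negFA (rv x)
    rv-neg x .at φ h = trans (ev-rv φ (negFA x)) (trans (ev-neg (revF φ) x) (sym (trans (ev-neg φ (rv x)) (cong ℤ.-_ (ev-rv φ x)))))

    rv-dbl : ∀ x → rv (dbl x) ≃ dbl (rv x)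
    rv-dbl x = ≃-trans (rv-++ (Vs i1 x) (Vs -1ᶻ x)) (≃-++ (rv-V i1 x) (rv-V -1ᶻ x))

    KL-dblR : ∀ {w C s} → KL w C → Dn w s → CR s C ≃ dbl C
    KL-dblR {w} {C} {s} kl d = ≃-trans (≃-sym (≃-trans (rv-C s (rv C)) (≃-mul (rv² C) (≃-refl {Cg s}))))
       (≃-trans (rv-cong (C²-lemma (KL-Fac {reverse w} {rv C} {s} (KL-rv kl) (subst (λ z → Dn z s) (sym (rev² w)) d)))) (≃-trans (rv-dbl (rv C)) (dbl-cong (rv² C))))

    kl-[] : KL [] (T [])
    kl-[] = proj₁ (proj₂ (exists 0 [] Red-[] z≤n))

    co-T[] : ∀ y e → e ≢ i0 → co y e (T []) ≡ i0
    co-T[] y e ne = trans (ev-T (τ y e) []) (go ([] ∼? y))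
      where
      go : Dec ([] ∼ y) → δC y e [] i0 ≡ i0
      go (yes p) = trans (δC-yes {y} {e} {[]} {i0} p) (δℤ-ne λ q → ne (sym q))
      go (no q) = δC-no q

    UpL-[] : ∀ s → UpL [] s
    UpL-[] s = ρ-up s

    Red1 : ∀ s → Reduced (s ∷ [])
    Red1 s = Red-upL {[]} {s} Red-[] (UpL-[] s)

    C1 : Fin n → FA
    C1 s = C· s (T [])
    C2 : Fin n → Fin n → FA
    C2 s t = C· s (C1 t)

    -- C_s C_w is C_sw as soon as its v⁰-coefficients below sw vanish
    KL-step : ∀ {s w C} → Reduced (s ∷ w) → KL w C → (∀ y → DnL y s → co y -1ᶻ C ≡ i0) → KL (s ∷ w) (C· s C)
    KL-step {s} {w} {C} h kl z = record { isRed = h ; isBar = lBar lx ; isNeg = lNeg lx ; isTop = top }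
      where
      lx : Latt (C· s C)
      lx = C-Latt {s} {w} kl (Red-cons⇒UpL {w} {s} h)
      top : ∀ y → co y i0 (C· s C) ≡ δC (s ∷ w) i0 y i0
      top y with upL? y s
      ... | inj₁ p = trans (co-C-up {s} {y} p i0 C) (trans (cong₂ ℤ._+_ (trans (isTop kl (s ∷ y)) (δC-move s w i0 y i0)) (isNeg kl y 0)) (ℤP.+-identityʳ _))
      ... | inj₂ p = trans (co-C-dn {s} {y} p i0 C) (trans (cong₂ ℤ._+_ (trans (isTop kl (s ∷ y)) (δC-move s w i0 y i0)) (z y p)) (ℤP.+-identityʳ _))

    KL-one : ∀ s → KL (s ∷ []) (C1 s)
    KL-one s = KL-step {s} {[]} (Red1 s) kl-[] λ y _ → co-T[] y -1ᶻ λ ()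

    ≁[] : ∀ {y p} → DnL y p → ¬ (y ∼ [])
    ≁[] {y} {p} d e = upL-dnL {[]} {p} (UpL-[] p) (DnL-resp {y} {[]} {p} e d)

    DnL1 : ∀ {s p} → DnL (s ∷ []) p → s ≡ p
    DnL1 {s} {p} d with s Fin.≟ p
    ... | yes e = e
    ... | no q = ⊥-elim (up-dn (Coset.word-other s p q {[]} (ρ-up s) (ρ-up p) false {1} (m>1 (m-cases q))) d)
      where
      m>1 : ∀ {k} → (k ≡ 2) ⊎ (3 ≤ k) → 1 < k
      m>1 (inj₁ refl) = s≤s (s≤s z≤n)
      m>1 (inj₂ l) = ≤-trans (s≤s (s≤s z≤n)) l

    private
      c1-neg1 : ∀ s y → ¬ (y ∼ []) → co y -1ᶻ (C1 s) ≡ i0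
      c1-neg1 s y ne with upL? y s
      ... | inj₁ p = trans (co-C-up {s} {y} p -1ᶻ (T [])) (cong₂ ℤ._+_ (co-T[] (s ∷ y) -1ᶻ λ ()) (trans (isTop kl-[] y) (δC-no {[]} {i0} {y} {i0} ne)))
      ... | inj₂ p = trans (co-C-dn {s} {y} p -1ᶻ (T [])) (cong₂ ℤ._+_ (co-T[] (s ∷ y) -1ᶻ λ ()) (co-T[] y (-1ᶻ ℤ.+ -1ᶻ) λ ()))

      c2-neg1 : ∀ t s y p → t ≢ s → DnL y p → p ≢ t → co y -1ᶻ (C2 t s) ≡ δC (s ∷ []) i0 y i0
      c2-neg1 t s y p t≢s d p≢t = go (upL? y t)
        where
        ty : ¬ (t ∷ y ∼ [])
        ty e = p≢t (sym (DnL1 {t} {p} (DnL-resp {y} {t ∷ []} {p} (∼-cons-move e) d)))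
        go : UpL y t ⊎ DnL y t → co y -1ᶻ (C2 t s) ≡ δC (s ∷ []) i0 y i0
        go (inj₁ u) = trans (co-C-up {t} {y} u -1ᶻ (C1 s)) (trans (cong₂ ℤ._+_ (c1-neg1 s (t ∷ y) ty) (isTop (KL-one s) y)) (ℤP.+-identityˡ _))
        go (inj₂ w) = trans (co-C-dn {t} {y} w -1ᶻ (C1 s)) (trans (cong₂ ℤ._+_ (c1-neg1 s (t ∷ y) ty) (neg2 (upL? y s)))
              (sym (δC-no {s ∷ []} {i0} {y} {i0} λ e → t≢s (sym (DnL1 {s} {t} (DnL-resp {y} {s ∷ []} {t} e w))))))
          where
          neg2 : UpL y s ⊎ DnL y s → co y (-1ᶻ ℤ.+ -1ᶻ) (C1 s) ≡ i0
          neg2 (inj₁ p) = trans (co-C-up {s} {y} p -[1+ 1 ] (T [])) (cong₂ ℤ._+_ (co-T[] (s ∷ y) -[1+ 1 ] λ ()) (co-T[] y -1ᶻ λ ()))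
          neg2 (inj₂ p) = trans (co-C-dn {s} {y} p -[1+ 1 ] (T [])) (cong₂ ℤ._+_ (co-T[] (s ∷ y) -[1+ 1 ] λ ()) (co-T[] y -[1+ 2 ] λ ()))

    Red2 : ∀ {s t} → s ≢ t → Reduced (s ∷ t ∷ [])
    Red2 {s} {t} q with upL? (t ∷ []) s
    ... | inj₁ u = Red-upL {t ∷ []} {s} (Red1 t) u
    ... | inj₂ d = ⊥-elim (q (sym (DnL1 {t} {s} d)))

    KL-two : ∀ {s t} → s ≢ t → KL (s ∷ t ∷ []) (C2 s t)
    KL-two {s} {t} q = KL-step {s} {t ∷ []} (Red2 q) (KL-one t) λ y d → c1-neg1 t y (≁[] {y} {s} d)

    KL-three : ∀ {a b c} → a ≢ b → a ≢ c → b ≢ c → Reduced (a ∷ b ∷ c ∷ []) → KL (a ∷ b ∷ c ∷ []) (C· a (C2 b c))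
    KL-three {a} {b} {c} p q r h = KL-step {a} {b ∷ c ∷ []} h (KL-two r) λ y d → trans (c2-neg1 b c y a r d p)
      (δC-no {c ∷ []} {i0} {y} {i0} λ e → q (sym (DnL1 {c} {a} (DnL-resp {y} {c ∷ []} {a} e d))))

    -- T_s has coefficient v⁻¹ in C_t C_s, which becomes a constant term at s in C_s C_t C_s;
    -- subtracting C_s removes it.
    KL-sts : ∀ {s t} → 3 ≤ m s t → KL (s ∷ t ∷ s ∷ []) (C· s (C2 t s) ++ negFA (sc i1 (C1 s)))
    KL-sts {s} {t} l = record { isRed = h ; isBar = lBar lx ; isNeg = lNeg lx ; isTop = top }
      where
      q : s ≢ t
      q = m≥3⇒≢ l
      q' : t ≢ s
      q' e = q (sym e)
      h : Reduced (s ∷ t ∷ s ∷ [])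
      h = Red-alt s t q 3 l
      k₂ : KL (t ∷ s ∷ []) (C2 t s)
      k₂ = KL-two q'
      lx : Latt (C· s (C2 t s) ++ negFA (sc i1 (C1 s)))
      lx = Latt-sub i1 (C-Latt {s} {t ∷ s ∷ []} k₂ (Red-cons⇒UpL {t ∷ s ∷ []} {s} h)) (KL-Latt (KL-one s))
      body : ∀ y → co y i0 (C· s (C2 t s)) ≡ δC (s ∷ t ∷ s ∷ []) i0 y i0 ℤ.+ δC (s ∷ []) i0 y i0
      body y with upL? y s
      ... | inj₁ p = trans (co-C-up {s} {y} p i0 (C2 t s)) (cong₂ ℤ._+_ (trans (isTop k₂ (s ∷ y)) (δC-move s (t ∷ s ∷ []) i0 y i0))
             (trans (isNeg k₂ y 0) (sym (δC-no {s ∷ []} {i0} {y} {i0} λ e → upL-dnL {y} {s} p (DnL-resp {s ∷ []} {y} {s} (∼sym e) (cons-DnL {[]} {s} (Red1 s)))))))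
      ... | inj₂ p = trans (co-C-dn {s} {y} p i0 (C2 t s)) (cong₂ ℤ._+_ (trans (isTop k₂ (s ∷ y)) (δC-move s (t ∷ s ∷ []) i0 y i0)) (c2-neg1 t s y s q' p q))
      top : ∀ y → co y i0 (C· s (C2 t s) ++ negFA (sc i1 (C1 s))) ≡ δC (s ∷ t ∷ s ∷ []) i0 y i0
      top y = trans (ev-sub (τ y i0) (C· s (C2 t s)) i1 (C1 s)) (trans (cong₂ (λ a b → a ℤ.+ ℤ.- (i1 ℤ.* b)) (body y) (isTop (KL-one s) y)) (l' (δC (s ∷ t ∷ s ∷ []) i0 y i0) (δC (s ∷ []) i0 y i0)))
        where l' : ∀ a b → (a ℤ.+ b) ℤ.+ ℤ.- (i1 ℤ.* b) ≡ a
              l' = solve-∀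

    -- C_w C_s = (v + v⁻¹) C_w for right descents s
    mul-T[]ʳ : ∀ x → mulFA x (T []) ≃ x
    mul-T[]ʳ x .at φ h = trans (ev-mul φ x (T [])) (ev-cong x λ u e → trans (ev-T (λ w f → φ (u ++ w) (e ℤ.+ f)) []) (cong₂ φ (LP.++-identityʳ u) (ℤP.+-identityʳ e)))
    mul-T[]ˡ : ∀ x → mulFA (T []) x ≃ x
    mul-T[]ˡ x .at φ h = trans (ev-mul φ (T []) x) (trans (ev-T (λ u e → ev (λ w f → φ (u ++ w) (e ℤ.+ f)) x) []) (ev-cong x λ v f → cong (φ v) (ℤP.+-identityˡ f)))

    mul-dn : ∀ {w C s} → KL w C → Dn w s → ∀ x → mulFA C (C· s x) ≃ dbl (mulFA C x)
    mul-dn {w} {C} {s} kl d x = ≃-trans (≃-sym (mul-assoc C (Cg s) x)) (≃-trans (≃-mul (KL-dblR {w} {C} {s} kl d) (≃-refl {x})) (Lin-dbl (mulʳ-Lin x) C))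

    -- These are (v + v⁻¹)² and (v + v⁻¹)³, with unmerged monomials. `[3]!'` is (v + v⁻¹)³ - (v +
    -- v⁻¹) = v³ + 2v + 2v⁻¹ + v⁻³, the quantum factorial of 3.
    [2]² [3]! : Laurent
    [2]² = (i1 , + 2) ∷ (i1 , i0) ∷ (i1 , i0) ∷ (i1 , -[1+ 1 ]) ∷ []
    [3]! = (i1 , + 3) ∷ (i1 , i1) ∷ (i1 , i1) ∷ (i1 , i1) ∷ (i1 , -1ᶻ) ∷ (i1 , -1ᶻ) ∷ (i1 , -1ᶻ) ∷ (i1 , -[1+ 2 ]) ∷ []
    [3]!' : Laurent
    [3]!' = (i1 , + 3) ∷ (i1 , i1) ∷ (i1 , i1) ∷ (i1 , -1ᶻ) ∷ (i1 , -1ᶻ) ∷ (i1 , -[1+ 2 ]) ∷ []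

    ev-dbl : ∀ φ x → ev φ (dbl x) ≡ ev (shift i1 φ) x ℤ.+ ev (shift -1ᶻ φ) x
    ev-dbl φ x = trans (ev-++ φ (Vs i1 x) (Vs -1ᶻ x)) (cong₂ ℤ._+_ (ev-V φ i1 x) (ev-V φ -1ᶻ x))

    private
      sh : ∀ a b φ x → ev (shift a (shift b φ)) x ≡ ev (shift (b ℤ.+ a) φ) x
      sh a b φ x = ev-cong x λ u f → cong (φ u) (sym (ℤP.+-assoc b a f))

    dbl²-scale : ∀ x → dbl (dbl x) ≃ scaleFA [2]² x ++ []
    dbl²-scale x .at φ h = trans (ev-dbl φ (dbl x)) (trans (cong₂ ℤ._+_ (ev-dbl (shift i1 φ) x) (ev-dbl (shift -1ᶻ φ) x))
       (trans (cong₂ ℤ._+_ (cong₂ ℤ._+_ (sh i1 i1 φ x) (sh -1ᶻ i1 φ x)) (cong₂ ℤ._+_ (sh i1 -1ᶻ φ x) (sh -1ᶻ -1ᶻ φ x)))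
         (trans (l (A (+ 2)) (A i0) (A -[1+ 1 ])) (sym (trans (ev-++ φ (scaleFA [2]² x) []) (trans (ℤP.+-identityʳ _) (ev-scale φ [2]² x)))))))
      where
      A : ℤ → ℤ
      A e = ev (shift e φ) x
      l : ∀ a b c → (a ℤ.+ b) ℤ.+ (b ℤ.+ c) ≡ i1 ℤ.* a ℤ.+ (i1 ℤ.* b ℤ.+ (i1 ℤ.* b ℤ.+ (i1 ℤ.* c ℤ.+ i0)))
      l = solve-∀

    ev-dbl³ : ∀ φ x → let A = λ e → ev (shift e φ) x in ev φ (dbl (dbl (dbl x))) ≡ ((A (+ 3) ℤ.+ A i1) ℤ.+ (A i1 ℤ.+ A -1ᶻ)) ℤ.+ ((A i1 ℤ.+ A -1ᶻ) ℤ.+ (A -1ᶻ ℤ.+ A -[1+ 2 ]))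
    ev-dbl³ φ x = trans (ev-dbl φ (dbl (dbl x))) (cong₂ ℤ._+_ (two i1) (two -1ᶻ))
      where
      A : ℤ → ℤ
      A e = ev (shift e φ) x
      two : ∀ b → ev (shift b φ) (dbl (dbl x)) ≡ (A (b ℤ.+ i1 ℤ.+ i1) ℤ.+ A (b ℤ.+ i1 ℤ.+ -1ᶻ)) ℤ.+ (A (b ℤ.+ -1ᶻ ℤ.+ i1) ℤ.+ A (b ℤ.+ -1ᶻ ℤ.+ -1ᶻ))
      two b = trans (ev-dbl (shift b φ) (dbl x)) (cong₂ ℤ._+_ (one i1) (one -1ᶻ))
        where
        one : ∀ c → ev (shift c (shift b φ)) (dbl x) ≡ A (b ℤ.+ c ℤ.+ i1) ℤ.+ A (b ℤ.+ c ℤ.+ -1ᶻ)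
        one c = trans (ev-dbl (shift c (shift b φ)) x) (cong₂ ℤ._+_ (three i1) (three -1ᶻ))
          where
          three : ∀ d → ev (shift d (shift c (shift b φ))) x ≡ A (b ℤ.+ c ℤ.+ d)
          three d = trans (sh d c (shift b φ) x) (trans (sh (c ℤ.+ d) b φ x) (cong A (sym (ℤP.+-assoc b c d))))

    single : ∀ {w C h P} → KL w C → P ≃ scaleFA h C ++ [] → IsExpansion P ((h , w , C) ∷ [])
    single kl e = (KL⇒IsKL kl ∷ []) , ([] ∷ []) , ≃⇒≈H e

    single-bound : ∀ {a w y C Cy h} → CoeffBound a w → KL w C → KL y Cy → mulFA C Cy ≃ scaleFA h C ++ [] → InVPow (+ a) h
    single-bound {a} {w} {y} {C} {Cy} {h} cb kl ky e = All.head (cb w y C Cy (KL⇒IsKL kl) (KL⇒IsKL ky) ((h , w , C) ∷ []) (single kl e)) ∼refl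

    private
      [2]²-lead : ¬ InVPow (+ 1) [2]²
      [2]²-lead f with f (+ 2) (ℤ.+<+ (s≤s (s≤s z≤n)))
      ... | ()
      [3]!'-lead : ¬ InVPow (+ 2) [3]!'
      [3]!'-lead f with f (+ 3) (ℤ.+<+ (s≤s (s≤s (s≤s z≤n))))
      ... | ()
      [3]!-lead : ¬ InVPow (+ 2) [3]!
      [3]!-lead f with f (+ 3) (ℤ.+<+ (s≤s (s≤s (s≤s z≤n))))
      ... | ()

    -- Right multiplication by C_s or C_t multiplies C_w by v + v⁻¹, and C_st = C_s C_t for distinct
    -- letters, so C_w C_st has degree 2 at w.
    ¬bound1 : ∀ {w s t} → Reduced w → s ≢ t → Dn w s → Dn w t → ¬ CoeffBound 1 w
    ¬bound1 {w} {s} {t} hw q ds dt cb = [2]²-lead (single-bound {1} {w} {_} {_} {_} {[2]²} cb kl (KL-two q) eq)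
      where
      C = proj₁ (KL-of w hw)
      kl = proj₂ (KL-of w hw)
      eq : mulFA C (C2 s t) ≃ scaleFA [2]² C ++ []
      eq = ≃-trans (mul-dn {w} {C} {s} kl ds (C1 t)) (≃-trans (dbl-cong (≃-trans (mul-dn {w} {C} {t} kl dt (T [])) (dbl-cong {mulFA C (T [])} {C} (mul-T[]ʳ C)))) (dbl²-scale C))

    -- The test element is sts for every m ≥ 3; it is the longest element of ⟨s , t⟩ only when m =
    -- 3, but degree 3 is enough. As C_s and C_t both act on C_w by v + v⁻¹, the formula of `KL-sts`
    -- gives the factor `[3]!'`.
    ¬bound2-edge : ∀ {w s t} → Reduced w → 3 ≤ m s t → Dn w s → Dn w t → ¬ CoeffBound 2 w
    ¬bound2-edge {w} {s} {t} hw l ds dt cb = [3]!'-lead (single-bound {2} {w} {_} {_} {_} {[3]!'} cb kl (KL-sts l) eq)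
      where
      C = proj₁ (KL-of w hw)
      kl = proj₂ (KL-of w hw)
      Cy = C· s (C2 t s) ++ negFA (sc i1 (C1 s))
      prod3 : mulFA C (C· s (C2 t s)) ≃ dbl (dbl (dbl C))
      prod3 = ≃-trans (mul-dn {w} {C} {s} kl ds (C2 t s)) (dbl-cong (≃-trans (mul-dn {w} {C} {t} kl dt (C1 s)) (dbl-cong (≃-trans (mul-dn {w} {C} {s} kl ds (T [])) (dbl-cong {mulFA C (T [])} {C} (mul-T[]ʳ C))))))
      prod1 : mulFA C (C1 s) ≃ dbl C
      prod1 = ≃-trans (mul-dn {w} {C} {s} kl ds (T [])) (dbl-cong {mulFA C (T [])} {C} (mul-T[]ʳ C))
      eq : mulFA C Cy ≃ scaleFA [3]!' C ++ []
      eq = ≃-trans (F-++ (mulˡ-Lin C) (C· s (C2 t s)) (negFA (sc i1 (C1 s)))) (≃-trans (≃-++ prod3 (≃-trans (F-neg (mulˡ-Lin C) (sc i1 (C1 s))) (≃-neg (≃-trans (F-cong (mulˡ-Lin C) (≃-sym (sc1 (C1 s)))) prod1)))) fin)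
        where
        lm : ∀ a b c d → (((a ℤ.+ b) ℤ.+ (b ℤ.+ c)) ℤ.+ ((b ℤ.+ c) ℤ.+ (c ℤ.+ d))) ℤ.+ ℤ.- (b ℤ.+ c) ≡
             i1 ℤ.* a ℤ.+ (i1 ℤ.* b ℤ.+ (i1 ℤ.* b ℤ.+ (i1 ℤ.* c ℤ.+ (i1 ℤ.* c ℤ.+ (i1 ℤ.* d ℤ.+ i0)))))
        lm = solve-∀
        fin : dbl (dbl (dbl C)) ++ negFA (dbl C) ≃ scaleFA [3]!' C ++ []
        fin .at φ h = trans (ev-minus φ (dbl (dbl (dbl C))) (dbl C)) (trans (cong₂ (λ a b → a ℤ.+ ℤ.- b) (ev-dbl³ φ C) (ev-dbl φ C))
           (trans (lm (ev (shift (+ 3) φ) C) (ev (shift i1 φ) C) (ev (shift -1ᶻ φ) C) (ev (shift -[1+ 2 ] φ) C)) (sym (trans (ev-++ φ (scaleFA [3]!' C) []) (trans (ℤP.+-identityʳ _) (ev-scale φ [3]!' C))))))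

    ¬bound2-triple : ∀ {w a b c} → Reduced w → a ≢ b → a ≢ c → b ≢ c → Reduced (a ∷ b ∷ c ∷ []) → Dn w a → Dn w b → Dn w c → ¬ CoeffBound 2 w
    ¬bound2-triple {w} {a} {b} {c} hw p q r hy da db dc cb = [3]!-lead (single-bound {2} {w} {_} {_} {_} {[3]!} cb kl (KL-three p q r hy) eq)
      where
      C = proj₁ (KL-of w hw)
      kl = proj₂ (KL-of w hw)
      eq : mulFA C (C· a (C2 b c)) ≃ scaleFA [3]! C ++ []
      eq = ≃-trans (≃-trans (mul-dn {w} {C} {a} kl da (C2 b c)) (dbl-cong (≃-trans (mul-dn {w} {C} {b} kl db (C1 c)) (dbl-cong (≃-trans (mul-dn {w} {C} {c} kl dc (T [])) (dbl-cong {mulFA C (T [])} {C} (mul-T[]ʳ C))))))) fin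
        where
        lm : ∀ a b c d → ((a ℤ.+ b) ℤ.+ (b ℤ.+ c)) ℤ.+ ((b ℤ.+ c) ℤ.+ (c ℤ.+ d)) ≡
             i1 ℤ.* a ℤ.+ (i1 ℤ.* b ℤ.+ (i1 ℤ.* b ℤ.+ (i1 ℤ.* b ℤ.+ (i1 ℤ.* c ℤ.+ (i1 ℤ.* c ℤ.+ (i1 ℤ.* c ℤ.+ (i1 ℤ.* d ℤ.+ i0)))))))
        lm = solve-∀
        fin : dbl (dbl (dbl C)) ≃ scaleFA [3]! C ++ []
        fin .at φ h = trans (ev-dbl³ φ C) (trans (lm (ev (shift (+ 3) φ) C) (ev (shift i1 φ) C) (ev (shift -1ᶻ φ) C) (ev (shift -[1+ 2 ] φ) C)) (sym (trans (ev-++ φ (scaleFA [3]! C) []) (trans (ℤP.+-identityʳ _) (ev-scale φ [3]! C)))))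

    bound : Bool → ℕ
    bound false = 1
    bound true = 2

    bnd : ℕ
    bnd = bound K

    LeB : ℤ → Set
    LeB e = e ℤ.≤ + bnd

    data Small (w : Word) : Set where
      nil : w ∼ [] → Small w
      one : ∀ s → w ∼ s ∷ [] → Small w
      two : ∀ s t → K ≡ true → s ≢ t → w ∼ s ∷ t ∷ [] → Small w

    1≤bnd : + 1 ℤ.≤ + bnd
    1≤bnd = ℤ.+≤+ (go K)
      where go : ∀ K → 1 ≤ bound K
            go false = s≤s z≤n
            go true = s≤s z≤n

    module Main (TR : ∀ w → Reduced w → BadR w ⊎ LRed (reverse w) ⊎ (G w × (Small w ⊎ LRed w))) where
      TL : ∀ w → Reduced w → BadL w ⊎ LRed w ⊎ G w
      TL w hw = go (TR (reverse w) (Red-rev hw))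
        where
        go : BadR (reverse w) ⊎ LRed (reverse (reverse w)) ⊎ (G (reverse w) × (Small (reverse w) ⊎ LRed (reverse w))) → BadL w ⊎ LRed w ⊎ G w
        go (inj₁ b) = inj₁ (subst BadL (rev² w) b)
        go (inj₂ (inj₁ l)) = inj₂ (inj₁ (subst LRed (rev² w) l))
        go (inj₂ (inj₂ (g , _))) = inj₂ (inj₂ (subst G (rev² w) (G-rev g)))

      open Claims TL

      Deg : Word → Set
      Deg w = ∀ {C} → KL w C → ∀ {y Cy} → KL y Cy → Span (Bnd LeB) (mulFA C Cy)

      Le : ℤ → Word → ℤ → Set
      Le k _ e = e ℤ.≤ k

      -- Either C_s C_w expands at v⁰ or it is (v + v⁻¹) C_w. So each letter of a small element
      -- costs one degree, which is where the bounds 1 and 2 come from.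
      Span-C≤ : ∀ {k s x} → Span (Le k) x → Span (Le (k ℤ.+ i1)) (C· s x)
      Span-C≤ {k} {s} = Span-Lin (mulˡ-Lin (Cg s)) λ {w} {e} {C} kl le → Span-V {Q = Le i1} e (λ q → ℤP.+-mono-≤ le q) (go kl (upL? w s))
        where
        go : ∀ {w C} → KL w C → UpL w s ⊎ DnL w s → Span (Le i1) (C· s C)
        go {w} {C} kl (inj₁ u) = Span-map (λ { (refl , _) → ℤ.+≤+ z≤n }) (expand (C· s C) (C-Latt {s} {w} kl u))
        go {w} {C} kl (inj₂ d) = s≃ (≃-sym (C²-lemma (KL-Fac {w} {C} {s} kl d))) (s+ (sgen {w = w} {e = i1} {C = C} kl (ℤ.+≤+ ≤-refl)) (sgen {w = w} {e = -1ᶻ} {C = C} kl ℤ.-≤+))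

      small-deg : ∀ {w} → Small w → Deg w
      small-deg {w} (nil p) {C} kl {y} {Cy} ky = s≃ (≃-sym (≃-trans (≃-mul (KL-unique p kl kl-[]) ≃-refl) (mul-T[]ˡ Cy))) (Span-one ky λ _ → ℤP.≤-trans (ℤ.+≤+ z≤n) 1≤bnd)
      small-deg {w} (one s p) {C} kl {y} {Cy} ky = s≃ (≃-sym (≃-trans (≃-mul (KL-unique p kl (KL-one s)) ≃-refl) (≃-trans (mul-assoc (Cg s) (T []) Cy) (C-cong s (mul-T[]ˡ Cy)))))
         (Span-map (λ q _ → ℤP.≤-trans q 1≤bnd) (Span-C≤ {i0} {s} (Span-one {Le i0} ky ℤP.≤-refl)))
      small-deg {w} (two s t refl ne p) {C} kl {y} {Cy} ky = s≃ (≃-sym (≃-trans (≃-mul (KL-unique p kl (KL-two ne)) ≃-refl) (≃-trans (mul-assoc (Cg s) (C1 t) Cy) (C-cong s (≃-trans (mul-assoc (Cg t) (T []) Cy) (C-cong t (mul-T[]ˡ Cy)))))))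
         (Span-map (λ q _ → q) (Span-C≤ {i1} {s} (Span-C≤ {i0} {t} (Span-one {Le i0} ky ℤP.≤-refl))))

      -- Induction on the length of w. A left star is split off by `star-eq`, and `stepL` does not
      -- raise the degree at good elements. A right star gives C_w as C_x₁ C_t minus correction
      -- terms, and C_t is absorbed into C_y. Degree is only picked up from the small elements at
      -- the end.
      deg : ∀ k w → length w ≤ k → Reduced w → Deg w
      deg k w le hw {C} kl {y} {Cy} ky = go k le (TR w hw)
        where
        V0' : ∀ {z e Cz x} → e ≡ i0 → KL z Cz → Span (Bnd LeB) (mulFA Cz x) → Span (Bnd LeB) (Vs e (mulFA Cz x))
        V0' {Cz = Cz} {x} refl kz s = s≃ (≃-sym (V0 (mulFA Cz x))) s
        ng-prod : ∀ {z Cz} → KL z Cz → ¬ G z → Span (Bnd LeB) (mulFA Cz Cy)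
        ng-prod kz ng = NG⇒Bnd (NG-mulʳ (Span-one {NG} kz ng) Cy)
        go : ∀ k → length w ≤ k → BadR w ⊎ LRed (reverse w) ⊎ (G w × (Small w ⊎ LRed w)) → Span (Bnd LeB) (mulFA C Cy)
        go k le (inj₁ b) = ng-prod kl λ g → G-notBad (G-rev g) b
        go k le (inj₂ (inj₂ (g , inj₁ s))) = small-deg s kl ky
        go zero le (inj₂ (inj₂ (g , inj₂ (lred t r w₁ eq redt dnr upr adj)))) with ≤-trans (≤-reflexive (Red-length redt hw eq)) le
        ... | ()
        go (suc k) le (inj₂ (inj₂ (g , inj₂ (lred t r w₁ eq redt dnr upr adj)))) = body (Red-dnL {w₁} {r} h₁ dnr)
          where
          h₁ : Reduced w₁
          h₁ = Red-suffix (t ∷ []) w₁ redt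
          l₁ : length w₁ ≤ k
          l₁ = ≤-pred (≤-trans (≤-reflexive (Red-length redt hw eq)) le)
          C₁ = proj₁ (KL-of w₁ h₁)
          kl₁ = proj₂ (KL-of w₁ h₁)
          se = star-eq {t} {r} {w₁} {w} {C₁} {C} eq redt dnr kl₁ kl
          d = proj₁ se
          body : (∃ λ a → Reduced (r ∷ a) × r ∷ a ∼ w₁ × suc (length a) ≡ length w₁) → Span (Bnd LeB) (mulFA C Cy)
          body (a , ha , ea , la) = s≃ (≃-sym (≃-trans (≃-mul (proj₁ (proj₂ se)) ≃-refl) (≃-trans (F-++ (mulʳ-Lin Cy) (C· t C₁) (negFA d)) (≃-++ (mul-assoc (Cg t) C₁ Cy) (F-neg (mulʳ-Lin Cy) d)))))
             (s+ (stepL {LeB} {r} {t} adj (Span-∩ (Resp-Bnd LeB) (Resp-Dn r) (deg k w₁ l₁ h₁ kl₁ ky) (Fac⇒Span (fac (KL-Fac {w₁} {C₁} {r} kl₁ dnr)))))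
                 (s- (Span-Lin (mulʳ-Lin Cy) dterm (proj₂ (proj₂ se)))))
            where
            fac : Fac r C₁ → Fac r (mulFA C₁ Cy)
            fac (z , e) = mulFA z Cy , ≃-trans (≃-mul e ≃-refl) (mul-assoc (Cg r) z Cy)
            dterm : ∀ {z e Cz} → KL z Cz → DfQ t r w₁ z e → Span (Bnd LeB) (Vs e (mulFA Cz Cy))
            dterm {z} {e} {Cz} kz (e0 , hz , dt , inj₁ dz) = V0' {x = Cy} e0 kz (ng-prod kz (edge-NG {z} adj dt dz))
            dterm {z} {e} {Cz} kz (e0 , hz , dt , inj₂ (uz , p)) = V0' {x = Cy} e0 kz (deg k z lz hz kz ky)
              where
              lz : length z ≤ k
              lz = ≤-trans (≤-reflexive (Red-length hz (Red-suffix (r ∷ []) a ha) (∼trans p (∼sym (∼-cons-move ea))))) (≤-trans (≤-trans (n≤1+n _) (≤-reflexive la)) l₁)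
        go zero le (inj₂ (inj₁ (lred t r w₁ eq redt dnr upr adj))) with ≤-trans (≤-reflexive (trans (Red-length redt (Red-rev hw) eq) (LP.length-reverse w))) le
        ... | ()
        go (suc k) le (inj₂ (inj₁ (lred t r w₁ eq redt dnr upr adj))) = body (Red-dnL {w₁} {r} h₁ dnr)
          where
          h₁ : Reduced w₁
          h₁ = Red-suffix (t ∷ []) w₁ redt
          l₁ : length w₁ ≤ k
          l₁ = ≤-pred (≤-trans (≤-reflexive (trans (Red-length redt (Red-rev hw) eq) (LP.length-reverse w))) le)
          C₁ = proj₁ (KL-of w₁ h₁)
          kl₁ = proj₂ (KL-of w₁ h₁)
          x₁ = reverse w₁
          X₁ = rv C₁
          kx : KL x₁ X₁
          kx = KL-rv kl₁
          lx : length x₁ ≤ k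
          lx = ≤-trans (≤-reflexive (LP.length-reverse w₁)) l₁
          se = star-eq {t} {r} {w₁} {reverse w} {C₁} {rv C} eq redt dnr kl₁ (KL-rv kl)
          d = proj₁ se
          C≃ : C ≃ CR t X₁ ++ negFA (rv d)
          C≃ = ≃-trans (≃-sym (rv² C)) (≃-trans (rv-cong (proj₁ (proj₂ se))) (≃-trans (rv-++ (C· t C₁) (negFA d)) (≃-++ (rv-C t C₁) (rv-neg d))))
          IH : ∀ {y Cy} → KL y Cy → Span (Bnd LeB) (mulFA X₁ Cy)
          IH ky = deg k x₁ lx (isRed kx) kx ky
          up-case : ∀ s → UpL y s → Span (Bnd LeB) (mulFA X₁ (C· s Cy))
          up-case s u = Span-Lin (mulˡ-Lin X₁) (λ { {z} {e} {Cz} kz (refl , _) → s≃ (≃-sym (V0 (mulFA X₁ Cz))) (IH kz) }) (expand (C· s Cy) (C-Latt {s} {y} ky u))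
          -- If t is a left descent of y, then C_t C_y = (v + v⁻¹) C_y, which seems to raise the
          -- degree. But r is a right descent of x₁, so the same factor can be produced as C_x₁ C_r,
          -- and C_r C_y expands at v⁰. If r is a left descent of y as well, then y is bad.
          first-part : UpL y t ⊎ DnL y t → UpL y r ⊎ DnL y r → Span (Bnd LeB) (mulFA X₁ (C· t Cy))
          first-part (inj₁ u) _ = up-case t u
          first-part (inj₂ dt) ur = s≃ (≃-trans eq₁ (≃-sym eq₂)) (viaR ur)
            where
            eq₂ : mulFA X₁ (C· t Cy) ≃ dbl (mulFA X₁ Cy)
            eq₂ = ≃-trans (F-cong (mulˡ-Lin X₁) (C²-lemma (KL-Fac {y} {Cy} {t} ky dt))) (Lin-dbl (mulˡ-Lin X₁) Cy)
            eq₁ : mulFA X₁ (C· r Cy) ≃ dbl (mulFA X₁ Cy)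
            eq₁ = mul-dn {x₁} {X₁} {r} kx dnr Cy
            viaR : UpL y r ⊎ DnL y r → Span (Bnd LeB) (mulFA X₁ (C· r Cy))
            viaR (inj₁ u) = up-case r u
            viaR (inj₂ dr) = s≃ (≃-sym eq₁) (NG⇒Bnd (Span-dbl {λ z → ¬ G z} (NG-mulˡ (Span-one {NG} ky (edge-NG {y} adj dt dr)) X₁)))
          body : (∃ λ a → Reduced (r ∷ a) × r ∷ a ∼ w₁ × suc (length a) ≡ length w₁) → Span (Bnd LeB) (mulFA C Cy)
          body (a , ha , ea , la) = s≃ (≃-sym (≃-trans (≃-mul C≃ ≃-refl) (≃-trans (F-++ (mulʳ-Lin Cy) (CR t X₁) (negFA (rv d))) (≃-++ (mul-assoc X₁ (Cg t) Cy) (F-neg (mulʳ-Lin Cy) (rv d))))))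
             (s+ (first-part (upL? y t) (upL? y r)) (s- (Span-Lin (mulʳ-Lin Cy) dterm (Span-rv {DfQ t r w₁} (proj₂ (proj₂ se))))))
            where
            dterm : ∀ {z e Cz} → KL z Cz → DfQ t r w₁ (reverse z) e → Span (Bnd LeB) (Vs e (mulFA Cz Cy))
            dterm {z} {e} {Cz} kz (e0 , hz , dt , inj₁ dz) = V0' {x = Cy} e0 kz (ng-prod kz λ g → edge-NG {reverse z} adj dt dz (G-rev g))
            dterm {z} {e} {Cz} kz (e0 , hz , dt , inj₂ (uz , p)) = V0' {x = Cy} e0 kz (deg k z lz (isRed kz) kz ky)
              where
              lz : length z ≤ k
              lz = ≤-trans (≤-reflexive (trans (sym (LP.length-reverse z)) (Red-length hz (Red-suffix (r ∷ []) a ha) (∼trans p (∼sym (∼-cons-move ea)))))) (≤-trans (≤-trans (n≤1+n _) (≤-reflexive la)) l₁)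

      coeffBound : ∀ z → G z → CoeffBound bnd z
      coeffBound z g x y Cx Cy kx ky E ex = All.tabulate λ {e} mem p k lt → trans (All.lookup (expansion-coeff {mulFA Cx Cy} {E} ex z k) mem p) (zero' k lt)
        where
        KX = IsKL⇒KL {x} {Cx} kx
        KY = IsKL⇒KL {y} {Cy} ky
        zero' : ∀ k → + bnd ℤ.< k → ev (Dk z k) (mulFA Cx Cy) ≡ i0
        zero' k lt with ev (Dk z k) (mulFA Cx Cy) ℤ.≟ i0
        ... | yes q = q
        ... | no q = ⊥-elim (ℤP.<⇒≱ lt (Span⇒Supp (Resp-Bnd LeB) (deg (length x) x ≤-refl (isRed KX) KX KY) z k q g))

    -- Elements at which right star operations stop.

    Q : Word → Set
    Q w = ∀ b x y → Reduced (b ++ x ∷ y ∷ []) → b ++ x ∷ y ∷ [] ∼ w → ¬ (3 ≤ m x y)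

    -- The condition passes to tails of the word (`P-tail`), so these elements can be classified by
    -- adding letters on the left.
    record P (w : Word) : Set where
      constructor mkP
      field
        isR : Reduced w
        ¬bad : ¬ BadR w
        noStar : Q w
    open P public

    m-sym : ∀ s t → m s t ≡ m t s
    m-sym = Geo.msym geo

    sym≤ : ∀ {k s t} → k ≤ m s t → k ≤ m t s
    sym≤ {k} {s} {t} = subst (k ≤_) (m-sym s t)

    m≡2⇒¬3≤ : ∀ {s t} → m s t ≡ 2 → ¬ (3 ≤ m s t)
    m≡2⇒¬3≤ e l = <⇒≢ l (sym e)

    m≡2⇒≢ : ∀ {s t} → m s t ≡ 2 → s ≢ t
    m≡2⇒≢ {s} e refl with trans (sym e) (Geo.mdiag geo s)
    ... | ()

    Dn-cons : ∀ {p x s} → Reduced (p ∷ x) → Dn x s → Dn (p ∷ x) s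
    Dn-cons {p} {x} {s} h d = go (Red-dn (Red-suffix (p ∷ []) x h) d)
      where
      go : (∃ λ a → Reduced (a ∷ʳ s) × a ∷ʳ s ∼ x × length (a ∷ʳ s) ≡ length x) → Dn (p ∷ x) s
      go (a , ha , ea , la) = Dn-resp (∼-++ˡ (p ∷ []) ea) (snoc-Dn {p ∷ a} {s} (Red-resp (∼-++ˡ (p ∷ []) (∼sym ea)) (cong suc (sym la)) h))

    toR : ∀ {y s} → Dn y s → DnL (reverse y) s
    toR {y} {s} = subst (λ z → Dn z s) (sym (rev² y))
    fromR : ∀ {y s} → DnL (reverse y) s → Dn y s
    fromR {y} {s} = subst (λ z → Dn z s) (rev² y)

    BadR-map : ∀ {x y} → (∀ s → Dn x s → Dn y s) → BadR x → BadR y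
    BadR-map {x} {y} f (inj₁ (p , q , l , a , b)) = inj₁ (p , q , l , toR {y} (f p (fromR {x} a)) , toR {y} (f q (fromR {x} b)))
    BadR-map {x} {y} f (inj₂ k) = inj₂ (go K k)
      where
      go : ∀ K → Many K (reverse x) → Many K (reverse y)
      go false (p , q , ne , a , b) = p , q , ne , toR {y} (f p (fromR {x} a)) , toR {y} (f q (fromR {x} b))
      go true (p , q , r , ne , a , b , c) = p , q , r , ne , toR {y} (f p (fromR {x} a)) , toR {y} (f q (fromR {x} b)) , toR {y} (f r (fromR {x} c))

    P-tail : ∀ {p x} → P (p ∷ x) → P x
    P-tail {p} {x} (mkP h nb q) = mkP (Red-suffix (p ∷ []) x h) (λ b → nb (BadR-map {x} (λ s → Dn-cons {p} {x} {s} h) b))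
       λ b y z hr e → q (p ∷ b) y z (Red-resp (∼-++ˡ (p ∷ []) (∼sym e)) (cong suc (Red-length (Red-suffix (p ∷ []) x h) hr (∼sym e))) h) (∼-++ˡ (p ∷ []) e)

    P-resp : ∀ {x y} → x ∼ y → Reduced y → P x → P y
    P-resp {x} {y} e hy (mkP h nb q) = mkP hy (λ b → nb (BadR-map {y} (λ s → Dn-resp (∼sym e)) b)) λ b u v hr e' → q b u v hr (∼trans e' (∼sym e))

    P-eq : ∀ {x y} → x ∼ y → length x ≡ length y → P x → P y
    P-eq e l p = P-resp e (Red-resp e l (isR p)) p

    P-end : ∀ {w} b x y → 3 ≤ m x y → w ∼ b ++ x ∷ y ∷ [] → length w ≡ length (b ++ x ∷ y ∷ []) → ¬ P w
    P-end b x y l e len p = noStar p b x y (Red-resp e len (isR p)) (∼sym e) l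

    Dn? : ∀ w s → Dec (Dn w s)
    Dn? w s = go (up? w s)
      where go : Up w s ⊎ Dn w s → Dec (Dn w s)
            go (inj₁ u) = no (up-dn u)
            go (inj₂ d) = yes d

    BadR? : ∀ w → Dec (BadR w)
    BadR? w = FP.any? (λ p → FP.any? λ q → (3 ℕ.≤? m p q) ×-dec D p ×-dec D q) ⊎-dec many K
      where
      D : ∀ s → Dec (DnL (reverse w) s)
      D s = Dn? (reverse (reverse w)) s
      many : ∀ K → Dec (Many K (reverse w))
      many false = FP.any? λ p → FP.any? λ q → ¬? (p Fin.≟ q) ×-dec D p ×-dec D q
      many true = FP.any? λ p → FP.any? λ q → FP.any? λ r → (¬? (p Fin.≟ q) ×-dec ¬? (p Fin.≟ r) ×-dec ¬? (q Fin.≟ r)) ×-dec D p ×-dec D q ×-dec D r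

    -- The negation of `Q` as a search over pairs of letters: once the descent y is removed, a
    -- letter x not commuting with y is a descent. Being finite, the search is decidable.
    RStar : Word → Set
    RStar w = ∃ λ y → ∃ λ x → 3 ≤ m x y × Dn w y × Dn (w ∷ʳ y) x

    RStar? : ∀ w → Dec (RStar w)
    RStar? w = FP.any? λ y → FP.any? λ x → (3 ℕ.≤? m x y) ×-dec Dn? w y ×-dec Dn? (w ∷ʳ y) x

    ¬RStar⇒Q : ∀ {w} → ¬ RStar w → Q w
    ¬RStar⇒Q {w} nr b x y h e l = nr (y , x , l , Dn-resp e (subst (λ z → Dn z y) eq (snoc-Dn {b ∷ʳ x} {y} h')) ,
        Dn-resp (∼-snoc-move (∼trans (≡⇒∼ eq) e)) (snoc-Dn {b} {x} (Red-prefix (b ∷ʳ x) (y ∷ []) h')))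
      where
      eq : (b ∷ʳ x) ∷ʳ y ≡ b ++ x ∷ y ∷ []
      eq = LP.++-assoc b (x ∷ []) (y ∷ [])
      h' : Reduced ((b ∷ʳ x) ∷ʳ y)
      h' = subst Reduced (sym eq) h

    RStar⇒ : ∀ {w} → Reduced w → RStar w → BadR w ⊎ LRed (reverse w)
    RStar⇒ {w} hw (y , x , l , dy , dx) = go (up? w x) (Red-dn hw dy)
      where
      go : Up w x ⊎ Dn w x → (∃ λ a → Reduced (a ∷ʳ y) × a ∷ʳ y ∼ w × length (a ∷ʳ y) ≡ length w) → BadR w ⊎ LRed (reverse w)
      go (inj₂ d) _ = inj₁ (inj₁ (x , y , l , toR {w} d , toR {w} dy))
      go (inj₁ u) (a , ha , ea , la) = inj₂ (lred y x (reverse a) (∼trans (≡⇒∼ (sym (rev-snoc a y))) (∼-rev ea)) (subst Reduced (rev-snoc a y) (Red-rev ha))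
          (toR {a} (Dn-resp (∼sym (∼-snoc-move ea)) dx)) (subst (λ z → Up z x) (sym (rev² w)) u) (sym≤ {s = x} {y} l))

    module _ (class : ∀ w → P w → G w × (Small w ⊎ LRed w)) where
      TR : ∀ w → Reduced w → BadR w ⊎ LRed (reverse w) ⊎ (G w × (Small w ⊎ LRed w))
      TR w hw with BadR? w | RStar? w
      ... | yes b | _ = inj₁ b
      ... | no nb | yes r with RStar⇒ hw r
      ...   | inj₁ b = inj₁ b
      ...   | inj₂ l = inj₂ (inj₁ l)
      TR w hw | no nb | no nr = inj₂ (inj₂ (class w (mkP hw nb (¬RStar⇒Q nr))))

      coeffBound : ∀ z → G z → CoeffBound bnd z
      coeffBound = Main.coeffBound TR

    P-pair : ∀ {p s} → P (p ∷ s ∷ []) → p ≢ s × m p s ≡ 2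
    P-pair {p} {s} h = p≢s , go (m-cases p≢s)
      where
      p≢s : p ≢ s
      p≢s refl with isR h [] (∼sym (∼-cons² p []))
      ... | ()
      go : m p s ≡ 2 ⊎ 3 ≤ m p s → m p s ≡ 2
      go (inj₁ e) = e
      go (inj₂ l) = ⊥-elim (P-end [] p s l ∼refl refl h)

    Dn-pair : ∀ {s t} → s ≢ t → m s t ≡ 2 → Dn (s ∷ t ∷ []) s × Dn (s ∷ t ∷ []) t
    Dn-pair {s} {t} q e = Dn-resp (∼sym (swap₂ e [])) (snoc-Dn {t ∷ []} {s} (Red2 λ e → q (sym e))) , snoc-Dn {s ∷ []} {t} (Red2 q)

    BadL-two : ∀ {y} → BadL y → ∃ λ p → ∃ λ q → p ≢ q × DnL y p × DnL y q
    BadL-two {y} (inj₁ (p , q , l , a , b)) = p , q , m≥3⇒≢ l , a , b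
    BadL-two {y} (inj₂ k) = go K k
      where
      go : ∀ K → Many K y → ∃ λ p → ∃ λ q → p ≢ q × DnL y p × DnL y q
      go false k = k
      go true (p , q , _ , (ne , _) , a , b , _) = p , q , ne , a , b

    DnL-[] : ∀ {p} → ¬ DnL [] p
    DnL-[] {p} d = upL-dnL {[]} {p} (UpL-[] p) d

    short-¬BadL : ∀ y → length y ≤ 1 → ¬ BadL y
    short-¬BadL y l b = go y l (BadL-two {y} b)
      where
      go : ∀ y → length y ≤ 1 → ¬ (∃ λ p → ∃ λ q → p ≢ q × DnL y p × DnL y q)
      go [] l (p , q , ne , a , b) = DnL-[] a
      go (s ∷ []) l (p , q , ne , a , b) = ne (trans (sym (DnL1 {s} {p} a)) (DnL1 {s} {q} b))
      go (_ ∷ _ ∷ _) (s≤s ())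

    G-short : ∀ w → length w ≤ 1 → Reduced w → G w
    G-short w l hw a y e hy = short-¬BadL y (≤-trans (m≤n+m (length y) (length a)) (≤-trans (≤-reflexive (trans (sym (LP.length-++ a)) (Red-length hy hw e))) l))

  -- With a single left descent allowed, only the identity and the generators remain unreduced. The
  -- bound 1 obtained for them is what rules them out as elements of a-value 2.
  module Low where
    open Level false

    Cls : Word → Set
    Cls w = (w ∼ []) ⊎ (∃ λ s → w ∼ s ∷ [])

    classify : ∀ w → P w → Cls w
    classify [] _ = inj₁ ∼refl
    classify (p ∷ v) h = go (classify v (P-tail h))
      where
      go : Cls v → Cls (p ∷ v)
      go (inj₁ e) = inj₂ (p , ∼-++ˡ (p ∷ []) e)
      go (inj₂ (s , e)) = ⊥-elim (¬bad h' (inj₂ (p , s , proj₁ ps , toR {p ∷ s ∷ []} (proj₁ dn) , toR {p ∷ s ∷ []} (proj₂ dn))))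
        where
        h' : P (p ∷ s ∷ [])
        h' = P-eq (∼-++ˡ (p ∷ []) e) (cong suc (Red-length (isR (P-tail h)) (Red1 s) e)) h
        ps = P-pair h'
        dn = Dn-pair (proj₁ ps) (proj₂ ps)

    class : ∀ w → P w → G w × (Small w ⊎ LRed w)
    class w h = go (classify w h)
      where
      go : Cls w → G w × (Small w ⊎ LRed w)
      go (inj₁ e) = G-resp (∼sym e) (G-short [] z≤n Red-[]) , inj₁ (nil e)
      go (inj₂ (s , e)) = G-resp (∼sym e) (G-short (s ∷ []) (s≤s z≤n) (Red1 s)) , inj₁ (one s e)

    bound1-[] : CoeffBound 1 []
    bound1-[] = coeffBound class [] (G-short [] z≤n Red-[])

    bound1-one : ∀ s → CoeffBound 1 (s ∷ [])
    bound1-one s = coeffBound class (s ∷ []) (G-short (s ∷ []) (s≤s z≤n) (Red1 s))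

  -- Chains: reducedness, goodness, distinctness, and their classification.

  module High where
    open Level true public

    Chain : Word → Set
    Chain = Ch m (λ s t → toℕ s < toℕ t)

    Tip : Word → Fin n → Set
    Tip [] r = ⊥
    Tip (c ∷ []) r = r ≡ c
    Tip (s ∷ t ∷ []) r = (r ≡ s) ⊎ (r ≡ t)
    Tip (c ∷ _ ∷ _ ∷ _) r = r ≡ c

    m-self : ∀ {s} → ¬ (3 ≤ m s s)
    m-self {s} l = go (subst (3 ≤_) (Geo.mdiag geo s) l)
      where go : ¬ (3 ≤ 1)
            go (s≤s ())

    m-val : ∀ {s t} → s ≢ t → (m s t ≡ 2) ⊎ (m s t ≡ 3) ⊎ (m s t ≡ 4) ⊎ (m s t ≡ 5)
    m-val {s} {t} q = go (Geo.combo geo s t q)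
      where
      go : ∀ {k a b} → Combo k a b → (k ≡ 2) ⊎ (k ≡ 3) ⊎ (k ≡ 4) ⊎ (k ≡ 5)
      go c2 = inj₁ refl
      go c3 = inj₂ (inj₁ refl)
      go c4 = inj₂ (inj₂ (inj₁ refl))
      go c4' = inj₂ (inj₂ (inj₁ refl))
      go c5 = inj₂ (inj₂ (inj₂ refl))

    adj-Tip : ∀ {p c d x} → Chain (p ∷ c ∷ d ∷ x) → ∀ {r} → Tip (c ∷ d ∷ x) r → 3 ≤ m p r
    adj-Tip (forkᶜ _ a b) (inj₁ refl) = a
    adj-Tip (forkᶜ _ a b) (inj₂ refl) = b
    adj-Tip (dblˡ {u} {s} _ l) refl = sym≤ {3} {u} {s} (<⇒≤ l)
    adj-Tip (dblʳ {u} {s} {t} _ l) refl = sym≤ {3} {u} {t} (<⇒≤ l)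
    adj-Tip (quint _ l) refl = <⇒≤ (<⇒≤ l)
    adj-Tip (tailᶜ _ _ e) refl = ≤-reflexive (sym e)

    record Ok (x : Word) : Set where
      field
        red-ok : Reduced x
        G-ok   : G x
        tip    : ∀ {r} → DnL x r → Tip x r
    open Ok public

    head-DnL : ∀ {y z w} → y ∷ z ∼ w → length (y ∷ z) ≡ length w → Reduced w → DnL w y
    head-DnL {y} {z} {w} e l h = DnL-resp {y ∷ z} {w} {y} e (cons-DnL {z} {y} (Red-resp (∼sym e) (sym l) h))

    pair-tip : ∀ {s t} → s ≢ t → ∀ {r} → DnL (s ∷ t ∷ []) r → Tip (s ∷ t ∷ []) r
    pair-tip {s} {t} q {r} d = go (s Fin.≟ r)
      where
      three : ∀ k → 3 ≤ k → ∀ b → length (alt s r k ++ b) ≢ 2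
      three (suc (suc (suc k))) (s≤s (s≤s (s≤s _))) b ()
      go' : s ≢ r → (m s r ≡ 2) ⊎ (3 ≤ m s r) → Tip (s ∷ t ∷ []) r
      go' ne (inj₁ e) = inj₂ (sym (DnL1 {t} {r} (uncons-comm {s} {r} {t ∷ []} e ne (Red2 q) d)))
      go' ne (inj₂ l) with bothL {s ∷ t ∷ []} {s} {r} ne (Red2 q) (cons-DnL {t ∷ []} {s} (Red2 q)) d
      ... | b , _ , len = ⊥-elim (three (m s r) l b len)
      go : Dec (s ≡ r) → Tip (s ∷ t ∷ []) r
      go (yes e) = inj₁ (sym e)
      go (no ne) = go' ne (m-cases ne)

    pair-ok : ∀ {s t} → m s t ≡ 2 → Ok (s ∷ t ∷ [])
    pair-ok {s} {t} e = record { red-ok = Red2 q ; G-ok = g ; tip = pair-tip q }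
      where
      q : s ≢ t
      q = m≡2⇒≢ e
      pairAdj : ∀ {p q} → Tip (s ∷ t ∷ []) p → Tip (s ∷ t ∷ []) q → ¬ (3 ≤ m p q)
      pairAdj (inj₁ refl) (inj₁ refl) = m-self
      pairAdj (inj₁ refl) (inj₂ refl) = m≡2⇒¬3≤ e
      pairAdj (inj₂ refl) (inj₁ refl) = m≡2⇒¬3≤ (trans (m-sym t s) e)
      pairAdj (inj₂ refl) (inj₂ refl) = m-self
      pigeon : ∀ {p q r} → Tip (s ∷ t ∷ []) p → Tip (s ∷ t ∷ []) q → Tip (s ∷ t ∷ []) r → p ≢ q → p ≢ r → q ≢ r → ⊥
      pigeon (inj₁ refl) (inj₁ refl) _ a b c = a refl
      pigeon (inj₂ refl) (inj₂ refl) _ a b c = a refl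
      pigeon (inj₁ refl) (inj₂ refl) (inj₁ refl) a b c = b refl
      pigeon (inj₁ refl) (inj₂ refl) (inj₂ refl) a b c = c refl
      pigeon (inj₂ refl) (inj₁ refl) (inj₁ refl) a b c = c refl
      pigeon (inj₂ refl) (inj₁ refl) (inj₂ refl) a b c = b refl
      nb : ¬ BadL (s ∷ t ∷ [])
      nb (inj₁ (p , r , l , a , b)) = pairAdj (pair-tip q a) (pair-tip q b) l
      nb (inj₂ (a , b , c , (x , y , z) , da , db , dc)) = pigeon (pair-tip q da) (pair-tip q db) (pair-tip q dc) x y z
      g : G (s ∷ t ∷ [])
      g [] y e' hy bad = nb (BadL-resp e' bad)
      g (a ∷ a') y e' hy bad = short-¬BadL y (≤-pred (≤-trans (s≤s (m≤n+m (length y) (length a'))) (≤-reflexive (trans (cong suc (sym (LP.length-++ a'))) (Red-length hy (Red2 q) e'))))) bad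

    -- p ∷ c ∷ x' would begin with a longest element of ⟨p, c⟩
    no-both : ∀ {p c d x} → Chain (p ∷ c ∷ d ∷ x) → Reduced (d ∷ x) → (∀ {e y} → x ≡ e ∷ y → Ok (d ∷ x)) →
              ∀ k → k ≡ m p c → ∀ b → alt p c k ++ b ∼ p ∷ c ∷ d ∷ x → length (alt p c k ++ b) ≢ length (p ∷ c ∷ d ∷ x)
    no-both {p} {c} {d} {x} ch hx okx k ek b e len = go k ek ch (adj-Tip ch (tip₀ {d ∷ x})) e len
      where
      tip₀ : ∀ {y} → Tip (c ∷ y) c
      tip₀ {[]} = refl
      tip₀ {_ ∷ []} = inj₁ refl
      tip₀ {_ ∷ _ ∷ _} = refl
      inj-len : ∀ {a b : Word} → suc (suc (length a)) ≡ suc (suc (length b)) → length a ≡ length b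
      inj-len q = suc-injective (suc-injective q)
      go : ∀ k → k ≡ m p c → Chain (p ∷ c ∷ d ∷ x) → 3 ≤ m p c → alt p c k ++ b ∼ p ∷ c ∷ d ∷ x → length (alt p c k ++ b) ≡ length (p ∷ c ∷ d ∷ x) → ⊥
      go 0 ek ch l with subst (3 ≤_) (sym ek) l
      ... | ()
      go 1 ek ch l with subst (3 ≤_) (sym ek) l
      ... | s≤s ()
      go 2 ek ch l with subst (3 ≤_) (sym ek) l
      ... | s≤s (s≤s ())
      go (suc (suc (suc k))) ek ch l e len = cases k ek ch (∼-cons-cancel (∼-cons-cancel e)) (inj-len {p ∷ alt c p k ++ b} {d ∷ x} len)
        where
        4≢3 : ¬ (4 ≤ 3)
        4≢3 (s≤s (s≤s (s≤s ())))
        5≢4 : ¬ (5 ≤ 4)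
        5≢4 (s≤s (s≤s (s≤s (s≤s ()))))
        cases : ∀ k → 3 ℕ.+ k ≡ m p c → Chain (p ∷ c ∷ d ∷ x) → p ∷ alt c p k ++ b ∼ d ∷ x → length (p ∷ alt c p k ++ b) ≡ length (d ∷ x) → ⊥
        cases k ek (forkᶜ (pairᶜ _ _) _ l) e len = m-self (subst (λ z → 3 ≤ m p z) (DnL1 {d} {p} (head-DnL {p} e len hx)) l)
        cases 0 ek (dblˡ {u} {s} _ l) e len = 4≢3 (subst (4 ≤_) (trans (m-sym u s) (sym ek)) l)
        cases (suc k) ek (dblˡ {u} {s} {t} (forkᶜ _ _ l) _) e len =
          m-self (subst (λ z → 3 ≤ m u z) (DnL1 {t} {u} (head-DnL {u} (∼-cons-cancel e) (suc-injective len) (Red1 t))) l)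
        cases 0 ek (dblʳ {u} {s} {t} _ l) e len = 4≢3 (subst (4 ≤_) (trans (m-sym u t) (sym ek)) l)
        cases (suc k) ek (dblʳ {u} {s} {t} (forkᶜ (pairᶜ _ st) l _) _) e len =
          m-self (subst (λ z → 3 ≤ m u z) (DnL1 {s} {u} (head-DnL {u} (∼-cons-cancel (∼trans e (swap₂ st []))) (suc-injective len) (Red1 s))) l)
        cases 0 ek (quint _ l) e len = 4≢3 (<⇒≤ (subst (5 ≤_) (sym ek) l))
        cases 1 ek (quint _ l) e len = 5≢4 (subst (5 ≤_) (sym ek) l)
        cases (suc (suc k)) ek (quint {u} {s} {t} (forkᶜ _ _ l) _) e len =
          m-self (subst (λ z → 3 ≤ m u z) (DnL1 {t} {u} (head-DnL {u} (∼-cons-cancel (∼-cons-cancel e)) (suc-injective (suc-injective len)) (Red1 t))) l)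
        cases k ek (tailᶜ {e = f} {y} _ fr _) e len = clash y fr (tip (okx refl) {p} (head-DnL {p} e len hx))
          where
          clash : ∀ y → Fresh p (d ∷ f ∷ y) → Tip (d ∷ f ∷ y) p → ⊥
          clash [] (a , b) (inj₁ q) = a q
          clash [] (a , b) (inj₂ q) = b q
          clash (_ ∷ _) a q = a q

    -- Putting p in front is an upper star operation. All left descents of the tail lie in its
    -- `Tip`, whose letters do not commute with p; so p is not one of them. By `no-both`, c is not a
    -- descent of the new word, and `starG` applies. Another descent of the new word would commute
    -- with p by `FCL` and yet lie in that `Tip`.
    cons-ok : ∀ {p c d x} → Chain (p ∷ c ∷ d ∷ x) → Ok (c ∷ d ∷ x) → (∀ {e y} → x ≡ e ∷ y → Ok (d ∷ x)) → Ok (p ∷ c ∷ d ∷ x)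
    cons-ok {p} {c} {d} {x} ch ok' ok'' = record { red-ok = h ; G-ok = g ; tip = tp }
      where
      hx : Reduced (c ∷ d ∷ x)
      hx = red-ok ok'
      dc : DnL (c ∷ d ∷ x) c
      dc = cons-DnL {d ∷ x} {c} hx
      l : 3 ≤ m p c
      l = adj-Tip ch (tip ok' dc)
      up : UpL (c ∷ d ∷ x) p
      up = go (upL? (c ∷ d ∷ x) p)
        where go : UpL (c ∷ d ∷ x) p ⊎ DnL (c ∷ d ∷ x) p → UpL (c ∷ d ∷ x) p
              go (inj₁ u) = u
              go (inj₂ dn) = ⊥-elim (m-self (adj-Tip ch (tip ok' dn)))
      h : Reduced (p ∷ c ∷ d ∷ x)
      h = Red-upL {c ∷ d ∷ x} {p} hx up
      ¬dn : ¬ DnL (p ∷ c ∷ d ∷ x) c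
      ¬dn dn = go (bothL {p ∷ c ∷ d ∷ x} {p} {c} (m≥3⇒≢ l) h (cons-DnL {c ∷ d ∷ x} {p} h) dn)
        where go : (∃ λ b → alt p c (m p c) ++ b ∼ p ∷ c ∷ d ∷ x × length (alt p c (m p c) ++ b) ≡ length (p ∷ c ∷ d ∷ x)) → ⊥
              go (b , e , len) = no-both ch (Red-suffix (c ∷ []) (d ∷ x) hx) ok'' (m p c) refl b e len
      upc : UpL (p ∷ c ∷ d ∷ x) c
      upc = go (upL? (p ∷ c ∷ d ∷ x) c)
        where go : UpL (p ∷ c ∷ d ∷ x) c ⊎ DnL (p ∷ c ∷ d ∷ x) c → UpL (p ∷ c ∷ d ∷ x) c
              go (inj₁ u) = u
              go (inj₂ dn) = ⊥-elim (¬dn dn)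
      g : G (p ∷ c ∷ d ∷ x)
      g = starG c p l {c ∷ d ∷ x} (G-ok ok') hx dc up upc
      tp : ∀ {r} → DnL (p ∷ c ∷ d ∷ x) r → r ≡ p
      tp {r} dn = go (p Fin.≟ r)
        where go : Dec (p ≡ r) → r ≡ p
              go (yes e) = sym e
              go (no ne) = ⊥-elim (m≡2⇒¬3≤ (proj₁ f) (adj-Tip ch (tip ok' (proj₂ f))))
                where f = FCL {p} {c ∷ d ∷ x} {r} h g dn ne

    chain-ok : ∀ x → Chain x → Ok x
    chain-ok (s ∷ t ∷ []) (pairᶜ _ e) = pair-ok e
    chain-ok (p ∷ c ∷ d ∷ []) ch = cons-ok ch (chain-ok (c ∷ d ∷ []) (Ch-tail ch)) λ ()
    chain-ok (p ∷ c ∷ d ∷ e ∷ x) ch = cons-ok ch (chain-ok (c ∷ d ∷ e ∷ x) (Ch-tail ch)) λ _ → chain-ok (d ∷ e ∷ x) (Ch-tail (Ch-tail ch))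

    chain-LRed : ∀ {p c d x} → Chain (p ∷ c ∷ d ∷ x) → LRed (p ∷ c ∷ d ∷ x)
    chain-LRed {p} {c} {d} {x} ch = lred p c (c ∷ d ∷ x) ∼refl (red-ok ok) dc (go (upL? (p ∷ c ∷ d ∷ x) c)) l
      where
      ok = chain-ok (p ∷ c ∷ d ∷ x) ch
      ok' = chain-ok (c ∷ d ∷ x) (Ch-tail ch)
      dc : DnL (c ∷ d ∷ x) c
      dc = cons-DnL {d ∷ x} {c} (red-ok ok')
      l : 3 ≤ m p c
      l = adj-Tip ch (tip ok' dc)
      go : UpL (p ∷ c ∷ d ∷ x) c ⊎ DnL (p ∷ c ∷ d ∷ x) c → UpL (p ∷ c ∷ d ∷ x) c
      go (inj₁ u) = u
      go (inj₂ dn) = ⊥-elim (m≥3⇒≢ l (sym (tip ok dn)))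

    -- Beyond the pair, the first letter of a chain is its only left descent. So every reduced word
    -- of the element follows the chain down to the commuting pair, and ends in its two letters.
    chain-Q : ∀ x → Chain x → Q x
    chain-Q (s ∷ t ∷ []) (pairᶜ _ st) [] y z h e l = go (pair-tip (m≡2⇒≢ st) (head-DnL {y} e refl (Red2 (m≡2⇒≢ st))))
      where
      last : ∀ {a b} → a ∷ [] ∼ b ∷ [] → b ≡ a
      last {a} {b} e = DnL1 {b} {a} (head-DnL {a} e refl (Red1 b))
      go : (y ≡ s) ⊎ (y ≡ t) → ⊥
      go (inj₁ refl) = m≡2⇒¬3≤ st (subst (λ v → 3 ≤ m y v) (sym (last (∼-cons-cancel e))) l)
      go (inj₂ refl) = m≡2⇒¬3≤ st (sym≤ {3} {y} {s} (subst (λ v → 3 ≤ m y v) (sym (last (∼-cons-cancel (∼trans e (swap₂ st []))))) l))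
    chain-Q (s ∷ t ∷ []) (pairᶜ _ st) (a ∷ b) y z h e l with m≤n⇒m≤o+n (length b) (≤-refl {3})
    ... | le = <⇒≱ (≤-reflexive refl) (≤-trans (≤-trans (≤-trans le (≤-reflexive (len b))) (≤-reflexive refl)) (≤-reflexive (Red-length h (Red2 (m≡2⇒≢ st)) e)))
      where
      len : ∀ (b : Word) → length b ℕ.+ 3 ≡ length (a ∷ b ++ y ∷ z ∷ [])
      len b = trans (+-suc (length b) 2) (cong suc (sym (LP.length-++ b)))
    chain-Q (p ∷ c ∷ d ∷ x) ch [] y z h e l with Red-length h (red-ok (chain-ok (p ∷ c ∷ d ∷ x) ch)) e
    ... | ()
    chain-Q (p ∷ c ∷ d ∷ x) ch (q ∷ b) y z h e l = go (tip ok (DnL-resp {q ∷ b ++ y ∷ z ∷ []} {p ∷ c ∷ d ∷ x} {q} e (cons-DnL {b ++ y ∷ z ∷ []} {q} h)))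
      where
      ok = chain-ok (p ∷ c ∷ d ∷ x) ch
      go : q ≡ p → ⊥
      go refl = chain-Q (c ∷ d ∷ x) (Ch-tail ch) b y z (Red-suffix (q ∷ []) (b ++ y ∷ z ∷ []) h) (∼-cons-cancel e) l

    chain-Dn : ∀ x → Chain x → ∃ λ s → ∃ λ t → s ≢ t × Dn x s × Dn x t
    chain-Dn (s ∷ t ∷ []) (pairᶜ _ e) = s , t , m≡2⇒≢ e , Dn-pair (m≡2⇒≢ e) e
    chain-Dn (p ∷ c ∷ d ∷ x) ch with chain-Dn (c ∷ d ∷ x) (Ch-tail ch)
    ... | s , t , ne , a , b = s , t , ne , Dn-cons {p} {c ∷ d ∷ x} {s} h a , Dn-cons {p} {c ∷ d ∷ x} {t} h b
      where h = red-ok (chain-ok (p ∷ c ∷ d ∷ x) ch)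

    -- First letters agree because each is the only left descent; at the commuting pair the order s
    -- < t selects one of its two words.
    chain-inj : ∀ x y → Chain x → Chain y → x ∼ y → x ≡ y
    chain-inj (s ∷ t ∷ []) (s' ∷ t' ∷ []) (pairᶜ l st) (pairᶜ l' st') e = go (pair-tip (m≡2⇒≢ st') (head-DnL {s} e refl (Red2 (m≡2⇒≢ st'))))
      where
      last : ∀ {a b} → a ∷ [] ∼ b ∷ [] → b ≡ a
      last {a} {b} e = DnL1 {b} {a} (head-DnL {a} e refl (Red1 b))
      go : (s ≡ s') ⊎ (s ≡ t') → s ∷ t ∷ [] ≡ s' ∷ t' ∷ []
      go (inj₁ refl) = cong (λ z → s ∷ z ∷ []) (sym (last (∼-cons-cancel e)))
      go (inj₂ refl) = ⊥-elim (<-asym l (subst (λ z → toℕ z < toℕ s) (last (∼-cons-cancel (∼trans e (swap₂ st' [])))) l'))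
    chain-inj (s ∷ t ∷ []) (p ∷ c ∷ d ∷ y) ch ch' e with Red-length (red-ok (chain-ok _ ch)) (red-ok (chain-ok _ ch')) e
    ... | ()
    chain-inj (p ∷ c ∷ d ∷ y) (s ∷ t ∷ []) ch ch' e with Red-length (red-ok (chain-ok _ ch)) (red-ok (chain-ok _ ch')) e
    ... | ()
    chain-inj (p ∷ c ∷ d ∷ x) (p' ∷ c' ∷ d' ∷ x') ch ch' e = go (chain-inj (c ∷ d ∷ x) (c' ∷ d' ∷ x') (Ch-tail ch) (Ch-tail ch'))
        (tip ok' (DnL-resp {p ∷ c ∷ d ∷ x} {p' ∷ c' ∷ d' ∷ x'} {p} e (cons-DnL {c ∷ d ∷ x} {p} (red-ok ok))))
      where
      ok = chain-ok (p ∷ c ∷ d ∷ x) ch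
      ok' = chain-ok (p' ∷ c' ∷ d' ∷ x') ch'
      go : (c ∷ d ∷ x ∼ c' ∷ d' ∷ x' → c ∷ d ∷ x ≡ c' ∷ d' ∷ x') → p ≡ p' → p ∷ c ∷ d ∷ x ≡ p' ∷ c' ∷ d' ∷ x'
      go rec refl = cong (p ∷_) (rec (∼-cons-cancel e))

    braid≡ : ∀ {k s t} → m s t ≡ k → ∀ z → alt s t k ++ z ∼ alt t s k ++ z
    braid≡ {k} {s} {t} e z = subst (λ k → alt s t k ++ z ∼ alt t s k ++ z) e (∼braid [] z s t)

    -- The properties of the diagram on which the classification rests. Uniqueness of prolongation
    -- excludes a letter that commutes with the head of a chain. The weight condition supplies the 3
    -- demanded by `tailᶜ`. As pairs are ordered by s < t, a weight 5 between u and t would call for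
    -- a mirror image of `quint`.
    Tame : Set
    Tame = (∀ {p p' c d x} → Chain (p ∷ c ∷ d ∷ x) → Chain (p' ∷ c ∷ d ∷ x) → p ≡ p') ×
           (∀ {p c d e x} → Chain (c ∷ d ∷ e ∷ x) → Fresh p (d ∷ e ∷ x) → 3 ≤ m p c → m p c ≡ 3) ×
           (∀ {u s t} → Chain (u ∷ s ∷ t ∷ []) → ¬ (5 ≤ m u t))

    module _ (tame : Tame) where
      private
        unique : ∀ {p p' c d x} → Chain (p ∷ c ∷ d ∷ x) → Chain (p' ∷ c ∷ d ∷ x) → p ≡ p'
        unique = proj₁ tame
        weight : ∀ {p c d e x} → Chain (c ∷ d ∷ e ∷ x) → Fresh p (d ∷ e ∷ x) → 3 ≤ m p c → m p c ≡ 3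
        weight = proj₁ (proj₂ tame)

      -- A letter p not commuting with c and different from the letters that can follow c gives
      -- `tailᶜ`. If p repeats such a letter, the weight of the edge decides: when a full braid word
      -- is present, the braid move produces either a word ending in two non-commuting letters or a
      -- second prolongation of a shorter chain; otherwise one of the special chains appears.
      extend : ∀ {c d e x} → Chain (c ∷ d ∷ e ∷ x) → (∀ p → P (p ∷ d ∷ e ∷ x) → Chain (p ∷ d ∷ e ∷ x)) →
        (∀ p → x ≢ [] → P (p ∷ e ∷ x) → Chain (p ∷ e ∷ x)) → ∀ p → P (p ∷ c ∷ d ∷ e ∷ x) → Chain (p ∷ c ∷ d ∷ e ∷ x)
      extend {c} {d} {e} {x} ch rec₁ rec₂ p h = go (p Fin.≟ c)
        where
        ¬cc : p ≢ c
        ¬cc refl = <⇒≱ (≤-trans (n≤1+n _) ≤-refl) (isR h (d ∷ e ∷ x) (∼sym (∼-cons² p (d ∷ e ∷ x))))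
        bad : ∀ {a b} → a ≢ b → ¬ (5 ≤ m a b) → 4 ≤ m a b → m a b ≡ 4
        bad {a} {b} q n5 l4 = f (m-val q)
          where
          f : (m a b ≡ 2) ⊎ (m a b ≡ 3) ⊎ (m a b ≡ 4) ⊎ (m a b ≡ 5) → m a b ≡ 4
          f (inj₁ r) with subst (4 ≤_) r l4
          ... | s≤s (s≤s ())
          f (inj₂ (inj₁ r)) with subst (4 ≤_) r l4
          ... | s≤s (s≤s (s≤s ()))
          f (inj₂ (inj₂ (inj₁ r))) = r
          f (inj₂ (inj₂ (inj₂ r))) = ⊥-elim (n5 (≤-reflexive (sym r)))
        is5 : ∀ {a b} → a ≢ b → 5 ≤ m a b → m a b ≡ 5
        is5 {a} {b} q l5 = f (m-val q)
          where
          f : (m a b ≡ 2) ⊎ (m a b ≡ 3) ⊎ (m a b ≡ 4) ⊎ (m a b ≡ 5) → m a b ≡ 5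
          f (inj₁ r) with subst (5 ≤_) r l5
          ... | s≤s (s≤s ())
          f (inj₂ (inj₁ r)) with subst (5 ≤_) r l5
          ... | s≤s (s≤s (s≤s ()))
          f (inj₂ (inj₂ (inj₁ r))) with subst (5 ≤_) r l5
          ... | s≤s (s≤s (s≤s (s≤s ())))
          f (inj₂ (inj₂ (inj₂ r))) = r
        -- p is the second letter of the chain and m p c ≥ 4
        far : ∀ {x} → P (d ∷ c ∷ d ∷ e ∷ x) → Chain (c ∷ d ∷ e ∷ x) → 4 ≤ m d c → Chain (d ∷ c ∷ d ∷ e ∷ x)
        far h (forkᶜ k a b) l = dblˡ (forkᶜ k a b) (sym≤ {4} {d} {c} l)
        far h (dblˡ {u} {s} {t} (forkᶜ k a b) l') l with 5 ℕ.≤? m u s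
        ... | yes l5 = quint (forkᶜ k a b) l5
        -- For weight 4 the braid relation turns u s u s t into s u s u t, which ends in the
        -- non-commuting letters u t. The cases `dblʳ` and `quint` fail in the same way.
        ... | no n5 = ⊥-elim (P-end (s ∷ u ∷ s ∷ []) u t b (braid≡ {4} (bad (m≥3⇒≢ a) n5 l) (t ∷ [])) refl h)
        far h (dblʳ {u} {s} {t} (forkᶜ (pairᶜ lt st) a b) l') l = ⊥-elim (P-end (t ∷ u ∷ t ∷ []) u s a
           (∼trans (∼-++ˡ (u ∷ t ∷ u ∷ []) (swap₂ st [])) (braid≡ {4} (bad (m≥3⇒≢ b) (proj₂ (proj₂ tame) (forkᶜ (pairᶜ lt st) a b)) l) (s ∷ []))) refl h)
        far h (quint {u} {s} {t} (forkᶜ k a b) l') l = ⊥-elim (P-end (u ∷ s ∷ u ∷ s ∷ []) u t b (braid≡ {5} (is5 (λ q → m≥3⇒≢ a (sym q)) (sym≤ {5} {u} {s} l')) (t ∷ [])) refl h)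
        far h (tailᶜ _ _ e3) l with subst (4 ≤_) (trans (m-sym d c) e3) l
        ... | s≤s (s≤s (s≤s ()))
        eq3 : ∀ {k} → 3 ≤ k → ¬ (4 ≤ k) → k ≡ 3
        eq3 l n4 = sym (≤-antisym l (≤-pred (≰⇒> n4)))
        -- Now d c d becomes c d c. If nothing follows e, the word ends in the non-commuting letters
        -- c e; otherwise c prolongs the chain after d just as d does, against uniqueness.
        near : ∀ x → (∀ p → x ≢ [] → P (p ∷ e ∷ x) → Chain (p ∷ e ∷ x)) → Chain (c ∷ d ∷ e ∷ x) → P (d ∷ c ∷ d ∷ e ∷ x) → m d c ≡ 3 → Chain (d ∷ c ∷ d ∷ e ∷ x)
        near [] rec (forkᶜ _ a b) h e3 = ⊥-elim (P-end (c ∷ d ∷ []) c e b (braid≡ {3} e3 (e ∷ [])) refl h)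
        near (f ∷ x) rec ch h e3 = ⊥-elim (m≥3⇒≢ {c} {d} (≤-reflexive (sym (trans (m-sym c d) e3)))
           (unique (rec c (λ ()) (P-tail (P-tail (P-eq (braid≡ {3} e3 (e ∷ f ∷ x)) refl h)))) (Ch-tail ch)))
        -- Here p is the second letter of the commuting pair. For weight 3, e c d e = e c e d = c e
        -- c d ends in the non-commuting letters c d.
        twin : Chain (c ∷ d ∷ e ∷ []) → P (e ∷ c ∷ d ∷ e ∷ []) → 3 ≤ m e c → Chain (e ∷ c ∷ d ∷ e ∷ [])
        twin ch h l with 4 ℕ.≤? m c e
        ... | yes l4 = dblʳ ch l4
        twin (forkᶜ (pairᶜ lt st) a b) h l | no n4 = ⊥-elim (P-end (c ∷ e ∷ []) c d a (∼trans (∼-++ˡ (e ∷ c ∷ []) (swap₂ st [])) (braid≡ {3} (trans (m-sym e c) (eq3 b n4)) (d ∷ []))) refl h)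
        third : ∀ x → Chain (c ∷ d ∷ e ∷ x) → P (p ∷ c ∷ d ∷ e ∷ x) → p ≢ d → 3 ≤ m p c → Chain (p ∷ c ∷ d ∷ e ∷ x)
        third (f ∷ x) ch h q l = tailᶜ ch q (weight ch q l)
        third [] ch h q l with p Fin.≟ e
        ... | yes refl = twin ch h l
        ... | no q' = tailᶜ ch (q , q') (weight ch (q , q') l)
        meet : Dec (p ≡ d) → 3 ≤ m p c → Chain (p ∷ c ∷ d ∷ e ∷ x)
        meet (no q) l = third x ch h q l
        meet (yes refl) l with 4 ℕ.≤? m p c
        ... | yes l4 = far h ch l4
        ... | no n4 = near x rec₂ ch h (eq3 l n4)
        go' : (m p c ≡ 2) ⊎ (3 ≤ m p c) → p ≢ c → Chain (p ∷ c ∷ d ∷ e ∷ x)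
        -- If p commutes with c it can be moved behind c; then p prolongs the tail as c does, so p =
        -- c.
        go' (inj₁ a) q = ⊥-elim (q (unique (rec₁ p (P-tail (P-eq (swap₂ a (d ∷ e ∷ x)) refl h))) ch))
        go' (inj₂ l) q = meet (p Fin.≟ d) l
        go : Dec (p ≡ c) → Chain (p ∷ c ∷ d ∷ e ∷ x)
        go (yes q) = ⊥-elim (¬cc q)
        go (no q) = go' (m-cases q) q

      -- Before a commuting pair, p may commute with neither letter: if it commutes with exactly
      -- one, the word can be made to end in p and the other, and if it commutes with both, there
      -- are three commuting right descents.
      prepend : ∀ x → Chain x → ∀ p → P (p ∷ x) → Chain (p ∷ x)
      prepend (s ∷ t ∷ []) (pairᶜ lt st) p h = go (m-cases p≢s) (m-cases p≢t)
        where
        p≢s : p ≢ s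
        p≢s refl with isR h (t ∷ []) (∼sym (∼-cons² p (t ∷ [])))
        ... | s≤s ()
        e₁ : p ∷ s ∷ t ∷ [] ∼ p ∷ t ∷ s ∷ []
        e₁ = ∼-++ˡ (p ∷ []) (swap₂ st [])
        p≢t : p ≢ t
        p≢t refl with isR h (s ∷ []) (∼sym (∼trans e₁ (∼-cons² p (s ∷ []))))
        ... | s≤s ()
        go : (m p s ≡ 2) ⊎ (3 ≤ m p s) → (m p t ≡ 2) ⊎ (3 ≤ m p t) → Chain (p ∷ s ∷ t ∷ [])
        go (inj₂ a) (inj₂ b) = forkᶜ (pairᶜ lt st) a b
        go (inj₁ a) (inj₂ b) = ⊥-elim (P-end (s ∷ []) p t b (swap₂ a (t ∷ [])) refl h)
        go (inj₂ a) (inj₁ b) = ⊥-elim (P-end (t ∷ []) p s a (∼trans e₁ (swap₂ b (s ∷ []))) refl h)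
        go (inj₁ a) (inj₁ b) = ⊥-elim (¬bad h (inj₂ (p , s , t , (p≢s , p≢t , m≡2⇒≢ st) , toR {w} (end (s ∷ t ∷ []) p e₂ refl) , toR {w} (end (p ∷ t ∷ []) s e₁ refl) , toR {w} (end (p ∷ s ∷ []) t ∼refl refl))))
          where
          w : Word
          w = p ∷ s ∷ t ∷ []
          end : ∀ b z → w ∼ b ∷ʳ z → length w ≡ length (b ∷ʳ z) → Dn w z
          end b z e l = Dn-resp (∼sym e) (snoc-Dn {b} {z} (Red-resp e l (isR h)))
          e₂ : w ∼ s ∷ t ∷ p ∷ []
          e₂ = ∼trans (swap₂ a (t ∷ [])) (∼-++ˡ (s ∷ []) (swap₂ b []))
      prepend (c ∷ d ∷ e ∷ []) ch = extend ch (prepend (d ∷ e ∷ []) (Ch-tail ch)) (λ _ q → ⊥-elim (q refl))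
      prepend (c ∷ d ∷ e ∷ f ∷ x) ch = extend ch (prepend (d ∷ e ∷ f ∷ x) (Ch-tail ch)) (λ p _ → prepend (e ∷ f ∷ x) (Ch-tail (Ch-tail ch)) p)

      Cls : Word → Set
      Cls w = (w ∼ []) ⊎ (∃ λ s → w ∼ s ∷ []) ⊎ (∃ λ x → Chain x × x ∼ w)

      classify : ∀ w → P w → Cls w
      classify [] _ = inj₁ ∼refl
      classify (p ∷ v) h = go (classify v (P-tail h))
        where
        go : Cls v → Cls (p ∷ v)
        go (inj₁ e) = inj₂ (inj₁ (p , ∼-++ˡ (p ∷ []) e))
        go (inj₂ (inj₂ (x , ch , e))) = inj₂ (inj₂ (p ∷ x , prepend x ch p (P-eq (∼-++ˡ (p ∷ []) (∼sym e)) (cong suc (Red-length (isR (P-tail h)) (red-ok (chain-ok x ch)) (∼sym e))) h) , ∼-++ˡ (p ∷ []) e))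
        go (inj₂ (inj₁ (s , e))) = order (P-pair (P-eq e' (cong suc (Red-length (isR (P-tail h)) (Red1 s) e)) h)) (<-cmp (toℕ p) (toℕ s))
          where
          e' : p ∷ v ∼ p ∷ s ∷ []
          e' = ∼-++ˡ (p ∷ []) e
          order : p ≢ s × m p s ≡ 2 → Tri (toℕ p < toℕ s) (toℕ p ≡ toℕ s) (toℕ s < toℕ p) → Cls (p ∷ v)
          order (q , c) (tri< l _ _) = inj₂ (inj₂ (p ∷ s ∷ [] , pairᶜ l c , ∼sym e'))
          order (q , c) (tri≈ _ l _) = ⊥-elim (q (FP.toℕ-injective l))
          order (q , c) (tri> _ _ l) = inj₂ (inj₂ (s ∷ p ∷ [] , pairᶜ l (trans (m-sym s p) c) , ∼sym (∼trans e' (swap₂ c []))))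

      chain-class : ∀ x → Chain x → Small x ⊎ LRed x
      chain-class (s ∷ t ∷ []) (pairᶜ _ e) = inj₁ (two s t refl (m≡2⇒≢ e) ∼refl)
      chain-class (p ∷ c ∷ d ∷ x) ch = inj₂ (chain-LRed ch)

      class : ∀ w → P w → G w × (Small w ⊎ LRed w)
      class w h = go (classify w h)
        where
        carry : ∀ {x} → x ∼ w → Small x ⊎ LRed x → Small w ⊎ LRed w
        carry e (inj₁ (nil q)) = inj₁ (nil (∼trans (∼sym e) q))
        carry e (inj₁ (one s q)) = inj₁ (one s (∼trans (∼sym e) q))
        carry e (inj₁ (two s t k ne q)) = inj₁ (two s t k ne (∼trans (∼sym e) q))
        carry {x} e (inj₂ (lred t r w₁ eq redt dnr upr adj)) = inj₂ (lred t r w₁ (∼trans eq e) redt dnr (UpL-resp {x} {w} {r} e upr) adj)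
        go : Cls w → G w × (Small w ⊎ LRed w)
        go (inj₁ e) = G-resp (∼sym e) (G-short [] z≤n Red-[]) , inj₁ (nil e)
        go (inj₂ (inj₁ (s , e))) = G-resp (∼sym e) (G-short (s ∷ []) (s≤s z≤n) (Red1 s)) , inj₁ (one s e)
        go (inj₂ (inj₂ (x , ch , e))) = G-resp e (G-ok (chain-ok x ch)) , carry e (chain-class x ch)

      CoeffBound-resp : ∀ {a z z'} → z ∼ z' → CoeffBound a z → CoeffBound a z'
      CoeffBound-resp e cb x y Cx Cy kx ky E ex = All.map (λ f p → f (∼trans p (∼sym e))) (cb x y Cx Cy kx ky E ex)

      lastL-adj : ∀ {s t} → 3 ≤ m s t → ∀ k → 3 ≤ m (lastL s t k) (lastL s t (suc k))
      lastL-adj l zero = l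
      lastL-adj {s} {t} l (suc k) = lastL-adj {t} {s} (sym≤ {3} {s} {t} l) k

      Q⇒LeftStub : ∀ {w} → Q w → LeftStub w
      Q⇒LeftStub {w} q s t l (a , suc (suc k) , _ , _ , h , e , _) = q (a ++ alt s t k) (lastL s t k) (lastL s t (suc k)) (subst Reduced eq h) (∼trans (≡⇒∼ (sym eq)) e) (lastL-adj {s} {t} l k)
        where
        eq : a ++ alt s t (suc (suc k)) ≡ (a ++ alt s t k) ++ lastL s t k ∷ lastL s t (suc k) ∷ []
        eq = trans (cong (a ++_) (trans (alt-snoc s t (suc k)) (trans (cong (_∷ʳ lastL s t (suc k)) (alt-snoc s t k)) (LP.++-assoc (alt s t k) (lastL s t k ∷ []) (lastL s t (suc k) ∷ []))))) (sym (LP.++-assoc a (alt s t k) _))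
      Q⇒LeftStub q s t l (a , suc zero , s≤s () , _)

      -- Let u end in the non-commuting letters x y and write u = a w_I with I = {x , y}. As y and
      -- then x can be taken off, w_I has length at least 2. Below m this is a right lower star
      -- operation; at m both letters are right descents, which is excluded.
      LeftStub⇒Q : ∀ {w} → ¬ BadR w → LeftStub w → Q w
      LeftStub⇒Q {w} nb st b x y h e l = go (decomp u h)
        where
        x≢y : x ≢ y
        x≢y = m≥3⇒≢ l
        open Coset x y x≢y
        u : Word
        u = b ++ x ∷ y ∷ []
        eq : (b ∷ʳ x) ∷ʳ y ≡ u
        eq = LP.++-assoc b (x ∷ []) (y ∷ [])
        h' : Reduced ((b ∷ʳ x) ∷ʳ y)
        h' = subst Reduced (sym eq) h
        dy : Dn u y
        dy = subst (λ z → Dn z y) eq (snoc-Dn {b ∷ʳ x} {y} h')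
        dx : Dn (b ∷ʳ x) x
        dx = snoc-Dn {b} {x} (Red-prefix (b ∷ʳ x) (y ∷ []) h')
        Dnw : ∀ z → Dn u z → Dn w z
        Dnw z = Dn-resp e
        ¬dx : ¬ Dn u x
        ¬dx d = nb (inj₁ (x , y , l , toR {w} (Dnw x d) , toR {w} (Dnw y dy)))
        m≤5 : m x y ≤ 5
        m≤5 = f (m-val x≢y)
          where
          f : (m x y ≡ 2) ⊎ (m x y ≡ 3) ⊎ (m x y ≡ 4) ⊎ (m x y ≡ 5) → m x y ≤ 5
          f (inj₁ r) = subst (_≤ 5) (sym r) (s≤s (s≤s z≤n))
          f (inj₂ (inj₁ r)) = subst (_≤ 5) (sym r) (s≤s (s≤s (s≤s z≤n)))
          f (inj₂ (inj₂ (inj₁ r))) = subst (_≤ 5) (sym r) (s≤s (s≤s (s≤s (s≤s z≤n))))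
          f (inj₂ (inj₂ (inj₂ r))) = ≤-reflexive r
        star : ∀ a z j → 2 ≤ j → j < m x y → word a z j ∼ u → Up a x → Up a y → Reduced a → ⊥
        star a z j l₂ lm e' ux uy ha = fin (altB-altF z j l₂ (≤-pred (≤-trans lm m≤5)))
          where
          hw : Reduced (word a z j)
          hw = word-Red ux uy ha z j (<⇒≤ lm)
          lm' : j ≤ m x y ∸ 1
          lm' = ∸-monoˡ-≤ 1 lm
          fin : (∃ λ z' → altB z j ≡ altF z' j) → ⊥
          fin (false , q) = st x y l (a , j , l₂ , lm' , subst Reduced q' hw , ∼trans (≡⇒∼ (sym q')) (∼trans e' e) , Red-up ha ux , Red-up ha uy)
            where q' : word a z j ≡ a ++ alt x y j
                  q' = cong (a ++_) (trans (cong (map ι) q) (sym (alt-s j)))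
          fin (true , q) = st y x (sym≤ {3} {x} {y} l) (a , j , l₂ , subst (λ k → j ≤ k ∸ 1) (m-sym x y) lm' , subst Reduced q' hw , ∼trans (≡⇒∼ (sym q')) (∼trans e' e) , Red-up ha uy , Red-up ha ux)
            where q' : word a z j ≡ a ++ alt y x j
                  q' = cong (a ++_) (trans (cong (map ι) q) (sym (alt-t j)))
        top : ∀ a z j → Up a x → Up a y → j ≡ m x y → word a z j ∼ u → ⊥
        top a z zero ux uy q e' with subst (3 ≤_) (sym q) l
        ... | ()
        top a z (suc j) ux uy q e' = both-dn z (Dn-resp e' (word-last ux uy z {j} (≤-reflexive q))) (Dn-resp e' (subst (λ k → Dn (word a z k) (ι (not z))) (sym q) (word-top ux uy z)))
          where
          both-dn : ∀ z → Dn u (ι z) → Dn u (ι (not z)) → ⊥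
          both-dn false d _ = ¬dx d
          both-dn true _ d = ¬dx d
        go : Decomp u → ⊥
        go (a , z , zero , jm , e' , len , ux , uy , ha) = up-dn uy (Dn-resp (∼sym (∼trans (≡⇒∼ (sym (LP.++-identityʳ a))) e')) dy)
        go (a , false , suc zero , jm , e' , len , ux , uy , ha) = up-dn (Up-resp e' (word-other ux uy false {1} (≤-trans (s≤s (s≤s z≤n)) l))) dy
        go (a , true , suc zero , jm , e' , len , ux , uy , ha) = up-dn ux (Dn-resp (∼sym (∼-snoc-cancel {a} {b ∷ʳ x} {y} (∼trans e' (≡⇒∼ (sym eq))))) dx)
        go (a , z , suc (suc j) , jm , e' , len , ux , uy , ha) with suc (suc j) ℕ.≟ m x y
        ... | yes q = top a z (suc (suc j)) ux uy q e'
        ... | no q = star a z (suc (suc j)) (s≤s (s≤s z≤n)) (≤∧≢⇒< jm q) e' ux uy ha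

      ¬BadR-bound2 : ∀ {w} → Reduced w → CoeffBound 2 w → ¬ BadR w
      ¬BadR-bound2 {w} h cb (inj₁ (s , t , l , a , b)) = ¬bound2-edge h l (fromR {w} a) (fromR {w} b) cb
      ¬BadR-bound2 {w} h cb (inj₂ (a , b , c , (p , q , r) , da , db , dc)) with 3 ℕ.≤? m a b | 3 ℕ.≤? m a c | 3 ℕ.≤? m b c
      ... | yes l | _ | _ = ¬bound2-edge h l (fromR {w} da) (fromR {w} db) cb
      ... | no _ | yes l | _ = ¬bound2-edge h l (fromR {w} da) (fromR {w} dc) cb
      ... | no _ | no _ | yes l = ¬bound2-edge h l (fromR {w} db) (fromR {w} dc) cb
      ... | no x | no y | no z = ¬bound2-triple h p q r red₃ (fromR {w} da) (fromR {w} db) (fromR {w} dc) cb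
        where
        comm : ∀ {s t} → s ≢ t → ¬ (3 ≤ m s t) → m s t ≡ 2
        comm q n = f (m-cases q)
          where f : _ → _
                f (inj₁ e) = e
                f (inj₂ l) = ⊥-elim (n l)
        red₃ : Reduced (a ∷ b ∷ c ∷ [])
        red₃ = f (upL? (b ∷ c ∷ []) a)
          where
          f : UpL (b ∷ c ∷ []) a ⊎ DnL (b ∷ c ∷ []) a → Reduced (a ∷ b ∷ c ∷ [])
          f (inj₁ u) = Red-upL {b ∷ c ∷ []} {a} (Red2 r) u
          f (inj₂ d) = g (pair-tip r d)
            where g : Tip (b ∷ c ∷ []) a → Reduced (a ∷ b ∷ c ∷ [])
                  g (inj₁ q') = ⊥-elim (p q')
                  g (inj₂ q') = ⊥-elim (q q')

      stub⇒chain : ∀ w → LeftStub w → AValue2 w → ∃ λ x → Chain x × x ∼ w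
      stub⇒chain w st (b2 , nb1) = go (classify v (mkP hv nb (LeftStub⇒Q nb stv)))
        where
        v : Word
        v = red w
        hv = red-Red w
        ev' : v ∼ w
        ev' = red-∼ w
        nb : ¬ BadR v
        nb = ¬BadR-bound2 hv (CoeffBound-resp (∼sym ev') b2)
        stv : LeftStub v
        stv s t l (a , i , x , y , h , e , k) = st s t l (a , i , x , y , h , ∼trans e ev' , k)
        go : Cls v → ∃ λ x → Chain x × x ∼ w
        go (inj₁ e) = ⊥-elim (nb1 (CoeffBound-resp (∼trans (∼sym e) ev') (Low.bound1-[])))
        go (inj₂ (inj₁ (s , e))) = ⊥-elim (nb1 (CoeffBound-resp (∼trans (∼sym e) ev') (Low.bound1-one s)))
        go (inj₂ (inj₂ (x , ch , e))) = x , ch , ∼trans e ev'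

      chain⇒stub : ∀ {x} w → Chain x → x ∼ w → LeftStub w × AValue2 w
      chain⇒stub {x} w ch e = (λ s t l → λ { (a , i , y , z , h , e' , k) → Q⇒LeftStub (chain-Q x ch) s t l (a , i , y , z , h , ∼trans e' (∼sym e) , k) }) ,
         CoeffBound-resp e (coeffBound class x (G-ok ok)) , λ cb → nb1 (chain-Dn x ch) (CoeffBound-resp (∼sym e) cb)
        where
        ok = chain-ok x ch
        nb1 : (∃ λ s → ∃ λ t → s ≢ t × Dn x s × Dn x t) → ¬ CoeffBound 1 x
        nb1 (s , t , ne , a , b) = ¬bound1 (red-ok ok) ne a b

-- From letters to numerical labels.

toFin-< : ∀ {n k} (p : k < n) → toFin {n} k ≡ Fin.fromℕ< p ∷ []
toFin-< {n} {k} p with k ℕ.<? n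
... | yes _ = refl
... | no q = ⊥-elim (q p)

lift : ∀ {n} w → All (_< n) w → List (Fin n)
lift [] [] = []
lift (k ∷ w) (p ∷ b) = Fin.fromℕ< p ∷ lift w b

embed0-lift : ∀ {n} w (b : All (_< n) w) → embed0 w ≡ lift w b
embed0-lift [] [] = refl
embed0-lift (k ∷ w) (p ∷ b) = cong₂ _++_ (toFin-< p) (embed0-lift w b)

embed1-suc : ∀ {n} w → embed1 {n} (map suc w) ≡ embed0 w
embed1-suc [] = refl
embed1-suc (k ∷ w) = cong (toFin k ++_) (embed1-suc w)

toℕ-bound : ∀ {n} (x : List (Fin n)) → All (_< n) (map toℕ x)
toℕ-bound [] = []
toℕ-bound (s ∷ x) = FP.toℕ<n s ∷ toℕ-bound x

embed0-toℕ : ∀ {n} (x : List (Fin n)) → embed0 (map toℕ x) ≡ x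
embed0-toℕ [] = refl
embed0-toℕ (s ∷ x) = cong₂ _++_ (trans (toFin-< (FP.toℕ<n s)) (cong (_∷ []) (FP.fromℕ<-toℕ s (FP.toℕ<n s)))) (embed0-toℕ x)

module Labels {n : ℕ} (M : ℕ → ℕ → ℕ) (geo : Geo n M) where
  open Theory {n} M geo
  open High

  ChN : List ℕ → Set
  ChN = Ch M _<_

  In : List ℕ → Set
  In = All (_< n)

  toℕ-≢ : ∀ {s t : Fin n} → s ≢ t → toℕ s ≢ toℕ t
  toℕ-≢ q e = q (FP.toℕ-injective e)

  Fresh-toℕ : ∀ {p d e : Fin n} x → Fresh p (d ∷ e ∷ x) → Fresh (toℕ p) (toℕ d ∷ toℕ e ∷ map toℕ x)
  Fresh-toℕ [] (a , b) = toℕ-≢ a , toℕ-≢ b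
  Fresh-toℕ (_ ∷ _) a = toℕ-≢ a

  chain-toℕ : ∀ {x} → Chain x → ChN (map toℕ x)
  chain-toℕ (pairᶜ l e) = pairᶜ l e
  chain-toℕ (forkᶜ c a b) = forkᶜ (chain-toℕ c) a b
  chain-toℕ (dblˡ c l) = dblˡ (chain-toℕ c) l
  chain-toℕ (dblʳ c l) = dblʳ (chain-toℕ c) l
  chain-toℕ (quint c l) = quint (chain-toℕ c) l
  chain-toℕ (tailᶜ {x = x} h fr m3) = tailᶜ (chain-toℕ h) (Fresh-toℕ x fr) m3

  chain-lift : ∀ {w} → ChN w → (b : In w) → Chain (lift w b)
  chain-lift h b = go h b
    where
    F : ∀ {k} → .(k < n) → Fin n
    F p = Fin.fromℕ< p
    M-F : ∀ {i j} .(p : i < n) .(q : j < n) → M i j ≡ m (F p) (F q)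
    M-F p q = cong₂ M (sym (FP.toℕ-fromℕ< p)) (sym (FP.toℕ-fromℕ< q))
    F-≢ : ∀ {i j} .(p : i < n) .(q : j < n) → i ≢ j → F p ≢ F q
    F-≢ p q r e = r (trans (sym (FP.toℕ-fromℕ< p)) (trans (cong toℕ e) (FP.toℕ-fromℕ< q)))
    le : ∀ k {i j} .(p : i < n) .(q : j < n) → k ≤ M i j → k ≤ m (F p) (F q)
    le k p q = subst (k ≤_) (M-F p q)
    go : ∀ {w} → ChN w → (b : In w) → Chain (lift w b)
    go (pairᶜ l e) (p ∷ q ∷ []) = pairᶜ (subst₂ _<_ (sym (FP.toℕ-fromℕ< p)) (sym (FP.toℕ-fromℕ< q)) l) (trans (sym (M-F p q)) e)
    go (forkᶜ h a b) (r ∷ p ∷ q ∷ []) = forkᶜ (go h (p ∷ q ∷ [])) (le 3 r p a) (le 3 r q b)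
    go (dblˡ h l) (p' ∷ r ∷ p ∷ q ∷ []) = dblˡ (go h (r ∷ p ∷ q ∷ [])) (le 4 r p l)
    go (dblʳ h l) (q' ∷ r ∷ p ∷ q ∷ []) = dblʳ (go h (r ∷ p ∷ q ∷ [])) (le 4 r q l)
    go (quint h l) (r' ∷ p' ∷ r ∷ p ∷ q ∷ []) = quint (go h (r ∷ p ∷ q ∷ [])) (le 5 r p l)
    go (tailᶜ {p} {c} {d} {e} {x} h fr m3) (bp ∷ bc ∷ bd ∷ be ∷ bx) = tailᶜ (go h (bc ∷ bd ∷ be ∷ bx)) (fresh x fr bx) (trans (sym (M-F bp bc)) m3)
      where
      fresh : ∀ x → Fresh p (d ∷ e ∷ x) → (bx : In x) → Fresh (F bp) (F bd ∷ F be ∷ lift x bx)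
      fresh [] (a , b) [] = F-≢ bp bd a , F-≢ bp be b
      fresh (_ ∷ _) a (_ ∷ _) = F-≢ bp bd a

  -- The bound on the letters matters: the matrices are defined on all of ℕ, and in type C̃ the
  -- heavy edge at the far end would start a further chain through a label that is not a generator.
  TameN : Set
  TameN = (∀ {p p' c d x} → In (p ∷ c ∷ d ∷ x) → In (p' ∷ c ∷ d ∷ x) → ChN (p ∷ c ∷ d ∷ x) → ChN (p' ∷ c ∷ d ∷ x) → p ≡ p') ×
          (∀ {p c d e x} → In (p ∷ c ∷ d ∷ e ∷ x) → ChN (c ∷ d ∷ e ∷ x) → Fresh p (d ∷ e ∷ x) → 3 ≤ M p c → M p c ≡ 3) ×
          (∀ {u s t} → In (u ∷ s ∷ t ∷ []) → ChN (u ∷ s ∷ t ∷ []) → ¬ (5 ≤ M u t))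

  tame : TameN → Tame
  tame (U , W , N) = (λ {p} {p'} {c} {d} {x} a b → FP.toℕ-injective (U (toℕ-bound (p ∷ c ∷ d ∷ x)) (toℕ-bound (p' ∷ c ∷ d ∷ x)) (chain-toℕ a) (chain-toℕ b))) ,
     (λ {p} {c} {d} {e} {x} a fr l → W (toℕ-bound (p ∷ c ∷ d ∷ e ∷ x)) (chain-toℕ a) (Fresh-toℕ x fr) l) ,
     λ {u} {s} {t} a → N (toℕ-bound (u ∷ s ∷ t ∷ [])) (chain-toℕ a)

  -- Two instances are used: `embed1` with `map suc` for words over labels starting at 1, and
  -- `embed0` with the identity for type E.
  module _ (emb : List ℕ → Word) (lab : List ℕ → List ℕ) (emb-lab : ∀ w → emb (lab w) ≡ embed0 w) where
    Good : List ℕ → Set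
    Good u = ∃ λ w → u ≡ lab w × ChN w × In w

    stubList : ∀ L → TameN → All Good L → (∀ {w} → ChN w → In w → lab w ∈ L) → AllPairs _≢_ L → StubList (map emb L)
    stubList L tn sound complete uniq = (λ w → to w , from w) , pairs L sound uniq
      where
      T' : Tame
      T' = tame tn
      to : ∀ w → LeftStub w × AValue2 w → Any.Any (λ u → u ∼ w) (map emb L)
      to w (s , a) = go (stub⇒chain T' w s a)
        where
        go : (∃ λ x → Chain x × x ∼ w) → Any.Any (λ u → u ∼ w) (map emb L)
        go (x , ch , e) = AnyP.map⁺ (Any.map (λ { refl → ∼trans (≡⇒∼ (trans (emb-lab (map toℕ x)) (embed0-toℕ x))) e }) (complete (chain-toℕ ch) (toℕ-bound x)))
      from' : ∀ w L → All Good L → Any.Any (λ u → u ∼ w) (map emb L) → LeftStub w × AValue2 w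
      from' w (_ ∷ _) ((v , refl , ch , b) ∷ _) (Any.here e) = chain⇒stub T' w (chain-lift ch b) (∼trans (≡⇒∼ (sym (trans (emb-lab v) (embed0-lift v b)))) e)
      from' w (_ ∷ L) (_ ∷ g) (Any.there a) = from' w L g a
      from : ∀ w → Any.Any (λ u → u ∼ w) (map emb L) → LeftStub w × AValue2 w
      from w = from' w L sound
      lift-toℕ : ∀ w (b : In w) → map toℕ (lift w b) ≡ w
      lift-toℕ [] [] = refl
      lift-toℕ (k ∷ w) (p ∷ b) = cong₂ _∷_ (FP.toℕ-fromℕ< p) (lift-toℕ w b)
      sep : ∀ {u v} → Good u → Good v → u ≢ v → ¬ (emb u ∼ emb v)
      sep (w , refl , ch , b) (w' , refl , ch' , b') ne e = ne (cong lab (trans (sym (lift-toℕ w b)) (trans (cong (map toℕ) (chain-inj _ _ (chain-lift ch b) (chain-lift ch' b') e')) (lift-toℕ w' b'))))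
        where
        e' : lift w b ∼ lift w' b'
        e' = ∼trans (≡⇒∼ (sym (trans (emb-lab w) (embed0-lift w b)))) (∼trans e (≡⇒∼ (trans (emb-lab w') (embed0-lift w' b'))))
      pairs : ∀ L → All Good L → AllPairs _≢_ L → AllPairs (λ u v → ¬ (u ∼ v)) (map emb L)
      pairs [] [] [] = []
      pairs (u ∷ L) (g ∷ gs) (a ∷ as) = AllP.map⁺ (All.zipWith (λ { (h , ne) → sep g h ne }) (gs , a)) ∷ pairs L gs as

-- Diagrams that are paths.

-- Coxeter matrix of a path whose edge {i, i + 1} has weight w i
pathW : (ℕ → ℕ) → ℕ → ℕ → ℕ
pathW w zero zero = 1
pathW w zero (suc zero) = w 0
pathW w zero (suc (suc j)) = 2
pathW w (suc zero) zero = w 0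
pathW w (suc (suc i)) zero = 2
pathW w (suc i) (suc j) = pathW (λ k → w (suc k)) i j

data Weight : ℕ → Set where
  three : Weight 3
  four  : Weight 4
  five  : Weight 5

w⁺ w⁻ : ∀ {k} → Weight k → R
w⁺ three = 1R
w⁺ four = 1R
w⁺ five = φR
w⁻ three = 1R
w⁻ four = 2R
w⁻ five = φR

wtW : ∀ w → (∀ i → Weight (w i)) → ℕ → ℕ → R
wtW w h zero zero = 0R
wtW w h zero (suc zero) = w⁺ (h 0)
wtW w h zero (suc (suc j)) = 0R
wtW w h (suc zero) zero = w⁻ (h 0)
wtW w h (suc (suc i)) zero = 0R
wtW w h (suc i) (suc j) = wtW (λ k → w (suc k)) (λ k → h (suc k)) i j

private
  cmb⁺ : ∀ {k} (h : Weight k) → Combo k (w⁺ h) (w⁻ h)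
  cmb⁺ three = c3
  cmb⁺ four = c4
  cmb⁺ five = c5
  cmb⁻ : ∀ {k} (h : Weight k) → Combo k (w⁻ h) (w⁺ h)
  cmb⁻ three = c3
  cmb⁻ four = c4'
  cmb⁻ five = c5

comboW : ∀ w (h : ∀ i → Weight (w i)) i j → i ≢ j → Combo (pathW w i j) (wtW w h i j) (wtW w h j i)
comboW w h zero zero q = ⊥-elim (q refl)
comboW w h zero (suc zero) q = cmb⁺ (h 0)
comboW w h zero (suc (suc j)) q = c2
comboW w h (suc zero) zero q = cmb⁻ (h 0)
comboW w h (suc (suc i)) zero q = c2
comboW w h (suc zero) (suc zero) q = ⊥-elim (q refl)
comboW w h (suc zero) (suc (suc j)) q = comboW (λ k → w (suc k)) (λ k → h (suc k)) zero (suc j) λ e → q (cong suc e)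
comboW w h (suc (suc i)) (suc zero) q = comboW (λ k → w (suc k)) (λ k → h (suc k)) (suc i) zero λ e → q (cong suc e)
comboW w h (suc (suc i)) (suc (suc j)) q = comboW (λ k → w (suc k)) (λ k → h (suc k)) (suc i) (suc j) λ e → q (cong suc e)

diagW : ∀ w i → pathW w i i ≡ 1
diagW w zero = refl
diagW w (suc zero) = refl
diagW w (suc (suc i)) = diagW (λ k → w (suc k)) (suc i)

symW : ∀ w i j → pathW w i j ≡ pathW w j i
symW w zero zero = refl
symW w zero (suc zero) = refl
symW w zero (suc (suc j)) = refl
symW w (suc zero) zero = refl
symW w (suc (suc i)) zero = refl
symW w (suc zero) (suc zero) = refl
symW w (suc zero) (suc (suc j)) = symW (λ k → w (suc k)) zero (suc j)
symW w (suc (suc i)) (suc zero) = symW (λ k → w (suc k)) (suc i) zero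
symW w (suc (suc i)) (suc (suc j)) = symW (λ k → w (suc k)) (suc i) (suc j)

nextW : ∀ w i → pathW w i (suc i) ≡ w i
nextW w zero = refl
nextW w (suc zero) = refl
nextW w (suc (suc i)) = nextW (λ k → w (suc k)) (suc i)

farW : ∀ w i k → pathW w i (2 ℕ.+ i ℕ.+ k) ≡ 2
farW w zero k = refl
farW w (suc zero) k = refl
farW w (suc (suc i)) k = farW (λ k → w (suc k)) (suc i) k

nearW : ∀ w i j → 3 ≤ pathW w i j → (j ≡ suc i × pathW w i j ≡ w i) ⊎ (i ≡ suc j × pathW w i j ≡ w j)
nearW w zero zero (s≤s ())
nearW w zero (suc zero) l = inj₁ (refl , refl)
nearW w zero (suc (suc j)) (s≤s (s≤s ()))
nearW w (suc zero) zero l = inj₂ (refl , refl)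
nearW w (suc (suc i)) zero (s≤s (s≤s ()))
nearW w (suc zero) (suc j) l with nearW (λ k → w (suc k)) zero j l
... | inj₁ (a , b) = inj₁ (cong suc a , b)
... | inj₂ (() , _)
nearW w (suc (suc i)) (suc j) l with nearW (λ k → w (suc k)) (suc i) j l
... | inj₁ (a , b) = inj₁ (cong suc a , b)
... | inj₂ (a , b) = inj₂ (cong suc a , b)

twoW : ∀ w → (∀ i → Weight (w i)) → ∀ i j → i < j → pathW w i j ≡ 2 → ∃ λ k → j ≡ 2 ℕ.+ i ℕ.+ k
twoW w h i j l e with m≤n⇒∃[o]m+o≡n l
... | suc k , refl = k , cong suc (+-suc i k)
... | zero , refl rewrite +-identityʳ i | nextW w i = ⊥-elim (go (h i) e)
  where go : ∀ {k} → Weight k → k ≢ 2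
        go three ()
        go four ()
        go five ()

-- The chains of length at least 4 on a path. They begin at a heavy edge and are prolonged along the
-- path away from it, towards 0 in `Down` and towards larger labels in `Upw`; the index is the first
-- letter.
data Down (w : ℕ → ℕ) : ℕ → List ℕ → Set where
  d0 : ∀ i → 4 ≤ w i → Down w i (i ∷ suc i ∷ i ∷ suc (suc i) ∷ [])
  ds : ∀ {i x} → Down w (suc i) x → w i ≡ 3 → Down w i (i ∷ x)

data Upw (w : ℕ → ℕ) : ℕ → List ℕ → Set where
  u0 : ∀ i → 4 ≤ w (suc i) → Upw w (suc (suc i)) (suc (suc i) ∷ suc i ∷ i ∷ suc (suc i) ∷ [])
  q0 : ∀ i → 5 ≤ w i → Upw w (suc i) (suc i ∷ i ∷ suc i ∷ i ∷ suc (suc i) ∷ [])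
  us : ∀ {i x} → Upw w i x → w i ≡ 3 → Upw w (suc i) (suc i ∷ x)

data PathView (w : ℕ → ℕ) : List ℕ → Set where
  vpair : ∀ i k → PathView w (i ∷ suc (suc (i ℕ.+ k)) ∷ [])
  vfork : ∀ i → PathView w (suc i ∷ i ∷ suc (suc i) ∷ [])
  vdown : ∀ {i x} → Down w i x → PathView w x
  vup   : ∀ {i x} → Upw w i x → PathView w x

module _ {w : ℕ → ℕ} where
  Down-shape : ∀ {i x} → Down w i x → ∃ λ e → ∃ λ f → ∃ λ y → x ≡ i ∷ suc i ∷ e ∷ f ∷ y
  Down-shape (d0 i l) = _ , _ , _ , refl
  Down-shape (ds d e) with Down-shape d
  ... | _ , _ , _ , refl = _ , _ , _ , refl

  Up-shape : ∀ {i x} → Upw w i x → ∃ λ d → ∃ λ e → ∃ λ f → ∃ λ y → i ≡ suc d × x ≡ i ∷ d ∷ e ∷ f ∷ y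
  Up-shape (u0 i l) = _ , _ , _ , _ , refl , refl
  Up-shape (q0 i l) = _ , _ , _ , _ , refl , refl
  Up-shape (us u e) with Up-shape u
  ... | _ , _ , _ , _ , refl , refl = _ , _ , _ , _ , refl , refl

  Down-head : ∀ {i c d y} → Down w i (c ∷ d ∷ y) → i ≡ c × d ≡ suc c
  Down-head d with Down-shape d
  ... | _ , _ , _ , refl = refl , refl

  Up-head : ∀ {i c d y} → Upw w i (c ∷ d ∷ y) → i ≡ c × c ≡ suc d
  Up-head u with Up-shape u
  ... | _ , _ , _ , _ , refl , refl = refl , refl

  ¬Down3 : ∀ {i a b c} → ¬ Down w i (a ∷ b ∷ c ∷ [])
  ¬Down3 d with Down-shape d
  ... | _ , _ , _ , ()

  ¬Up3 : ∀ {i a b c} → ¬ Upw w i (a ∷ b ∷ c ∷ [])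
  ¬Up3 d with Up-shape d
  ... | _ , _ , _ , _ , _ , ()

  ¬Down2 : ∀ {i a b} → ¬ Down w i (a ∷ b ∷ [])
  ¬Down2 d with Down-shape d
  ... | _ , _ , _ , ()

  ¬Up2 : ∀ {i a b} → ¬ Upw w i (a ∷ b ∷ [])
  ¬Up2 d with Up-shape d
  ... | _ , _ , _ , _ , _ , ()

Fresh-head : ∀ {p d e : ℕ} x → Fresh p (d ∷ e ∷ x) → p ≢ d
Fresh-head [] (a , _) = a
Fresh-head (_ ∷ _) a = a

module PathType {n : ℕ} (M : ℕ → ℕ → ℕ) (w : ℕ → ℕ) (wgt : ∀ i → Weight (w i)) (eq : ∀ i j → M i j ≡ pathW w i j) where
  geoW : Geo n M
  geoW = record
    { wt = λ s t → wtW w wgt (toℕ s) (toℕ t)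
    ; mdiag = λ s → trans (eq (toℕ s) (toℕ s)) (diagW w (toℕ s))
    ; msym = λ s t → trans (eq (toℕ s) (toℕ t)) (trans (symW w (toℕ s) (toℕ t)) (sym (eq (toℕ t) (toℕ s))))
    ; combo = λ s t q → subst (λ k → Combo k (wtW w wgt (toℕ s) (toℕ t)) (wtW w wgt (toℕ t) (toℕ s))) (sym (eq (toℕ s) (toℕ t))) (comboW w wgt (toℕ s) (toℕ t) λ e → q (FP.toℕ-injective e))
    }

  open Labels {n} M geoW public

  next : ∀ i → M i (suc i) ≡ w i
  next i = trans (eq i (suc i)) (nextW w i)
  prev : ∀ i → M (suc i) i ≡ w i
  prev i = trans (eq (suc i) i) (trans (symW w (suc i) i) (nextW w i))
  far : ∀ i k → M i (suc (suc (i ℕ.+ k))) ≡ 2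
  far i k = trans (eq i (suc (suc (i ℕ.+ k)))) (farW w i k)
  near : ∀ {i j} → 3 ≤ M i j → (j ≡ suc i × M i j ≡ w i) ⊎ (i ≡ suc j × M i j ≡ w j)
  near {i} {j} l with nearW w i j (subst (3 ≤_) (eq i j) l)
  ... | inj₁ (a , b) = inj₁ (a , trans (eq i j) b)
  ... | inj₂ (a , b) = inj₂ (a , trans (eq i j) b)

  3≤w : ∀ i → 3 ≤ w i
  3≤w i = go (wgt i)
    where go : ∀ {k} → Weight k → 3 ≤ k
          go three = ≤-refl
          go four = n≤1+n 3
          go five = s≤s (s≤s (s≤s z≤n))

  fork-inv : ∀ {u s t} → ChN (u ∷ s ∷ t ∷ []) → u ≡ suc s × t ≡ suc (suc s)
  fork-inv (forkᶜ (pairᶜ l _) a b) with near a | near b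
  ... | inj₂ (refl , _) | inj₁ (refl , _) = refl , refl
  ... | inj₁ (refl , _) | inj₁ (refl , _) = ⊥-elim (<-irrefl refl l)
  ... | inj₂ (refl , _) | inj₂ (refl , _) = ⊥-elim (<-irrefl refl l)
  ... | inj₁ (refl , _) | inj₂ (refl , _) = ⊥-elim (<-asym l (m<n⇒m<1+n (n<1+n _)))

  view : ∀ {x} → ChN x → PathView w x
  view (pairᶜ {s} {t} l e) with twoW w wgt s t l (trans (sym (eq s t)) e)
  ... | k , refl = vpair s k
  view h@(forkᶜ _ _ _) with fork-inv h
  ... | refl , refl = vfork _
  view (dblˡ {s = s} h l) with fork-inv h
  ... | refl , refl = vdown (d0 s (subst (4 ≤_) (prev s) l))
  view (dblʳ {s = s} h l) with fork-inv h
  ... | refl , refl = vup (u0 s (subst (4 ≤_) (next (suc s)) l))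
  view (quint {s = s} h l) with fork-inv h
  ... | refl , refl = vup (q0 s (subst (5 ≤_) (prev s) l))
  view (tailᶜ {p} {c} {d} {e} {x} h fr m3) = go (view h) (near (≤-reflexive (sym m3)))
    where
    go : PathView w (c ∷ d ∷ e ∷ x) → (c ≡ suc p × M p c ≡ w p) ⊎ (p ≡ suc c × M p c ≡ w c) → PathView w (p ∷ c ∷ d ∷ e ∷ x)
    go (vfork i) (inj₁ (refl , _)) = ⊥-elim (proj₁ fr refl)
    go (vfork i) (inj₂ (refl , _)) = ⊥-elim (proj₂ fr refl)
    go (vdown v) (inj₁ (refl , q)) with Down-head v
    ... | refl , refl = vdown (ds v (trans (sym q) m3))
    go (vdown v) (inj₂ (refl , q)) with Down-head v
    ... | refl , refl = ⊥-elim (Fresh-head x fr refl)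
    go (vup v) (inj₁ (refl , q)) with Up-head v
    ... | refl , refl = ⊥-elim (Fresh-head x fr refl)
    go (vup v) (inj₂ (refl , q)) with Up-head v
    ... | refl , refl = vup (us v (trans (sym q) m3))

  pair-chain : ∀ i k → ChN (i ∷ suc (suc (i ℕ.+ k)) ∷ [])
  pair-chain i k = pairᶜ (s≤s (≤-trans (m≤m+n i k) (n≤1+n _))) (far i k)

  fork-chain : ∀ i → ChN (suc i ∷ i ∷ suc (suc i) ∷ [])
  fork-chain i = forkᶜ (subst (λ z → ChN (i ∷ suc (suc z) ∷ [])) (+-identityʳ i) (pair-chain i 0))
     (subst (3 ≤_) (sym (prev i)) (3≤w i)) (subst (3 ≤_) (sym (next (suc i))) (3≤w (suc i)))

  up-chain : ∀ {i x} → Upw w i x → ChN x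
  up-chain (u0 i l) = dblʳ (fork-chain i) (subst (4 ≤_) (sym (next (suc i))) l)
  up-chain (q0 i l) = quint (fork-chain i) (subst (5 ≤_) (sym (prev i)) l)
  up-chain (us {i} u e) with Up-shape u | up-chain u
  ... | d , _ , _ , _ , refl , refl | c = tailᶜ c (λ q → <⇒≢ (m<n⇒m<1+n (n<1+n d)) (sym q)) (trans (prev i) e)

  down-chain : ∀ {i x} → Down w i x → ChN x
  down-chain (d0 i l) = dblˡ (fork-chain i) (subst (4 ≤_) (sym (prev i)) l)
  down-chain (ds {i} u e) with Down-shape u | down-chain u
  ... | _ , _ , _ , refl | c = tailᶜ c (λ q → <⇒≢ (m<n⇒m<1+n (n<1+n i)) q) (trans (next i) e)

  -- `h1` separates i and i + 2 as prolongations of the fork (i + 1) i (i + 2). `h2` leaves i + 1 as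
  -- the only prolongation of i (i + 1) i (i + 2) on an edge of weight 5, there being no label below
  -- i. `h3` and `h4` give weight 3 to every further edge along which a chain can grow.
  module _ (h1 : ∀ i → 4 ≤ w i → ¬ (4 ≤ w (suc i))) (h2 : ∀ i → 5 ≤ w i → i ≡ 0)
           (h3 : ∀ {p x} → Down w (suc p) x → In x → w p ≡ 3) (h4 : ∀ {i x} → Upw w i x → w i ≡ 3) where
    uniq : ∀ {p p' c d x} → PathView w (p ∷ c ∷ d ∷ x) → PathView w (p' ∷ c ∷ d ∷ x) → p ≡ p'
    uniq (vfork i) (vfork .i) = refl
    uniq (vfork i) (vdown (ds v _)) = ⊥-elim (¬Down2 v)
    uniq (vfork i) (vup (us v _)) = ⊥-elim (¬Up2 v)
    uniq (vdown (ds v _)) (vfork i) = ⊥-elim (¬Down2 v)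
    uniq (vup (us v _)) (vfork i) = ⊥-elim (¬Up2 v)
    uniq (vdown (d0 i l)) (vdown (d0 .i _)) = refl
    uniq (vdown (d0 i l)) (vdown (ds v _)) = ⊥-elim (¬Down3 v)
    uniq (vdown (ds v _)) (vdown (d0 i l)) = ⊥-elim (¬Down3 v)
    uniq (vdown (ds v _)) (vdown (ds v' _)) = suc-injective (trans (proj₁ (Down-head v)) (sym (proj₁ (Down-head v'))))
    uniq (vdown (d0 i l)) (vup (u0 .i l')) = ⊥-elim (h1 i l l')
    uniq (vdown (d0 i l)) (vup (us v _)) = ⊥-elim (¬Up3 v)
    uniq (vup (u0 i l)) (vdown (d0 .i l')) = ⊥-elim (h1 i l' l)
    uniq (vup (us v _)) (vdown (d0 i l)) = ⊥-elim (¬Up3 v)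
    uniq (vdown (ds v _)) (vup (u0 i l)) = ⊥-elim (¬Down3 v)
    uniq (vup (u0 i l)) (vdown (ds v _)) = ⊥-elim (¬Down3 v)
    uniq (vdown (ds v _)) (vup (q0 i l)) with trans (proj₁ (Down-head v)) (h2 i l)
    ... | ()
    uniq (vup (q0 i l)) (vdown (ds v _)) with trans (proj₁ (Down-head v)) (h2 i l)
    ... | ()
    uniq (vdown (ds v _)) (vup (us v' _)) = ⊥-elim (<-asym (≤-reflexive (sym (proj₂ (Down-head v)))) (≤-reflexive (sym (proj₂ (Up-head v')))))
    uniq (vup (us v' _)) (vdown (ds v _)) = ⊥-elim (<-asym (≤-reflexive (sym (proj₂ (Down-head v)))) (≤-reflexive (sym (proj₂ (Up-head v')))))
    uniq (vup (u0 i l)) (vup (u0 .i _)) = refl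
    uniq (vup (u0 i l)) (vup (us v _)) = ⊥-elim (¬Up3 v)
    uniq (vup (us v _)) (vup (u0 i l)) = ⊥-elim (¬Up3 v)
    uniq (vup (q0 i l)) (vup (q0 .i _)) = refl
    uniq (vup (q0 i l)) (vup (us v _)) = ⊥-elim (<⇒≢ (m<n⇒m<1+n (n<1+n i)) (proj₂ (Up-head v)))
    uniq (vup (us v _)) (vup (q0 i l)) = ⊥-elim (<⇒≢ (m<n⇒m<1+n (n<1+n i)) (proj₂ (Up-head v)))
    uniq (vup (us v _)) (vup (us v' _)) = cong suc (trans (proj₁ (Up-head v)) (sym (proj₁ (Up-head v'))))

    weight3 : ∀ {p c d e x} → In (p ∷ c ∷ d ∷ e ∷ x) → PathView w (c ∷ d ∷ e ∷ x) → Fresh p (d ∷ e ∷ x) → (c ≡ suc p × M p c ≡ w p) ⊎ (p ≡ suc c × M p c ≡ w c) → M p c ≡ 3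
    weight3 _ (vfork i) fr (inj₁ (refl , _)) = ⊥-elim (proj₁ fr refl)
    weight3 _ (vfork i) fr (inj₂ (refl , _)) = ⊥-elim (proj₂ fr refl)
    weight3 (_ ∷ b) (vdown v) fr (inj₁ (refl , q)) with Down-head v
    ... | refl , refl = trans q (h3 v b)
    weight3 {x = x} _ (vdown v) fr (inj₂ (refl , q)) with Down-head v
    ... | refl , refl = ⊥-elim (Fresh-head x fr refl)
    weight3 {x = x} _ (vup v) fr (inj₁ (refl , q)) with Up-head v
    ... | refl , refl = ⊥-elim (Fresh-head x fr refl)
    weight3 _ (vup v) fr (inj₂ (refl , q)) with Up-head v
    ... | refl , refl = trans q (h4 v)

    tameN : TameN
    tameN = (λ _ _ a b → uniq (view a) (view b)) , (λ b a fr l → weight3 b (view a) fr (near l)) , no5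
      where
      no5 : ∀ {u s t} → In (u ∷ s ∷ t ∷ []) → ChN (u ∷ s ∷ t ∷ []) → ¬ (5 ≤ M u t)
      no5 {s = s} _ h l with fork-inv h
      ... | refl , refl with h2 (suc s) (subst (5 ≤_) (next (suc s)) l)
      ...   | ()

-- Membership, distinctness and counting for the listed words.

open import Data.List using (applyUpTo; filter)
open import Data.Nat.ListAction using (sum)
open import Data.Nat.Combinatorics using (_C_; nC1≡n; nCk+nC[k+1]≡[n+1]C[k+1])

range∈ : ∀ {a b j} → a ≤ j → j ≤ b → j ∈ range a b
range∈ {a} {b} {j} l h = subst (_∈ range a b) (m+[n∸m]≡n l) (∈P.∈-applyUpTo⁺ (a ℕ.+_) (∸-monoˡ-< (s≤s h) l))

range∋ : ∀ {a b j} → j ∈ range a b → a ≤ j × j ≤ b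
range∋ {a} {b} h with ∈P.∈-applyUpTo⁻ (a ℕ.+_) h
... | i , l , refl = m≤m+n a i , ≤-pred (subst (_≤ suc b) (cong suc (+-comm i a)) (go a (suc b) l))
  where
  go : ∀ a c → i < c ∸ a → suc (i ℕ.+ a) ≤ c
  go zero c l = subst (_≤ c) (cong suc (sym (+-identityʳ i))) l
  go (suc a) (suc c) l = subst (_≤ suc c) (cong suc (sym (+-suc i a))) (s≤s (go a c l))

range-sorted : ∀ a b → AllPairs _<_ (range a b)
range-sorted a b = AllPairsP.applyUpTo⁺₁ (a ℕ.+_) (suc b ∸ a) λ l _ → +-monoʳ-< a l

length-range : ∀ a b → length (range a b) ≡ suc b ∸ a
length-range a b = LP.length-applyUpTo (a ℕ.+_) (suc b ∸ a)

range-snoc : ∀ {a b} → a ≤ suc b → range a (suc b) ≡ range a b ∷ʳ suc b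
range-snoc {a} {b} l = trans (cong (applyUpTo (a ℕ.+_)) (+-∸-assoc 1 l)) (trans (sym (LP.applyUpTo-∷ʳ (a ℕ.+_) (suc b ∸ a))) (cong (range a b ∷ʳ_) (m+[n∸m]≡n l)))

reverse-range : ∀ {a b} → a ≤ suc b → reverse (range a (suc b)) ≡ suc b ∷ reverse (range a b)
reverse-range {a} {b} l = trans (cong reverse (range-snoc l)) (LP.reverse-++ (range a b) (suc b ∷ []))

module _ {A : Set} where
  ++-unique : ∀ {P : A → Set} {xs ys} → AllPairs _≢_ xs → AllPairs _≢_ ys → All P xs → All (λ y → ¬ P y) ys → AllPairs _≢_ (xs ++ ys)
  ++-unique ux uy px py = AllPairsP.++⁺ ux uy (All.map (λ p → All.map (λ q → λ { refl → q p }) py) px)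

  concatMap-unique : ∀ (f : ℕ → List A) xs → AllPairs _<_ xs → (∀ i → AllPairs _≢_ (f i)) →
    (∀ {i j x} → x ∈ f i → x ∈ f j → i ≡ j) → AllPairs _≢_ (concatMap f xs)
  concatMap-unique f [] [] h sep = []
  concatMap-unique f (i ∷ xs) (a ∷ as) h sep = AllPairsP.++⁺ (h i) (concatMap-unique f xs as h sep)
    (All.tabulate λ mx → All.tabulate λ my → λ { refl → clash mx (∈P.∈-concatMap⁻ f my) a })
    where
    clash : ∀ {x xs} → x ∈ f i → Any.Any (λ j → x ∈ f j) xs → All (i <_) xs → ⊥
    clash m (Any.here m') (l ∷ _) = <⇒≢ l (sep m m')
    clash m (Any.there n) (_ ∷ ls) = clash m n ls

  map-unique : ∀ (f : ℕ → A) {xs} → (∀ {i j} → f i ≡ f j → i ≡ j) → AllPairs _<_ xs → AllPairs _≢_ (map f xs)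
  map-unique f inj s = AllPairsP.map⁺ (AllPairs.map (λ l e → <⇒≢ l (inj e)) s)

  length-concatMap : ∀ (f : ℕ → List A) (h : ℕ → ℕ) n → ∀ (c : ℕ → ℕ) → (∀ i → length (f (h i)) ≡ c i) → length (concatMap f (applyUpTo h n)) ≡ sum (applyUpTo c n)
  length-concatMap f h zero c e = refl
  length-concatMap f h (suc n) c e = trans (LP.length-++ (f (h 0))) (cong₂ ℕ._+_ (e 0) (length-concatMap f (λ i → h (suc i)) n (λ i → c (suc i)) λ i → e (suc i)))

S1∈ : ∀ {n i j} → 1 ≤ i → suc (suc i) ≤ j → j ≤ n → i ∷ j ∷ [] ∈ S1 n
S1∈ {n} {i} a b c = ∈P.∈-concatMap⁺ _ (Any.map (λ { refl → ∈P.∈-map⁺ _ (range∈ b c) }) (range∈ {1} {n} a (≤-trans (≤-trans (n≤1+n _) (n≤1+n _)) (≤-trans b c))))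

S1∋ : ∀ {n u} → u ∈ S1 n → ∃ λ i → ∃ λ j → u ≡ i ∷ j ∷ [] × 1 ≤ i × suc (suc i) ≤ j × j ≤ n
S1∋ {n} {u} m = go (range 1 n) (λ x → proj₁ (range∋ x)) (∈P.∈-concatMap⁻ _ m)
  where
  go : ∀ xs → (∀ {i} → i ∈ xs → 1 ≤ i) → Any.Any (λ i → u ∈ map (λ j → i ∷ j ∷ []) (range (suc (suc i)) n)) xs → ∃ λ i → ∃ λ j → u ≡ i ∷ j ∷ [] × 1 ≤ i × suc (suc i) ≤ j × j ≤ n
  go (i ∷ xs) h (Any.here p) with ∈P.∈-map⁻ _ p
  ... | j , mj , refl = i , j , refl , h (Any.here refl) , proj₁ (range∋ {suc (suc i)} {n} mj) , proj₂ (range∋ {suc (suc i)} {n} mj)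
  go (i ∷ xs) h (Any.there p) = go xs (λ x → h (Any.there x)) p

S1-unique : ∀ n → AllPairs _≢_ (S1 n)
S1-unique n = concatMap-unique _ (range 1 n) (range-sorted 1 n) (λ i → map-unique _ (λ { refl → refl }) (range-sorted (suc (suc i)) n)) sep
  where
  sep : ∀ {i j x} → x ∈ map (λ k → i ∷ k ∷ []) (range (suc (suc i)) n) → x ∈ map (λ k → j ∷ k ∷ []) (range (suc (suc j)) n) → i ≡ j
  sep a b with ∈P.∈-map⁻ _ a | ∈P.∈-map⁻ _ b
  ... | _ , _ , refl | _ , _ , refl = refl

S2∋ : ∀ {n u} → u ∈ S2 n → ∃ λ i → u ≡ suc (suc i) ∷ suc i ∷ suc (suc (suc i)) ∷ [] × suc (suc i) ≤ n ∸ 1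
S2∋ {n} m with ∈P.∈-map⁻ _ m
... | zero , mi , e with proj₁ (range∋ {2} {n ∸ 1} mi)
...   | ()
S2∋ {n} m | suc zero , mi , e with proj₁ (range∋ {2} {n ∸ 1} mi)
...   | s≤s ()
S2∋ {n} m | suc (suc i) , mi , e = i , e , proj₂ (range∋ {2} {n ∸ 1} mi)

S2∈ : ∀ {n i} → suc (suc i) ≤ n ∸ 1 → suc (suc i) ∷ suc i ∷ suc (suc (suc i)) ∷ [] ∈ S2 n
S2∈ {n} l = ∈P.∈-map⁺ _ (range∈ {2} {n ∸ 1} (s≤s (s≤s z≤n)) l)

listA-short : ∀ n → All (λ u → length u ≤ 3) (listA n)
listA-short n = AllP.++⁺ (All.tabulate λ m → a (S1∋ {n} m)) (All.tabulate λ m → b (S2∋ {n} m))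
  where
  a : ∀ {u : List ℕ} → (∃ λ i → ∃ λ j → u ≡ i ∷ j ∷ [] × 1 ≤ i × suc (suc i) ≤ j × j ≤ n) → length u ≤ 3
  a (_ , _ , refl , _) = s≤s (s≤s z≤n)
  b : ∀ {u : List ℕ} → (∃ λ i → u ≡ suc (suc i) ∷ suc i ∷ suc (suc (suc i)) ∷ [] × suc (suc i) ≤ n ∸ 1) → length u ≤ 3
  b (_ , refl , _) = ≤-refl

listA-unique : ∀ n → AllPairs _≢_ (listA n)
listA-unique n = ++-unique {P = λ u → length u ≡ 2} (S1-unique n) (map-unique _ (λ { refl → refl }) (range-sorted 2 (n ∸ 1)))
   (All.tabulate λ m → a (S1∋ {n} m)) (All.tabulate λ m → b (S2∋ {n} m))
  where
  a : ∀ {u : List ℕ} → (∃ λ i → ∃ λ j → u ≡ i ∷ j ∷ [] × 1 ≤ i × suc (suc i) ≤ j × j ≤ n) → length u ≡ 2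
  a (_ , _ , refl , _) = refl
  b : ∀ {u : List ℕ} → (∃ λ i → u ≡ suc (suc i) ∷ suc i ∷ suc (suc (suc i)) ∷ [] × suc (suc i) ≤ n ∸ 1) → length u ≢ 2
  b (_ , refl , _) ()

C2-suc : ∀ n → suc n C 2 ≡ n C 2 ℕ.+ n
C2-suc n = trans (sym (nCk+nC[k+1]≡[n+1]C[k+1] n 1)) (trans (cong (ℕ._+ (n C 2)) (nC1≡n n)) (+-comm n (n C 2)))

length-S1 : ∀ n → length (S1 n) ≡ sum (applyUpTo (λ i → n ∸ suc (suc i)) n)
length-S1 n = length-concatMap _ suc n _ λ i → trans (LP.length-map _ (range (suc (suc (suc i))) n)) (length-range (suc (suc (suc i))) n)

sum-tri : ∀ n → sum (applyUpTo (λ i → suc n ∸ suc (suc i)) (suc n)) ℕ.+ n ≡ suc n C 2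
sum-tri zero = refl
sum-tri (suc n) = trans (cong (ℕ._+ suc n) (trans (+-comm n _) (sum-tri n))) (sym (C2-suc (suc n)))

-- For n = k + 2 there are C(n - 1, 2) commuting pairs and n - 2 forks; one more makes C(n - 1, 2) +
-- (n - 1) = C(n, 2).
length-listA : ∀ k → suc (length (listA (suc (suc k)))) ≡ suc (suc k) C 2
length-listA k = trans (cong suc (trans (LP.length-++ (S1 (suc (suc k)))) (cong₂ ℕ._+_ (length-S1 (suc (suc k))) (trans (LP.length-map _ (range 2 (suc k))) (length-range 2 (suc k))))))
   (trans (sym (+-suc _ k)) (sum-tri (suc k)))

pathM-W : ∀ i j → pathM i j ≡ pathW (λ _ → 3) i j
pathM-W zero zero = refl
pathM-W zero (suc zero) = refl
pathM-W zero (suc (suc j)) = refl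
pathM-W (suc zero) zero = refl
pathM-W (suc (suc i)) zero = refl
pathM-W (suc zero) (suc j) = pathM-W zero j
pathM-W (suc (suc i)) (suc j) = pathM-W (suc i) j

-- A path with one special edge {a , a + 1} of weight k: `mB`, `mF` and `mH` are the instances (0 ,
-- 4), (1 , 4) and (0 , 5).
edgeM : ℕ → ℕ → ℕ → ℕ → ℕ
edgeM a k i j = if isEdge a (suc a) i j then k else pathM i j

edgeW : ℕ → ℕ → ℕ → ℕ
edgeW a k i = if i ≡ᵇ a then k else 3

edgeM-W : ∀ a k i j → edgeM a k i j ≡ pathW (edgeW a k) i j
edgeM-W zero k zero zero = refl
edgeM-W zero k zero (suc zero) = refl
edgeM-W zero k zero (suc (suc j)) = refl
edgeM-W zero k (suc zero) zero = refl
edgeM-W zero k (suc (suc i)) zero = refl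
edgeM-W zero k (suc zero) (suc j) = pathM-W zero j
edgeM-W zero k (suc (suc i)) (suc j) = pathM-W (suc i) j
edgeM-W (suc a) k zero zero = refl
edgeM-W (suc a) k zero (suc zero) = refl
edgeM-W (suc a) k zero (suc (suc j)) = refl
edgeM-W (suc a) k (suc zero) zero rewrite ∧-zeroʳ (0 ≡ᵇ a) = refl
edgeM-W (suc a) k (suc (suc i)) zero rewrite ∧-zeroʳ (suc i ≡ᵇ a) | ∧-zeroʳ (i ≡ᵇ a) = refl
edgeM-W (suc a) k (suc zero) (suc j) = edgeM-W a k zero j
edgeM-W (suc a) k (suc (suc i)) (suc j) = edgeM-W a k (suc i) j

edge-weight : ∀ a {k} → Weight k → ∀ i → Weight (edgeW a k i)
edge-weight a h i with i ≡ᵇ a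
... | true = h
... | false = three

edge-heavy : ∀ a {k} i → 4 ≤ edgeW a k i → i ≡ a
edge-heavy zero zero l = refl
edge-heavy zero (suc i) (s≤s (s≤s (s≤s ())))
edge-heavy (suc a) zero (s≤s (s≤s (s≤s ())))
edge-heavy (suc a) (suc i) l = cong suc (edge-heavy a i l)

edge-light : ∀ a {k} i → i ≢ a → edgeW a k i ≡ 3
edge-light zero zero q = ⊥-elim (q refl)
edge-light zero (suc i) q = refl
edge-light (suc a) zero q = refl
edge-light (suc a) (suc i) q = edge-light a i λ e → q (cong suc e)

module PathLists {n : ℕ} (M : ℕ → ℕ → ℕ) (w : ℕ → ℕ) (wgt : ∀ i → Weight (w i)) (eq : ∀ i j → M i j ≡ pathW w i j) where
  open PathType {n} M w wgt eq public

  Listed : List ℕ → Set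
  Listed = Good embed1 (map suc) embed1-suc

  listA-good : All Listed (listA n)
  listA-good = AllP.++⁺ (All.tabulate λ m → a (S1∋ {n} m)) (All.tabulate λ m → b (S2∋ {n} m))
    where
    a : ∀ {u} → (∃ λ i → ∃ λ j → u ≡ i ∷ j ∷ [] × 1 ≤ i × suc (suc i) ≤ j × j ≤ n) → Listed u
    a (suc i , suc j , refl , _ , s≤s l , h) with m≤n⇒∃[o]m+o≡n l
    ... | k , refl = i ∷ j ∷ [] , refl , pair-chain i k , ≤-trans (≤-trans (m≤n⇒m≤1+n (n≤1+n (suc i))) (s≤s (m≤m+n (suc (suc i)) k))) h ∷ h ∷ []
    b : ∀ {u} → (∃ λ i → u ≡ suc (suc i) ∷ suc i ∷ suc (suc (suc i)) ∷ [] × suc (suc i) ≤ n ∸ 1) → Listed u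
    b (i , refl , l) = suc i ∷ i ∷ suc (suc i) ∷ [] , refl , fork-chain i , <⇒≤ l' ∷ <⇒≤ (<⇒≤ l') ∷ l' ∷ []
      where
      go : ∀ n → suc (suc i) ≤ n ∸ 1 → suc (suc (suc i)) ≤ n
      go (suc n) l = s≤s l
      l' : suc (suc (suc i)) ≤ n
      l' = go n l

  -- Pairs and forks are the same for all path types and form `listA n`. Only the stubs of length at
  -- least 4, collected in X, depend on the weights, and their length separates them from the rest.
  listed : ∀ X → (∀ i → 4 ≤ w i → ¬ (4 ≤ w (suc i))) → (∀ i → 5 ≤ w i → i ≡ 0) →
    (∀ {p x} → Down w (suc p) x → In x → w p ≡ 3) → (∀ {i x} → Upw w i x → w i ≡ 3) →
    All Listed X → (∀ {i x} → Down w i x → In x → map suc x ∈ X) → (∀ {i x} → Upw w i x → In x → map suc x ∈ X) →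
    AllPairs _≢_ X → All (λ u → 4 ≤ length u) X → Coxeter.StubList {n} M (map embed1 (listA n ++ X))
  listed X h1 h2 h3 h4 good dn up uX lX = stubList embed1 (map suc) embed1-suc (listA n ++ X) (tameN h1 h2 h3 h4) (AllP.++⁺ listA-good good)
    (λ c b → mem (view c) b) (++-unique (listA-unique n) uX (listA-short n) (All.map <⇒≱ lX))
    where
    mem : ∀ {x} → PathView w x → In x → map suc x ∈ listA n ++ X
    mem (vpair i k) (_ ∷ l ∷ []) = ∈P.∈-++⁺ˡ (∈P.∈-++⁺ˡ (S1∈ (s≤s z≤n) (s≤s (s≤s (s≤s (m≤m+n i k)))) l))
    mem (vfork i) (_ ∷ _ ∷ l ∷ []) = ∈P.∈-++⁺ˡ (∈P.∈-++⁺ʳ (S1 n) (S2∈ {n} (≤-pred (≤-trans l (go n l)))))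
      where go : ∀ n → suc (suc i) < n → n ≤ suc (n ∸ 1)
            go (suc n) _ = ≤-refl
    mem (vdown v) b = ∈P.∈-++⁺ʳ (listA n) (dn v b)
    mem (vup v) b = ∈P.∈-++⁺ʳ (listA n) (up v b)

-- The types A, B, C̃, F and H.

private
  4≰3 : ¬ (4 ≤ 3)
  4≰3 (s≤s (s≤s (s≤s ())))
  5≰4 : ¬ (5 ≤ 4)
  5≰4 (s≤s l) = 4≰3 l

∈map⁻ : ∀ (f : ℕ → List ℕ) xs {y} → y ∈ map f xs → ∃ λ x → x ∈ xs × y ≡ f x
∈map⁻ f xs = ∈P.∈-map⁻ f

¬Down-simple : ∀ {i x} → ¬ Down (λ _ → 3) i x
¬Down-simple (d0 i l) = 4≰3 l
¬Down-simple (ds d _) = ¬Down-simple d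

¬Up-simple : ∀ {i x} → ¬ Upw (λ _ → 3) i x
¬Up-simple (u0 i l) = 4≰3 l
¬Up-simple (q0 i l) = 4≰3 (<⇒≤ l)
¬Up-simple (us d _) = ¬Up-simple d

typeA : ∀ n → 3 ≤ n → Coxeter.StubList {n} mA (map embed1 (listA n)) × length (listA n) ≡ n C 2 ∸ 1
typeA (suc zero) (s≤s ())
typeA (suc (suc zero)) (s≤s (s≤s ()))
typeA n@(suc (suc (suc k))) _ = subst (λ L → Coxeter.StubList {n} mA (map embed1 L)) (LP.++-identityʳ (listA n))
    (PathLists.listed {n} mA (λ _ → 3) (λ _ → three) pathM-W [] (λ i l → ⊥-elim (4≰3 l)) (λ i l → ⊥-elim (4≰3 (<⇒≤ l)))
      (λ v _ → refl) (λ v → refl) [] (λ v → ⊥-elim (¬Down-simple v)) (λ v → ⊥-elim (¬Up-simple v)) [] []) ,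
  cong (_∸ 1) (length-listA (suc k))

module _ (a k : ℕ) where
  edge-h1 : ∀ i → 4 ≤ edgeW a k i → ¬ (4 ≤ edgeW a k (suc i))
  edge-h1 i l l' = 1+n≢n (trans (edge-heavy a (suc i) l') (sym (edge-heavy a i l)))

  Down-edge : ∀ {i x} → Down (edgeW a k) i x → i ≤ a
  Down-edge (d0 i l) = ≤-reflexive (edge-heavy a i l)
  Down-edge (ds d _) = <⇒≤ (Down-edge d)

  Up-edge : ∀ {i x} → Upw (edgeW a k) i x → a < i
  Up-edge (u0 i l) = s≤s (≤-reflexive (sym (edge-heavy a (suc i) l)))
  Up-edge (q0 i l) = s≤s (≤-reflexive (sym (edge-heavy a i (<⇒≤ l))))
  Up-edge (us u _) = m<n⇒m<1+n (Up-edge u)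

  edge-h3 : ∀ {p x} → Down (edgeW a k) (suc p) x → edgeW a k p ≡ 3
  edge-h3 v = edge-light a _ (<⇒≢ (Down-edge v))

  edge-h4 : ∀ {i x} → Upw (edgeW a k) i x → edgeW a k i ≡ 3
  edge-h4 v = edge-light a _ λ e → <⇒≢ (Up-edge v) (sym e)

edge4-h2 : ∀ a i → 5 ≤ edgeW a 4 i → i ≡ 0
edge4-h2 a i l with edge-heavy a i (<⇒≤ l)
... | refl = ⊥-elim (go a l)
  where go : ∀ a → ¬ (5 ≤ edgeW a 4 a)
        go zero l = 5≰4 l
        go (suc a) l = go a l

¬5≤edge4 : ∀ a i → ¬ (5 ≤ edgeW a 4 i)
¬5≤edge4 zero zero l = 5≰4 l
¬5≤edge4 zero (suc i) l = 4≰3 (<⇒≤ l)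
¬5≤edge4 (suc a) zero l = 4≰3 (<⇒≤ l)
¬5≤edge4 (suc a) (suc i) l = ¬5≤edge4 a i l

Down-edge0 : ∀ {k i x} → Down (edgeW 0 k) i x → map suc x ≡ 1 ∷ 2 ∷ 1 ∷ 3 ∷ []
Down-edge0 {k} (d0 i l) with edge-heavy 0 i l
... | refl = refl
Down-edge0 {k} (ds v _) with Down-edge 0 k v
... | ()

¬Up-B : ∀ {i x} → ¬ Upw (edgeW 0 4) i x
¬Up-B (u0 i l) with edge-heavy 0 {4} (suc i) l
... | ()
¬Up-B (q0 i l) = ¬5≤edge4 0 i l
¬Up-B (us u _) = ¬Up-B u

typeB : ∀ n → 3 ≤ n → Coxeter.StubList {n} mB (map embed1 (listB n)) × length (listB n) ≡ n C 2
typeB (suc zero) (s≤s ())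
typeB (suc (suc zero)) (s≤s (s≤s ()))
typeB n@(suc (suc (suc k))) _ =
  listed ((1 ∷ 2 ∷ 1 ∷ 3 ∷ []) ∷ []) (edge-h1 0 4) (edge4-h2 0) (λ v _ → edge-h3 0 4 v) (edge-h4 0 4)
    ((0 ∷ 1 ∷ 0 ∷ 2 ∷ [] , refl , down-chain (d0 0 ≤-refl) , s≤s z≤n ∷ s≤s (s≤s z≤n) ∷ s≤s z≤n ∷ s≤s (s≤s (s≤s z≤n)) ∷ []) ∷ [])
    (λ v _ → Any.here (Down-edge0 v)) (λ v → ⊥-elim (¬Up-B v)) ([] ∷ []) (≤-refl ∷ []) ,
  trans (LP.length-++ (listA n)) (trans (+-comm _ 1) (length-listA (suc k)))
  where open PathLists {n} mB (edgeW 0 4) (edge-weight 0 four) (edgeM-W 0 4)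

-- For n = k + 5: the second heavy edge {n - 2 , n - 1}, with labels counted from 0, starts at k +
-- 3, which the shift by one makes k + 2 here.
wC : ℕ → ℕ → ℕ
wC k zero = 4
wC k (suc i) = edgeW (suc (suc k)) 4 i

mC-W : ∀ k i j → mC (suc (suc (suc (suc (suc k))))) i j ≡ pathW (wC k) i j
mC-W k zero zero = refl
mC-W k zero (suc zero) = refl
mC-W k zero (suc (suc j)) = refl
mC-W k (suc zero) zero = refl
mC-W k (suc (suc i)) zero rewrite ∧-zeroʳ (i ≡ᵇ suc k) | ∧-zeroʳ (i ≡ᵇ suc (suc k)) = refl
mC-W k (suc zero) (suc j) = edgeM-W (suc (suc k)) 4 zero j
mC-W k (suc (suc i)) (suc j) = edgeM-W (suc (suc k)) 4 (suc i) j

weightC : ∀ k i → Weight (wC k i)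
weightC k zero = four
weightC k (suc i) = edge-weight (suc (suc k)) four i

heavyC : ∀ k i → 4 ≤ wC k i → i ≡ 0 ⊎ i ≡ suc (suc (suc k))
heavyC k zero l = inj₁ refl
heavyC k (suc i) l = inj₂ (cong suc (edge-heavy (suc (suc k)) i l))

typeC : ∀ n → 5 ≤ n → Coxeter.StubList {n} (mC n) (map embed1 (listC n)) × length (listC n) ≡ n C 2 ℕ.+ 1
typeC (suc zero) (s≤s ())
typeC (suc (suc zero)) (s≤s (s≤s ()))
typeC (suc (suc (suc zero))) (s≤s (s≤s (s≤s ())))
typeC (suc (suc (suc (suc zero)))) (s≤s (s≤s (s≤s (s≤s ()))))
typeC n@(suc (suc (suc (suc (suc k))))) _ = subst (λ L → Coxeter.StubList {n} (mC n) (map embed1 L)) (sym (LP.++-assoc (listA n) _ _))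
    (listed (w₁ ∷ w₂ ∷ []) h1 h2 (λ v b → h3 v b) h4
      ((0 ∷ 1 ∷ 0 ∷ 2 ∷ [] , refl , down-chain (d0 0 ≤-refl) , s≤s z≤n ∷ s≤s (s≤s z≤n) ∷ s≤s z≤n ∷ s≤s (s≤s (s≤s z≤n)) ∷ []) ∷
       (suc (suc (suc (suc k))) ∷ suc (suc (suc k)) ∷ suc (suc k) ∷ suc (suc (suc (suc k))) ∷ [] , refl , up-chain (u0 (suc (suc k)) top4) ,
          ≤-refl ∷ n≤1+n _ ∷ m≤n⇒m≤1+n (n≤1+n _) ∷ ≤-refl ∷ []) ∷ [])
      (λ v b → Any.here (downC v b)) (λ v b → Any.there (Any.here (upC v b))) (((λ ()) ∷ []) ∷ [] ∷ []) (≤-refl ∷ ≤-refl ∷ [])) ,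
  trans (LP.length-++ (listB n)) (cong (ℕ._+ 1) (trans (LP.length-++ (listA n)) (trans (+-comm _ 1) (length-listA (suc (suc (suc k)))))))
  where
  open PathLists {n} (mC n) (wC k) (weightC k) (mC-W k)
  w₁ w₂ : List ℕ
  w₁ = 1 ∷ 2 ∷ 1 ∷ 3 ∷ []
  w₂ = n ∷ (n ∸ 1) ∷ (n ∸ 2) ∷ n ∷ []
  edge-self : ∀ a → edgeW a 4 a ≡ 4
  edge-self zero = refl
  edge-self (suc a) = edge-self a
  top4 : 4 ≤ wC k (suc (suc (suc k)))
  top4 = ≤-reflexive (sym (edge-self k))
  h1 : ∀ i → 4 ≤ wC k i → ¬ (4 ≤ wC k (suc i))
  h1 zero l l' = 4≰3 l'
  h1 (suc i) l l' = edge-h1 (suc (suc k)) 4 i l l'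
  h2 : ∀ i → 5 ≤ wC k i → i ≡ 0
  h2 zero l = refl
  h2 (suc i) l = ⊥-elim (¬5≤edge4 (suc (suc k)) i l)
  -- A downward chain from the last edge would contain the label n, one beyond the last generator.
  down0 : ∀ {i x} → Down (wC k) i x → In x → i ≡ 0
  down0 (d0 i l) (_ ∷ _ ∷ _ ∷ b ∷ []) with heavyC k i l
  ... | inj₁ e = e
  ... | inj₂ refl = ⊥-elim (<-irrefl refl b)
  down0 (ds v _) (_ ∷ b) with down0 v b
  ... | ()
  downC : ∀ {i x} → Down (wC k) i x → In x → map suc x ≡ w₁
  downC (d0 i l) b with down0 (d0 i l) b
  ... | refl = refl
  downC (ds v _) (_ ∷ b) with down0 v b
  ... | ()
  h3 : ∀ {p x} → Down (wC k) (suc p) x → In x → wC k p ≡ 3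
  h3 v b with down0 v b
  ... | ()
  up≥ : ∀ {i x} → Upw (wC k) i x → suc (suc (suc (suc k))) ≤ i
  up≥ (u0 i l) = s≤s (s≤s (≤-reflexive (sym (edge-heavy (suc (suc k)) i l))))
  up≥ (q0 zero l) = ⊥-elim (5≰4 l)
  up≥ (q0 (suc i) l) = ⊥-elim (¬5≤edge4 (suc (suc k)) i l)
  up≥ (us u _) = m≤n⇒m≤1+n (up≥ u)
  h4 : ∀ {i x} → Upw (wC k) i x → wC k i ≡ 3
  h4 {i} v = go i (up≥ v)
    where go : ∀ i → suc (suc (suc (suc k))) ≤ i → wC k i ≡ 3
          go (suc i) (s≤s l) = edge-light (suc (suc k)) i λ e → <⇒≢ l (sym e)
  upC : ∀ {i x} → Upw (wC k) i x → In x → map suc x ≡ w₂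
  upC (u0 i l) b with edge-heavy (suc (suc k)) i l
  ... | refl = refl
  upC (q0 zero l) b = ⊥-elim (5≰4 l)
  upC (q0 (suc i) l) b = ⊥-elim (¬5≤edge4 (suc (suc k)) i l)
  upC (us u _) (b ∷ _) = ⊥-elim (<-irrefl refl (≤-trans (s≤s (s≤s (up≥ u))) b))

ladder-unique : ∀ (f : ℕ → List ℕ) a b c → (∀ i → length (f (a ℕ.+ i)) ≡ i ℕ.+ c) → AllPairs _≢_ (map f (range a b))
ladder-unique f a b c h = subst (AllPairs _≢_) (sym (LP.map-applyUpTo (a ℕ.+_) f (suc b ∸ a)))
  (AllPairsP.applyUpTo⁺₁ (λ i → f (a ℕ.+ i)) (suc b ∸ a) λ {i} {j} l _ e → <⇒≢ l (+-cancelʳ-≡ c i j (trans (sym (h i)) (trans (cong length e) (h j)))))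

typeF : ∀ n → 4 ≤ n → Coxeter.StubList {n} mF (map embed1 (listF n)) × length (listF n) ≡ suc n C 2 ∸ 1
typeF (suc zero) (s≤s ())
typeF (suc (suc zero)) (s≤s (s≤s ()))
typeF (suc (suc (suc zero))) (s≤s (s≤s (s≤s ())))
typeF n@(suc (suc (suc (suc k)))) _ =
  listed (w₁ ∷ w₂ ∷ map f (range 3 n)) (edge-h1 1 4) (edge4-h2 1) (λ v _ → edge-h3 1 4 v) (edge-h4 1 4) good
    downF upF (((λ ()) ∷ head≢ 1 (λ { (s≤s ()) })) ∷ head≢ 2 (λ { (s≤s (s≤s ())) }) ∷ ladder-unique f 3 n 4 len)
    (s≤s (s≤s (s≤s (s≤s z≤n))) ∷ ≤-refl ∷ All.tabulate long) ,
  trans (LP.length-++ (listA n)) (trans (cong (λ z → length (listA n) ℕ.+ suc (suc z)) (trans (LP.length-map f (range 3 n)) (length-range 3 n)))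
    (sym (cong (_∸ 1) (trans (C2-suc n) (cong (ℕ._+ n) (sym (length-listA (suc (suc k)))))))))
  where
  open PathLists {n} mF (edgeW 1 4) (edge-weight 1 four) (edgeM-W 1 4)
  w₁ w₂ : List ℕ
  w₁ = 1 ∷ 2 ∷ 3 ∷ 2 ∷ 4 ∷ []
  w₂ = 2 ∷ 3 ∷ 2 ∷ 4 ∷ []
  f : ℕ → List ℕ
  f i = reverse (range 1 i) ++ 3 ∷ []
  f-suc : ∀ i → f (suc i) ≡ suc i ∷ f i
  f-suc i = cong (_++ 3 ∷ []) (reverse-range {1} {i} (s≤s z≤n))
  len : ∀ i → length (f (3 ℕ.+ i)) ≡ i ℕ.+ 4
  len i = trans (LP.length-++ (reverse (range 1 (3 ℕ.+ i)))) (trans (cong (ℕ._+ 1) (trans (LP.length-reverse (range 1 (3 ℕ.+ i))) (length-range 1 (3 ℕ.+ i)))) (trans (+-comm _ 1) (+-comm 4 i)))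
  long : ∀ {u} → u ∈ map f (range 3 n) → 4 ≤ length u
  long m with ∈map⁻ f (range 3 n) m
  ... | j , mj , refl with m≤n⇒∃[o]m+o≡n (proj₁ (range∋ {3} {n} mj))
  ...   | i , refl = ≤-trans (m≤n+m 4 i) (≤-reflexive (sym (len i)))
  head≢ : ∀ h {y} → ¬ (3 ≤ h) → All (h ∷ y ≢_) (map f (range 3 n))
  head≢ h {y} q = All.tabulate go
    where
    go : ∀ {u} → u ∈ map f (range 3 n) → h ∷ y ≢ u
    go m e with ∈map⁻ f (range 3 n) m
    ... | suc j , mj , refl with trans e (f-suc j)
    ...   | refl = q (proj₁ (range∋ {3} {n} mj))
    go m e | zero , mj , refl with proj₁ (range∋ {3} {n} mj)
    ... | ()
  downF : ∀ {i x} → Down (edgeW 1 4) i x → In x → map suc x ∈ w₁ ∷ w₂ ∷ map f (range 3 n)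
  downF (d0 i l) _ with edge-heavy 1 i l
  ... | refl = Any.there (Any.here refl)
  downF (ds (d0 i l) e) _ with edge-heavy 1 i l
  ... | refl = Any.here refl
  downF (ds (ds v _) _) _ with Down-edge 1 4 v
  ... | s≤s ()
  word : ∀ {i x} → Upw (edgeW 1 4) i x → map suc x ≡ f (suc i)
  word (u0 i l) with edge-heavy 1 (suc i) l
  ... | refl = refl
  word (q0 i l) = ⊥-elim (¬5≤edge4 1 i l)
  word (us {i} u _) = trans (cong (suc (suc i) ∷_) (word u)) (sym (f-suc (suc i)))
  upF : ∀ {i x} → Upw (edgeW 1 4) i x → In x → map suc x ∈ w₁ ∷ w₂ ∷ map f (range 3 n)
  upF {i} v b with Up-shape v
  upF {i} v (l ∷ _) | _ , _ , _ , _ , _ , refl = Any.there (Any.there (subst (_∈ map f (range 3 n)) (sym (word v)) (∈P.∈-map⁺ f (range∈ {3} {n} (s≤s (Up-edge 1 4 v)) l))))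
  build : ∀ j → 3 ℕ.+ j ≤ n → ∃ λ x → Upw (edgeW 1 4) (2 ℕ.+ j) x × In x
  build zero l = _ , u0 0 ≤-refl , s≤s (s≤s (s≤s z≤n)) ∷ s≤s (s≤s z≤n) ∷ s≤s z≤n ∷ s≤s (s≤s (s≤s z≤n)) ∷ []
  build (suc j) l with build j (<⇒≤ l)
  ... | x , u , b = _ , us u refl , l ∷ b
  good : All Listed (w₁ ∷ w₂ ∷ map f (range 3 n))
  good = (0 ∷ 1 ∷ 2 ∷ 1 ∷ 3 ∷ [] , refl , down-chain (ds (d0 1 ≤-refl) refl) , s≤s z≤n ∷ b₂) ∷ (1 ∷ 2 ∷ 1 ∷ 3 ∷ [] , refl , down-chain (d0 1 ≤-refl) , b₂) ∷ All.tabulate go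
    where
    b₂ : In (1 ∷ 2 ∷ 1 ∷ 3 ∷ [])
    b₂ = s≤s (s≤s z≤n) ∷ s≤s (s≤s (s≤s z≤n)) ∷ s≤s (s≤s z≤n) ∷ s≤s (s≤s (s≤s (s≤s z≤n))) ∷ []
    go : ∀ {u} → u ∈ map f (range 3 n) → Listed u
    go m with ∈map⁻ f (range 3 n) m
    ... | j , mj , refl with m≤n⇒∃[o]m+o≡n (proj₁ (range∋ {3} {n} mj))
    ...   | i , refl with build i (proj₂ (range∋ {3} {n} mj))
    ...     | x , u , b = x , sym (word u) , up-chain u , b

typeH : ∀ n → 3 ≤ n → Coxeter.StubList {n} mH (map embed1 (listH n)) × length (listH n) ≡ suc n C 2 ∸ 1
typeH (suc zero) (s≤s ())
typeH (suc (suc zero)) (s≤s (s≤s ()))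
typeH n@(suc (suc (suc k))) _ = subst (λ L → Coxeter.StubList {n} mH (map embed1 L)) (sym (LP.++-assoc (listA n) _ _))
    (listed (w₁ ∷ map f (range 2 n)) (edge-h1 0 5) (λ i l → edge-heavy 0 {5} i (<⇒≤ l)) (λ v _ → edge-h3 0 5 v) (edge-h4 0 5) good
      (λ v _ → Any.here (Down-edge0 v)) upH (All.tabulate head≢ ∷ ladder-unique f 2 n 5 len) (≤-refl ∷ All.tabulate long)) ,
  trans (LP.length-++ (listB n)) (trans (cong₂ ℕ._+_ (LP.length-++ (listA n)) (trans (LP.length-map f (range 2 n)) (length-range 2 n)))
    (trans (+-assoc (length (listA n)) 1 (suc (suc k))) (sym (cong (_∸ 1) (trans (C2-suc n) (cong (ℕ._+ n) (sym (length-listA (suc k)))))))))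
  where
  open PathLists {n} mH (edgeW 0 5) (edge-weight 0 five) (edgeM-W 0 5)
  w₁ : List ℕ
  w₁ = 1 ∷ 2 ∷ 1 ∷ 3 ∷ []
  f : ℕ → List ℕ
  f i = reverse (range 2 i) ++ w₁
  f-suc : ∀ i → f (suc (suc i)) ≡ suc (suc i) ∷ f (suc i)
  f-suc i = cong (_++ w₁) (reverse-range {2} {suc i} (s≤s (s≤s z≤n)))
  len : ∀ i → length (f (2 ℕ.+ i)) ≡ i ℕ.+ 5
  len i = trans (LP.length-++ (reverse (range 2 (2 ℕ.+ i)))) (trans (cong (ℕ._+ 4) (trans (LP.length-reverse (range 2 (2 ℕ.+ i))) (length-range 2 (2 ℕ.+ i)))) (sym (+-suc i 4)))
  long : ∀ {u} → u ∈ map f (range 2 n) → 4 ≤ length u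
  long m with ∈map⁻ f (range 2 n) m
  ... | j , mj , refl = ≤-trans (m≤n+m 4 (length (reverse (range 2 j)))) (≤-reflexive (sym (LP.length-++ (reverse (range 2 j)))))
  head≢ : ∀ {u} → u ∈ map f (range 2 n) → w₁ ≢ u
  head≢ m e with ∈map⁻ f (range 2 n) m
  ... | zero , mj , refl with proj₁ (range∋ {2} {n} mj)
  ...   | ()
  head≢ m e | suc zero , mj , refl with proj₁ (range∋ {2} {n} mj)
  ...   | s≤s ()
  head≢ m e | suc (suc j) , mj , refl with trans e (f-suc j)
  ...   | ()
  word : ∀ {i x} → Upw (edgeW 0 5) i x → map suc x ≡ f (suc i)
  word (u0 i l) with edge-heavy 0 {5} (suc i) l
  ... | ()
  word (q0 i l) with edge-heavy 0 {5} i (<⇒≤ l)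
  ... | refl = refl
  word (us {i} u _) = trans (cong (suc (suc i) ∷_) (word u)) (sym (f-suc i))
  upH : ∀ {i x} → Upw (edgeW 0 5) i x → In x → map suc x ∈ w₁ ∷ map f (range 2 n)
  upH {i} v b with Up-shape v
  upH {i} v (l ∷ _) | _ , _ , _ , _ , _ , refl = Any.there (subst (_∈ map f (range 2 n)) (sym (word v)) (∈P.∈-map⁺ f (range∈ {2} {n} (s≤s (Up-edge 0 5 v)) l)))
  build : ∀ j → 2 ℕ.+ j ≤ n → ∃ λ x → Upw (edgeW 0 5) (1 ℕ.+ j) x × In x
  build zero l = _ , q0 0 ≤-refl , s≤s (s≤s z≤n) ∷ s≤s z≤n ∷ s≤s (s≤s z≤n) ∷ s≤s z≤n ∷ s≤s (s≤s (s≤s z≤n)) ∷ []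
  build (suc j) l with build j (<⇒≤ l)
  ... | x , u , b = _ , us u refl , l ∷ b
  good : All Listed (w₁ ∷ map f (range 2 n))
  good = (0 ∷ 1 ∷ 0 ∷ 2 ∷ [] , refl , down-chain (d0 0 (n≤1+n 4)) , s≤s z≤n ∷ s≤s (s≤s z≤n) ∷ s≤s z≤n ∷ s≤s (s≤s (s≤s z≤n)) ∷ []) ∷ All.tabulate go
    where
    go : ∀ {u} → u ∈ map f (range 2 n) → Listed u
    go m with ∈map⁻ f (range 2 n) m
    ... | j , mj , refl with m≤n⇒∃[o]m+o≡n (proj₁ (range∋ {2} {n} mj))
    ...   | i , refl with build i (proj₂ (range∋ {2} {n} mj))
    ...     | x , u , b = x , sym (word u) , up-chain u , b

-- The types E.

eqb-refl : ∀ i → (i ≡ᵇ i) ≡ true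
eqb-refl zero = refl
eqb-refl (suc i) = eqb-refl i

eqb-≢ : ∀ {i j} → i ≢ j → (i ≡ᵇ j) ≡ false
eqb-≢ {zero} {zero} q = ⊥-elim (q refl)
eqb-≢ {zero} {suc j} q = refl
eqb-≢ {suc i} {zero} q = refl
eqb-≢ {suc i} {suc j} q = eqb-≢ {i} {j} λ e → q (cong suc e)

pathM-val : ∀ i j → i ≢ j → pathM i j ≡ 2 ⊎ pathM i j ≡ 3
pathM-val zero zero q = ⊥-elim (q refl)
pathM-val zero (suc zero) q = inj₂ refl
pathM-val zero (suc (suc j)) q = inj₁ refl
pathM-val (suc zero) zero q = inj₂ refl
pathM-val (suc (suc i)) zero q = inj₁ refl
pathM-val (suc i) (suc j) q = pathM-val i j λ e → q (cong suc e)

pathM-sym : ∀ i j → pathM i j ≡ pathM j i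
pathM-sym i j = trans (pathM-W i j) (trans (symW _ i j) (sym (pathM-W j i)))

-- Writing q = a + 1 makes a the index of the label -1. The path is 0, ..., q + r with branch node
-- q, and N is the index of v.
module EType (a r : ℕ) (1≤r : 1 ≤ r) where
  q N n : ℕ
  q = suc a
  N = q ℕ.+ r ℕ.+ 1
  n = q ℕ.+ r ℕ.+ 2

  N≡ : N ≡ suc (q ℕ.+ r)
  N≡ = +-comm (q ℕ.+ r) 1
  n≡ : n ≡ suc N
  n≡ = +-suc (q ℕ.+ r) 1

  q+1<N : suc q < N
  q+1<N = subst (suc q <_) (sym N≡) (s≤s (≤-trans (≤-reflexive (+-comm 1 q)) (+-monoʳ-≤ q 1≤r)))
  q<N : q < N
  q<N = <⇒≤ q+1<N
  a<N : a < N
  a<N = <⇒≤ q<N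

  M : ℕ → ℕ → ℕ
  M = mE q r

  <⇒≢' : ∀ {i j} → i < j → j ≢ i
  <⇒≢' l e = <⇒≢ l (sym e)

  M-diag : ∀ i → M i i ≡ 1
  M-diag i rewrite eqb-refl i = refl

  M-path : ∀ {i j} → i ≢ j → i ≢ N → j ≢ N → M i j ≡ pathM i j
  M-path p x y rewrite eqb-≢ p | eqb-≢ x | eqb-≢ y = refl

  M-N : ∀ {i} → i ≢ N → M i N ≡ (if i ≡ᵇ q then 3 else 2)
  M-N {i} p rewrite eqb-≢ p | eqb-refl N with i ≡ᵇ q
  ... | true = refl
  ... | false = refl

  N-M : ∀ {i} → i ≢ N → M N i ≡ (if i ≡ᵇ q then 3 else 2)
  N-M {i} p rewrite eqb-≢ {N} {i} (λ e → p (sym e)) | eqb-refl N | eqb-≢ {N} {q} (<⇒≢' q<N) = refl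

  M-sym : ∀ i j → M i j ≡ M j i
  M-sym i j with i ℕ.≟ j | i ℕ.≟ N | j ℕ.≟ N
  ... | yes refl | _ | _ = refl
  ... | no p | yes refl | yes refl = ⊥-elim (p refl)
  ... | no p | yes refl | no y = trans (N-M y) (sym (M-N y))
  ... | no p | no x | yes refl = trans (M-N x) (sym (N-M x))
  ... | no p | no x | no y = trans (M-path p x y) (trans (pathM-sym i j) (sym (M-path (λ e → p (sym e)) y x)))

  data Edg : ℕ → ℕ → Set where
    right : ∀ {i} → i ≢ N → suc i ≢ N → Edg i (suc i)
    left  : ∀ {i} → i ≢ N → suc i ≢ N → Edg (suc i) i
    arm   : Edg q N
    arm'  : Edg N q

  M-qN : M q N ≡ 3
  M-qN = trans (M-N (<⇒≢ q<N)) (cong (λ b → if b then 3 else 2) (eqb-refl q))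

  M-next : ∀ {i} → i ≢ N → suc i ≢ N → M i (suc i) ≡ 3
  M-next {i} x y = trans (M-path (λ e → 1+n≢n (sym e)) x y) (trans (pathM-W i (suc i)) (nextW _ i))

  Edg⇒3 : ∀ {i j} → Edg i j → M i j ≡ 3
  Edg⇒3 (right x y) = M-next x y
  Edg⇒3 (left {i} x y) = trans (M-sym (suc i) i) (M-next x y)
  Edg⇒3 arm = M-qN
  Edg⇒3 arm' = trans (M-sym N q) M-qN

  private
    if-edge : ∀ i → 3 ≤ (if i ≡ᵇ q then 3 else 2) → i ≡ q
    if-edge i l with i ℕ.≟ q
    ... | yes e = e
    ... | no ne with subst (λ b → 3 ≤ (if b then 3 else 2)) (eqb-≢ ne) l
    ...   | s≤s (s≤s ())

  near : ∀ {i j} → 3 ≤ M i j → Edg i j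
  near {i} {j} l with i ℕ.≟ j | i ℕ.≟ N | j ℕ.≟ N
  near {i} l | yes refl | _ | _ with subst (3 ≤_) (M-diag i) l
  ... | s≤s ()
  near l | no p | yes refl | yes refl = ⊥-elim (p refl)
  near {_} {j} l | no p | yes refl | no y with if-edge j (subst (3 ≤_) (N-M y) l)
  ... | refl = arm'
  near {i} l | no p | no x | yes refl with if-edge i (subst (3 ≤_) (M-N x) l)
  ... | refl = arm
  near {i} {j} l | no p | no x | no y with nearW _ i j (subst (3 ≤_) (trans (M-path p x y) (pathM-W i j)) l)
  ... | inj₁ (refl , _) = right x y
  ... | inj₂ (refl , _) = left y x

  ¬4≤M : ∀ {i j} → ¬ (4 ≤ M i j)
  ¬4≤M {i} {j} l with subst (4 ≤_) (Edg⇒3 (near {i} {j} (<⇒≤ l))) l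
  ... | s≤s (s≤s (s≤s ()))

  M-val : ∀ {i j} → i ≢ j → M i j ≡ 2 ⊎ M i j ≡ 3
  M-val {i} {j} p with i ℕ.≟ N | j ℕ.≟ N
  ... | yes refl | yes refl = ⊥-elim (p refl)
  ... | yes refl | no y rewrite N-M y with j ≡ᵇ q
  ...   | true = inj₂ refl
  ...   | false = inj₁ refl
  M-val {i} p | no x | yes refl rewrite M-N x with i ≡ᵇ q
  ...   | true = inj₂ refl
  ...   | false = inj₁ refl
  M-val {i} {j} p | no x | no y rewrite M-path p x y = pathM-val i j p

  M-far : ∀ i {j} → suc (suc i) ≤ j → j < N → M i j ≡ 2
  M-far i l h with m≤n⇒∃[o]m+o≡n l
  ... | k , refl = trans (M-path (<⇒≢ l') (<⇒≢ (<-trans l' h)) (<⇒≢ h)) (trans (pathM-W i _) (farW _ i k))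
    where l' = <⇒≤ l

  M-v : ∀ {i} → i < N → i ≢ q → M i N ≡ 2
  M-v {i} l p = trans (M-N (<⇒≢ l)) (cong (λ b → if b then 3 else 2) (eqb-≢ p))

  geoE : Geo n M
  geoE = record
    { wt = λ s t → wt' (M (toℕ s) (toℕ t))
    ; mdiag = λ s → M-diag (toℕ s)
    ; msym = λ s t → M-sym (toℕ s) (toℕ t)
    ; combo = λ s t p → go (M-val (λ e → p (FP.toℕ-injective e))) (M-sym (toℕ s) (toℕ t))
    }
    where
    wt' : ℕ → R
    wt' k = if k ≡ᵇ 3 then 1R else 0R
    go : ∀ {k k'} → k ≡ 2 ⊎ k ≡ 3 → k ≡ k' → Combo k (wt' k) (wt' k')
    go (inj₁ refl) refl = c2
    go (inj₂ refl) refl = c3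

  open Labels {n} M geoE public

  ≤N : ∀ {k} → k < n → k ≤ N
  ≤N {k} l = ≤-pred (subst (suc k ≤_) n≡ l)
  <n : ∀ {k} → k ≤ N → k < n
  <n {k} l = subst (suc k ≤_) (sym n≡) (s≤s l)

  -- The words z_s of the path, generated by prolongation: here from z_1 with s growing, and in `ED`
  -- from z_(-1) with s falling.
  data EU : ℕ → List ℕ → Set where
    e0 : EU (suc q) (suc q ∷ q ∷ a ∷ N ∷ [])
    es : ∀ {j x} → EU j x → suc j < N → EU (suc j) (suc j ∷ x)
  data ED : ℕ → List ℕ → Set where
    e0 : ED a (a ∷ q ∷ suc q ∷ N ∷ [])
    es : ∀ {j x} → ED (suc j) x → ED j (j ∷ x)
  data EV : List ℕ → Set where
    vpair : ∀ {i j} → i < j → M i j ≡ 2 → EV (i ∷ j ∷ [])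
    vfork : ∀ {i} → suc (suc i) < N → EV (suc i ∷ i ∷ suc (suc i) ∷ [])
    vl : EV (q ∷ a ∷ N ∷ [])
    vr : EV (q ∷ suc q ∷ N ∷ [])
    vz : EV (N ∷ q ∷ a ∷ suc q ∷ [])
    vU : ∀ {j x} → EU j x → EV x
    vD : ∀ {j x} → ED j x → EV x

  EU-shape : ∀ {j x} → EU j x → ∃ λ d → ∃ λ e → ∃ λ f → ∃ λ y → j ≡ suc d × x ≡ j ∷ d ∷ e ∷ f ∷ y
  EU-shape e0 = _ , _ , _ , _ , refl , refl
  EU-shape (es u _) with EU-shape u
  ... | _ , _ , _ , _ , refl , refl = _ , _ , _ , _ , refl , refl
  ED-shape : ∀ {j x} → ED j x → ∃ λ e → ∃ λ f → ∃ λ y → x ≡ j ∷ suc j ∷ e ∷ f ∷ y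
  ED-shape e0 = _ , _ , _ , refl
  ED-shape (es u) with ED-shape u
  ... | _ , _ , _ , refl = _ , _ , _ , refl
  EU-bound : ∀ {j x} → EU j x → q < j × j < N
  EU-bound e0 = ≤-refl , q+1<N
  EU-bound (es u l) = m<n⇒m<1+n (proj₁ (EU-bound u)) , l
  ED-bound : ∀ {j x} → ED j x → j ≤ a
  ED-bound e0 = ≤-refl
  ED-bound (es u) = <⇒≤ (ED-bound u)

  fork-view : ∀ {u s t} → s < t → In (u ∷ s ∷ t ∷ []) → Edg u s → Edg u t → EV (u ∷ s ∷ t ∷ [])
  fork-view l b (right x y) (right _ _) = ⊥-elim (<-irrefl refl l)
  fork-view l b (right x y) (left _ _) = ⊥-elim (<-asym l (m<n⇒m<1+n (n<1+n _)))
  fork-view l b (right x y) arm = vr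
  fork-view l b (right x y) arm' = ⊥-elim (x refl)
  fork-view l (_ ∷ _ ∷ c ∷ []) (left x y) (right _ z) = vfork (≤∧≢⇒< (≤N c) z)
  fork-view l b (left x y) (left _ _) = ⊥-elim (<-irrefl refl l)
  fork-view l b (left x y) arm = vl
  fork-view l b (left x y) arm' = ⊥-elim (y refl)
  fork-view l (_ ∷ _ ∷ c ∷ []) arm _ = ⊥-elim (<⇒≱ l (≤N c))
  fork-view l b arm' B = ⊥-elim (go refl B l)
    where
    go : ∀ {u t} → u ≡ N → Edg u t → ¬ (q < t)
    go e (right x _) _ = x e
    go e (left _ y) _ = y e
    go e arm _ = <⇒≢ q<N e
    go e arm' l = <-irrefl refl l

  nbr : ∀ {p c} → Edg p c → c ≢ q → c ≢ N → c ≡ suc p ⊎ (p ≡ suc c × suc c ≢ N)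
  nbr (right _ _) _ _ = inj₁ refl
  nbr (left _ y) _ _ = inj₂ (refl , y)
  nbr arm _ x = ⊥-elim (x refl)
  nbr arm' x _ = ⊥-elim (x refl)

  nbr-N : ∀ {p c} → Edg p c → c ≡ N → p ≡ q
  nbr-N (right _ y) e = ⊥-elim (y e)
  nbr-N (left x _) e = ⊥-elim (x e)
  nbr-N arm e = refl
  nbr-N arm' e = ⊥-elim (<⇒≢ q<N e)

  nbr-q : ∀ {p c} → Edg p c → c ≡ q → p ≡ a ⊎ p ≡ suc q ⊎ p ≡ N
  nbr-q (right _ y) e = inj₁ (suc-injective e)
  nbr-q (left x _) e = inj₂ (inj₁ (cong suc e))
  nbr-q arm e = ⊥-elim (<⇒≢ q<N (sym e))
  nbr-q arm' e = inj₂ (inj₂ refl)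

  -- A fork can grow only at the branch node, by the third neighbour of q: over both path neighbours
  -- this is N, over the left one and N it is q + 1, over the right one and N it is a. The word that
  -- starts with N stops there, because q is the only neighbour of N; the others run on along the
  -- path.
  tail-view : ∀ {p c d e x} → EV (c ∷ d ∷ e ∷ x) → Edg p c → Fresh p (d ∷ e ∷ x) → EV (p ∷ c ∷ d ∷ e ∷ x)
  tail-view (vfork {i} l) E fr with suc i ℕ.≟ q
  ... | no ne with nbr E ne (<⇒≢ (<⇒≤ l))
  ...   | inj₁ refl = ⊥-elim (proj₁ fr refl)
  ...   | inj₂ (refl , _) = ⊥-elim (proj₂ fr refl)
  tail-view (vfork {i} l) E fr | yes refl with nbr-q E refl
  ... | inj₁ refl = ⊥-elim (proj₁ fr refl)
  ... | inj₂ (inj₁ refl) = ⊥-elim (proj₂ fr refl)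
  ... | inj₂ (inj₂ refl) = vz
  tail-view vl E fr with nbr-q E refl
  ... | inj₁ refl = ⊥-elim (proj₁ fr refl)
  ... | inj₂ (inj₁ refl) = vU e0
  ... | inj₂ (inj₂ refl) = ⊥-elim (proj₂ fr refl)
  tail-view vr E fr with nbr-q E refl
  ... | inj₁ refl = vD e0
  ... | inj₂ (inj₁ refl) = ⊥-elim (proj₁ fr refl)
  ... | inj₂ (inj₂ refl) = ⊥-elim (proj₂ fr refl)
  tail-view vz E fr = ⊥-elim (fr (nbr-N E refl))
  tail-view (vU u) E fr with EU-shape u
  ... | d , _ , _ , _ , refl , refl with nbr E (<⇒≢' (proj₁ (EU-bound u))) (<⇒≢ (proj₂ (EU-bound u)))
  ...   | inj₁ refl = ⊥-elim (fr refl)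
  ...   | inj₂ (refl , ne) = vU (es u (≤∧≢⇒< (proj₂ (EU-bound u)) ne))
  tail-view (vD u) E fr with ED-shape u
  ... | _ , _ , _ , refl with nbr E (<⇒≢ (s≤s (ED-bound u))) (<⇒≢ (≤-trans (s≤s (ED-bound u)) (<⇒≤ q<N)))
  ...   | inj₁ refl = vD (es u)
  ...   | inj₂ (refl , _) = ⊥-elim (fr refl)

  view : ∀ {x} → ChN x → In x → EV x
  view (pairᶜ l e) b = vpair l e
  view (forkᶜ {u} {s} {t} (pairᶜ l e) A B) b = fork-view l b (near {u} {s} A) (near {u} {t} B)
  view (dblˡ {u} {s} _ l) b = ⊥-elim (¬4≤M {u} {s} l)
  view (dblʳ {u} {s} {t} _ l) b = ⊥-elim (¬4≤M {u} {t} l)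
  view (quint {u} {s} _ l) b = ⊥-elim (¬4≤M {u} {s} (<⇒≤ l))
  view (tailᶜ {p} {c} h fr m3) (_ ∷ b) = tail-view (view h b) (near {p} {c} (≤-reflexive (sym m3))) fr

  -- the only letter by which a stub can be prolonged
  ahead : List ℕ → ℕ
  ahead (s ∷ t ∷ []) = if t ≡ᵇ N then q else suc s
  ahead (c ∷ d ∷ e ∷ []) = if e ≡ᵇ N then (if d ≡ᵇ a then suc q else a) else N
  ahead (c ∷ d ∷ e ∷ f ∷ x) = if c ≡ᵇ suc d then suc c else c ∸ 1
  ahead _ = 0

  private
    ifc : ∀ {x y : ℕ} {b b'} → b ≡ b' → (if b then x else y) ≡ (if b' then x else y)
    ifc refl = refl

  ahead-ok : ∀ {p c d x} → EV (p ∷ c ∷ d ∷ x) → p ≡ ahead (c ∷ d ∷ x)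
  ahead-ok (vfork l) = sym (ifc (eqb-≢ (<⇒≢ l)))
  ahead-ok vl = sym (ifc (eqb-refl N))
  ahead-ok vr = sym (ifc (eqb-refl N))
  ahead-ok vz = sym (ifc (eqb-≢ (<⇒≢ q+1<N)))
  ahead-ok (vU e0) = sym (trans (ifc (eqb-refl N)) (ifc (eqb-refl a)))
  ahead-ok (vU (es u l)) with EU-shape u
  ... | d , _ , _ , _ , refl , refl = sym (ifc (eqb-refl d))
  ahead-ok (vD e0) = sym (trans (ifc (eqb-refl N)) (ifc (eqb-≢ {suc q} {a} (<⇒≢' (m<n⇒m<1+n (n<1+n a))))))
  ahead-ok (vD (es {j} u)) with ED-shape u
  ... | _ , _ , _ , refl = sym (ifc (eqb-≢ {j} {suc (suc j)} (<⇒≢ (m<n⇒m<1+n (n<1+n j)))))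

  tameE : TameN
  tameE = (λ b b' h h' → trans (ahead-ok (view h b)) (sym (ahead-ok (view h' b')))) , (λ {p} {c} _ _ _ l → Edg⇒3 (near {p} {c} l)) ,
    λ {u} {_} {t} _ _ l → ¬4≤M {u} {t} (<⇒≤ l)

  3≤ : ∀ {k} → k ≡ 3 → 3 ≤ k
  3≤ e = ≤-reflexive (sym e)

  fork-chain : ∀ {i} → suc (suc i) < N → ChN (suc i ∷ i ∷ suc (suc i) ∷ [])
  fork-chain {i} l = forkᶜ (pairᶜ (m<n⇒m<1+n (n<1+n i)) (M-far i ≤-refl l)) (3≤ (Edg⇒3 (left (<⇒≢ l₁) (<⇒≢ l₂)))) (3≤ (Edg⇒3 (right (<⇒≢ l₂) (<⇒≢ l))))
    where
    l₂ = <⇒≤ l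
    l₁ = <⇒≤ l₂

  vl-chain : ChN (q ∷ a ∷ N ∷ [])
  vl-chain = forkᶜ (pairᶜ a<N (M-v a<N λ e → 1+n≢n (sym e))) (3≤ (Edg⇒3 (left (<⇒≢ a<N) (<⇒≢ q<N)))) (3≤ M-qN)

  vr-chain : ChN (q ∷ suc q ∷ N ∷ [])
  vr-chain = forkᶜ (pairᶜ q+1<N (M-v q+1<N 1+n≢n)) (3≤ (Edg⇒3 (right (<⇒≢ q<N) (<⇒≢ q+1<N)))) (3≤ M-qN)

  vz-chain : ChN (N ∷ q ∷ a ∷ suc q ∷ [])
  vz-chain = tailᶜ (fork-chain q+1<N) (<⇒≢' a<N , <⇒≢' q+1<N) (Edg⇒3 arm')

  EU-chain : ∀ {j x} → EU j x → ChN x × In x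
  EU-chain e0 = tailᶜ vl-chain ((λ e → <⇒≢ (m<n⇒m<1+n (n<1+n a)) (sym e)) , <⇒≢ q+1<N) (Edg⇒3 (left (<⇒≢ q<N) (<⇒≢ q+1<N))) ,
    <n (<⇒≤ q+1<N) ∷ <n (<⇒≤ q<N) ∷ <n (<⇒≤ a<N) ∷ <n ≤-refl ∷ []
  EU-chain (es u l) with EU-shape u | EU-chain u
  ... | d , _ , _ , _ , refl , refl | c , b = tailᶜ c (λ e → <⇒≢ (m<n⇒m<1+n (n<1+n d)) (sym e)) (Edg⇒3 (left (<⇒≢ (<⇒≤ l)) (<⇒≢ l))) , <n (<⇒≤ l) ∷ b

  ED-chain : ∀ {j x} → ED j x → ChN x × In x
  ED-chain e0 = tailᶜ vr-chain ((λ e → <⇒≢ (m<n⇒m<1+n (n<1+n a)) e) , <⇒≢ a<N) (Edg⇒3 (right (<⇒≢ a<N) (<⇒≢ q<N))) ,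
    <n (<⇒≤ a<N) ∷ <n (<⇒≤ q<N) ∷ <n (<⇒≤ q+1<N) ∷ <n ≤-refl ∷ []
  ED-chain (es {j} u) with ED-shape u | ED-chain u
  ... | _ , _ , _ , refl | c , b = tailᶜ c (λ e → <⇒≢ (m<n⇒m<1+n (n<1+n j)) e) (Edg⇒3 (right (<⇒≢ j<N) (<⇒≢ j+1<N))) , <n (<⇒≤ j<N) ∷ b
    where
    j+1<N : suc j < N
    j+1<N = ≤-trans (s≤s (ED-bound u)) (<⇒≤ q<N)
    j<N : j < N
    j<N = <⇒≤ j+1<N

range-cons : ∀ {a b} → a ≤ b → range a b ≡ a ∷ range (suc a) b
range-cons {a} {b} l = trans (cong (applyUpTo (a ℕ.+_)) (+-∸-assoc 1 l)) (cong₂ _∷_ (+-identityʳ a) (ext (b ∸ a) λ i → +-suc a i))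
  where
  ext : ∀ {f g : ℕ → ℕ} k → (∀ i → f i ≡ g i) → applyUpTo f k ≡ applyUpTo g k
  ext zero h = refl
  ext (suc k) h = cong₂ _∷_ (h 0) (ext k λ i → h (suc i))

range-empty : ∀ {a b} → b < a → range a b ≡ []
range-empty {a} {b} l = cong (applyUpTo (a ℕ.+_)) (m≤n⇒m∸n≡0 l)

range-one : ∀ a → range a a ≡ a ∷ []
range-one a = trans (range-cons (≤-refl {a})) (cong (a ∷_) (range-empty (n<1+n a)))

map-unique∈ : ∀ {A : Set} (f : ℕ → A) xs → AllPairs _<_ xs → (∀ {i j} → i ∈ xs → j ∈ xs → f i ≡ f j → i ≡ j) → AllPairs _≢_ (map f xs)
map-unique∈ f [] [] inj = []
map-unique∈ f (x ∷ xs) (l ∷ ls) inj = AllP.map⁺ (All.tabulate λ m e → <⇒≢ (All.lookup l m) (inj (Any.here refl) (Any.there m) e)) ∷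
  map-unique∈ f xs ls λ p q → inj (Any.there p) (Any.there q)

sum-+ : ∀ (f g : ℕ → ℕ) k → sum (applyUpTo (λ i → f i ℕ.+ g i) k) ≡ sum (applyUpTo f k) ℕ.+ sum (applyUpTo g k)
sum-+ f g zero = refl
sum-+ f g (suc k) = trans (cong (ℕ._+_ (f 0 ℕ.+ g 0)) (sum-+ (λ i → f (suc i)) (λ i → g (suc i)) k))
  (interchange (f 0) (g 0) (sum (applyUpTo (λ i → f (suc i)) k)) (sum (applyUpTo (λ i → g (suc i)) k)))
  where
  interchange : ∀ a b c d → (a ℕ.+ b) ℕ.+ (c ℕ.+ d) ≡ (a ℕ.+ c) ℕ.+ (b ℕ.+ d)
  interchange = ℕSolver.solve-∀

sum-cong : ∀ {f g : ℕ → ℕ} k → (∀ i → f i ≡ g i) → sum (applyUpTo f k) ≡ sum (applyUpTo g k)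
sum-cong zero h = refl
sum-cong (suc k) h = cong₂ ℕ._+_ (h 0) (sum-cong k λ i → h (suc i))

sum-0 : ∀ k → sum (applyUpTo (λ _ → 0) k) ≡ 0
sum-0 zero = refl
sum-0 (suc k) = sum-0 k

sum-δ : ∀ q {k} → q < k → sum (applyUpTo (λ i → if i ≡ᵇ q then 1 else 0) k) ≡ 1
sum-δ zero (s≤s {n = k} _) = cong suc (sum-0 k)
sum-δ (suc q) (s≤s l) = sum-δ q l

sum-< : ∀ c {k} → c ≤ k → sum (applyUpTo (λ i → if i ℕ.<ᵇ c then 1 else 0) k) ≡ c
sum-< zero {k} _ = trans (sum-cong k λ { zero → refl ; (suc i) → refl }) (sum-0 k)
sum-< (suc c) (s≤s l) = cong suc (sum-< c l)

sum-∸ : ∀ N → sum (applyUpTo (N ∸_) (suc N)) ≡ suc N C 2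
sum-∸ zero = refl
sum-∸ (suc N) = trans (cong (ℕ._+_ (suc N)) (sum-∸ N)) (trans (+-comm (suc N) _) (sym (C2-suc (suc N))))

<ᵇ-true : ∀ i c → i < c → (i ℕ.<ᵇ c) ≡ true
<ᵇ-true zero (suc c) _ = refl
<ᵇ-true (suc i) (suc c) (s≤s l) = <ᵇ-true i c l

<ᵇ-false : ∀ i c → c ≤ i → (i ℕ.<ᵇ c) ≡ false
<ᵇ-false i zero _ = refl
<ᵇ-false (suc i) (suc c) (s≤s l) = <ᵇ-false i c l

indicator : Bool → ℕ
indicator b = if b then 1 else 0

module EList (a r' : ℕ) where
  r : ℕ
  r = suc r'
  open EType a r (s≤s z≤n)

  two? : ∀ i j → Dec (M i j ≡ 2)
  two? i j = M i j ℕ.≟ 2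

  row : ℕ → List ℕ
  row i = filter (two? i) (range (suc i) N)

  pairs₁ forks₁ forks₂ ups downs ES3 : List (List ℕ)
  pairs₁ = concatMap (λ i → map (λ j → i ∷ j ∷ []) (row i)) (range 0 N)
  forks₁ = map (λ j → j ∷ (j ∸ 1) ∷ suc j ∷ []) (range 1 (q ℕ.+ r ∸ 1))
  forks₂ = (q ∷ a ∷ N ∷ []) ∷ (q ∷ suc q ∷ N ∷ []) ∷ []
  fU fD : ℕ → List ℕ
  fU j = reverse (range a j) ++ N ∷ []
  fD j = range j (suc q) ++ N ∷ []
  ups = map fU (range (suc q) (q ℕ.+ r))
  downs = map fD (range 0 a)
  ES3 = ups ++ downs ++ (N ∷ q ∷ a ∷ suc q ∷ []) ∷ []

  Listed : List ℕ → Set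
  Listed = Good embed0 (λ w → w) (λ _ → refl)

  pair∈ : ∀ {i j} → i < j → j ≤ N → M i j ≡ 2 → i ∷ j ∷ [] ∈ pairs₁
  pair∈ {i} {j} l h e = ∈P.∈-concatMap⁺ (λ i → map (λ j → i ∷ j ∷ []) (row i)) (Any.map (λ { refl → ∈P.∈-map⁺ (λ j → i ∷ j ∷ []) (∈P.∈-filter⁺ (two? i) (range∈ {suc i} {N} l h) e) }) (range∈ {0} {N} z≤n (≤-trans (<⇒≤ l) h)))

  pair∋ : ∀ {u} → u ∈ pairs₁ → ∃ λ i → ∃ λ j → u ≡ i ∷ j ∷ [] × i < j × j ≤ N × M i j ≡ 2
  pair∋ {u} m = go (range 0 N) (∈P.∈-concatMap⁻ _ m)
    where
    go : ∀ xs → Any.Any (λ i → u ∈ map (λ j → i ∷ j ∷ []) (row i)) xs → ∃ λ i → ∃ λ j → u ≡ i ∷ j ∷ [] × i < j × j ≤ N × M i j ≡ 2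
    go (i ∷ xs) (Any.here p) with ∈P.∈-map⁻ _ p
    ... | j , mj , refl with ∈P.∈-filter⁻ (two? i) {xs = range (suc i) N} mj
    ...   | mr , e = i , j , refl , proj₁ (range∋ {suc i} {N} mr) , proj₂ (range∋ {suc i} {N} mr) , e
    go (i ∷ xs) (Any.there p) = go xs p

  pairs-unique : AllPairs _≢_ pairs₁
  pairs-unique = concatMap-unique _ (range 0 N) (range-sorted 0 N) (λ i → map-unique _ (λ { refl → refl }) (AllPairsP.filter⁺ (two? i) (range-sorted (suc i) N))) sep
    where
    sep : ∀ {i j x} → x ∈ map (λ k → i ∷ k ∷ []) (row i) → x ∈ map (λ k → j ∷ k ∷ []) (row j) → i ≡ j
    sep {i} {j} p p' with ∈P.∈-map⁻ (λ k → i ∷ k ∷ []) {xs = row i} p | ∈P.∈-map⁻ (λ k → j ∷ k ∷ []) {xs = row j} p'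
    ... | _ , _ , refl | _ , _ , refl = refl

  N-2 : q ℕ.+ r ∸ 1 ≡ suc (a ℕ.+ r')
  N-2 = +-suc a r'

  fork∋ : ∀ {u} → u ∈ forks₁ → ∃ λ i → u ≡ suc i ∷ i ∷ suc (suc i) ∷ [] × suc (suc i) < N
  fork∋ m with ∈P.∈-map⁻ (λ j → j ∷ (j ∸ 1) ∷ suc j ∷ []) {xs = range 1 (q ℕ.+ r ∸ 1)} m
  ... | zero , mj , refl with proj₁ (range∋ {1} {q ℕ.+ r ∸ 1} mj)
  ...   | ()
  fork∋ m | suc i , mj , refl = i , refl , subst (suc (suc i) <_) (sym N≡) (s≤s (s≤s (proj₂ (range∋ {1} {q ℕ.+ r ∸ 1} mj))))

  fork∈ : ∀ {i} → suc (suc i) < N → suc i ∷ i ∷ suc (suc i) ∷ [] ∈ forks₁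
  fork∈ {i} l = ∈P.∈-map⁺ (λ j → j ∷ (j ∸ 1) ∷ suc j ∷ []) (range∈ {1} {q ℕ.+ r ∸ 1} (s≤s z≤n) (≤-pred (≤-pred (subst (suc (suc i) <_) N≡ l))))

  fU-suc : ∀ {j} → a ≤ suc j → fU (suc j) ≡ suc j ∷ fU j
  fU-suc l = cong (_++ N ∷ []) (reverse-range l)

  fU-e0 : fU (suc q) ≡ suc q ∷ q ∷ a ∷ N ∷ []
  fU-e0 = trans (fU-suc (m≤n⇒m≤1+n (n≤1+n a))) (cong (suc q ∷_) (trans (fU-suc (n≤1+n a)) (cong (q ∷_) (cong (λ z → reverse z ++ N ∷ []) (range-one a)))))

  fD-cons : ∀ {j} → j ≤ suc q → fD j ≡ j ∷ fD (suc j)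
  fD-cons l = cong (_++ N ∷ []) (range-cons l)

  fD-e0 : fD a ≡ a ∷ q ∷ suc q ∷ N ∷ []
  fD-e0 = trans (fD-cons (m≤n⇒m≤1+n (n≤1+n a))) (cong (a ∷_) (trans (fD-cons (n≤1+n q)) (cong (λ z → q ∷ z ++ N ∷ []) (range-one (suc q)))))

  EU-word : ∀ {j x} → EU j x → x ≡ fU j
  EU-word e0 = sym fU-e0
  EU-word (es {j} u _) = trans (cong (suc j ∷_) (EU-word u)) (sym (fU-suc (m≤n⇒m≤1+n (<⇒≤ (<⇒≤ (proj₁ (EU-bound u)))))))

  ED-word : ∀ {j x} → ED j x → x ≡ fD j
  ED-word e0 = sym fD-e0
  ED-word (es {j} u) = trans (cong (j ∷_) (ED-word u)) (sym (fD-cons (≤-trans (<⇒≤ (ED-bound u)) (m≤n⇒m≤1+n (n≤1+n a)))))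

  EU-build : ∀ k → suc q ℕ.+ k ≤ q ℕ.+ r → ∃ λ x → EU (suc q ℕ.+ k) x
  EU-build zero l = subst (λ z → ∃ λ x → EU z x) (sym (+-identityʳ (suc q))) (_ , e0)
  EU-build (suc k) l with EU-build k (≤-trans (+-monoʳ-≤ (suc q) (n≤1+n k)) l)
  ... | x , u = subst (λ z → ∃ λ x → EU z x) (sym (+-suc (suc q) k)) (_ , es u (subst (suc (suc q ℕ.+ k) <_) (sym N≡) (s≤s (subst (_≤ q ℕ.+ r) (+-suc (suc q) k) l))))

  ED-build : ∀ j k → j ℕ.+ k ≡ a → ∃ λ x → ED j x
  ED-build j zero e = subst (λ z → ∃ λ x → ED z x) (trans (sym e) (+-identityʳ j)) (_ , e0)
  ED-build j (suc k) e with ED-build (suc j) k (trans (sym (+-suc j k)) e)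
  ... | x , u = _ , es u

  up∋ : ∀ {u} → u ∈ ups → ∃ λ j → u ≡ fU j × EU j u
  up∋ m with ∈P.∈-map⁻ fU {xs = range (suc q) (q ℕ.+ r)} m
  ... | j , mj , refl with m≤n⇒∃[o]m+o≡n (proj₁ (range∋ {suc q} {q ℕ.+ r} mj))
  ...   | k , refl with EU-build k (proj₂ (range∋ {suc q} {q ℕ.+ r} mj))
  ...     | x , u = _ , refl , subst (EU _) (EU-word u) u

  down∋ : ∀ {u} → u ∈ downs → ∃ λ j → u ≡ fD j × ED j u
  down∋ m with ∈P.∈-map⁻ fD {xs = range 0 a} m
  ... | j , mj , refl with m≤n⇒∃[o]m+o≡n (proj₂ (range∋ {0} {a} mj))
  ...   | k , e with ED-build j k e
  ...     | x , u = _ , refl , subst (ED _) (ED-word u) u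

  goodE : All Listed (listE q r)
  goodE = AllP.++⁺ (All.tabulate λ m → g₁ (pair∋ m)) (AllP.++⁺ (All.tabulate λ m → g₂ (fork∋ m)) (g₃ (vl-chain) ∷ (_ , refl , vr-chain , <n (<⇒≤ q<N) ∷ <n (<⇒≤ q+1<N) ∷ <n ≤-refl ∷ []) ∷
     AllP.++⁺ (All.tabulate λ m → g₄ (up∋ m)) (AllP.++⁺ (All.tabulate λ m → g₅ (down∋ m))
       ((_ , refl , vz-chain , <n ≤-refl ∷ <n (<⇒≤ q<N) ∷ <n (<⇒≤ a<N) ∷ <n (<⇒≤ q+1<N) ∷ []) ∷ []))))
    where
    g₁ : ∀ {u} → (∃ λ i → ∃ λ j → u ≡ i ∷ j ∷ [] × i < j × j ≤ N × M i j ≡ 2) → Listed u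
    g₁ (i , j , refl , l , h , e) = _ , refl , pairᶜ l e , <n (≤-trans (<⇒≤ l) h) ∷ <n h ∷ []
    g₂ : ∀ {u} → (∃ λ i → u ≡ suc i ∷ i ∷ suc (suc i) ∷ [] × suc (suc i) < N) → Listed u
    g₂ (i , refl , l) = _ , refl , fork-chain l , <n (<⇒≤ (<⇒≤ l)) ∷ <n (<⇒≤ (<⇒≤ (<⇒≤ l))) ∷ <n (<⇒≤ l) ∷ []
    g₃ : ChN (q ∷ a ∷ N ∷ []) → Listed (q ∷ a ∷ N ∷ [])
    g₃ c = _ , refl , c , <n (<⇒≤ q<N) ∷ <n (<⇒≤ a<N) ∷ <n ≤-refl ∷ []
    g₄ : ∀ {u} → (∃ λ j → u ≡ fU j × EU j u) → Listed u
    g₄ (_ , _ , u) = _ , refl , EU-chain u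
    g₅ : ∀ {u} → (∃ λ j → u ≡ fD j × ED j u) → Listed u
    g₅ (_ , _ , u) = _ , refl , ED-chain u

  completeE : ∀ {x} → EV x → In x → x ∈ listE q r
  completeE (vpair l e) (_ ∷ b ∷ []) = ∈P.∈-++⁺ˡ (pair∈ l (≤N b) e)
  completeE (vfork l) b = ∈P.∈-++⁺ʳ pairs₁ (∈P.∈-++⁺ˡ (fork∈ l))
  completeE vl b = ∈P.∈-++⁺ʳ pairs₁ (∈P.∈-++⁺ʳ forks₁ (Any.here refl))
  completeE vr b = ∈P.∈-++⁺ʳ pairs₁ (∈P.∈-++⁺ʳ forks₁ (Any.there (Any.here refl)))
  completeE vz b = ∈P.∈-++⁺ʳ pairs₁ (∈P.∈-++⁺ʳ forks₁ (Any.there (Any.there (∈P.∈-++⁺ʳ ups (∈P.∈-++⁺ʳ downs (Any.here refl))))))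
  completeE (vU {j} u) b = ∈P.∈-++⁺ʳ pairs₁ (∈P.∈-++⁺ʳ forks₁ (Any.there (Any.there (∈P.∈-++⁺ˡ
    (subst (_∈ ups) (sym (EU-word u)) (∈P.∈-map⁺ fU (range∈ {suc q} {q ℕ.+ r} (proj₁ (EU-bound u)) (≤-pred (subst (j <_) N≡ (proj₂ (EU-bound u)))))))))))
  completeE (vD u) b = ∈P.∈-++⁺ʳ pairs₁ (∈P.∈-++⁺ʳ forks₁ (Any.there (Any.there (∈P.∈-++⁺ʳ ups (∈P.∈-++⁺ˡ
    (subst (_∈ downs) (sym (ED-word u)) (∈P.∈-map⁺ fD (range∈ {0} {a} z≤n (ED-bound u)))))))))

  hd : List ℕ → ℕ
  hd [] = 0
  hd (x ∷ _) = x

  last₃ : List ℕ → ℕ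
  last₃ (_ ∷ _ ∷ c ∷ []) = c
  last₃ _ = 0

  EU-hd : ∀ {j u} → EU j u → hd u ≡ j
  EU-hd u with EU-shape u
  ... | _ , _ , _ , _ , _ , refl = refl
  ED-hd : ∀ {j u} → ED j u → hd u ≡ j
  ED-hd u with ED-shape u
  ... | _ , _ , _ , refl = refl

  ups-hd : ∀ {u} → u ∈ ups → a < hd u × hd u ≢ N
  ups-hd m with up∋ m
  ... | j , _ , u = subst (λ z → a < z × z ≢ N) (sym (EU-hd u)) (<⇒≤ (proj₁ (EU-bound u)) , <⇒≢ (proj₂ (EU-bound u)))
  downs-hd : ∀ {u} → u ∈ downs → hd u ≤ a
  downs-hd m with down∋ m
  ... | j , _ , u = subst (_≤ a) (sym (ED-hd u)) (ED-bound u)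

  ups-long : ∀ {u} → u ∈ ups → 4 ≤ length u
  ups-long m with up∋ m
  ... | _ , _ , u with EU-shape u
  ...   | _ , _ , _ , _ , _ , refl = s≤s (s≤s (s≤s (s≤s z≤n)))
  downs-long : ∀ {u} → u ∈ downs → 4 ≤ length u
  downs-long m with down∋ m
  ... | _ , _ , u with ED-shape u
  ...   | _ , _ , _ , refl = s≤s (s≤s (s≤s (s≤s z≤n)))

  ES3-long : All (λ u → 4 ≤ length u) ES3
  ES3-long = AllP.++⁺ (All.tabulate ups-long) (AllP.++⁺ (All.tabulate downs-long) (≤-refl ∷ []))

  fU-len : ∀ i → length (fU (suc q ℕ.+ i)) ≡ i ℕ.+ 4
  fU-len i = trans (LP.length-++ (reverse (range a (suc q ℕ.+ i)))) (trans (cong (ℕ._+ 1) (trans (LP.length-reverse (range a (suc q ℕ.+ i))) (trans (length-range a (suc q ℕ.+ i))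
     (trans (cong (_∸ a) (shuffle a i)) (m+n∸m≡n a (i ℕ.+ 3)))))) (+-assoc i 3 1))
    where
    shuffle : ∀ a i → suc (suc (suc a) ℕ.+ i) ≡ a ℕ.+ (i ℕ.+ 3)
    shuffle = ℕSolver.solve-∀

  -- First letters tell the families apart: above a but not N, at most a, and N. Within the first
  -- family the lengths differ, within the second the first letters.
  ES3-unique : AllPairs _≢_ ES3
  ES3-unique = ++-unique {P = λ u → a < hd u × hd u ≢ N} (ladder-unique fU (suc q) (q ℕ.+ r) 4 fU-len)
     (++-unique {P = λ u → hd u ≤ a} (map-unique∈ fD (range 0 a) (range-sorted 0 a) inj) ([] ∷ []) (All.tabulate downs-hd) ((λ l → <⇒≱ a<N l) ∷ []))
     (All.tabulate ups-hd) (AllP.++⁺ (All.tabulate λ m p → <⇒≱ (proj₁ p) (downs-hd m)) ((λ p → proj₂ p refl) ∷ []))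
    where
    inj : ∀ {i j} → i ∈ range 0 a → j ∈ range 0 a → fD i ≡ fD j → i ≡ j
    inj {i} {j} p p' e with trans (sym (fD-cons (bd p))) (trans e (fD-cons (bd p')))
      where bd : ∀ {i} → i ∈ range 0 a → i ≤ suc q
            bd m = ≤-trans (proj₂ (range∋ {0} {a} m)) (m≤n⇒m≤1+n (n≤1+n a))
    ... | refl = refl

  uniqueE : AllPairs _≢_ (listE q r)
  uniqueE = ++-unique {P = λ u → length u ≡ 2} pairs-unique rest (All.tabulate λ m → len₂ (pair∋ m))
     (AllP.++⁺ (All.tabulate λ m → len₃ (fork∋ m)) ((λ ()) ∷ (λ ()) ∷ All.map (λ l e → <⇒≱ l (≤-trans (≤-reflexive e) (n≤1+n 2))) ES3-long))
    where
    len₂ : ∀ {u : List ℕ} → (∃ λ i → ∃ λ j → u ≡ i ∷ j ∷ [] × i < j × j ≤ N × M i j ≡ 2) → length u ≡ 2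
    len₂ (_ , _ , refl , _) = refl
    len₃ : ∀ {u : List ℕ} → (∃ λ i → u ≡ suc i ∷ i ∷ suc (suc i) ∷ [] × suc (suc i) < N) → length u ≢ 2
    len₃ (_ , refl , _) ()
    P₃ : ∀ {u : List ℕ} → (∃ λ i → u ≡ suc i ∷ i ∷ suc (suc i) ∷ [] × suc (suc i) < N) → length u ≡ 3 × last₃ u ≢ N
    P₃ (_ , refl , l) = refl , <⇒≢ l
    ¬3 : ∀ {u : List ℕ} → 4 ≤ length u → length u ≢ 3
    ¬3 l e = <⇒≢ l (sym e)
    rest : AllPairs _≢_ (forks₁ ++ forks₂ ++ ES3)
    rest = ++-unique {P = λ u → length u ≡ 3 × last₃ u ≢ N} (map-unique _ (λ e → cong hd e) (range-sorted 1 (q ℕ.+ r ∸ 1)))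
      (++-unique {P = λ u → length u ≡ 3} (((λ e → <⇒≢ (m<n⇒m<1+n (n<1+n a)) (cong (λ { (_ ∷ x ∷ _) → x ; _ → 0 }) e)) ∷ []) ∷ [] ∷ []) ES3-unique (refl ∷ refl ∷ []) (All.map (λ {u} → ¬3 {u}) ES3-long))
      (All.tabulate λ m → P₃ (fork∋ m)) ((λ p → proj₂ p refl) ∷ (λ p → proj₂ p refl) ∷ All.map (λ {u} l p → ¬3 {u} l (proj₁ p)) ES3-long)

  -- Among the N − i letters beyond i, those not commuting with i are i + 1 (if it lies on the path)
  -- and the branch letter N (if i = q).
  row-length : ∀ i → length (row i) ℕ.+ ((if i ℕ.<ᵇ N ∸ 1 then 1 else 0) ℕ.+ (if i ≡ᵇ q then 1 else 0)) ≡ N ∸ i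
  row-length i with <-cmp (suc i) N
  ... | tri< l _ _ = go (i ℕ.≟ q)
    where
    i≢N : i ≢ N
    i≢N = <⇒≢ (<⇒≤ l)
    N' : ℕ
    N' = q ℕ.+ r
    l' : suc i ≤ N'
    l' = ≤-pred (subst (suc i <_) N≡ l)
    rng : range (suc i) N ≡ suc i ∷ range (suc (suc i)) N' ++ N ∷ []
    rng = trans (range-cons (<⇒≤ l)) (cong (suc i ∷_) (trans (cong (range (suc (suc i))) N≡) (trans (range-snoc (s≤s l')) (cong (λ z → range (suc (suc i)) N' ++ z ∷ []) (sym N≡)))))
    mid : filter (two? i) (range (suc (suc i)) N') ≡ range (suc (suc i)) N'
    mid = LP.filter-all (two? i) (All.tabulate λ {j} m → M-far i {j} (proj₁ (range∋ {suc (suc i)} {N'} m)) (subst (j <_) (sym N≡) (s≤s (proj₂ (range∋ {suc (suc i)} {N'} m)))))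
    3≢2 : ∀ {k} → k ≡ 3 → k ≢ 2
    3≢2 refl ()
    row≡ : row i ≡ range (suc (suc i)) N' ++ filter (two? i) (N ∷ [])
    row≡ = trans (cong (filter (two? i)) rng) (trans (LP.filter-reject (two? i) (3≢2 (M-next i≢N (<⇒≢ l)))) (trans (LP.filter-++ (two? i) (range (suc (suc i)) N') (N ∷ [])) (cong (_++ filter (two? i) (N ∷ [])) mid)))
    len : length (row i) ≡ (N' ∸ suc i) ℕ.+ length (filter (two? i) (N ∷ []))
    len = trans (cong length row≡) (trans (LP.length-++ (range (suc (suc i)) N')) (cong (ℕ._+ length (filter (two? i) (N ∷ []))) (length-range (suc (suc i)) N')))
    x1 : (if i ℕ.<ᵇ N ∸ 1 then 1 else 0) ≡ 1
    x1 = cong indicator (<ᵇ-true i (N ∸ 1) (subst (i <_) (sym (cong (_∸ 1) N≡)) l'))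
    tot : N ∸ i ≡ (N' ∸ suc i) ℕ.+ 2
    tot = trans (cong (_∸ i) N≡) (trans (+-∸-assoc 1 (<⇒≤ l')) (trans (cong suc (trans (cong (_∸ i) (sym (m+[n∸m]≡n l'))) (trans (cong (_∸ i) (sym (+-suc i (N' ∸ suc i)))) (m+n∸m≡n i _)))) (+-comm 2 (N' ∸ suc i))))
    go : Dec (i ≡ q) → length (row i) ℕ.+ ((if i ℕ.<ᵇ N ∸ 1 then 1 else 0) ℕ.+ (if i ≡ᵇ q then 1 else 0)) ≡ N ∸ i
    go (yes refl) = trans (cong₂ ℕ._+_ (trans len (trans (cong (λ z → (N' ∸ suc i) ℕ.+ length z) (LP.filter-reject (two? i) {N} {[]} (3≢2 M-qN))) (+-identityʳ _)))
       (cong₂ ℕ._+_ x1 (cong indicator (eqb-refl i)))) (sym tot)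
    go (no ne) = trans (cong₂ ℕ._+_ (trans len (cong (λ z → (N' ∸ suc i) ℕ.+ length z) (LP.filter-accept (two? i) {N} {[]} (M-v (<⇒≤ l) ne))))
       (cong₂ ℕ._+_ x1 (cong indicator (eqb-≢ {i} {q} ne)))) (trans (+-assoc (N' ∸ suc i) 1 1) (sym tot))
  ... | tri≈ _ e _ = trans (cong₂ ℕ._+_ (cong length row≡) (cong₂ ℕ._+_ x0 y0)) (sym tot)
    where
    i≢q : i ≢ q
    i≢q refl = <⇒≢ q+1<N e
    row≡ : row i ≡ N ∷ []
    row≡ = trans (cong (filter (two? i)) (trans (cong (λ z → range z N) e) (range-one N))) (LP.filter-accept (two? i) {N} {[]} (M-v (≤-reflexive e) i≢q))
    x0 : (if i ℕ.<ᵇ N ∸ 1 then 1 else 0) ≡ 0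
    x0 = cong indicator (<ᵇ-false i (N ∸ 1) (≤-reflexive (sym (cong (_∸ 1) e))))
    y0 : (if i ≡ᵇ q then 1 else 0) ≡ 0
    y0 = cong indicator (eqb-≢ {i} {q} i≢q)
    tot : N ∸ i ≡ 1
    tot = trans (cong (_∸ i) (trans (sym e) (+-comm 1 i))) (m+n∸m≡n i 1)
  ... | tri> _ _ g = trans (cong₂ ℕ._+_ (cong length row≡) (cong₂ ℕ._+_ x0 y0)) (sym (m≤n⇒m∸n≡0 (≤-pred g)))
    where
    row≡ : row i ≡ []
    row≡ = cong (filter (two? i)) (range-empty g)
    x0 : (if i ℕ.<ᵇ N ∸ 1 then 1 else 0) ≡ 0
    x0 = cong indicator (<ᵇ-false i (N ∸ 1) (≤-trans (m∸n≤m N 1) (≤-pred g)))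
    y0 : (if i ≡ᵇ q then 1 else 0) ≡ 0
    y0 = cong indicator (eqb-≢ {i} {q} λ e → <⇒≱ q<N (subst (N ≤_) e (≤-pred g)))

  -- The diagram is a tree on N + 1 nodes: N - 1 edges on the path and one at the branch, counted by
  -- the two indicator sums. The remaining pairs of nodes commute.
  pairs-length : length pairs₁ ℕ.+ N ≡ suc N C 2
  pairs-length = trans (cong₂ ℕ._+_ (length-concatMap (λ i → map (λ j → i ∷ j ∷ []) (row i)) (λ i → i) (suc N) (λ i → length (row i)) (λ i → LP.length-map (λ j → i ∷ j ∷ []) (row i))) N-split)
     (trans (sym (trans (sum-+ (λ i → length (row i)) (λ i → ind₁ i ℕ.+ ind₂ i) (suc N)) (cong (ℕ._+_ (sum (applyUpTo (λ i → length (row i)) (suc N)))) (sum-+ ind₁ ind₂ (suc N)))))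
       (trans (sum-cong (suc N) row-length) (sum-∸ N)))
    where
    ind₁ ind₂ : ℕ → ℕ
    ind₁ i = if i ℕ.<ᵇ N ∸ 1 then 1 else 0
    ind₂ i = if i ≡ᵇ q then 1 else 0
    N-split : N ≡ sum (applyUpTo (λ i → if i ℕ.<ᵇ N ∸ 1 then 1 else 0) (suc N)) ℕ.+ sum (applyUpTo (λ i → if i ≡ᵇ q then 1 else 0) (suc N))
    N-split = sym (trans (cong₂ ℕ._+_ (sum-< (N ∸ 1) (m≤n⇒m≤1+n (m∸n≤m N 1))) (sum-δ q (m<n⇒m<1+n q<N))) (m∸n+n≡m {N} {1} (s≤s z≤n)))

  -- Besides the pairs there are N - 2 forks on the path, 2 forks at the branch and N words z_s,
  -- altogether 2N; and C(N + 1, 2) - N + 2N = C(N + 2, 2) - 1 with n = N + 1.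
  lengthE : length (listE q r) ≡ suc n C 2 ∸ 1
  lengthE = trans (LP.length-++ pairs₁) (trans (cong (length pairs₁ ℕ.+_) rest) (sym total))
    where
    rest : length (forks₁ ++ forks₂ ++ ES3) ≡ N ℕ.+ N
    rest = trans (LP.length-++ forks₁) (trans (cong₂ ℕ._+_ (trans (LP.length-map _ (range 1 (q ℕ.+ r ∸ 1))) (trans (length-range 1 (q ℕ.+ r ∸ 1)) N-2))
      (cong (λ z → suc (suc z)) (trans (LP.length-++ ups) (cong₂ ℕ._+_ (trans (LP.length-map fU (range (suc q) (q ℕ.+ r))) (trans (length-range (suc q) (q ℕ.+ r)) (m+n∸m≡n q r)))
        (trans (LP.length-++ downs) (cong (ℕ._+ 1) (trans (LP.length-map fD (range 0 a)) (length-range 0 a)))))))) (arith a r'))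
      where
      arith : ∀ a r' → suc (a ℕ.+ r') ℕ.+ suc (suc (suc r' ℕ.+ (suc a ℕ.+ 1))) ≡ (suc a ℕ.+ suc r' ℕ.+ 1) ℕ.+ (suc a ℕ.+ suc r' ℕ.+ 1)
      arith = ℕSolver.solve-∀
    total : suc n C 2 ∸ 1 ≡ length pairs₁ ℕ.+ (N ℕ.+ N)
    total = trans (cong (λ z → suc z C 2 ∸ 1) n≡) (trans (cong (_∸ 1) (trans (C2-suc (suc N)) (trans (cong (ℕ._+ suc N) (sym pairs-length)) (+-suc _ N)))) (+-assoc (length pairs₁) N N))

  stubsE : Coxeter.StubList {n} (mE q r) (map embed0 (listE q r))
  stubsE = stubList embed0 (λ w → w) (λ _ → refl) (listE q r) tameE goodE (λ c b → completeE (view c b) b) uniqueE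

typeE : ∀ q r → 1 ≤ q → q ≤ r → Coxeter.StubList {q ℕ.+ r ℕ.+ 2} (mE q r) (map embed0 (listE q r)) × length (listE q r) ≡ suc (q ℕ.+ r ℕ.+ 2) C 2 ∸ 1
typeE (suc a) (suc r) _ _ = EList.stubsE a r , EList.lengthE a r

theorem3p7 : (∀ n → 3 ≤ n →
    Coxeter.Boundedness {n} mA →
    Coxeter.StubList {n} mA (map embed1 (listA n)) × length (listA n) ≡ n C 2 ∸ 1) ×
    (∀ n → 3 ≤ n →
    Coxeter.Boundedness {n} mB →
    Coxeter.StubList {n} mB (map embed1 (listB n)) × length (listB n) ≡ n C 2) ×
    (∀ n → 5 ≤ n →
    Coxeter.Boundedness {n} (mC n) →
    Coxeter.StubList {n} (mC n) (map embed1 (listC n)) × length (listC n) ≡ n C 2 + 1) ×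
    (∀ q r → 1 ≤ q → q ≤ r →
    Coxeter.Boundedness {q + r + 2} (mE q r) →
    Coxeter.StubList {q + r + 2} (mE q r) (map embed0 (listE q r)) ×
    length (listE q r) ≡ suc (q + r + 2) C 2 ∸ 1) ×
    (∀ n → 4 ≤ n →
    Coxeter.Boundedness {n} mF →
    Coxeter.StubList {n} mF (map embed1 (listF n)) × length (listF n) ≡ suc n C 2 ∸ 1) ×
    (∀ n → 3 ≤ n →
    Coxeter.Boundedness {n} mH →
    Coxeter.StubList {n} mH (map embed1 (listH n)) × length (listH n) ≡ suc n C 2 ∸ 1)
theorem3p7 =
  (λ n l _ → typeA n l) , (λ n l _ → typeB n l) , (λ n l _ → typeC n l) ,
  (λ q r l l' _ → typeE q r l l') , (λ n l _ → typeF n l) , (λ n l _ → typeH n l)
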